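{- There exists an integer $n_0$ such that for all integers $n\ge n_0$ and $d$ with $n\le 4d+1$, every $d$-regular oriented graph on $n$ vertices has a Hamilton cycle.
   Context: An oriented graph is a digraph with no loops and at most one edge between any pair of vertices. A digraph is $d$-regular if every vertex has exactly $d$ outneighbours and exactly $d$ inneighbours. A Hamilton cycle is a directed cycle visiting every vertex. -}

module Defs where

open import Data.Nat using (ℕ; zero; suc)
open import Data.Bool using (Bool; true; false; T)
open import Data.Fin using (Fin; zero; suc; inject₁; fromℕ)
open import Data.List using (List; length; filter)
open import Data.List using () renaming (allFin to allFinL)
open import Data.Product using (Σ; _×_; _,_)
open import Relation.Nullary using (¬_)
open import Relation.Binary.PropositionalEquality using (_≡_)
open import Function.Bundles using (_↔_; Inverse)
open import Data.Empty using (⊥)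
open import Data.Bool.Properties using (T?)

-- A digraph on vertex set Fin n, given by its (Boolean) adjacency relation:
-- E u v ≡ true means there is a directed edge u → v.
Digraph : ℕ → Set
Digraph n = Fin n → Fin n → Bool

Oriented : ∀ {n} → Digraph n → Set
Oriented {n} E = (∀ (u : Fin n) → E u u ≡ false)
               × (∀ (u v : Fin n) → T (E u v) → E v u ≡ false)

outdeg : ∀ {n} → Digraph n → Fin n → ℕ
outdeg {n} E u = length (filter (λ v → T? (E u v)) (allFinL n))

indeg : ∀ {n} → Digraph n → Fin n → ℕ
indeg {n} E v = length (filter (λ u → T? (E u v)) (allFinL n))

Regular : ∀ {n} → ℕ → Digraph n → Set
Regular {n} d E = ∀ (u : Fin n) → outdeg E u ≡ d × indeg E u ≡ d

HamiltonCycle : ∀ {n} → Digraph n → Set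
HamiltonCycle {zero} E = ⊥ -- the empty digraph has no cycle; irrelevant since n ≥ n₀
HamiltonCycle {suc m} E =
  Σ (Fin (suc m) ↔ Fin (suc m)) λ σ →
    (∀ (i : Fin m) → T (E (Inverse.to σ (inject₁ i)) (Inverse.to σ (suc i))))
    × T (E (Inverse.to σ (fromℕ m)) (Inverse.to σ zero))

{-# OPTIONS --safe #-}
module Submission where

-- A 1-factor of the digraph is a permutation π with E u (π u); the aim is to merge its cycles into one.
--
-- Split the out-copies and the in-copies of the vertices along sparse cuts into at most eight classes, so
-- that few edges run between different classes while each class is robustly connected. Between out- and
-- in-vertices of a class there are then many short alternating walks relative to π. Counting closed walks
-- and blowing up every vertex of one of them (except a chosen vertex w) to four copies gives complete
-- bipartite pieces inside which the images of π may be permuted freely; this merges the cycle of w with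
-- any other cycle meeting the class. So all of a class can be put on a single cycle.
--
-- Where the out- and in-vertices of a union of classes do not balance, regularity supplies many edges
-- leaving it, from which vertex-disjoint edges are chosen greedily; forcing these into the 1-factor, Hall's
-- condition for the remaining vertices follows from robustness. As forced edges are disjoint, every cycle
-- meets a class and at most eight cycles remain.
--
-- If there are still two cycles, few edges join them, so both sides have about 2d vertices and are nearly
-- regular tournaments, hence each consists of one class. The smaller side W has at most 2d vertices
-- because n ≤ 4d + 1, and therefore at least |W| (2d + 1 - |W|) / 2 ≥ d edges leave it, and as many enter.
-- Forcing one suitable edge in each direction (or exchanging one forced edge for another that joins the
-- two sides) links the two classes, and merging again produces a Hamilton cycle.

-- The bound is sharp: for n = 4d + 2, two disjoint regular tournaments on 2d + 1 vertices have no
-- Hamilton cycle. Approximate structure alone cannot finish the proof, so the edges between two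
-- remaining cycles have to be counted exactly.
--
-- Out-copies and in-copies are classified separately because a class need not return to itself: in
-- the blow-up of a directed 4-cycle with parts of size d, all edges from one part end in the next,
-- so the two copies of a vertex belong to different classes. Each class has at least d / 2
-- out-vertices, which leaves room for eight of them.
--
-- Of the four copies of a vertex of the closed walk, three are rotated around the whole walk, which
-- makes their images interchangeable; the fourth is spent on a shorter closed walk through w, which
-- is prescribed and may be atypical, so it cannot be blown up itself. The copies are taken at
-- bounded distance along π or on short cycles, so that the old cycles can still be traced after the
-- rewiring.

open import Defs
open import Data.Bool using (Bool; true; false; T)
open import Data.Bool.Properties using (T?)
open import Data.Empty using (⊥; ⊥-elim)
open import Data.Fin using (Fin; zero; suc; inject₁; fromℕ; toℕ; fromℕ<; punchOut; inject≤)
open import Data.Fin.Properties using (_≟_; pigeonhole; toℕ-fromℕ<; toℕ<n; toℕ-injective; punchOut-injective; toℕ-fromℕ; toℕ-inject₁; toℕ-inject≤; injective⇒≤; any?)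
open import Data.Fin.Subset.Properties using (anySubset?)
open import Data.List using (List; []; _∷_; length; filter; map; _++_) renaming (tabulate to tabulateL)
open import Data.Nat using (ℕ; zero; suc; _+_; _*_; _∸_; _^_; _≤_; _<_; z≤n; s≤s; _≤?_; _<?_; _/_; _%_; NonZero; >-nonZero)
open import Data.Nat.Properties hiding (_≟_)
open import Data.Nat.DivMod using (m≡m%n+[m/n]*n; m%n<n; m/n*n≤m)
open import Data.Nat.Tactic.RingSolver using (solve-∀)
open import Data.Product using (Σ; ∃; ∃₂; _×_; _,_; proj₁; proj₂)
open import Data.Sum using (_⊎_; inj₁; inj₂; [_,_]′)
open import Data.Unit using (tt)
open import Data.Vec using (Vec; []; _∷_; lookup; tabulate)
open import Data.Vec.Properties using (lookup∘tabulate)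
open import Function using (_∘_; id; case_of_)
open import Function.Bundles using (mk↔ₛ′)
open import Relation.Binary.PropositionalEquality using (_≡_; _≢_; refl; sym; trans; cong; cong₂; subst; subst₂; module ≡-Reasoning)
open import Relation.Nullary using (¬_; Dec; yes; no)
open import Relation.Nullary.Decidable using (⌊_⌋; toWitness; fromWitness; _×-dec_; ¬?)
open import Data.List.Membership.Propositional using (_∈_)
open import Data.List.Membership.Propositional.Properties using (∈-++⁺ˡ; ∈-++⁺ʳ; ∈-map⁺)
open import Data.List.Properties using (length-++; length-map)
open import Data.List.Relation.Unary.Any using (here; there)

-- Booleans as decidable propositions

infixr 6 _∧_
infixr 5 _∨_

-- The connectives are abstract so that unification can decompose them.
abstract
  _∧_ _∨_ : Bool → Bool → Bool
  true ∧ b = b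
  false ∧ b = false
  true ∨ b = true
  false ∨ b = b

  not : Bool → Bool
  not true = false
  not false = true

  ∧⁺ : ∀ {a b} → T a → T b → T (a ∧ b)
  ∧⁺ {true} {true} _ _ = tt

  ∧₁ : ∀ {a b} → T (a ∧ b) → T a
  ∧₁ {true} _ = tt

  ∧₂ : ∀ {a b} → T (a ∧ b) → T b
  ∧₂ {true} h = h

  ∨₁ : ∀ {a b} → T a → T (a ∨ b)
  ∨₁ {true} _ = tt

  ∨₂ : ∀ {a b} → T b → T (a ∨ b)
  ∨₂ {true} _ = tt
  ∨₂ {false} h = h

  ∨⁻ : ∀ {a b} → T (a ∨ b) → T a ⊎ T b
  ∨⁻ {true} _ = inj₁ tt
  ∨⁻ {false} h = inj₂ h

  not⁺ : ∀ {a} → ¬ T a → T (not a)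
  not⁺ {true} h = h tt
  not⁺ {false} _ = tt

  not⁻ : ∀ {a} → T (not a) → ¬ T a
  not⁻ {false} _ ()

em : ∀ a → T a ⊎ ¬ T a
em true = inj₁ tt
em false = inj₂ λ ()

≡false⇒¬T : ∀ {a} → a ≡ false → ¬ T a
≡false⇒¬T refl ()

infix 4 _==_ _≤ᵇ′_

_==_ : ∀ {n} → Fin n → Fin n → Bool
x == y = ⌊ x ≟ y ⌋

==⁺ : ∀ {n} {x y : Fin n} → x ≡ y → T (x == y)
==⁺ {x = x} {y} p = fromWitness {a? = x ≟ y} p

==⁻ : ∀ {n} {x y : Fin n} → T (x == y) → x ≡ y
==⁻ {x = x} {y} p = toWitness {a? = x ≟ y} p

_≤ᵇ′_ : ℕ → ℕ → Bool
a ≤ᵇ′ b = ⌊ a ≤? b ⌋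

≤ᵇ⁺ : ∀ {a b} → a ≤ b → T (a ≤ᵇ′ b)
≤ᵇ⁺ {a} {b} p = fromWitness {a? = a ≤? b} p

≤ᵇ⁻ : ∀ {a b} → T (a ≤ᵇ′ b) → a ≤ b
≤ᵇ⁻ {a} {b} p = toWitness {a? = a ≤? b} p

abstract
  any : ∀ {n} → (Fin n → Bool) → Bool
  any {zero} f = false
  any {suc n} f = f zero ∨ any (f ∘ suc)

  any⁺ : ∀ {n} (f : Fin n → Bool) x → T (f x) → T (any f)
  any⁺ f zero h = ∨₁ h
  any⁺ f (suc x) h = ∨₂ {f zero} (any⁺ (f ∘ suc) x h)

  any⁻ : ∀ {n} (f : Fin n → Bool) → T (any f) → ∃ λ x → T (f x)
  any⁻ {suc n} f h with ∨⁻ {f zero} h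
  ... | inj₁ p = zero , p
  ... | inj₂ p with any⁻ (f ∘ suc) p
  ...   | x , q = suc x , q

  all : ∀ {n} → (Fin n → Bool) → Bool
  all {zero} f = true
  all {suc n} f = f zero ∧ all (f ∘ suc)

  all⁺ : ∀ {n} (f : Fin n → Bool) → (∀ x → T (f x)) → T (all f)
  all⁺ {zero} f h = tt
  all⁺ {suc n} f h = ∧⁺ (h zero) (all⁺ (f ∘ suc) (h ∘ suc))

  all⁻ : ∀ {n} (f : Fin n → Bool) → T (all f) → ∀ x → T (f x)
  all⁻ f h zero = ∧₁ h
  all⁻ f h (suc x) = all⁻ (f ∘ suc) (∧₂ {f zero} h) x

-- Sums and cardinalities over Fin n

abstract
  ∑ : ∀ {n} → (Fin n → ℕ) → ℕ
  ∑ {zero} f = 0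
  ∑ {suc n} f = f zero + ∑ (f ∘ suc)

  ∑-zero : (f : Fin 0 → ℕ) → ∑ f ≡ 0
  ∑-zero f = refl

  ∑-suc : ∀ {n} (f : Fin (suc n) → ℕ) → ∑ f ≡ f zero + ∑ (f ∘ suc)
  ∑-suc f = refl

  ∑-cong : ∀ {n} {f g : Fin n → ℕ} → (∀ x → f x ≡ g x) → ∑ f ≡ ∑ g
  ∑-cong {zero} h = refl
  ∑-cong {suc n} h = cong₂ _+_ (h zero) (∑-cong (h ∘ suc))

  ∑-mono : ∀ {n} {f g : Fin n → ℕ} → (∀ x → f x ≤ g x) → ∑ f ≤ ∑ g
  ∑-mono {zero} h = z≤n
  ∑-mono {suc n} h = +-mono-≤ (h zero) (∑-mono (h ∘ suc))

  +-interchange : ∀ a b c d → (a + b) + (c + d) ≡ (a + c) + (b + d)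
  +-interchange = solve-∀

  ∑-+ : ∀ {n} (f g : Fin n → ℕ) → ∑ (λ x → f x + g x) ≡ ∑ f + ∑ g
  ∑-+ {zero} f g = refl
  ∑-+ {suc n} f g = trans (cong (f zero + g zero +_) (∑-+ (f ∘ suc) (g ∘ suc)))
    (+-interchange (f zero) (g zero) (∑ (f ∘ suc)) (∑ (g ∘ suc)))

  ∑-*ˡ : ∀ {n} c (f : Fin n → ℕ) → ∑ (λ x → c * f x) ≡ c * ∑ f
  ∑-*ˡ {zero} c f = sym (*-zeroʳ c)
  ∑-*ˡ {suc n} c f = trans (cong (c * f zero +_) (∑-*ˡ c (f ∘ suc)))
    (sym (*-distribˡ-+ c (f zero) (∑ (f ∘ suc))))

  ∑-*ʳ : ∀ {n} c (f : Fin n → ℕ) → ∑ (λ x → f x * c) ≡ ∑ f * c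
  ∑-*ʳ c f = trans (∑-cong (λ x → *-comm (f x) c)) (trans (∑-*ˡ c f) (*-comm c (∑ f)))

  ∑-const : ∀ n c → ∑ {n} (λ _ → c) ≡ n * c
  ∑-const zero c = refl
  ∑-const (suc n) c = cong (c +_) (∑-const n c)

  ∑-swap : ∀ {m n} (f : Fin m → Fin n → ℕ) → ∑ (λ x → ∑ (f x)) ≡ ∑ (λ y → ∑ (λ x → f x y))
  ∑-swap {zero} {n} f = sym (trans (∑-const n 0) (*-zeroʳ n))
  ∑-swap {suc m} f = trans (cong (∑ (f zero) +_) (∑-swap (f ∘ suc)))
    (sym (∑-+ (f zero) (λ y → ∑ (λ x → f (suc x) y))))

abstract
  ∑-≥ : ∀ {n} (f : Fin n → ℕ) x → f x ≤ ∑ f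
  ∑-≥ f zero = m≤m+n (f zero) _
  ∑-≥ f (suc x) = ≤-trans (∑-≥ (f ∘ suc) x) (m≤n+m _ (f zero))

∑-bound : ∀ {n} (f : Fin n → ℕ) c → (∀ x → f x ≤ c) → ∑ f ≤ n * c
∑-bound {n} f c h = ≤-trans (∑-mono h) (≤-reflexive (∑-const n c))

abstract
  ∑-avg : ∀ {n} (f : Fin n → ℕ) c → n * c < ∑ f ⊎ (0 < n × n * c ≤ ∑ f) → ∃ λ x → c ≤ f x
  ∑-avg {n} f c h with any? (λ x → c ≤? f x)
  ... | yes p = p
  ... | no ¬p = ⊥-elim (help n f c (λ x → ≰⇒> λ q → ¬p (x , q)) h)
    where
    strict : ∀ n (f : Fin n → ℕ) c → (∀ x → f x < c) → ∑ f + n ≤ n * c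
    strict zero f c h = z≤n
    strict (suc n) f c h = subst (_≤ c + n * c) (eq (f zero) (∑ (f ∘ suc)) n)
      (+-mono-≤ (h zero) (strict n (f ∘ suc) c (h ∘ suc)))
      where
      eq : ∀ a b n → suc a + (b + n) ≡ a + b + suc n
      eq = solve-∀
    help : ∀ n (f : Fin n → ℕ) c → (∀ x → f x < c) → n * c < ∑ f ⊎ (0 < n × n * c ≤ ∑ f) → ⊥
    help n f c h (inj₁ q) = <⇒≱ q (≤-trans (m≤m+n _ n) (strict n f c h))
    help (suc n) f c h (inj₂ (_ , q)) = <⇒≱ (m<m+n (∑ f) (s≤s z≤n)) (≤-trans (strict (suc n) f c h) q)

⟦_⟧ : Bool → ℕ
⟦ true ⟧ = 1
⟦ false ⟧ = 0

⟦⟧≤1 : ∀ b → ⟦ b ⟧ ≤ 1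
⟦⟧≤1 true = s≤s z≤n
⟦⟧≤1 false = z≤n

⟦⟧-T : ∀ {b} → T b → ⟦ b ⟧ ≡ 1
⟦⟧-T {true} _ = refl

⟦⟧-¬T : ∀ {b} → ¬ T b → ⟦ b ⟧ ≡ 0
⟦⟧-¬T {true} h = ⊥-elim (h tt)
⟦⟧-¬T {false} _ = refl

⟦⟧-mono : ∀ {a b} → (T a → T b) → ⟦ a ⟧ ≤ ⟦ b ⟧
⟦⟧-mono {false} h = z≤n
⟦⟧-mono {true} {true} h = s≤s z≤n
⟦⟧-mono {true} {false} h = ⊥-elim (h tt)

⟦⟧-∪ : ∀ {a b c} → (T a → T b ⊎ T c) → ⟦ a ⟧ ≤ ⟦ b ⟧ + ⟦ c ⟧
⟦⟧-∪ {false} h = z≤n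
⟦⟧-∪ {true} {true} h = s≤s z≤n
⟦⟧-∪ {true} {false} {true} h = s≤s z≤n
⟦⟧-∪ {true} {false} {false} h with h tt
... | inj₁ ()
... | inj₂ ()

abstract
  ⟦⟧-split : ∀ a b → ⟦ a ⟧ ≡ ⟦ a ∧ b ⟧ + ⟦ a ∧ not b ⟧
  ⟦⟧-split false b = refl
  ⟦⟧-split true true = refl
  ⟦⟧-split true false = refl

  ⟦⟧-∧ : ∀ a b → ⟦ a ∧ b ⟧ ≡ ⟦ a ⟧ * ⟦ b ⟧
  ⟦⟧-∧ true b = sym (+-identityʳ ⟦ b ⟧)
  ⟦⟧-∧ false b = refl

# : ∀ {n} → (Fin n → Bool) → ℕ
# P = ∑ λ x → ⟦ P x ⟧

#-mono : ∀ {n} {P Q : Fin n → Bool} → (∀ x → T (P x) → T (Q x)) → # P ≤ # Q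
#-mono h = ∑-mono λ x → ⟦⟧-mono (h x)

#-cong : ∀ {n} {P Q : Fin n → Bool} → (∀ x → T (P x) → T (Q x)) → (∀ x → T (Q x) → T (P x)) → # P ≡ # Q
#-cong f g = ≤-antisym (#-mono f) (#-mono g)

#-∪ : ∀ {n} {P Q R : Fin n → Bool} → (∀ x → T (P x) → T (Q x) ⊎ T (R x)) → # P ≤ # Q + # R
#-∪ {P = P} {Q} {R} h = ≤-trans (∑-mono λ x → ⟦⟧-∪ (h x)) (≤-reflexive (∑-+ (λ x → ⟦ Q x ⟧) (λ x → ⟦ R x ⟧)))

#-split : ∀ {n} (P Q : Fin n → Bool) → # P ≡ # (λ x → P x ∧ Q x) + # (λ x → P x ∧ not (Q x))
#-split P Q = trans (∑-cong λ x → ⟦⟧-split (P x) (Q x)) (∑-+ (λ x → ⟦ P x ∧ Q x ⟧) (λ x → ⟦ P x ∧ not (Q x) ⟧))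

#≤n : ∀ {n} (P : Fin n → Bool) → # P ≤ n
#≤n {n} P = ≤-trans (∑-bound _ 1 (λ x → ⟦⟧≤1 (P x))) (≤-reflexive (*-identityʳ n))

#-all : ∀ n → # {n} (λ _ → true) ≡ n
#-all n = trans (∑-const n 1) (*-identityʳ n)

#-none : ∀ {n} {P : Fin n → Bool} → (∀ x → ¬ T (P x)) → # P ≡ 0
#-none {n} h = trans (∑-cong λ x → ⟦⟧-¬T (h x)) (trans (∑-const n 0) (*-zeroʳ n))

#-compl : ∀ {n} (P : Fin n → Bool) → # P + # (λ x → not (P x)) ≡ n
#-compl {n} P = trans (cong₂ _+_ (#-cong {P = P} (λ x p → ∧⁺ {true} tt p) (λ x → ∧₂ {true})) (#-cong {P = λ x → not (P x)} (λ x p → ∧⁺ {true} tt p) (λ x → ∧₂ {true})))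
  (trans (sym (#-split (λ _ → true) P)) (#-all n))

abstract
  #-∃ : ∀ {n} (P : Fin n → Bool) → 0 < # P → ∃ λ x → T (P x)
  #-∃ {suc n} P h with em (P zero)
  ... | inj₁ p = zero , p
  ... | inj₂ ¬p with #-∃ (P ∘ suc) (subst (λ a → 0 < a + # (P ∘ suc)) (⟦⟧-¬T ¬p) h)
  ...   | x , q = suc x , q

#-pos : ∀ {n} (P : Fin n → Bool) x → T (P x) → 1 ≤ # P
#-pos P x h = ≤-trans (≤-reflexive (sym (⟦⟧-T h))) (∑-≥ _ x)

#-excess : ∀ {n} (P Q : Fin n → Bool) → # Q < # P → ∃ λ x → T (P x) × ¬ T (Q x)
#-excess P Q h with #-∃ (λ x → P x ∧ not (Q x)) (+-cancelˡ-< (# Q) _ _ lt)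
  where
  lt : # Q + 0 < # Q + # (λ x → P x ∧ not (Q x))
  lt = subst (_< # Q + # (λ x → P x ∧ not (Q x))) (sym (+-identityʳ (# Q)))
    (<-≤-trans h (#-∪ λ x p → [ inj₁ , (λ ¬q → inj₂ (∧⁺ p (not⁺ ¬q))) ]′ (em (Q x))))
... | x , q = x , ∧₁ q , not⁻ (∧₂ {P x} q)

markov : ∀ {n} (P : Fin n → Bool) (f : Fin n → ℕ) c → (∀ x → T (P x) → c ≤ f x) → # P * c ≤ ∑ f
markov P f c h = ≤-trans (≤-reflexive (sym (∑-*ʳ c (λ x → ⟦ P x ⟧)))) (∑-mono λ x → go (P x) (h x))
  where
  go : ∀ b {y} → (T b → c ≤ y) → ⟦ b ⟧ * c ≤ y
  go true h = ≤-trans (≤-reflexive (+-identityʳ c)) (h tt)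
  go false h = z≤n

abstract
  ∑-at : ∀ {n} (x : Fin n) (f : Fin n → ℕ) → ∑ (λ y → ⟦ x == y ⟧ * f y) ≡ f x
  ∑-at {suc n} zero f = trans (cong₂ _+_ (+-identityʳ (f zero)) (trans (∑-const n 0) (*-zeroʳ n))) (+-identityʳ (f zero))
  ∑-at {suc n} (suc x) f = trans (∑-cong {g = λ y → ⟦ x == y ⟧ * f (suc y)} λ y → cong (_* f (suc y)) (e y)) (∑-at x (f ∘ suc))
    where
    e : ∀ y → ⟦ suc x == suc y ⟧ ≡ ⟦ x == y ⟧
    e y with x ≟ y
    ... | yes _ = refl
    ... | no _ = refl

#-single : ∀ {n} (x : Fin n) → # (x ==_) ≡ 1
#-single x = trans (∑-cong λ y → sym (*-identityʳ ⟦ x == y ⟧)) (∑-at x (λ _ → 1))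

#-∪-family : ∀ {m n} (P : Fin n → Bool) (Q : Fin m → Fin n → Bool) →
  (∀ x → T (P x) → ∃ λ i → T (Q i x)) → # P ≤ ∑ (λ i → # (Q i))
#-∪-family P Q h = ≤-trans (∑-mono λ x → go x (P x) (h x)) (≤-reflexive (∑-swap (λ x i → ⟦ Q i x ⟧)))
  where
  go : ∀ x b → (T b → ∃ λ i → T (Q i x)) → ⟦ b ⟧ ≤ ∑ (λ i → ⟦ Q i x ⟧)
  go x false _ = z≤n
  go x true h with h tt
  ... | i , q = ≤-trans (≤-reflexive (sym (⟦⟧-T q))) (∑-≥ (λ i → ⟦ Q i x ⟧) i)

-- Binary relations

#₂ : ∀ {m n} → (Fin m → Fin n → Bool) → ℕ
#₂ R = ∑ λ x → # (R x)

#₂-mono : ∀ {m n} {P Q : Fin m → Fin n → Bool} → (∀ x y → T (P x y) → T (Q x y)) → #₂ P ≤ #₂ Q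
#₂-mono h = ∑-mono λ x → #-mono (h x)

#₂-cong : ∀ {m n} {P Q : Fin m → Fin n → Bool} → (∀ x y → T (P x y) → T (Q x y)) → (∀ x y → T (Q x y) → T (P x y)) → #₂ P ≡ #₂ Q
#₂-cong f g = ≤-antisym (#₂-mono f) (#₂-mono g)

#₂-∪ : ∀ {m n} {P Q R : Fin m → Fin n → Bool} → (∀ x y → T (P x y) → T (Q x y) ⊎ T (R x y)) → #₂ P ≤ #₂ Q + #₂ R
#₂-∪ {P = P} {Q} {R} h = ≤-trans (∑-mono λ x → #-∪ (h x)) (≤-reflexive (∑-+ (λ x → # (Q x)) (λ x → # (R x))))

#₂-split : ∀ {m n} (P Q : Fin m → Fin n → Bool) →
  #₂ P ≡ #₂ (λ x y → P x y ∧ Q x y) + #₂ (λ x y → P x y ∧ not (Q x y))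
#₂-split P Q = trans (∑-cong λ x → #-split (P x) (Q x)) (∑-+ (λ x → # (λ y → P x y ∧ Q x y)) (λ x → # (λ y → P x y ∧ not (Q x y))))

#₂-swap : ∀ {m n} (P : Fin m → Fin n → Bool) → #₂ P ≡ #₂ (λ y x → P x y)
#₂-swap P = ∑-swap λ x y → ⟦ P x y ⟧

abstract
  #₂-∃ : ∀ {m n} (P : Fin m → Fin n → Bool) → 0 < #₂ P → ∃₂ λ x y → T (P x y)
  #₂-∃ {suc m} P h with em (any (P zero))
  ... | inj₁ p with any⁻ (P zero) p
  ...   | y , q = zero , y , q
  #₂-∃ {suc m} P h | inj₂ ¬p with #₂-∃ (P ∘ suc) (subst (λ a → 0 < a + #₂ (P ∘ suc)) (#-none λ y q → ¬p (any⁺ (P zero) y q)) h)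
  ... | x , y , q = suc x , y , q

#₂-rows : ∀ {m n} (A : Fin m → Bool) (P : Fin m → Fin n → Bool) d → (∀ x → # (P x) ≡ d) →
  #₂ (λ x y → A x ∧ P x y) ≡ # A * d
#₂-rows {n = n} A P d h = trans (∑-cong λ x → go x (A x)) (∑-*ʳ d (λ x → ⟦ A x ⟧))
  where
  go : ∀ x b → # (λ y → b ∧ P x y) ≡ ⟦ b ⟧ * d
  go x true = trans (#-cong (λ y → ∧₂ {true}) (λ y → ∧⁺ tt)) (trans (h x) (sym (+-identityʳ d)))
  go x false = #-none {n} {λ y → false ∧ P x y} λ y → ∧₁

#₂-rows-≤ : ∀ {m n} (A : Fin m → Bool) (P : Fin m → Fin n → Bool) d → (∀ x → T (A x) → # (P x) ≤ d) →
  #₂ (λ x y → A x ∧ P x y) ≤ # A * d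
#₂-rows-≤ {n = n} A P d h = ≤-trans (∑-mono λ x → go x (A x) (h x)) (≤-reflexive (∑-*ʳ d (λ x → ⟦ A x ⟧)))
  where
  go : ∀ x b → (T b → # (P x) ≤ d) → # (λ y → b ∧ P x y) ≤ ⟦ b ⟧ * d
  go x true h = ≤-trans (#-mono λ y → ∧₂ {true}) (≤-trans (h tt) (≤-reflexive (sym (+-identityʳ d))))
  go x false _ = ≤-reflexive (#-none {n} {λ y → false ∧ P x y} λ y → ∧₁)

#₂-× : ∀ {m n} (A : Fin m → Bool) (B : Fin n → Bool) → #₂ (λ x y → A x ∧ B y) ≡ # A * # B
#₂-× A B = #₂-rows A (λ _ → B) (# B) (λ _ → refl)

abstract
  ∑-max : ∀ {n} (f : Fin n → ℕ) → 0 < n → ∃ λ x → ∑ f ≤ n * f x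
  ∑-max {suc zero} f _ = zero , ≤-refl
  ∑-max {suc (suc n)} f _ with ∑-max {suc n} (f ∘ suc) (s≤s z≤n)
  ... | x , h with f zero ≤? f (suc x)
  ...   | yes p = suc x , +-mono-≤ p h
  ...   | no p = zero , +-monoʳ-≤ (f zero) (≤-trans h (*-monoʳ-≤ (suc n) (<⇒≤ (≰⇒> p))))

  -- Taking the least admissible index leaves all other admissible indices strictly above it. This
  -- lets `pick-index` choose indices in increasing order, one after another.
  least : ∀ {K} (f : Fin K → Bool) ℓ s → suc s ≤ # (λ t → (ℓ ≤ᵇ′ toℕ t) ∧ f t) →
    ∃ λ t → ℓ ≤ toℕ t × T (f t) × s ≤ # (λ t′ → (suc (toℕ t) ≤ᵇ′ toℕ t′) ∧ f t′)
  least {suc K} f ℓ s h with em ((ℓ ≤ᵇ′ 0) ∧ f zero)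
  ... | inj₁ p = zero , ≤ᵇ⁻ {ℓ} (∧₁ p) , ∧₂ {ℓ ≤ᵇ′ 0} p , ≤-pred (≤-trans h (+-mono-≤ (⟦⟧≤1 _) rest))
    where
    rest : # (λ t → (ℓ ≤ᵇ′ suc (toℕ t)) ∧ f (suc t)) ≤ ⟦ (1 ≤ᵇ′ 0) ∧ f zero ⟧ + # (λ t → (1 ≤ᵇ′ suc (toℕ t)) ∧ f (suc t))
    rest = #-mono {P = λ t → (ℓ ≤ᵇ′ suc (toℕ t)) ∧ f (suc t)} {Q = λ t → (1 ≤ᵇ′ suc (toℕ t)) ∧ f (suc t)}
      λ t q → ∧⁺ (≤ᵇ⁺ {1} {suc (toℕ t)} (s≤s z≤n)) (∧₂ {ℓ ≤ᵇ′ suc (toℕ t)} q)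
  ... | inj₂ ¬p with least (f ∘ suc) (ℓ ∸ 1) s h′
    where
    h′ : suc s ≤ # (λ t → (ℓ ∸ 1 ≤ᵇ′ toℕ t) ∧ f (suc t))
    h′ = ≤-trans (subst (λ a → suc s ≤ a + # (λ t → (ℓ ≤ᵇ′ suc (toℕ t)) ∧ f (suc t))) (⟦⟧-¬T ¬p) h)
      (#-mono {P = λ t → (ℓ ≤ᵇ′ suc (toℕ t)) ∧ f (suc t)} {Q = λ t → (ℓ ∸ 1 ≤ᵇ′ toℕ t) ∧ f (suc t)}
        λ t q → ∧⁺ (≤ᵇ⁺ (∸-monoˡ-≤ 1 (≤ᵇ⁻ {ℓ} (∧₁ q)))) (∧₂ {ℓ ≤ᵇ′ suc (toℕ t)} q))
  ...   | t , l , q , r = suc t , ≤-trans (m≤n+m∸n ℓ 1) (s≤s l) , q , ≤-trans r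
          (≤-trans (#-mono {P = λ t′ → (suc (toℕ t) ≤ᵇ′ toℕ t′) ∧ f (suc t′)} {Q = λ t′ → (suc (suc (toℕ t)) ≤ᵇ′ suc (toℕ t′)) ∧ f (suc t′)}
            λ t′ z → ∧⁺ (≤ᵇ⁺ (s≤s (≤ᵇ⁻ {suc (toℕ t)} (∧₁ z)))) (∧₂ {suc (toℕ t) ≤ᵇ′ toℕ t′} z))
          (m≤n+m _ ⟦ (suc (suc (toℕ t)) ≤ᵇ′ 0) ∧ f zero ⟧))

-- Permutations and their cycles

record Perm (n : ℕ) : Set where
  field
    to from : Fin n → Fin n
    to-from : ∀ x → to (from x) ≡ x
    from-to : ∀ x → from (to x) ≡ x
open Perm public

to-inj : ∀ {n} (π : Perm n) {x y} → to π x ≡ to π y → x ≡ y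
to-inj π {x} {y} h = trans (sym (from-to π x)) (trans (cong (from π) h) (from-to π y))

from-unique : ∀ {n} (π : Perm n) {x y} → to π x ≡ y → x ≡ from π y
from-unique π {x} h = trans (sym (from-to π x)) (cong (from π) h)

inverse : ∀ {n} → Perm n → Perm n
inverse π = record { to = from π ; from = to π ; to-from = from-to π ; from-to = to-from π }

∑-perm : ∀ {n} (π : Perm n) (f : Fin n → ℕ) → ∑ (f ∘ to π) ≡ ∑ f
∑-perm π f = begin
  ∑ (λ x → f (to π x)) ≡⟨ ∑-cong (λ x → sym (∑-at (to π x) f)) ⟩
  ∑ (λ x → ∑ (λ y → ⟦ to π x == y ⟧ * f y)) ≡⟨ ∑-swap (λ x y → ⟦ to π x == y ⟧ * f y) ⟩
  ∑ (λ y → ∑ (λ x → ⟦ to π x == y ⟧ * f y)) ≡⟨ ∑-cong (λ y → ∑-*ʳ (f y) (λ x → ⟦ to π x == y ⟧)) ⟩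
  ∑ (λ y → # (λ x → to π x == y) * f y) ≡⟨ ∑-cong (λ y → cong (_* f y) (one y)) ⟩
  ∑ (λ y → 1 * f y) ≡⟨ ∑-cong (λ y → +-identityʳ (f y)) ⟩
  ∑ f ∎
  where
  open ≡-Reasoning
  one : ∀ y → # (λ x → to π x == y) ≡ 1
  one y = trans (#-cong {P = λ x → to π x == y} {Q = from π y ==_} (λ x h → ==⁺ (sym (from-unique π (==⁻ h))))
                        (λ x h → ==⁺ (trans (cong (to π) (sym (==⁻ h))) (to-from π y))))
                (#-single (from π y))

#-perm : ∀ {n} (π : Perm n) (P : Fin n → Bool) → # (P ∘ to π) ≡ # P
#-perm π P = ∑-perm π (λ x → ⟦ P x ⟧)

-- An injection missing a value `y` would, after `punchOut` at `y`, inject `Fin (suc m)` into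
-- `Fin m`.
injection⇒Perm : ∀ {n} (f : Fin n → Fin n) → (∀ {x y} → f x ≡ f y → x ≡ y) → ∃ λ (π : Perm n) → ∀ x → to π x ≡ f x
injection⇒Perm {n} f inj = record { to = f ; from = λ y → proj₁ (pre y) ; to-from = λ y → proj₂ (pre y)
                              ; from-to = λ x → inj (proj₂ (pre (f x))) } , λ _ → refl
  where
  surj : ∀ m (g : Fin m → Fin m) → (∀ {x y} → g x ≡ g y → x ≡ y) → ∀ y → ∃ λ x → g x ≡ y
  surj (suc m) g inj y with any? (λ x → g x ≟ y)
  ... | yes p = p
  ... | no ¬p = ⊥-elim (1+n≰n (injective⇒≤ {f = λ x → punchOut {i = y} {j = g x} (λ e → ¬p (x , sym e))}
                  (λ e → inj (punchOut-injective {i = y} _ _ e))))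
  pre : ∀ y → ∃ λ x → f x ≡ y
  pre = surj n f inj

idPerm : ∀ {n} → Perm n
idPerm = record { to = id ; from = id ; to-from = λ _ → refl ; from-to = λ _ → refl }

transpose : ∀ {n} → Fin n → Fin n → Fin n → Fin n
transpose a b x with x ≟ a
... | yes _ = b
... | no _ with x ≟ b
...   | yes _ = a
...   | no _ = x

transpose-l : ∀ {n} (a b : Fin n) → transpose a b a ≡ b
transpose-l a b with a ≟ a
... | yes _ = refl
... | no h = ⊥-elim (h refl)

transpose-r : ∀ {n} (a b : Fin n) → transpose a b b ≡ a
transpose-r a b with b ≟ a
... | yes e = e
... | no _ with b ≟ b
...   | yes _ = refl
...   | no h = ⊥-elim (h refl)

transpose-o : ∀ {n} {a b x : Fin n} → x ≢ a → x ≢ b → transpose a b x ≡ x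
transpose-o {a = a} {b} {x} p q with x ≟ a
... | yes e = ⊥-elim (p e)
... | no _ with x ≟ b
...   | yes e = ⊥-elim (q e)
...   | no _ = refl

transpose-case : ∀ {n} (a b x : Fin n) → (x ≡ a × transpose a b x ≡ b) ⊎ ((x ≡ b × transpose a b x ≡ a) ⊎ (x ≢ a × x ≢ b × transpose a b x ≡ x))
transpose-case a b x with x ≟ a
... | yes e = inj₁ (e , refl)
... | no p with x ≟ b
...   | yes e = inj₂ (inj₁ (e , refl))
...   | no q = inj₂ (inj₂ (p , q , refl))

transpose-invol : ∀ {n} (a b x : Fin n) → transpose a b (transpose a b x) ≡ x
transpose-invol a b x with transpose-case a b x
... | inj₁ (refl , e) = trans (cong (transpose a b) e) (transpose-r a b)
... | inj₂ (inj₁ (refl , e)) = trans (cong (transpose a b) e) (transpose-l a b)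
... | inj₂ (inj₂ (p , q , e)) = trans (cong (transpose a b) e) e

swap : ∀ {n} → Fin n → Fin n → Perm n → Perm n
swap a b π = record
  { to = to π ∘ transpose a b ; from = transpose a b ∘ from π
  ; to-from = λ x → trans (cong (to π) (transpose-invol a b (from π x))) (to-from π x)
  ; from-to = λ x → trans (cong (transpose a b) (from-to π (transpose a b x))) (transpose-invol a b x) }

iter : ∀ {n} → Perm n → ℕ → Fin n → Fin n
iter π zero x = x
iter π (suc t) x = iter π t (to π x)

iter-+ : ∀ {n} (π : Perm n) s t x → iter π (s + t) x ≡ iter π t (iter π s x)
iter-+ π zero t x = refl
iter-+ π (suc s) t x = iter-+ π s t (to π x)

iter-suc : ∀ {n} (π : Perm n) t x → iter π (suc t) x ≡ to π (iter π t x)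
iter-suc π t x = trans (cong (λ r → iter π r x) (+-comm 1 t)) (iter-+ π t 1 x)

iter-inj : ∀ {n} (π : Perm n) t {x y} → iter π t x ≡ iter π t y → x ≡ y
iter-inj π zero h = h
iter-inj π (suc t) h = to-inj π (iter-inj π t h)

iter-perm : ∀ {n} → Perm n → ℕ → Perm n
iter-perm π zero = idPerm
iter-perm π (suc t) = record
  { to = to (iter-perm π t) ∘ to π ; from = from π ∘ from (iter-perm π t)
  ; to-from = λ x → trans (cong (to (iter-perm π t)) (to-from π _)) (to-from (iter-perm π t) x)
  ; from-to = λ x → trans (cong (from π) (from-to (iter-perm π t) (to π x))) (from-to π x) }

iter-perm-to : ∀ {n} (π : Perm n) t x → to (iter-perm π t) x ≡ iter π t x
iter-perm-to π zero x = refl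
iter-perm-to π (suc t) x = iter-perm-to π t (to π x)

-- Two of the first n + 1 iterates coincide, and cancelling the common initial steps moves the
-- coincidence back to `x`. Periods are written `suc r` to keep them positive.
period : ∀ {n} (π : Perm n) x → ∃ λ r → r < n × iter π (suc r) x ≡ x
period {n} π x with pigeonhole {n} {suc n} (n<1+n n) (λ i → iter π (toℕ i) x)
... | i , j , i<j , e with m≤n⇒∃[o]m+o≡n i<j
...   | r , p = r , ≤-trans (s≤s (m≤n+m r (toℕ i))) (≤-trans (≤-reflexive p) (≤-pred (toℕ<n j))) ,
        sym (iter-inj π (toℕ i) (trans e (trans (cong (λ t → iter π t x) (sym (trans (eq r (toℕ i)) p))) (iter-+ π (suc r) (toℕ i) x))))
  where
  eq : ∀ r i → suc r + i ≡ suc i + r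
  eq = solve-∀

iter-multiple : ∀ {n} (π : Perm n) r x → iter π r x ≡ x → ∀ k → iter π (k * r) x ≡ x
iter-multiple π r x h zero = refl
iter-multiple π r x h (suc k) = trans (iter-+ π r (k * r) x) (trans (cong (iter π (k * r)) h) (iter-multiple π r x h k))

-- Only forward iterates are allowed; periodicity still makes this an equivalence relation
-- (`Cyc-sym`).
Cyc : ∀ {n} → Perm n → Fin n → Fin n → Set
Cyc π x y = ∃ λ t → iter π t x ≡ y

Cyc-refl : ∀ {n} (π : Perm n) {x} → Cyc π x x
Cyc-refl π = 0 , refl

Cyc-trans : ∀ {n} (π : Perm n) {x y z} → Cyc π x y → Cyc π y z → Cyc π x z
Cyc-trans π {x} (s , p) (t , q) = s + t , trans (iter-+ π s t x) (trans (cong (iter π t) p) q)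

Cyc-sym : ∀ {n} (π : Perm n) {x y} → Cyc π x y → Cyc π y x
Cyc-sym π {x} {y} (t , p) with period π x
-- From `x`, t (r + 1) steps lead back to `x`; the first t of them reach `y`, and t r remain.
... | r , _ , e = t * r , trans (cong (iter π (t * r)) (sym p)) (trans (sym (iter-+ π t (t * r) x))
        (trans (cong (λ s → iter π s x) (sym (*-suc t r))) (iter-multiple π (suc r) x e t)))

Cyc-step : ∀ {n} (π : Perm n) x → Cyc π x (to π x)
Cyc-step π x = 1 , refl

-- Reduces `π ⊑ π′` to checking that `x` and `to π x` share a cycle of `π′`.
Cyc-generated : ∀ {n} (π : Perm n) (R : Fin n → Fin n → Set) → (∀ {x} → R x x) → (∀ {x y z} → R x y → R y z → R x z) →
  (∀ x → R x (to π x)) → ∀ {x y} → Cyc π x y → R x y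
Cyc-generated π R rfl trn stp (zero , refl) = rfl
Cyc-generated π R rfl trn stp {x} (suc t , e) = trn (stp x) (Cyc-generated π R rfl trn stp (t , e))

-- Only the residue of the number of steps modulo the period matters, so fewer than n steps need to
-- be tried.
Cyc? : ∀ {n} (π : Perm n) x y → Dec (Cyc π x y)
Cyc? {n} π x y with any? {n = n} (λ t → iter π (toℕ t) x ≟ y)
... | yes (t , e) = yes (toℕ t , e)
... | no h = no λ (t , e) → h (go t e)
  where
  go : ∀ t → iter π t x ≡ y → ∃ λ (s : Fin n) → iter π (toℕ s) x ≡ y
  go t e with period π x
  ... | r , r<n , p = fromℕ< lt , trans (cong (λ s → iter π s x) (toℕ-fromℕ< lt)) (trans (sym red) e)
    where
    lt : t % suc r < n
    lt = ≤-trans (m%n<n t (suc r)) r<n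
    red : iter π t x ≡ iter π (t % suc r) x
    red = trans (cong (λ s → iter π s x) (trans (m≡m%n+[m/n]*n t (suc r)) (+-comm (t % suc r) _)))
      (trans (iter-+ π (t / suc r * suc r) (t % suc r) x) (cong (iter π (t % suc r)) (iter-multiple π (suc r) x p (t / suc r))))

cyc : ∀ {n} → Perm n → Fin n → Fin n → Bool
cyc π x y = ⌊ Cyc? π x y ⌋

cyc⁺ : ∀ {n} (π : Perm n) {x y} → Cyc π x y → T (cyc π x y)
cyc⁺ π {x} {y} h = fromWitness {a? = Cyc? π x y} h

cyc⁻ : ∀ {n} (π : Perm n) {x y} → T (cyc π x y) → Cyc π x y
cyc⁻ π {x} {y} h = toWitness {a? = Cyc? π x y} h

infix 4 _⊑_

_⊑_ : ∀ {n} → Perm n → Perm n → Set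
π ⊑ π′ = ∀ x y → Cyc π x y → Cyc π′ x y

-- Following the new permutation from b one traverses the old cycle of a until it returns to a.
swap-merges : ∀ {n} (π : Perm n) a b → ¬ Cyc π a b →
  Cyc (swap a b π) a b × π ⊑ swap a b π
swap-merges {n} π a b ¬ab = ab , λ x y → Cyc-generated π R (Cyc-refl π′) (Cyc-trans π′) step {x} {y}
  where
  π′ = swap a b π
  R : Fin n → Fin n → Set
  R = Cyc π′
  follow : ∀ t x → (∀ s → s < t → iter π s x ≢ a × iter π s x ≢ b) → iter π′ t x ≡ iter π t x
  follow zero x h = refl
  follow (suc t) x h = trans (cong (iter π′ t) (cong (to π) (transpose-o (proj₁ (h 0 (s≤s z≤n))) (proj₂ (h 0 (s≤s z≤n))))))
    (follow t (to π x) λ s p → h (suc s) (s≤s p))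
  first : ∀ c t x → iter π t x ≡ c → ∃ λ s → iter π s x ≡ c × ∀ r → r < s → iter π r x ≢ c
  first c t x e with x ≟ c
  ... | yes p = 0 , p , λ _ ()
  first c zero x e | no p = ⊥-elim (p e)
  first c (suc t) x e | no p with first c t (to π x) e
  ... | s , q , m = suc s , q , λ { zero _ → p ; (suc r) (s≤s l) → m r l }
  return-a : R (to π a) a
  return-a with period π a
  ... | r , _ , e with first a r (to π a) e
  ...   | s , q , m = s , trans (follow s (to π a) λ t p → m t p , λ e′ → ¬ab (suc t , e′)) q
  return-b : R (to π b) b
  return-b with period π b
  ... | r , _ , e with first b r (to π b) e
  ...   | s , q , m = s , trans (follow s (to π b) λ t p → (λ e′ → ¬ab (Cyc-sym π (suc t , e′))) , m t p) q
  hop-a : R a (to π b)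
  hop-a = 1 , cong (to π) (transpose-l a b)
  hop-b : R b (to π a)
  hop-b = 1 , cong (to π) (transpose-r a b)
  ab : R a b
  ab = Cyc-trans π′ hop-a return-b
  step : ∀ x → R x (to π x)
  step x with transpose-case a b x
  ... | inj₁ (refl , _) = Cyc-trans π′ ab hop-b
  ... | inj₂ (inj₁ (refl , _)) = Cyc-trans π′ (Cyc-sym π′ ab) hop-a
  ... | inj₂ (inj₂ (_ , _ , e)) = 1 , cong (to π) e

-- Swapping inside the classes of Q keeps all edges, so the cycles meeting a common class of Q can be merged.
abstract
  merge-classes : ∀ {n} (E : Digraph n) (Q : Fin n → Fin n → Bool) →
    (∀ {x} → T (Q x x)) → (∀ {x y} → T (Q x y) → T (Q y x)) → (∀ {x y z} → T (Q x y) → T (Q y z) → T (Q x z)) →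
    (π : Perm n) → (∀ {x y} → T (Q x y) → T (E x (to π y))) →
    ∃ λ π′ → π ⊑ π′ × (∀ x y → T (Q x y) → Cyc π′ x y) ×
      (∀ x → T (E x (to π′ x))) × (∀ x → ∃ λ y → T (Q x y) × to π′ x ≡ to π y)
  merge-classes {n} E Q rfl sm trn π ok = let π′ , (inc , cls) , h = rows n ≤-refl in π′ , inc , (λ x y q → h x (toℕ<n x) y q) ,
      (λ x → let y , q , e = cls x in subst (λ z → T (E x z)) (sym e) (ok q)) , cls
    where
    -- Invariant under swaps inside a class. Its second half keeps `ok` applicable, in whatever
    -- order the swaps are made.
    State : Perm n → Set
    State π′ = π ⊑ π′ × (∀ x → ∃ λ y → T (Q x y) × to π′ x ≡ to π y)
    merge2 : ∀ π′ a b → T (Q a b) → State π′ → ∃ λ π″ → State π″ × π′ ⊑ π″ × Cyc π″ a b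
    merge2 π′ a b q (inc , cls) with Cyc? π′ a b
    ... | yes c = π′ , (inc , cls) , (λ _ _ → id) , c
    ... | no ¬c = swap a b π′ , ((λ x y → proj₂ (swap-merges π′ a b ¬c) x y ∘ inc x y) , cls′) , proj₂ (swap-merges π′ a b ¬c) , proj₁ (swap-merges π′ a b ¬c)
      where
      cls′ : ∀ x → ∃ λ y → T (Q x y) × to π′ (transpose a b x) ≡ to π y
      cls′ x with transpose-case a b x
      ... | inj₁ (refl , e) = let y , q′ , e′ = cls b in y , trn q q′ , trans (cong (to π′) e) e′
      ... | inj₂ (inj₁ (refl , e)) = let y , q′ , e′ = cls a in y , trn (sm q) q′ , trans (cong (to π′) e) e′
      ... | inj₂ (inj₂ (_ , _ , e)) = let y , q′ , e′ = cls x in y , q′ , trans (cong (to π′) e) e′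
    row : ∀ a m → m ≤ n → ∀ π′ → State π′ → ∃ λ π″ → State π″ × π′ ⊑ π″ ×
      (∀ y → toℕ y < m → T (Q a y) → Cyc π″ a y)
    row a zero _ π′ st = π′ , st , (λ _ _ → id) , λ _ ()
    row a (suc m) le π′ st with row a m (≤-trans (n≤1+n m) le) π′ st
    ... | π₁ , st₁ , inc₁ , h₁ with em (Q a (fromℕ< le))
    ...   | inj₂ ¬q = π₁ , st₁ , inc₁ , λ y l q → case m≤n⇒m<n∨m≡n (≤-pred l) of λ
              { (inj₁ l′) → h₁ y l′ q
              ; (inj₂ e) → ⊥-elim (¬q (subst (λ z → T (Q a z)) (toℕ-injective (trans e (sym (toℕ-fromℕ< le)))) q)) }
    ...   | inj₁ q with merge2 π₁ a (fromℕ< le) q st₁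
    ...     | π₂ , st₂ , inc₂ , c = π₂ , st₂ , (λ x y → inc₂ x y ∘ inc₁ x y) , λ y l q → case m≤n⇒m<n∨m≡n (≤-pred l) of λ
              { (inj₁ l′) → inc₂ a y (h₁ y l′ q)
              ; (inj₂ e) → subst (Cyc π₂ a) (sym (toℕ-injective (trans e (sym (toℕ-fromℕ< le))))) c }
    rows : ∀ m → m ≤ n → ∃ λ π′ → State π′ × (∀ x → toℕ x < m → ∀ y → T (Q x y) → Cyc π′ x y)
    rows zero _ = π , ((λ _ _ → id) , λ x → x , rfl , refl) , λ _ ()
    rows (suc m) le with rows m (≤-trans (n≤1+n m) le)
    ... | π₁ , st₁ , h₁ with row (fromℕ< le) n ≤-refl π₁ st₁
    ...   | π₂ , st₂ , inc , h₂ = π₂ , st₂ , λ x l y q → case m≤n⇒m<n∨m≡n (≤-pred l) of λ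
              { (inj₁ l′) → inc x y (h₁ x l′ y q)
              ; (inj₂ e) → fix x (toℕ-injective (trans e (sym (toℕ-fromℕ< le)))) y q }
      where
      fix : ∀ x → x ≡ fromℕ< le → ∀ y → T (Q x y) → Cyc π₂ x y
      fix x refl y q = h₂ y (toℕ<n y) q

abstract
  -- Turns a closed walk v₀, v₁, ... of the relation `E x (to π y)` into edges of a new 1-factor:
  -- every vertex takes over the image of its successor. The rotation is a product of transpositions
  -- of consecutive entries.
  rotate : ∀ {n} r (v : Fin (suc r) → Fin n) → (∀ {i j} → v i ≡ v j → i ≡ j) → (π : Perm n) →
    ∃ λ π′ → (∀ i → to π′ (v (inject₁ i)) ≡ to π (v (suc i))) × to π′ (v (fromℕ r)) ≡ to π (v zero) ×
      (∀ x → (∀ i → x ≢ v i) → to π′ x ≡ to π x)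
  rotate zero v inj π = π , (λ ()) , refl , λ _ _ → refl
  rotate (suc r) v inj π with rotate r (v ∘ suc) (λ e → suc-inj (inj e)) (swap (v zero) (v (suc zero)) π)
    where
    suc-inj : ∀ {m} {i j : Fin m} → Fin.suc i ≡ suc j → i ≡ j
    suc-inj refl = refl
  ... | π′ , p , q , o = π′ , p′ , trans q (cong (to π) (transpose-r (v zero) (v (suc zero)))) , o′
    where
    0≢s : ∀ {m} {i : Fin m} → zero ≢ Fin.suc i
    0≢s ()
    p′ : ∀ i → to π′ (v (inject₁ i)) ≡ to π (v (suc i))
    p′ zero = trans (o (v zero) λ i e → 0≢s (inj e)) (cong (to π) (transpose-l (v zero) (v (suc zero))))
    p′ (suc i) = trans (p i) (cong (to π) (transpose-o (λ e → 0≢s (sym (inj e))) (λ e → ss (inj e))))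
      where
      ss : ∀ {m} {i : Fin m} → Fin.suc (suc i) ≢ suc zero
      ss ()
    o′ : ∀ x → (∀ i → x ≢ v i) → to π′ x ≡ to π x
    o′ x h = trans (o x (h ∘ suc)) (cong (to π) (transpose-o (h zero) (h (suc zero))))


-- Hall's theorem

-- Subsets are Boolean functions, while the search runs over vectors. A property has to be carried
-- between the two along pointwise equality, hence the hypothesis that `C` respects it.
search : ∀ {m} (C : (Fin m → Bool) → Set) → (∀ S → Dec (C S)) → (∀ S S′ → (∀ x → S x ≡ S′ x) → C S → C S′) →
  (∃ λ S → C S) ⊎ (∀ S → ¬ C S)
search C C? ext with anySubset? (λ S → C? (lookup S))
... | yes (S , p) = inj₁ (lookup S , p)
... | no h = inj₂ λ S p → h (tabulate S , ext S _ (λ x → sym (lookup∘tabulate S x)) p)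

N⁺ : ∀ {m n} → (Fin m → Fin n → Bool) → (Fin m → Bool) → Fin n → Bool
N⁺ J S y = any λ x → S x ∧ J x y

N⁺-intro : ∀ {m n} (J : Fin m → Fin n → Bool) (S : Fin m → Bool) {x y} → T (S x) → T (J x y) → T (N⁺ J S y)
N⁺-intro J S {x} {y} s j = any⁺ (λ x → S x ∧ J x y) x (∧⁺ s j)

N⁺-elim : ∀ {m n} (J : Fin m → Fin n → Bool) (S : Fin m → Bool) {y} → T (N⁺ J S y) → ∃ λ x → T (S x) × T (J x y)
N⁺-elim J S {y} h with any⁻ (λ x → S x ∧ J x y) h
... | x , p = x , ∧₁ p , ∧₂ {S x} p

hall-on : ∀ {m n} (J : Fin m → Fin n → Bool) size (A : Fin m → Bool) (B : Fin n → Bool) → # A ≤ size →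
  (∀ S → (∀ x → T (S x) → T (A x)) → # S ≤ # (λ y → B y ∧ N⁺ J S y)) →
  ∃ λ (M : Fin m → Fin n → Bool) → (∀ x → T (A x) → ∃ λ y → T (M x y)) ×
    (∀ x y → T (M x y) → T (A x) × T (B y) × T (J x y)) × (∀ x x′ y → T (M x y) → T (M x′ y) → x ≡ x′)
hall-on {m} {n} J size A B sz H with em (any A)
... | inj₂ ¬a = (λ _ _ → false) , (λ x a → ⊥-elim (¬a (any⁺ A x a))) , (λ _ _ ()) , λ _ _ _ ()
hall-on {m} {n} J zero A B sz H | inj₁ a = ⊥-elim (n≮0 (≤-trans (#-pos A (proj₁ (any⁻ A a)) (proj₂ (any⁻ A a))) sz))
hall-on {m} {n} J (suc size) A B sz H | inj₁ a = pick (any⁻ A a)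
  where
  pick : (∃ λ u → T (A u)) → _
  pick (u , au) with search Tight Tight? tight-ext
    where
    Tight : (Fin m → Bool) → Set
    Tight S = (∀ x → T (S x) → T (A x ∧ not (u == x))) × T (any S) × # (λ y → B y ∧ N⁺ J S y) ≤ # S
    Tight? : ∀ S → Dec (Tight S)
    Tight? S = imp? ×-dec (T? (any S) ×-dec (_ ≤? _))
      where
      imp? : Dec (∀ x → T (S x) → T (A x ∧ not (u == x)))
      imp? with T? (all λ x → not (S x) ∨ (A x ∧ not (u == x)))
      ... | yes h = yes λ x s → [ (λ ¬s → ⊥-elim (not⁻ ¬s s)) , id ]′ (∨⁻ {not (S x)} (all⁻ _ h x))
      ... | no h = no λ g → h (all⁺ _ λ x → [ (λ s → ∨₂ {not (S x)} (g x s)) , (λ ¬s → ∨₁ (not⁺ ¬s)) ]′ (em (S x)))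
    tight-ext : ∀ S S′ → (∀ x → S x ≡ S′ x) → Tight S → Tight S′
    tight-ext S S′ e (h , s , t) = (λ x s′ → h x (back x s′)) ,
      any⁺ S′ (proj₁ (any⁻ S s)) (fwd _ (proj₂ (any⁻ S s))) ,
      ≤-trans (#-mono λ y p → ∧⁺ (∧₁ p) (mono y (∧₂ {B y} p))) (≤-trans t (#-mono fwd))
      where
      fwd : ∀ x → T (S x) → T (S′ x)
      fwd x = subst T (e x)
      back : ∀ x → T (S′ x) → T (S x)
      back x = subst T (sym (e x))
      mono : ∀ y → T (N⁺ J S′ y) → T (N⁺ J S y)
      mono y q = let x , s′ , j = N⁺-elim J S′ q in N⁺-intro J S (back x s′) j
  ... | inj₁ (S₀ , S₀⊆ , ne , tight) = combine
    where
    A₂ : Fin m → Bool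
    A₂ x = A x ∧ not (S₀ x)
    B₂ : Fin n → Bool
    B₂ y = B y ∧ not (N⁺ J S₀ y)
    S₀A : ∀ x → T (S₀ x) → T (A x)
    S₀A x s = ∧₁ (S₀⊆ x s)
    sz₁ : # S₀ ≤ size
    sz₁ = ≤-pred (≤-trans (≤-trans (s≤s (#-mono S₀⊆)) (≤-trans (≤-reflexive (+-comm 1 _))
      (≤-trans (+-monoʳ-≤ (# (λ x → A x ∧ not (u == x))) (≤-trans (#-pos (λ x → A x ∧ (u == x)) u (∧⁺ au (==⁺ {x = u} refl))) ≤-refl))
      (≤-reflexive (trans (+-comm (# (λ x → A x ∧ not (u == x))) _) (sym (#-split A (u ==_)))))))) sz)
    sz₂ : # A₂ ≤ size
    sz₂ = ≤-pred (≤-trans (≤-trans (+-monoˡ-≤ (# A₂) (#-pos (λ x → A x ∧ S₀ x) x₀ (∧⁺ (S₀A x₀ s₀) s₀))) (≤-reflexive (sym (#-split A S₀)))) sz)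
      where
      x₀ = proj₁ (any⁻ S₀ ne)
      s₀ = proj₂ (any⁻ S₀ ne)
    -- Hall's condition for the union of `S₀` and `S`, from which the tight set `S₀` is subtracted.
    H₂ : ∀ S → (∀ x → T (S x) → T (A₂ x)) → # S ≤ # (λ y → B₂ y ∧ N⁺ J S y)
    H₂ S S⊆ = +-cancelˡ-≤ (# S₀) _ _ (begin
      # S₀ + # S ≡⟨ sym eqU ⟩
      # U ≤⟨ H U U⊆ ⟩
      # (λ y → B y ∧ N⁺ J U y) ≤⟨ #-∪ nbr ⟩
      # (λ y → B y ∧ N⁺ J S₀ y) + # (λ y → B₂ y ∧ N⁺ J S y) ≤⟨ +-monoˡ-≤ _ tight ⟩
      # S₀ + # (λ y → B₂ y ∧ N⁺ J S y) ∎)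
      where
      open ≤-Reasoning
      U : Fin m → Bool
      U x = S₀ x ∨ S x
      U⊆ : ∀ x → T (U x) → T (A x)
      U⊆ x p = [ S₀A x , (λ s → ∧₁ (S⊆ x s)) ]′ (∨⁻ {S₀ x} p)
      eqU : # U ≡ # S₀ + # S
      eqU = trans (#-split U S₀) (cong₂ _+_ (#-cong (λ x p → ∧₂ {U x} p) (λ x p → ∧⁺ (∨₁ p) p))
        (#-cong (λ x p → [ (λ s → ⊥-elim (not⁻ (∧₂ {U x} p) s)) , id ]′ (∨⁻ {S₀ x} (∧₁ p)))
                (λ x s → ∧⁺ (∨₂ {S₀ x} s) (∧₂ {A x} (S⊆ x s)))))
      nbr : ∀ y → T (B y ∧ N⁺ J U y) → T (B y ∧ N⁺ J S₀ y) ⊎ T (B₂ y ∧ N⁺ J S y)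
      nbr y p with em (N⁺ J S₀ y)
      ... | inj₁ q = inj₁ (∧⁺ (∧₁ p) q)
      ... | inj₂ ¬q = let x , u , j = N⁺-elim J U (∧₂ {B y} p) in
        inj₂ (∧⁺ (∧⁺ (∧₁ p) (not⁺ ¬q)) ([ (λ s → ⊥-elim (¬q (N⁺-intro J S₀ s j))) , (λ s → N⁺-intro J S s j) ]′ (∨⁻ {S₀ x} u)))
    combine : _
    combine with hall-on J size S₀ B sz₁ (λ S h → H S (λ x s → S₀A x (h x s))) | hall-on J size A₂ B₂ sz₂ H₂
    ... | M₁ , tot₁ , ok₁ , inj₁′ | M₂ , tot₂ , ok₂ , inj₂′ = M , tot , ok , inj′
      where
      M : Fin m → Fin n → Bool
      M x y = M₁ x y ∨ M₂ x y
      tot : ∀ x → T (A x) → ∃ λ y → T (M x y)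
      tot x a with em (S₀ x)
      ... | inj₁ s = let y , q = tot₁ x s in y , ∨₁ q
      ... | inj₂ ¬s = let y , q = tot₂ x (∧⁺ a (not⁺ ¬s)) in y , ∨₂ {M₁ x y} q
      ok : ∀ x y → T (M x y) → T (A x) × T (B y) × T (J x y)
      ok x y p with ∨⁻ {M₁ x y} p
      ... | inj₁ q = let s , b , j = ok₁ x y q in S₀A x s , b , j
      ... | inj₂ q = let s , b , j = ok₂ x y q in ∧₁ s , ∧₁ b , j
      clash : ∀ x x′ y → T (M₁ x y) → ¬ T (M₂ x′ y)
      clash x x′ y p q = let s , _ , j = ok₁ x y p ; _ , b , _ = ok₂ x′ y q in not⁻ (∧₂ {B y} b) (N⁺-intro J S₀ s j)
      inj′ : ∀ x x′ y → T (M x y) → T (M x′ y) → x ≡ x′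
      inj′ x x′ y p p′ with ∨⁻ {M₁ x y} p | ∨⁻ {M₁ x′ y} p′
      ... | inj₁ q | inj₁ q′ = inj₁′ x x′ y q q′
      ... | inj₂ q | inj₂ q′ = inj₂′ x x′ y q q′
      ... | inj₁ q | inj₂ q′ = ⊥-elim (clash x x′ y q q′)
      ... | inj₂ q | inj₁ q′ = ⊥-elim (clash x′ x y q′ q)
  ... | inj₂ none = extend (#-∃ _ (≤-trans (≤-reflexive (sym (#-single u))) (H (u ==_) λ x e → subst (λ z → T (A z)) (==⁻ e) au)))
    where
    A′ : Fin m → Bool
    A′ x = A x ∧ not (u == x)
    sz′ : # A′ ≤ size
    sz′ = ≤-pred (≤-trans (≤-trans (+-monoˡ-≤ (# A′) (#-pos (λ x → A x ∧ (u == x)) u (∧⁺ au (==⁺ {x = u} refl)))) (≤-reflexive (sym (#-split A (u ==_))))) sz)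
    extend : (∃ λ v → T (B v ∧ N⁺ J (u ==_) v)) → _
    extend (v , bv) = finish (hall-on J size A′ B′ sz′ H′)
      where
      B′ : Fin n → Bool
      B′ y = B y ∧ not (v == y)
      juv : T (J u v)
      juv = let x , e , j = N⁺-elim J (u ==_) (∧₂ {B v} bv) in subst (λ z → T (J z v)) (sym (==⁻ e)) j
      H′ : ∀ S → (∀ x → T (S x) → T (A′ x)) → # S ≤ # (λ y → B′ y ∧ N⁺ J S y)
      H′ S S⊆ with em (any S)
      ... | inj₂ ¬s = ≤-trans (≤-reflexive (#-none λ x s → ¬s (any⁺ S x s))) z≤n
      ... | inj₁ s = ≤-pred (≤-trans (≰⇒> λ t → none S (S⊆ , s , t)) (≤-trans (#-∪ {Q = v ==_} {R = λ y → B′ y ∧ N⁺ J S y} rm) (≤-reflexive (cong (_+ # (λ y → B′ y ∧ N⁺ J S y)) (#-single v)))))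
        where
        rm : ∀ y → T (B y ∧ N⁺ J S y) → T (v == y) ⊎ T (B′ y ∧ N⁺ J S y)
        rm y p with em (v == y)
        ... | inj₁ e = inj₁ e
        ... | inj₂ ¬e = inj₂ (∧⁺ (∧⁺ (∧₁ p) (not⁺ ¬e)) (∧₂ {B y} p))
      finish : _ → _
      finish (M , tot , ok , inj′) = M′ , tot′ , ok′ , inj″
        where
        M′ : Fin m → Fin n → Bool
        M′ x y = ((u == x) ∧ (v == y)) ∨ M x y
        tot′ : ∀ x → T (A x) → ∃ λ y → T (M′ x y)
        tot′ x a with em (u == x)
        ... | inj₁ e = v , ∨₁ (∧⁺ e (==⁺ {x = v} refl))
        ... | inj₂ ¬e = let y , q = tot x (∧⁺ a (not⁺ ¬e)) in y , ∨₂ {(u == x) ∧ (v == y)} q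
        ok′ : ∀ x y → T (M′ x y) → T (A x) × T (B y) × T (J x y)
        ok′ x y p with ∨⁻ {(u == x) ∧ (v == y)} p
        ... | inj₂ q = let s , b , j = ok x y q in ∧₁ s , ∧₁ b , j
        ... | inj₁ q with ==⁻ {x = u} {x} (∧₁ q) | ==⁻ {x = v} {y} (∧₂ {u == x} q)
        ...   | refl | refl = au , ∧₁ bv , juv
        inj″ : ∀ x x′ y → T (M′ x y) → T (M′ x′ y) → x ≡ x′
        inj″ x x′ y p p′ with ∨⁻ {(u == x) ∧ (v == y)} p | ∨⁻ {(u == x′) ∧ (v == y)} p′
        ... | inj₂ q | inj₂ q′ = inj′ x x′ y q q′
        ... | inj₁ q | inj₁ q′ = trans (sym (==⁻ {x = u} (∧₁ q))) (==⁻ {x = u} (∧₁ q′))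
        ... | inj₁ q | inj₂ q′ = ⊥-elim (not⁻ (∧₂ {B y} (proj₁ (proj₂ (ok x′ y q′)))) (∧₂ {u == x} q))
        ... | inj₂ q | inj₁ q′ = ⊥-elim (not⁻ (∧₂ {B y} (proj₁ (proj₂ (ok x y q)))) (∧₂ {u == x′} q′))

hall : ∀ {n} (J : Fin n → Fin n → Bool) → (∀ S → # S ≤ # (N⁺ J S)) → ∃ λ (π : Perm n) → ∀ x → T (J x (to π x))
hall {n} J H with hall-on J n (λ _ → true) (λ _ → true) (#≤n _) (λ S _ → ≤-trans (H S) (#-mono λ y → ∧⁺ tt))
... | M , tot , ok , inj with injection⇒Perm (λ x → proj₁ (tot x tt)) (λ {x} {y} e → inj x y _ (proj₂ (tot x tt)) (subst (λ z → T (M y z)) (sym e) (proj₂ (tot y tt))))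
...   | π , h = π , λ x → subst (λ z → T (J x z)) (sym (h x)) (proj₂ (proj₂ (ok x _ (proj₂ (tot x tt)))))

-- Complete multipartite blow-ups in dense sets of tuples

∑ᵛ : ∀ {n} m → (Vec (Fin n) m → ℕ) → ℕ
∑ᵛ zero f = f []
∑ᵛ (suc m) f = ∑ λ x → ∑ᵛ m λ z → f (x ∷ z)

#ᵛ : ∀ {n} m → (Vec (Fin n) m → Bool) → ℕ
#ᵛ m P = ∑ᵛ m λ z → ⟦ P z ⟧

∑ᵛ-mono : ∀ {n} m {f g : Vec (Fin n) m → ℕ} → (∀ z → f z ≤ g z) → ∑ᵛ m f ≤ ∑ᵛ m g
∑ᵛ-mono zero h = h []
∑ᵛ-mono (suc m) h = ∑-mono λ x → ∑ᵛ-mono m λ z → h (x ∷ z)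

∑ᵛ-cong : ∀ {n} m {f g : Vec (Fin n) m → ℕ} → (∀ z → f z ≡ g z) → ∑ᵛ m f ≡ ∑ᵛ m g
∑ᵛ-cong zero h = h []
∑ᵛ-cong (suc m) h = ∑-cong λ x → ∑ᵛ-cong m λ z → h (x ∷ z)

∑ᵛ-+ : ∀ {n} m (f g : Vec (Fin n) m → ℕ) → ∑ᵛ m (λ z → f z + g z) ≡ ∑ᵛ m f + ∑ᵛ m g
∑ᵛ-+ zero f g = refl
∑ᵛ-+ (suc m) f g = trans (∑-cong λ x → ∑ᵛ-+ m (λ z → f (x ∷ z)) (λ z → g (x ∷ z)))
  (∑-+ (λ x → ∑ᵛ m (λ z → f (x ∷ z))) (λ x → ∑ᵛ m (λ z → g (x ∷ z))))

∑ᵛ-*ˡ : ∀ {n} m c (f : Vec (Fin n) m → ℕ) → ∑ᵛ m (λ z → c * f z) ≡ c * ∑ᵛ m f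
∑ᵛ-*ˡ zero c f = refl
∑ᵛ-*ˡ (suc m) c f = trans (∑-cong λ x → ∑ᵛ-*ˡ m c (λ z → f (x ∷ z))) (∑-*ˡ c (λ x → ∑ᵛ m (λ z → f (x ∷ z))))

∑ᵛ-const : ∀ {n} m c → ∑ᵛ {n} m (λ _ → c) ≡ n ^ m * c
∑ᵛ-const zero c = sym (+-identityʳ c)
∑ᵛ-const {n} (suc m) c = trans (∑-cong {n} λ _ → ∑ᵛ-const m c) (trans (∑-const n (n ^ m * c)) (sym (*-assoc n (n ^ m) c)))

∑ᵛ-swap : ∀ {n k} m (f : Fin k → Vec (Fin n) m → ℕ) → ∑ (λ t → ∑ᵛ m (f t)) ≡ ∑ᵛ m (λ z → ∑ (λ t → f t z))
∑ᵛ-swap zero f = refl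
∑ᵛ-swap (suc m) f = trans (∑-swap (λ t x → ∑ᵛ m (λ z → f t (x ∷ z)))) (∑-cong λ x → ∑ᵛ-swap m (λ t z → f t (x ∷ z)))

#ᵛ-∪ : ∀ {n} m {P Q R : Vec (Fin n) m → Bool} → (∀ z → T (P z) → T (Q z) ⊎ T (R z)) → #ᵛ m P ≤ #ᵛ m Q + #ᵛ m R
#ᵛ-∪ m {P} {Q} {R} h = ≤-trans (∑ᵛ-mono m λ z → ⟦⟧-∪ (h z)) (≤-reflexive (∑ᵛ-+ m (λ z → ⟦ Q z ⟧) (λ z → ⟦ R z ⟧)))

#ᵛ-∪-family : ∀ {n k} m (P : Vec (Fin n) m → Bool) (Q : Fin k → Vec (Fin n) m → Bool) →
  (∀ z → T (P z) → ∃ λ t → T (Q t z)) → #ᵛ m P ≤ ∑ (λ t → #ᵛ m (Q t))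
#ᵛ-∪-family m P Q h = ≤-trans (∑ᵛ-mono m λ z → go z (P z) (h z)) (≤-reflexive (sym (∑ᵛ-swap m (λ t z → ⟦ Q t z ⟧))))
  where
  go : ∀ z b → (T b → ∃ λ t → T (Q t z)) → ⟦ b ⟧ ≤ ∑ (λ t → ⟦ Q t z ⟧)
  go z false _ = z≤n
  go z true h with h tt
  ... | t , q = ≤-trans (≤-reflexive (sym (⟦⟧-T q))) (∑-≥ (λ t → ⟦ Q t z ⟧) t)

#ᵛ-∃ : ∀ {n} m (P : Vec (Fin n) m → Bool) → 0 < #ᵛ m P → ∃ λ z → T (P z)
#ᵛ-∃ zero P h with em (P [])
... | inj₁ p = [] , p
... | inj₂ ¬p = ⊥-elim (<-irrefl (sym (⟦⟧-¬T ¬p)) h)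
#ᵛ-∃ {n} (suc m) P h with any? (λ x → 0 <? #ᵛ m (λ z → P (x ∷ z)))
... | yes (x , p) = let z , q = #ᵛ-∃ m (λ z → P (x ∷ z)) p in x ∷ z , q
... | no ¬p = ⊥-elim (<⇒≱ h (≤-trans (∑-bound _ 0 λ x → ≮⇒≥ λ p → ¬p (x , p)) (≤-reflexive (*-zeroʳ n))))

record Pick {n} m {K} (f : Vec (Fin n) m → Fin K → Bool) (G : Vec (Fin n) m → Bool) (ℓ s : ℕ) : Set where
  field
    t : Fin K
    ℓ≤t : ℓ ≤ toℕ t
    G′ : Vec (Fin n) m → Bool
    loss : #ᵛ m G ≤ K * #ᵛ m G′
    pos : 0 < #ᵛ m G′
    old : ∀ z → T (G′ z) → T (G z)
    new : ∀ z → T (G′ z) → T (f z t)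
    rest : ∀ z → T (G′ z) → s ≤ # (λ t′ → (suc (toℕ t) ≤ᵇ′ toℕ t′) ∧ f z t′)

-- Each tuple of `G` has a least usable index. The most popular value is kept, at the cost of a
-- factor `K` in the number of tuples.
pick-index : ∀ {n} m {K} → 0 < K → (f : Vec (Fin n) m → Fin K → Bool) (G : Vec (Fin n) m → Bool) → ∀ ℓ s →
  (∀ z → T (G z) → suc s ≤ # (λ t → (ℓ ≤ᵇ′ toℕ t) ∧ f z t)) → 0 < #ᵛ m G → Pick m f G ℓ s
pick-index {n} m {K} K>0 f G ℓ s h pos = record
  { t = t ; ℓ≤t = ≤ᵇ⁻ {ℓ} (∧₁ (proj₂ (#ᵛ-∃ m (G′ t) pos′))) ; G′ = G′ t ; loss = le′ ; pos = pos′
  ; old = λ z g → ∧₁ (∧₂ {ℓ ≤ᵇ′ toℕ t} g) ; new = λ z g → ∧₁ (∧₂ {G z} (∧₂ {ℓ ≤ᵇ′ toℕ t} g))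
  ; rest = λ z g → ≤ᵇ⁻ (∧₂ {f z t} (∧₂ {G z} (∧₂ {ℓ ≤ᵇ′ toℕ t} g))) }
  where
  G′ : Fin K → Vec (Fin n) m → Bool
  G′ t z = (ℓ ≤ᵇ′ toℕ t) ∧ (G z ∧ (f z t ∧ (s ≤ᵇ′ # (λ t′ → (suc (toℕ t) ≤ᵇ′ toℕ t′) ∧ f z t′))))
  best = ∑-max (λ t → #ᵛ m (G′ t)) K>0
  t = proj₁ best
  le′ : #ᵛ m G ≤ K * #ᵛ m (G′ t)
  le′ = ≤-trans (#ᵛ-∪-family m G G′ λ z g → let t , l , q , r = least (f z) ℓ s (h z g) in t , ∧⁺ (≤ᵇ⁺ l) (∧⁺ g (∧⁺ q (≤ᵇ⁺ r)))) (proj₂ best)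
  pos′ : 0 < #ᵛ m (G′ t)
  pos′ = n≢0⇒n>0 λ e → <⇒≱ pos (≤-trans le′ (≤-reflexive (trans (cong (K *_) e) (*-zeroʳ K))))

-- Needed to trace old cycles after the rewiring: copies 1 and 2 will have interchangeable images,
-- so following `π` from copy 1 to either of them comes back to the same class within `K` steps.
Linked : ∀ {n} → Perm n → ℕ → (Fin 4 → Fin n) → Set
Linked π K u = ∃ λ r → r < K × (iter π (suc r) (u (suc zero)) ≡ u (suc zero) ⊎ iter π (suc r) (u (suc zero)) ≡ u (suc (suc zero)))

sel : ∀ {n m} → Vec (Fin 4 → Fin n) m → (Fin m → Fin 4) → Vec (Fin n) m
sel [] c = []
sel (u ∷ U) c = u (c zero) ∷ sel U (c ∘ suc)

lookup-sel : ∀ {n m} (U : Vec (Fin 4 → Fin n) m) c i → lookup (sel U c) i ≡ lookup U i (c i)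
lookup-sel (u ∷ U) c zero = refl
lookup-sel (u ∷ U) c (suc i) = lookup-sel U (c ∘ suc) i

four : ∀ {A : Set} → A → A → A → A → Fin 4 → A
four a b c d zero = a
four a b c d (suc zero) = b
four a b c d (suc (suc zero)) = c
four a b c d (suc (suc (suc zero))) = d

four-inj : ∀ {A B : Set} (f : A → B) (R : A → A → Set) → (∀ {x y} → R x y → f x ≢ f y) → ∀ {a b c d} →
  R a b → R a c → R a d → R b c → R b d → R c d → ∀ {i j} → f (four a b c d i) ≡ f (four a b c d j) → i ≡ j
four-inj f R h ab ac ad bc bd cd {zero} {zero} e = refl
four-inj f R h ab ac ad bc bd cd {zero} {suc zero} e = ⊥-elim (h ab e)
four-inj f R h ab ac ad bc bd cd {zero} {suc (suc zero)} e = ⊥-elim (h ac e)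
four-inj f R h ab ac ad bc bd cd {zero} {suc (suc (suc zero))} e = ⊥-elim (h ad e)
four-inj f R h ab ac ad bc bd cd {suc zero} {zero} e = ⊥-elim (h ab (sym e))
four-inj f R h ab ac ad bc bd cd {suc zero} {suc zero} e = refl
four-inj f R h ab ac ad bc bd cd {suc zero} {suc (suc zero)} e = ⊥-elim (h bc e)
four-inj f R h ab ac ad bc bd cd {suc zero} {suc (suc (suc zero))} e = ⊥-elim (h bd e)
four-inj f R h ab ac ad bc bd cd {suc (suc zero)} {zero} e = ⊥-elim (h ac (sym e))
four-inj f R h ab ac ad bc bd cd {suc (suc zero)} {suc zero} e = ⊥-elim (h bc (sym e))
four-inj f R h ab ac ad bc bd cd {suc (suc zero)} {suc (suc zero)} e = refl
four-inj f R h ab ac ad bc bd cd {suc (suc zero)} {suc (suc (suc zero))} e = ⊥-elim (h cd e)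
four-inj f R h ab ac ad bc bd cd {suc (suc (suc zero))} {zero} e = ⊥-elim (h ad (sym e))
four-inj f R h ab ac ad bc bd cd {suc (suc (suc zero))} {suc zero} e = ⊥-elim (h bd (sym e))
four-inj f R h ab ac ad bc bd cd {suc (suc (suc zero))} {suc (suc zero)} e = ⊥-elim (h cd (sym e))
four-inj f R h ab ac ad bc bd cd {suc (suc (suc zero))} {suc (suc (suc zero))} e = refl

pow5 : ∀ K x → K * (K * (K * (K * (K * x)))) ≡ K ^ 5 * x
pow5 K x = e K x
  where
  e : ∀ K x → K * (K * (K * (K * (K * x)))) ≡ (K * (K * (K * (K * (K * 1))))) * x
  e = solve-∀

record Block {n} m K (ρ : Perm n) (P : Fin n → Vec (Fin n) m → Bool) : Set where
  field
    v : Fin n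
    t : Fin 4 → Fin K
    t₀<t₁ : toℕ (t zero) < toℕ (t (suc zero))
    t₁<t₂ : toℕ (t (suc zero)) < toℕ (t (suc (suc zero)))
    t₂<t₃ : toℕ (t (suc (suc zero))) < toℕ (t (suc (suc (suc zero))))
    G : Vec (Fin n) m → Bool
    bound : n ^ m ≤ K ^ 5 * #ᵛ m G
    pos : 0 < #ᵛ m G
    mem : ∀ z → T (G z) → ∀ i → T (P (iter ρ (toℕ (t i)) v) z)

-- Density 1 / q means that some window of `K = 4q` consecutive iterates contains four hits per
-- tuple on average, so at least a 1 / K fraction of the tuples has four hits there. Four rounds of
-- `pick-index` fix the positions; together this costs the fifth power of `K`, which does not depend
-- on `n`.
block : ∀ {n} m q K (ρ : Perm n) (P : Fin n → Vec (Fin n) m → Bool) → K ≡ 4 * q → 0 < q → 0 < n →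
  n * n ^ m ≤ q * ∑ (λ x → #ᵛ m (P x)) →
  Block m K ρ P
block {n} m q K ρ P Keq q>0 n>0 big = from-heavy (proj₁ heavy) (proj₂ heavy)
  where
  K>0 : 0 < K
  K>0 = subst (0 <_) (sym Keq) (*-mono-≤ {1} {4} (s≤s z≤n) q>0)
  f : Fin n → ℕ
  f x = #ᵛ m (P x)
  N = n ^ m
  N>0 : 0 < N
  N>0 = m^n>0 n {{>-nonZero n>0}} m
  bsum : Fin n → ℕ
  bsum v = ∑ {K} (λ t → f (iter ρ (toℕ t) v))
  total : ∑ bsum ≡ K * ∑ f
  total = trans (∑-swap (λ v (t : Fin K) → f (iter ρ (toℕ t) v)))
    (trans (∑-cong {K} λ t → trans (∑-cong λ v → cong f (sym (iter-perm-to ρ (toℕ t) v))) (∑-perm (iter-perm ρ (toℕ t)) f)) (∑-const K (∑ f)))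
  heavy : ∃ λ v → K * N ≤ q * bsum v
  heavy = ∑-avg (λ v → q * bsum v) (K * N) (inj₂ (n>0 , ≤-trans (≤-reflexive (e₁ n K N)) (≤-trans (*-monoʳ-≤ K big)
    (≤-reflexive (trans (e₂ K q (∑ f)) (trans (cong (q *_) (sym total)) (sym (∑-*ˡ q bsum))))))))
    where
    e₁ : ∀ n K N → n * (K * N) ≡ K * (n * N)
    e₁ = solve-∀
    e₂ : ∀ K q s → K * (q * s) ≡ q * (K * s)
    e₂ = solve-∀
  module _ (v : Fin n) (hv : K * N ≤ q * bsum v) where
    F : Vec (Fin n) m → Fin K → Bool
    F z t = P (iter ρ (toℕ t) v) z
    G₄ : Vec (Fin n) m → Bool
    G₄ z = 4 ≤ᵇ′ # (F z)
    -- A tuple outside `G₄` has at most three hits in the window, and one in `G₄` at most `K`.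
    deg-sum : bsum v ≤ 3 * N + K * #ᵛ m G₄
    deg-sum = ≤-trans (≤-reflexive (∑ᵛ-swap m (λ t z → ⟦ F z t ⟧))) (≤-trans (∑ᵛ-mono m pt)
      (≤-reflexive (trans (∑ᵛ-+ m (λ _ → 3) (λ z → K * ⟦ G₄ z ⟧)) (cong₂ _+_ (trans (∑ᵛ-const m 3) (*-comm N 3)) (∑ᵛ-*ˡ m K (λ z → ⟦ G₄ z ⟧))))))
      where
      pt : ∀ z → # (F z) ≤ 3 + K * ⟦ G₄ z ⟧
      pt z with em (G₄ z)
      ... | inj₁ g = ≤-trans (#≤n (F z)) (≤-trans (≤-reflexive (trans (sym (*-identityʳ K)) (cong (K *_) (sym (⟦⟧-T g))))) (m≤n+m _ 3))
      ... | inj₂ ¬g = ≤-trans (≤-pred (≰⇒> λ l → ¬g (≤ᵇ⁺ l))) (m≤m+n 3 _)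
    N≤ : N ≤ K * #ᵛ m G₄
    N≤ = *-cancelˡ-≤ q {{>-nonZero q>0}} (+-cancelˡ-≤ (q * (3 * N)) _ _ (≤-trans (≤-reflexive (trans (e q N) (cong (_* N) (sym Keq)))) (≤-trans hv (≤-trans (*-monoʳ-≤ q deg-sum) (≤-reflexive (*-distribˡ-+ q (3 * N) _))))))
      where
      e : ∀ q N → q * (3 * N) + q * N ≡ 4 * q * N
      e = solve-∀
    G₄>0 : 0 < #ᵛ m G₄
    G₄>0 = n≢0⇒n>0 λ z → <⇒≱ N>0 (≤-trans N≤ (≤-reflexive (trans (cong (K *_) z) (*-zeroʳ K))))
    p₀ = pick-index m K>0 F G₄ 0 3 (λ z g → ≤-trans (≤ᵇ⁻ {4} g) (#-mono {P = F z} {Q = λ t → (0 ≤ᵇ′ toℕ t) ∧ F z t} λ t p → ∧⁺ (≤ᵇ⁺ {0} {toℕ t} z≤n) p)) G₄>0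
    again : ∀ {G ℓ s} (p : Pick m F G ℓ (suc s)) → Pick m F (Pick.G′ p) (suc (toℕ (Pick.t p))) s
    again {s = s} p = pick-index m K>0 F (Pick.G′ p) (suc (toℕ (Pick.t p))) s (Pick.rest p) (Pick.pos p)
    p₁ = again p₀
    p₂ = again p₁
    p₃ = again p₂
    open Pick
    from-heavy : Block m K ρ P
    from-heavy = record
      { v = v ; t = four (t p₀) (t p₁) (t p₂) (t p₃) ; t₀<t₁ = ℓ≤t p₁ ; t₁<t₂ = ℓ≤t p₂ ; t₂<t₃ = ℓ≤t p₃ ; G = G′ p₃
      ; bound = ≤-trans N≤ (≤-trans (*-monoʳ-≤ K (≤-trans (loss p₀) (*-monoʳ-≤ K (≤-trans (loss p₁) (*-monoʳ-≤ K (≤-trans (loss p₂) (*-monoʳ-≤ K (loss p₃)))))))) (≤-reflexive (pow5 K (#ᵛ m (G′ p₃)))))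
      ; pos = pos p₃ ; mem = mem }
      where
      mem : ∀ z → T (G′ p₃ z) → ∀ i → T (F z (four (t p₀) (t p₁) (t p₂) (t p₃) i))
      mem z g zero = new p₀ z (old p₁ z (old p₂ z (old p₃ z g)))
      mem z g (suc zero) = new p₁ z (old p₂ z (old p₃ z g))
      mem z g (suc (suc zero)) = new p₂ z (old p₃ z g)
      mem z g (suc (suc (suc zero))) = new p₃ z g

-- The cyclic shift, whose orbits supply blocks of arbitrary distinct elements.
shift : ∀ {m} → Fin (suc m) → Fin (suc m)
shift {m} x with toℕ x <? m
... | yes p = suc (fromℕ< p)
... | no _ = zero

shift-< : ∀ {m} (x : Fin (suc m)) → toℕ x < m → toℕ (shift x) ≡ suc (toℕ x)
shift-< {m} x p with toℕ x <? m
... | yes q = cong suc (toℕ-fromℕ< q)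
... | no ¬q = ⊥-elim (¬q p)

shift-last : ∀ {m} (x : Fin (suc m)) → toℕ x ≡ m → toℕ (shift x) ≡ 0
shift-last {m} x e with toℕ x <? m
... | yes q = ⊥-elim (<-irrefl e q)
... | no _ = refl

abstract
  shift-perm : ∀ {m} → ∃ λ (ρ : Perm (suc m)) → ∀ x → to ρ x ≡ shift x
  shift-perm {m} = injection⇒Perm shift inj
    where
    inj : ∀ {x y : Fin (suc m)} → shift x ≡ shift y → x ≡ y
    inj {x} {y} e with m≤n⇒m<n∨m≡n (≤-pred (toℕ<n x)) | m≤n⇒m<n∨m≡n (≤-pred (toℕ<n y))
    ... | inj₁ p | inj₁ q = toℕ-injective (suc-injective (trans (sym (shift-< x p)) (trans (cong toℕ e) (shift-< y q))))
    ... | inj₂ p | inj₂ q = toℕ-injective (trans p (sym q))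
    ... | inj₁ p | inj₂ q = ⊥-elim (1+n≢0 (trans (sym (shift-< x p)) (trans (cong toℕ e) (shift-last y q))))
    ... | inj₂ p | inj₁ q = ⊥-elim (1+n≢0 (trans (sym (shift-< y q)) (trans (cong toℕ (sym e)) (shift-last x p))))

climb : ∀ {m} t (x : Fin (suc m)) → toℕ x + t ≤ m → toℕ (iter (proj₁ (shift-perm {m})) t x) ≡ toℕ x + t
climb zero x p = sym (+-identityʳ _)
climb {m} (suc t) x p = trans (climb t _ (≤-trans (≤-reflexive eq) p)) eq
  where
  eq : toℕ (to (proj₁ (shift-perm {m})) x) + t ≡ toℕ x + suc t
  eq = trans (cong (_+ t) (trans (cong toℕ (proj₂ (shift-perm {m}) x)) (shift-< x (≤-trans (m≤m+n (suc (toℕ x)) t) (≤-trans (≤-reflexive (sym (+-suc (toℕ x) t))) p))))) (sym (+-suc (toℕ x) t))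

-- A walk that does not pass the end strictly climbs. One that does pass it has made too few steps
-- to climb back to `v`, so it ends below.
shift-aperiodic : ∀ {m} (v : Fin (suc m)) r → suc r ≤ m → iter (proj₁ (shift-perm {m})) (suc r) v ≢ v
shift-aperiodic {m} v r r<m e with toℕ v + suc r ≤? m
... | yes p = <⇒≢ (m<m+n (toℕ v) (s≤s z≤n)) (sym (trans (sym (climb (suc r) v p)) (cong toℕ e)))
... | no ¬p = <⇒≢ small (trans (sym wrap) (cong toℕ e))
  where
  ρ = proj₁ (shift-perm {m})
  a = m ∸ toℕ v
  va : toℕ v + a ≡ m
  va = m+[n∸m]≡n (≤-pred (toℕ<n v))
  s = toℕ v + suc r ∸ suc m
  vs : suc m + s ≡ toℕ v + suc r
  vs = m+[n∸m]≡n (≰⇒> ¬p)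
  small : s < toℕ v
  small = +-cancelˡ-< (suc m) s (toℕ v) (subst (_< suc m + toℕ v) (sym vs) (subst (toℕ v + suc r <_) (+-comm (toℕ v) (suc m)) (+-monoʳ-< (toℕ v) (s≤s r<m))))
  ra : suc r ≡ a + suc s
  ra = +-cancelˡ-≡ (toℕ v) _ _ (trans (sym vs) (trans (eq m s) (trans (cong (_+ suc s) (sym va)) (+-assoc (toℕ v) a (suc s)))))
    where
    eq : ∀ m s → suc m + s ≡ m + suc s
    eq = solve-∀
  top : toℕ (iter ρ a v) ≡ m
  top = trans (climb a v (≤-reflexive va)) va
  z0 : to ρ (iter ρ a v) ≡ zero
  z0 = toℕ-injective (trans (cong toℕ (proj₂ (shift-perm {m}) _)) (shift-last _ top))
  wrap : toℕ (iter ρ (suc r) v) ≡ s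
  wrap = trans (cong (λ t → toℕ (iter ρ t v)) ra) (trans (cong toℕ (iter-+ ρ a (suc s) v))
    (trans (cong (λ w → toℕ (iter ρ s w)) z0) (climb s zero (≤-trans (<⇒≤ small) (≤-pred (toℕ<n v))))))

iter-gap : ∀ {n} (ρ : Perm n) v {s t} → s < t → ∃ λ r → suc r ≤ t × iter ρ (suc r) (iter ρ s v) ≡ iter ρ t v
iter-gap ρ v {s} {t} s<t with m≤n⇒∃[o]m+o≡n s<t
... | r , p = r , ≤-trans (s≤s (m≤n+m r s)) (≤-reflexive p) , trans (sym (iter-+ ρ s (suc r) v)) (cong (λ a → iter ρ a v) (trans (+-suc s r) p))

iter-distinct : ∀ {n} (ρ : Perm n) v {s t} → s < t → (∀ r → suc r ≤ t → iter ρ (suc r) (iter ρ s v) ≢ iter ρ s v) → iter ρ s v ≢ iter ρ t v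
iter-distinct ρ v {s} {t} s<t h e = let r , le , g = iter-gap ρ v s<t in h r le (trans g (sym e))

short : ∀ {n} → Perm n → ℕ → Fin n → Bool
short π K x = any {K} λ r → iter π (suc (toℕ r)) x == x

short⁺ : ∀ {n} (π : Perm n) K x r → suc r ≤ K → iter π (suc r) x ≡ x → T (short π K x)
short⁺ π K x r le e = any⁺ {K} (λ r → iter π (suc (toℕ r)) x == x) (fromℕ< le)
  (==⁺ (subst (λ a → iter π (suc a) x ≡ x) (sym (toℕ-fromℕ< le)) e))

record BlowStep {n} m K (π : Perm n) (P : Fin n → Vec (Fin n) m → Bool) : Set where
  field
    u : Fin 4 → Fin n
    inj : ∀ {i j} → u i ≡ u j → i ≡ j
    link : Linked π K u
    G : Vec (Fin n) m → Bool
    bound : n ^ m ≤ K ^ 5 * #ᵛ m G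
    mem : ∀ z → T (G z) → ∀ i → T (P (u i) z)

-- Vertices on cycles of length at most `K` are separated from the others; one kind keeps half of
-- the density, hence `8 * q` instead of `4 * q`. For vertices on long cycles the window runs along
-- `π` itself, so its entries are distinct and copy 2 is reached from copy 1. For those on short
-- cycles it runs along the cyclic shift, and copy 1 returns to itself within `K` steps.
blow-step : ∀ {n} m q K (π : Perm n) (P : Fin n → Vec (Fin n) m → Bool) → K ≡ 8 * q → 0 < q → 0 < n → K < n →
  n * n ^ m ≤ q * ∑ (λ x → #ᵛ m (P x)) → BlowStep m K π P
blow-step {suc n₁} m q K π P Keq q>0 n>0 Kn big = [ shorts , longs ]′ (halves _ _ (≤-trans big (*-monoʳ-≤ q splitle)))
  where
  n = suc n₁
  Ps Pl : Fin n → Vec (Fin n) m → Bool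
  Ps x z = short π K x ∧ P x z
  Pl x z = not (short π K x) ∧ P x z
  splitle : ∑ (λ x → #ᵛ m (P x)) ≤ ∑ (λ x → #ᵛ m (Ps x)) + ∑ (λ x → #ᵛ m (Pl x))
  splitle = ≤-trans (∑-mono λ x → #ᵛ-∪ m {P x} {Ps x} {Pl x} λ z p → [ (λ s → inj₁ (∧⁺ s p)) , (λ ¬s → inj₂ (∧⁺ (not⁺ ¬s) p)) ]′ (em (short π K x)))
    (≤-reflexive (∑-+ (λ x → #ᵛ m (Ps x)) (λ x → #ᵛ m (Pl x))))
  double : ∀ q b → q * (b + b) ≡ 2 * q * b
  double = solve-∀
  halves : ∀ a b → n * n ^ m ≤ q * (a + b) → n * n ^ m ≤ (2 * q) * a ⊎ n * n ^ m ≤ (2 * q) * b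
  halves a b h with ≤-total a b
  ... | inj₁ p = inj₂ (≤-trans h (≤-trans (*-monoʳ-≤ q (+-monoˡ-≤ b p)) (≤-reflexive (double q b))))
  ... | inj₂ p = inj₁ (≤-trans h (≤-trans (*-monoʳ-≤ q (+-monoʳ-≤ a p)) (≤-reflexive (double q a))))
  2q>0 : 0 < 2 * q
  2q>0 = *-mono-≤ {1} {2} (s≤s z≤n) q>0
  Keq′ : K ≡ 4 * (2 * q)
  Keq′ = trans Keq (*-assoc 4 2 q)
  module _ (ρ : Perm n) (P′ : Fin n → Vec (Fin n) m → Bool) (B : Block m K ρ P′) where
    open Block B
    pt : Fin 4 → Fin n
    pt i = iter ρ (toℕ (t i)) v
    distinct : (∀ i j → toℕ (t i) < toℕ (t j) → pt i ≢ pt j) → ∀ {i j} → pt i ≡ pt j → i ≡ j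
    distinct ne {i} {j} e = four-inj pt (λ i j → toℕ (t i) < toℕ (t j)) (λ {i} {j} → ne i j) {zero} {suc zero} {suc (suc zero)} {suc (suc (suc zero))}
      t₀<t₁ (<-trans t₀<t₁ t₁<t₂) (<-trans t₀<t₁ (<-trans t₁<t₂ t₂<t₃)) t₁<t₂ (<-trans t₁<t₂ t₂<t₃) t₂<t₃ {i} {j} (trans (cong pt (η i)) (trans e (cong pt (sym (η j)))))
      where
      η : ∀ i → four zero (suc zero) (suc (suc zero)) (suc (suc (suc zero))) i ≡ i
      η zero = refl
      η (suc zero) = refl
      η (suc (suc zero)) = refl
      η (suc (suc (suc zero))) = refl
  shorts : n * n ^ m ≤ (2 * q) * ∑ (λ x → #ᵛ m (Ps x)) → BlowStep m K π P
  shorts h = record { u = u ; inj = distinct ρ Ps B ne ; link = link ; G = G ; bound = bound ; mem = λ z g i → ∧₂ {short π K (u i)} (mem z g i) }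
    where
    ρ = proj₁ (shift-perm {n₁})
    B = block m (2 * q) K ρ Ps Keq′ 2q>0 n>0 h
    open Block B
    u : Fin 4 → Fin n
    u = pt ρ Ps B
    ne : ∀ i j → toℕ (t i) < toℕ (t j) → u i ≢ u j
    ne i j l = iter-distinct ρ v l λ r le → shift-aperiodic (iter ρ (toℕ (t i)) v) r (≤-trans le (≤-trans (<⇒≤ (toℕ<n (t j))) (≤-pred Kn)))
    link : Linked π K u
    link = let z , g = #ᵛ-∃ m G pos ; r , e = any⁻ {K} (λ r → iter π (suc (toℕ r)) (u (suc zero)) == u (suc zero)) (∧₁ (mem z g (suc zero))) in toℕ r , toℕ<n r , inj₁ (==⁻ {x = iter π (suc (toℕ r)) (u (suc zero))} {u (suc zero)} e)
  longs : n * n ^ m ≤ (2 * q) * ∑ (λ x → #ᵛ m (Pl x)) → BlowStep m K π P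
  longs h = record { u = u ; inj = distinct π Pl B ne ; link = link ; G = G ; bound = bound ; mem = λ z g i → ∧₂ {not (short π K (u i))} (mem z g i) }
    where
    B = block m (2 * q) K π Pl Keq′ 2q>0 n>0 h
    open Block B
    u : Fin 4 → Fin n
    u = pt π Pl B
    long : ∀ i → ¬ T (short π K (u i))
    long i = let z , g = #ᵛ-∃ m G pos in not⁻ (∧₁ (mem z g i))
    ne : ∀ i j → toℕ (t i) < toℕ (t j) → u i ≢ u j
    ne i j l = iter-distinct π v l λ r le e → long i (short⁺ π K (u i) r (≤-trans le (<⇒≤ (toℕ<n (t j)))) e)
    gap : ∃ λ r → suc r ≤ toℕ (t (suc (suc zero))) × iter π (suc r) (u (suc zero)) ≡ u (suc (suc zero))
    gap = iter-gap π v t₁<t₂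
    link : Linked π K u
    link = proj₁ gap , ≤-trans (proj₁ (proj₂ gap)) (<⇒≤ (toℕ<n (t (suc (suc zero))))) , inj₂ (proj₂ (proj₂ gap))

abstract
  K-step : ℕ → ℕ
  K-step q = 8 * q

  K-step-≡ : ∀ q → K-step q ≡ 8 * q
  K-step-≡ q = refl

-- The number of tuples lost in a step depends only on q, so K-bound is independent of n.
K-bound : ℕ → ℕ → ℕ
K-bound zero q = 0
K-bound (suc m) q = K-step q + K-bound m (K-step q ^ 5)

Linked-mono : ∀ {n} (π : Perm n) {K K′ u} → K ≤ K′ → Linked π K u → Linked π K′ u
Linked-mono π le (r , l , h) = r , ≤-trans l le , h

record BlowUp {n} m K (π : Perm n) (P : Vec (Fin n) m → Bool) : Set where
  field
    U : Vec (Fin 4 → Fin n) m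
    distinct : ∀ i {a b} → lookup U i a ≡ lookup U i b → a ≡ b
    linked : ∀ i → Linked π K (lookup U i)
    complete : ∀ c → T (P (sel U c))

-- A form of the theorem of Erdős on complete multipartite subhypergraphs, with the extra property
-- `Linked`. The first coordinate is blown up; the tuples compatible with all four of its copies
-- still make up a fraction 1 / K⁵, so the recursion continues with `K ^ 5` in place of `q`.
blow-up : ∀ {n} (π : Perm n) m q (P : Vec (Fin n) m → Bool) → 0 < q → 0 < n → K-bound m q < n →
  n ^ m ≤ q * #ᵛ m P → BlowUp m (K-bound m q) π P
blow-up π zero q P q>0 n>0 Kn big = record { U = [] ; distinct = λ () ; linked = λ () ; complete = λ c → only (#ᵛ-∃ 0 P (n≢0⇒n>0 λ e → <⇒≱ big (≤-trans (≤-reflexive (trans (cong (q *_) e) (*-zeroʳ q))) z≤n))) }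
  where
  only : (∃ λ z → T (P z)) → T (P [])
  only ([] , p) = p
blow-up {n} π (suc m) q P q>0 n>0 Kn big = go (K-step q) (K-step-≡ q) Kn
  where
  go : ∀ K → K ≡ 8 * q → K + K-bound m (K ^ 5) < n → BlowUp (suc m) (K + K-bound m (K ^ 5)) π P
  go K Keq Kn = record { U = u ∷ U ; distinct = inj′ ; linked = link′ ; complete = λ c → mem (sel U (c ∘ suc)) (complete (c ∘ suc)) (c zero) }
    where
    S = blow-step m q K π (λ x z → P (x ∷ z)) Keq q>0 n>0 (≤-trans (s≤s (m≤m+n K _)) Kn) big
    open BlowStep S
    K>0 : 0 < K
    K>0 = subst (0 <_) (sym Keq) (*-mono-≤ {1} {8} (s≤s z≤n) q>0)
    open BlowUp (blow-up π m (K ^ 5) G (m^n>0 K {{>-nonZero K>0}} 5) n>0 (≤-trans (s≤s (m≤n+m _ K)) Kn) bound)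
    inj′ : ∀ i {a b} → lookup (u ∷ U) i a ≡ lookup (u ∷ U) i b → a ≡ b
    inj′ zero = inj
    inj′ (suc i) = distinct i
    link′ : ∀ i → Linked π (K + K-bound m (K ^ 5)) (lookup (u ∷ U) i)
    link′ zero = Linked-mono π {u = u} (m≤m+n K _) link
    link′ (suc i) = Linked-mono π {u = lookup U i} (m≤n+m _ K) (linked i)

-- Merging cycles along a blown-up closed walk

shift-fromℕ : ∀ m → shift (fromℕ m) ≡ zero
shift-fromℕ m = toℕ-injective (shift-last (fromℕ m) (toℕ-fromℕ m))

shift-inject₁ : ∀ {m} (i : Fin m) → shift (inject₁ i) ≡ suc i
shift-inject₁ i = toℕ-injective (trans (shift-< (inject₁ i) (≤-trans (s≤s (≤-reflexive (toℕ-inject₁ i))) (toℕ<n i))) (cong suc (toℕ-inject₁ i)))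

shift-surj : ∀ {m} (i : Fin (suc m)) → ∃ λ i₀ → shift i₀ ≡ i
shift-surj {m} zero = fromℕ m , shift-fromℕ m
shift-surj (suc i) = inject₁ i , shift-inject₁ i

last? : ∀ {m} (i : Fin (suc m)) → i ≡ fromℕ m ⊎ ∃ λ i′ → i ≡ inject₁ i′
last? {zero} zero = inj₁ refl
last? {suc m} zero = inj₂ (zero , refl)
last? {suc m} (suc i) with last? i
... | inj₁ e = inj₁ (cong suc e)
... | inj₂ (i′ , e) = inj₂ (suc i′ , cong suc e)

-- A closed walk U₀ → U₁ → … → U_m → U₀ for the relation E x (π y), each vertex blown up to four, together
-- with an extra vertex w having all of U₀ as out-neighbours and all of U_j as in-neighbours.
record Chain {n} (E : Digraph n) (π : Perm n) (K m : ℕ) : Set where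
  field
    U : Fin (suc m) → Fin 4 → Fin n
    w : Fin n
    j : Fin (suc m)
    j≢last : j ≢ fromℕ m
    factor : ∀ x → T (E x (to π x))
    U-inj : ∀ {i a b} → U i a ≡ U i b → a ≡ b
    separated : ∀ {i i′ a b} s → s ≤ K → iter π s (U i a) ≡ U i′ b → i ≡ i′
    far-from-w : ∀ {i a} s → s ≤ K → iter π s (U i a) ≢ w
    linked : ∀ i → Linked π K (U i)
    walk : ∀ i a b → T (E (U i a) (to π (U (shift i) b)))
    enter : ∀ b → T (E w (to π (U zero b)))
    leave : ∀ a → T (E (U j a) (to π w))

-- Result of four rotations: copies 1, 2 and 3 go around the whole walk, while copy 0 serves the
-- shorter closed walk from `w` through `U zero` up to `U j` and back to `w`. All copies of a set,
-- and `w`, can afterwards exchange images within their label.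
record Rewired {n} {E : Digraph n} {π : Perm n} {K m : ℕ} (C : Chain E π K m) : Set where
  open Chain C
  field
    π₀ : Perm n
    π₀-copy : ∀ c i → to π₀ (U i (suc c)) ≡ to π (U (shift i) (suc c))
    π₀-w : to π₀ w ≡ to π (U zero zero)
    part-image : ∀ i → toℕ i ≤ toℕ j → to π₀ (U i zero) ≡ to π (U (shift i) zero) ⊎ (i ≡ j × to π₀ (U i zero) ≡ to π w)
    π₀-j : to π₀ (U j zero) ≡ to π w
    π₀-off : ∀ x → (∀ c i → x ≢ U i (suc c)) → x ≢ w → (∀ i → toℕ i ≤ toℕ j → x ≢ U i zero) → to π₀ x ≡ to π x

module _ {n} {E : Digraph n} {π : Perm n} {K m : ℕ} (C : Chain E π K m) where
  open Chain C

  UU : ∀ {i i′ a b} → U i a ≡ U i′ b → i ≡ i′ × a ≡ b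
  UU {i} {i′} e with separated 0 z≤n e
  ... | refl = refl , U-inj e

module _ {n} {E : Digraph n} {π : Perm n} {K m : ℕ} (C : Chain E π K m) where
  open Chain C

  private
    copy : Fin 3 → Fin (suc m) → Fin n
    copy c i = U i (suc c)

    copy-inj : ∀ c {i i′} → copy c i ≡ copy c i′ → i ≡ i′
    copy-inj c e = proj₁ (UU C e)

    emb : Fin (suc (toℕ j)) → Fin (suc m)
    emb i = inject≤ i (toℕ<n j)

    path : Fin (suc (suc (toℕ j))) → Fin n
    path zero = w
    path (suc i) = U (emb i) zero

    path-inj : ∀ {i i′} → path i ≡ path i′ → i ≡ i′
    path-inj {zero} {zero} e = refl
    path-inj {zero} {suc i′} e = ⊥-elim (far-from-w 0 z≤n (sym e))
    path-inj {suc i} {zero} e = ⊥-elim (far-from-w 0 z≤n e)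
    path-inj {suc i} {suc i′} e = cong suc (toℕ-injective (trans (sym (toℕ-inject≤ i (toℕ<n j))) (trans (cong toℕ (proj₁ (UU C e))) (toℕ-inject≤ i′ (toℕ<n j)))))

    rot₁ = rotate m (copy zero) (copy-inj zero) π
    rot₂ = rotate m (copy (suc zero)) (copy-inj (suc zero)) (proj₁ rot₁)
    rot₃ = rotate m (copy (suc (suc zero))) (copy-inj (suc (suc zero))) (proj₁ rot₂)
    rot₄ = rotate (suc (toℕ j)) path path-inj (proj₁ rot₃)

    π₀ : Perm n
    π₀ = proj₁ rot₄

    copy≢copy : ∀ {c c′ i i′} → c ≢ c′ → copy c i ≢ copy c′ i′
    copy≢copy ne e with proj₂ (UU C e)
    ... | refl = ne refl

    copy≢path : ∀ {c i} i′ → copy c i ≢ path i′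
    copy≢path zero e = far-from-w 0 z≤n e
    copy≢path (suc i′) e with proj₂ (UU C e)
    ... | ()

    around : ∀ {v : Fin (suc m) → Fin n} {π′ : Perm n} (R : ∃ λ π″ → (∀ i → to π″ (v (inject₁ i)) ≡ to π′ (v (suc i))) × to π″ (v (fromℕ m)) ≡ to π′ (v zero) × (∀ x → (∀ (i : Fin (suc m)) → x ≢ v i) → to π″ x ≡ to π′ x)) →
      ∀ i → to (proj₁ R) (v i) ≡ to π′ (v (shift i))
    around {v} {π′} R i with last? i
    ... | inj₁ refl = trans (proj₁ (proj₂ (proj₂ R))) (cong (λ k → to π′ (v k)) (sym (shift-fromℕ m)))
    ... | inj₂ (i′ , refl) = trans (proj₁ (proj₂ R) i′) (cong (λ k → to π′ (v k)) (sym (shift-inject₁ i′)))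

    off₁ = proj₂ (proj₂ (proj₂ rot₁))
    off₂ = proj₂ (proj₂ (proj₂ rot₂))
    off₃ = proj₂ (proj₂ (proj₂ rot₃))
    off₄ = proj₂ (proj₂ (proj₂ rot₄))

    π₀-copy : ∀ c i → to π₀ (copy c i) ≡ to π (copy c (shift i))
    π₀-copy zero i = trans (off₄ _ copy≢path) (trans (off₃ _ λ _ → copy≢copy (λ ())) (trans (off₂ _ λ _ → copy≢copy (λ ())) (around {copy zero} {π} rot₁ i)))
    π₀-copy (suc zero) i = trans (off₄ _ copy≢path) (trans (off₃ _ λ _ → copy≢copy (λ ())) (trans (around {copy (suc zero)} {proj₁ rot₁} rot₂ i) (off₁ _ λ _ → copy≢copy (λ ()))))
    π₀-copy (suc (suc zero)) i = trans (off₄ _ copy≢path) (trans (around {copy (suc (suc zero))} {proj₁ rot₂} rot₃ i) (trans (off₂ _ λ _ → copy≢copy (λ ())) (off₁ _ λ _ → copy≢copy (λ ()))))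

    π₃-path : ∀ i → to (proj₁ rot₃) (path i) ≡ to π (path i)
    π₃-path i = trans (off₃ _ λ _ e → copy≢path i (sym e)) (trans (off₂ _ λ _ e → copy≢path i (sym e)) (off₁ _ λ _ e → copy≢path i (sym e)))

    π₀-w : to π₀ w ≡ to π (U zero zero)
    π₀-w = trans (proj₁ (proj₂ rot₄) zero) (π₃-path (suc zero))

    emb-suc : ∀ i → emb (suc i) ≡ shift (emb (inject₁ i))
    emb-suc i = toℕ-injective (trans (toℕ-inject≤ (suc i) (toℕ<n j)) (sym (trans (shift-< (emb (inject₁ i)) lt) (cong suc eq))))
      where
      eq : toℕ (emb (inject₁ i)) ≡ toℕ i
      eq = trans (toℕ-inject≤ (inject₁ i) (toℕ<n j)) (toℕ-inject₁ i)
      lt : toℕ (emb (inject₁ i)) < m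
      lt = ≤-trans (s≤s (≤-reflexive eq)) (≤-trans (toℕ<n i) (≤-pred (toℕ<n j)))

    emb-last : emb (fromℕ (toℕ j)) ≡ j
    emb-last = toℕ-injective (trans (toℕ-inject≤ _ (toℕ<n j)) (toℕ-fromℕ (toℕ j)))

    emb-onto : ∀ i → toℕ i ≤ toℕ j → ∃ λ i′ → emb i′ ≡ i
    emb-onto i le = fromℕ< (s≤s le) , toℕ-injective (trans (toℕ-inject≤ _ (toℕ<n j)) (toℕ-fromℕ< (s≤s le)))

    part-image : ∀ i → toℕ i ≤ toℕ j → to π₀ (U i zero) ≡ to π (U (shift i) zero) ⊎ (i ≡ j × to π₀ (U i zero) ≡ to π w)
    part-image i le with emb-onto i le
    ... | i′ , refl with last? i′
    ...   | inj₁ refl = inj₂ (emb-last , trans (proj₁ (proj₂ (proj₂ rot₄))) (π₃-path zero))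
    ...   | inj₂ (i″ , refl) = inj₁ (trans (proj₁ (proj₂ rot₄) (suc i″)) (trans (π₃-path (suc (suc i″))) (cong (λ k → to π (U k zero)) (emb-suc i″))))

  rewired : Rewired C
  rewired = record
    { π₀ = π₀ ; π₀-copy = π₀-copy ; π₀-w = π₀-w ; part-image = part-image
    ; π₀-j = subst (λ k → to π₀ (U k zero) ≡ to π w) emb-last (trans (proj₁ (proj₂ (proj₂ rot₄))) (π₃-path zero))
    ; π₀-off = λ x f h p → trans (off₄ x (offpath x h p)) (trans (off₃ x (f _)) (trans (off₂ x (f _)) (off₁ x (f _)))) }
    where
    offpath : ∀ x → x ≢ w → (∀ i → toℕ i ≤ toℕ j → x ≢ U i zero) → ∀ i → x ≢ path i
    offpath x h p zero = h
    offpath x h p (suc i) = p (emb i) (≤-trans (≤-reflexive (toℕ-inject≤ i (toℕ<n j))) (≤-pred (toℕ<n i)))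

module Labels {n} {E : Digraph n} {π : Perm n} {K m : ℕ} (C : Chain E π K m) (R : Rewired C) where
  open Chain C
  open Rewired R

  -- Copy 0 of U_i is used only for i ≤ j, on the closed walk through w.
  data Lab : Fin (suc m) → Fin n → Set where
    full : ∀ i c → Lab i (U i (suc c))
    part : ∀ i → toℕ i ≤ toℕ j → Lab i (U i zero)
    here : Lab (fromℕ m) w

  lab-unique : ∀ {i i′ x y} → Lab i x → Lab i′ y → x ≡ y → i ≡ i′
  lab-unique (full i c) (full i′ c′) e = proj₁ (UU C e)
  lab-unique (full i c) (part i′ _) e = proj₁ (UU C e)
  lab-unique (full i c) here e = ⊥-elim (far-from-w 0 z≤n e)
  lab-unique (part i _) (full i′ c′) e = proj₁ (UU C e)
  lab-unique (part i _) (part i′ _) e = proj₁ (UU C e)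
  lab-unique (part i _) here e = ⊥-elim (far-from-w 0 z≤n e)
  lab-unique here (full i c) e = ⊥-elim (far-from-w 0 z≤n (sym e))
  lab-unique here (part i _) e = ⊥-elim (far-from-w 0 z≤n (sym e))
  lab-unique here here e = refl

  Lab? : ∀ i x → Dec (Lab i x)
  Lab? i x with any? (λ c → x ≟ U i (suc c))
  ... | yes (c , refl) = yes (full i c)
  ... | no ¬f with (toℕ i ≤? toℕ j) ×-dec (x ≟ U i zero)
  ...   | yes (le , refl) = yes (part i le)
  ...   | no ¬p with (i ≟ fromℕ m) ×-dec (x ≟ w)
  ...     | yes (refl , refl) = yes here
  ...     | no ¬h = no λ { (full _ c) → ¬f (c , refl) ; (part _ le) → ¬p (le , refl) ; here → ¬h (refl , refl) }

  Marked? : ∀ x → Dec (∃ λ i → Lab i x)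
  Marked? x = any? (λ i → Lab? i x)

  Q? : ∀ x y → Dec (x ≡ y ⊎ ∃ λ i → Lab i x × Lab i y)
  Q? x y with x ≟ y | any? (λ i → Lab? i x ×-dec Lab? i y)
  ... | yes e | _ = yes (inj₁ e)
  ... | no _ | yes l = yes (inj₂ l)
  ... | no ¬e | no ¬l = no λ { (inj₁ e) → ¬e e ; (inj₂ l) → ¬l l }

  Q : Fin n → Fin n → Bool
  Q x y = ⌊ Q? x y ⌋

  Q⁺ : ∀ {x y} → x ≡ y ⊎ (∃ λ i → Lab i x × Lab i y) → T (Q x y)
  Q⁺ {x} {y} h = fromWitness {a? = Q? x y} h

  Q⁻ : ∀ {x y} → T (Q x y) → x ≡ y ⊎ ∃ λ i → Lab i x × Lab i y
  Q⁻ {x} {y} h = toWitness {a? = Q? x y} h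

  π₀-unmarked : ∀ {x} → (∀ i → ¬ Lab i x) → to π₀ x ≡ to π x
  π₀-unmarked {x} h = π₀-off x (λ { c i refl → h i (full i c) }) (λ { refl → h _ here }) (λ { i le refl → h i (part i le) })

  Inside : Fin n → Set
  Inside x = x ≡ w ⊎ ∃₂ λ i a → x ≡ U i a

  lab-inside : ∀ {i x} → Lab i x → Inside x
  lab-inside (full i c) = inj₂ (i , suc c , refl)
  lab-inside (part i _) = inj₂ (i , zero , refl)
  lab-inside here = inj₁ refl

  image : ∀ {i y} → Lab i y → (∃ λ b → to π₀ y ≡ to π (U (shift i) b)) ⊎ (i ≡ j × to π₀ y ≡ to π w)
  image (full i c) = inj₁ (suc c , π₀-copy c i)
  image (part i le) with part-image i le
  ... | inj₁ e = inj₁ (zero , e)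
  ... | inj₂ p = inj₂ p
  image here = inj₁ (zero , trans π₀-w (cong (λ k → to π (U k zero)) (sym (shift-fromℕ m))))

  -- This is why `w` carries the last label: like the last set of the walk, it has all of `U zero`
  -- as out-neighbours.
  out : ∀ {i x} → Lab i x → ∀ b → T (E x (to π (U (shift i) b)))
  out (full i c) b = walk i (suc c) b
  out (part i _) b = walk i zero b
  out here b = subst (λ k → T (E w (to π (U k b)))) (sym (shift-fromℕ m)) (enter b)

  out-w : ∀ {x} i → i ≡ j → Lab i x → T (E x (to π w))
  out-w i refl (full i c) = leave (suc c)
  out-w i refl (part i _) = leave zero
  out-w i e here = ⊥-elim (j≢last (sym e))

  labelled-edge : ∀ {i x y} → Lab i x → Lab i y → T (E x (to π₀ y))
  labelled-edge {i} {x} lx ly with image ly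
  ... | inj₁ (b , e) = subst (λ z → T (E x z)) (sym e) (out lx b)
  ... | inj₂ (e , e′) = subst (λ z → T (E x z)) (sym e′) (out-w i e lx)

  Q-edge : ∀ {x y} → T (Q x y) → T (E x (to π₀ y))
  Q-edge {x} {y} q with Q⁻ q
  ... | inj₂ (i , lx , ly) = labelled-edge lx ly
  ... | inj₁ refl with Marked? x
  ...   | yes (i , l) = labelled-edge l l
  ...   | no ¬l = subst (λ z → T (E x z)) (sym (π₀-unmarked λ i l → ¬l (i , l))) (factor x)

  Q-sym : ∀ {x y} → T (Q x y) → T (Q y x)
  Q-sym q with Q⁻ q
  ... | inj₁ e = Q⁺ (inj₁ (sym e))
  ... | inj₂ (i , lx , ly) = Q⁺ (inj₂ (i , ly , lx))

  Q-trans : ∀ {x y z} → T (Q x y) → T (Q y z) → T (Q x z)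
  Q-trans p q with Q⁻ p | Q⁻ q
  ... | inj₁ refl | _ = q
  ... | inj₂ _ | inj₁ refl = p
  ... | inj₂ (i , lx , ly) | inj₂ (i′ , ly′ , lz) with lab-unique ly ly′ refl
  ...   | refl = Q⁺ (inj₂ (i , lx , lz))

  record Merged : Set where
    field
      σ : Perm n
      inc : π₀ ⊑ σ
      classes : ∀ x y → T (Q x y) → Cyc σ x y
      edges : ∀ x → T (E x (to σ x))
      local : ∀ x → ∃ λ y → T (Q x y) × to σ x ≡ to π₀ y

  merged : Merged
  merged = let σ , i , c , e , l = merge-classes E Q (Q⁺ (inj₁ refl)) Q-sym Q-trans π₀ Q-edge in
    record { σ = σ ; inc = i ; classes = c ; edges = e ; local = l }

module Connect {n} {E : Digraph n} {π : Perm n} {K m : ℕ} (C : Chain E π K m) (R : Rewired C) (M : Labels.Merged C R) where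
  open Chain C
  open Rewired R
  open Labels C R
  open Merged M

  infix 4 _≈_
  _≈_ : Fin n → Fin n → Set
  x ≈ y = Cyc σ x y

  ≈-sym : ∀ {x y} → x ≈ y → y ≈ x
  ≈-sym = Cyc-sym σ
  ≈-trans : ∀ {x y z} → x ≈ y → y ≈ z → x ≈ z
  ≈-trans = Cyc-trans σ

  ≈-π₀ : ∀ x → x ≈ to π₀ x
  ≈-π₀ x = inc x _ (Cyc-step π₀ x)

  ≈-lab : ∀ {i x y} → Lab i x → Lab i y → x ≈ y
  ≈-lab lx ly = classes _ _ (Q⁺ (inj₂ (_ , lx , ly)))

  near-lab : ∀ {i i′ x} s → s ≤ K → iter π s (U i (suc zero)) ≡ x → Lab i′ x → Lab i x
  near-lab s le e (full i′ c) with separated s le e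
  ... | refl = full _ c
  near-lab s le e (part i′ l) with separated s le e
  ... | refl = part _ l
  near-lab s le e here = ⊥-elim (far-from-w s le e)

  -- Following π from π (U_i 1), the first marked vertex met has label i.
  follow : ∀ i r s x → s + r ≤ K → iter π s (U i (suc zero)) ≡ x → (∃ λ c → iter π r x ≡ U i (suc c)) → x ≈ U i (suc zero)
  follow i r s x le e end with Marked? x
  ... | yes (i′ , l) = ≈-lab (near-lab s (≤-trans (m≤m+n s r) le) e l) (full i zero)
  follow i zero s x le e (c , e′) | no ¬l = ⊥-elim (¬l (i , subst (Lab i) (sym e′) (full i c)))
  follow i (suc r) s x le e end | no ¬l =
    ≈-trans (subst (x ≈_) (π₀-unmarked λ i l → ¬l (i , l)) (≈-π₀ x))
      (follow i r (suc s) (to π x) (≤-trans (≤-reflexive (sym (+-suc s r))) le) (trans (iter-suc π s _) (cong (to π) e)) end)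

  -- `π₀` sends copy 1 of a set to the `π`-image of copy 1 of the next set. From there `π` runs to
  -- copy 1 or 2 of that next set within `K` steps, and by separation it meets no vertex with a
  -- different label on the way.
  step-back : ∀ i → U i (suc zero) ≈ U (shift i) (suc zero)
  step-back i with linked (shift i)
  ... | r , r<K , h = ≈-trans (subst (U i (suc zero) ≈_) (π₀-copy zero i) (≈-π₀ _))
      (follow (shift i) r 1 _ r<K refl (end h))
    where
    end : (iter π (suc r) (U (shift i) (suc zero)) ≡ U (shift i) (suc zero) ⊎ iter π (suc r) (U (shift i) (suc zero)) ≡ U (shift i) (suc (suc zero))) →
      ∃ λ c → iter π r (to π (U (shift i) (suc zero))) ≡ U (shift i) (suc c)
    end (inj₁ e) = zero , e
    end (inj₂ e) = suc zero , e

  ρ₀ : Fin n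
  ρ₀ = U zero (suc zero)

  to-ρ₀ : ∀ i → U i (suc zero) ≈ ρ₀
  to-ρ₀ i = go (toℕ i) i refl
    where
    go : ∀ t i → toℕ i ≡ t → U i (suc zero) ≈ ρ₀
    go t zero e = Cyc-refl σ
    go (suc t) (suc i) e = ≈-trans (≈-sym (subst (λ k → U (inject₁ i) (suc zero) ≈ U k (suc zero)) (shift-inject₁ i) (step-back (inject₁ i))))
      (go t (inject₁ i) (trans (toℕ-inject₁ i) (suc-injective e)))

  lab-ρ₀ : ∀ {i x} → Lab i x → x ≈ ρ₀
  lab-ρ₀ {i} l = ≈-trans (≈-lab l (full i zero)) (to-ρ₀ i)

  -- The rotations only permute the `π`-images of marked vertices, so each of these images is the
  -- `π₀`-successor of a marked vertex. With `lab-ρ₀` this joins a marked `x` to `to π x`; at all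
  -- other vertices `π₀` and `π` agree.
  image-ρ₀ : ∀ {i x} → Lab i x → to π x ≈ ρ₀
  image-ρ₀ (full i c) with shift-surj i
  ... | i₀ , refl = ≈-trans (≈-sym (subst (U i₀ (suc c) ≈_) (π₀-copy c i₀) (≈-π₀ _))) (lab-ρ₀ (full i₀ c))
  image-ρ₀ (part zero le) = ≈-trans (≈-sym (subst (w ≈_) π₀-w (≈-π₀ w))) (lab-ρ₀ here)
  image-ρ₀ (part (suc i) le) with part-image (inject₁ i) (≤-trans (≤-reflexive (toℕ-inject₁ i)) (<⇒≤ le))
  ... | inj₁ e = ≈-trans (≈-sym (subst (U (inject₁ i) zero ≈_) (trans e (cong (λ k → to π (U k zero)) (shift-inject₁ i))) (≈-π₀ _)))
      (lab-ρ₀ (part (inject₁ i) (≤-trans (≤-reflexive (toℕ-inject₁ i)) (<⇒≤ le))))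
  ... | inj₂ (e , _) = ⊥-elim (<-irrefl (trans (sym (toℕ-inject₁ i)) (cong toℕ e)) le)
  image-ρ₀ here = ≈-trans (≈-sym (subst (U j zero ≈_) π₀-j (≈-π₀ _))) (lab-ρ₀ (part j ≤-refl))

  step : ∀ x → x ≈ to π x
  step x with Marked? x
  ... | yes (i , l) = ≈-trans (lab-ρ₀ l) (≈-sym (image-ρ₀ l))
  ... | no ¬l = subst (x ≈_) (π₀-unmarked λ i l → ¬l (i , l)) (≈-π₀ x)

  marked-image : ∀ {i y} → Lab i y → ∃ λ z → Inside z × to π₀ y ≡ to π z
  marked-image l with image l
  ... | inj₁ (b , e) = _ , inj₂ (_ , b , refl) , e
  ... | inj₂ (_ , e) = w , inj₁ refl , e

  locally : ∀ x y → to σ x ≡ to π₀ y → (x ≡ y ⊎ ∃ λ i → Lab i x × Lab i y) → to σ x ≡ to π x ⊎ Inside x × ∃ λ z → Inside z × to σ x ≡ to π z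
  locally x y e (inj₂ (i , lx , ly)) = let z , iz , e′ = marked-image ly in inj₂ (lab-inside lx , z , iz , trans e e′)
  locally x .x e (inj₁ refl) with Marked? x
  ... | yes (i , l) = let z , iz , e′ = marked-image l in inj₂ (lab-inside l , z , iz , trans e e′)
  ... | no ¬l = inj₁ (trans e (π₀-unmarked λ i l → ¬l (i , l)))

record ChainMerge {n} {E : Digraph n} {π : Perm n} {K m : ℕ} (C : Chain E π K m) : Set where
  open Chain C
  field
    σ : Perm n
    inc : π ⊑ σ
    joined : ∀ i a → Cyc σ w (U i (suc a))
    edges : ∀ x → T (E x (to σ x))
    local : ∀ x → to σ x ≡ to π x ⊎ (x ≡ w ⊎ ∃₂ λ i a → x ≡ U i a) × ∃ λ z → (z ≡ w ⊎ ∃₂ λ i a → z ≡ U i a) × to σ x ≡ to π z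

chain-merge : ∀ {n} {E : Digraph n} {π : Perm n} {K m : ℕ} (C : Chain E π K m) → ChainMerge C
chain-merge {π = π} C = record
  { σ = σ ; inc = λ x y → Cyc-generated π _≈_ (Cyc-refl σ) ≈-trans step ; joined = λ i a → ≈-trans (lab-ρ₀ here) (≈-sym (lab-ρ₀ (full i a)))
  ; edges = edges ; local = λ x → let y , q , e = local x in locally x y e (Q⁻ q) }
  where
  R = rewired C
  M = Labels.merged C R
  open Labels C R
  open Labels.Merged M
  open Connect C R M

-- Counting lazy walks

module LazyWalk {n} (F : Fin n → Fin n → Bool) (Y : Fin n → Bool) where

  -- Staying has weight n, comparable to the number of moves. A fixed number of lazy steps thus
  -- counts walks of all shorter lengths on one common scale, which matters because the distance
  -- between two vertices of `Y` is not known.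
  lz : (Fin n → ℕ) → Fin n → ℕ
  lz h x = n * h x + ∑ λ y → ⟦ Y y ∧ F x y ⟧ * h y

  visit : (Fin n → Bool) → (Fin n → ℕ) → Fin n → ℕ
  visit B h x = ∑ λ y → ⟦ B y ∧ F x y ⟧ * h y

  lzs : ℕ → (Fin n → ℕ) → Fin n → ℕ
  lzs zero h = h
  lzs (suc i) h = lz (lzs i h)

  lz-cong : ∀ {f g} → (∀ x → f x ≡ g x) → ∀ x → lz f x ≡ lz g x
  lz-cong e x = cong₂ _+_ (cong (n *_) (e x)) (∑-cong λ y → cong (⟦ Y y ∧ F x y ⟧ *_) (e y))

  lzs-cong : ∀ i {f g} → (∀ x → f x ≡ g x) → ∀ x → lzs i f x ≡ lzs i g x
  lzs-cong zero e = e
  lzs-cong (suc i) e = lz-cong (lzs-cong i e)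

  lzs-comm : ∀ i f x → lzs (suc i) f x ≡ lzs i (lz f) x
  lzs-comm zero f x = refl
  lzs-comm (suc i) f x = lz-cong (lzs-comm i f) x

  lz-+ : ∀ f g x → lz (λ v → f v + g v) x ≡ lz f x + lz g x
  lz-+ f g x = trans (cong₂ _+_ (*-distribˡ-+ n (f x) (g x)) (trans (∑-cong λ y → *-distribˡ-+ ⟦ Y y ∧ F x y ⟧ (f y) (g y)) (∑-+ _ _)))
    (+-interchange (n * f x) (n * g x) (∑ λ y → ⟦ Y y ∧ F x y ⟧ * f y) (∑ λ y → ⟦ Y y ∧ F x y ⟧ * g y))

  lz-* : ∀ c f x → lz (λ v → c * f v) x ≡ c * lz f x
  lz-* c f x = trans (cong₂ _+_ (e n c (f x)) (trans (∑-cong λ y → e ⟦ Y y ∧ F x y ⟧ c (f y)) (∑-*ˡ c _))) (sym (*-distribˡ-+ c (n * f x) _))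
    where
    e : ∀ a c b → a * (c * b) ≡ c * (a * b)
    e = solve-∀

  lz-∑ : ∀ {k} (f : Fin k → Fin n → ℕ) x → lz (λ v → ∑ λ y → f y v) x ≡ ∑ λ y → lz (f y) x
  lz-∑ f x = trans (cong₂ _+_ (sym (∑-*ˡ n (λ y → f y x))) (trans (∑-cong λ v → sym (∑-*ˡ ⟦ Y v ∧ F x v ⟧ (λ y → f y v))) (∑-swap λ v y → ⟦ Y v ∧ F x v ⟧ * f y v)))
    (sym (∑-+ (λ y → n * f y x) _))

  lzs-+ : ∀ i f g x → lzs i (λ v → f v + g v) x ≡ lzs i f x + lzs i g x
  lzs-+ zero f g x = refl
  lzs-+ (suc i) f g x = trans (lz-cong (lzs-+ i f g) x) (lz-+ (lzs i f) (lzs i g) x)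

  lzs-∑ : ∀ i {k} (c : Fin k → ℕ) (f : Fin k → Fin n → ℕ) x → lzs i (λ v → ∑ λ y → c y * f y v) x ≡ ∑ λ y → c y * lzs i (f y) x
  lzs-∑ zero c f x = refl
  lzs-∑ (suc i) c f x = trans (lz-cong (lzs-∑ i c f) x) (trans (lz-∑ (λ y v → c y * lzs i (f y) v) x) (∑-cong λ y → lz-* (c y) (lzs i (f y)) x))

  lzs-* : ∀ i c f x → lzs i (λ v → c * f v) x ≡ c * lzs i f x
  lzs-* zero c f x = refl
  lzs-* (suc i) c f x = trans (lz-cong (lzs-* i c f) x) (lz-* c (lzs i f) x)

  -- Walks from x whose last edge ends in y.
  ending : ℕ → Fin n → Fin n → ℕ
  ending i x y = lzs i (λ v → ⟦ F v y ⟧) x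

  lzs-visit : ∀ i B h x → lzs i (visit B h) x ≡ ∑ λ y → (⟦ B y ⟧ * h y) * ending i x y
  lzs-visit i B h x = trans (lzs-cong i (λ v → ∑-cong λ y → trans (cong (_* h y) (⟦⟧-∧ (B y) (F v y))) (e ⟦ B y ⟧ ⟦ F v y ⟧ (h y))) x)
    (lzs-∑ i (λ y → ⟦ B y ⟧ * h y) (λ y v → ⟦ F v y ⟧) x)
    where
    e : ∀ a b c → a * b * c ≡ a * c * b
    e = solve-∀

  ending-suc : ∀ i x y → ending (suc i) x y ≡ n * ending i x y + ∑ λ z → ⟦ Y z ∧ F z y ⟧ * ending i x z
  ending-suc i x y = trans (lzs-comm i _ x) (trans (lzs-+ i (λ v → n * ⟦ F v y ⟧) (λ v → ∑ λ z → ⟦ Y z ∧ F v z ⟧ * ⟦ F z y ⟧) x)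
    (cong₂ _+_ (lzs-* i n (λ v → ⟦ F v y ⟧) x)
      (trans (lzs-cong i (λ v → ∑-cong λ z → trans (cong (_* ⟦ F z y ⟧) (⟦⟧-∧ (Y z) (F v z))) (trans (e ⟦ Y z ⟧ ⟦ F v z ⟧ ⟦ F z y ⟧) (cong (_* ⟦ F v z ⟧) (sym (⟦⟧-∧ (Y z) (F z y)))))) x)
        (lzs-∑ i (λ z → ⟦ Y z ∧ F z y ⟧) (λ z v → ⟦ F v z ⟧) x))))
    where
    e : ∀ a b c → a * b * c ≡ a * c * b
    e = solve-∀

  rich : ℕ → (Fin n → Bool) → Fin n → Bool
  rich g R y = n ≤ᵇ′ (2 * g) * # (λ z → R z ∧ F z y)

  -- A subset of the vertices to which a positive fraction of all lazy walks leads: a vertex is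
  -- added once it has at least n / (2g) in-neighbours reached before.
  reach : ℕ → ℕ → Fin n → Fin n → Bool
  reach g zero x y = Y y ∧ F x y
  reach g (suc i) x y = reach g i x y ∨ (Y y ∧ rich g (reach g i x) y)

  reach⊆Y : ∀ g i x y → T (reach g i x y) → T (Y y)
  reach⊆Y g zero x y h = ∧₁ h
  reach⊆Y g (suc i) x y h = [ reach⊆Y g i x y , ∧₁ ]′ (∨⁻ {reach g i x y} h)

  -- Each round loses at most a factor `2 * g`. A vertex reached before gains a factor n from
  -- staying; a new one collects the walks to its n / (2g) reached in-neighbours.
  reach-count : ∀ g i x y → 0 < g → T (reach g i x y) → n ^ i ≤ (2 * g) ^ i * ending i x y
  reach-count g zero x y g>0 h = ≤-trans (≤-reflexive (sym (⟦⟧-T (∧₂ {Y y} h)))) (≤-reflexive (sym (+-identityʳ _)))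
  reach-count g (suc i) x y g>0 h with ∨⁻ {reach g i x y} h
  ... | inj₁ p = ≤-trans (*-mono-≤ {n} {n * (2 * g)} (m≤m*n n (2 * g) {{>-nonZero (*-mono-≤ {1} {2} (s≤s z≤n) g>0)}}) (reach-count g i x y g>0 p))
      (≤-trans (≤-reflexive (e n (2 * g) ((2 * g) ^ i) (ending i x y))) (*-monoʳ-≤ ((2 * g) ^ suc i) (≤-trans (m≤m+n _ _) (≤-reflexive (sym (ending-suc i x y))))))
    where
    e : ∀ n q Q t → n * q * (Q * t) ≡ q * Q * (n * t)
    e = solve-∀
  ... | inj₂ p = ≤-trans (*-monoˡ-≤ (n ^ i) (≤ᵇ⁻ {n} (∧₂ {Y y} p))) (≤-trans (≤-reflexive (*-assoc (2 * g) _ (n ^ i)))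
      (≤-trans (*-monoʳ-≤ (2 * g) sumbound) (≤-trans (≤-reflexive (sym (*-assoc (2 * g) ((2 * g) ^ i) _))) (*-monoʳ-≤ ((2 * g) ^ suc i) (≤-trans (m≤n+m _ (n * ending i x y)) (≤-reflexive (sym (ending-suc i x y))))))))
    where
    R = reach g i x
    sumbound : # (λ z → R z ∧ F z y) * n ^ i ≤ (2 * g) ^ i * ∑ (λ z → ⟦ Y z ∧ F z y ⟧ * ending i x z)
    sumbound = ≤-trans (markov (λ z → R z ∧ F z y) _ (n ^ i) λ z q → ≤-trans (reach-count g i x z g>0 (∧₁ q))
      (≤-reflexive (trans (sym (+-identityʳ _)) (trans (cong (_* ((2 * g) ^ i * ending i x z)) (sym (⟦⟧-T {Y z ∧ F z y} (∧⁺ (reach⊆Y g i x z (∧₁ q)) (∧₂ {R z} q))))) (e ⟦ Y z ∧ F z y ⟧ ((2 * g) ^ i) (ending i x z))))))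
      (≤-reflexive (∑-*ˡ ((2 * g) ^ i) _))
      where
      e : ∀ a Q t → a * (Q * t) ≡ Q * (a * t)
      e = solve-∀

  missing : (Fin n → Bool) → ℕ
  missing R = # λ y → Y y ∧ not (R y)

  leaving : (Fin n → Bool) → ℕ
  leaving R = #₂ λ x y → R x ∧ (F x y ∧ (Y y ∧ not (R y)))

  module Expanding (g b γ : ℕ) (g>0 : 0 < g) (b>0 : 0 < b) (n>0 : 0 < n)
    (expand : ∀ R → (∀ y → T (R y) → T (Y y)) → n ≤ γ * # R → b ≤ missing R → n * n ≤ g * leaving R) where

    -- At least n² / g edges leave `R`. At most half of that number end in vertices that are not
    -- rich, since those receive less than n / (2g) each; a rich vertex takes at most n of the
    -- others.
    grow : ∀ R → (∀ y → T (R y) → T (Y y)) → n ≤ γ * # R → b ≤ missing R →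
      n ≤ (2 * g) * # (λ y → (Y y ∧ not (R y)) ∧ rich g R y)
    grow R R⊆Y dense miss = *-cancelˡ-≤ n {{>-nonZero n>0}} (+-cancelʳ-≤ (n * n) _ _ (begin
      n * n + n * n ≡⟨ sym (e₁ (n * n)) ⟩
      2 * (n * n) ≤⟨ *-monoʳ-≤ 2 (expand R R⊆Y dense miss) ⟩
      2 * (g * leaving R) ≡⟨ sym (*-assoc 2 g (leaving R)) ⟩
      (2 * g) * leaving R ≡⟨ cong ((2 * g) *_) (#₂-swap (λ x y → R x ∧ (F x y ∧ M y))) ⟩
      (2 * g) * ∑ (λ y → # (λ x → R x ∧ (F x y ∧ M y))) ≡⟨ sym (∑-*ˡ (2 * g) _) ⟩
      ∑ (λ y → (2 * g) * # (λ x → R x ∧ (F x y ∧ M y))) ≤⟨ ∑-mono pt ⟩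
      ∑ (λ y → ((2 * g) * n) * ⟦ M y ∧ rich g R y ⟧ + n) ≡⟨ ∑-+ _ (λ _ → n) ⟩
      ∑ (λ y → ((2 * g) * n) * ⟦ M y ∧ rich g R y ⟧) + ∑ {n} (λ _ → n) ≡⟨ cong₂ _+_ (∑-*ˡ ((2 * g) * n) _) (∑-const n n) ⟩
      (2 * g) * n * # (λ y → M y ∧ rich g R y) + n * n ≡⟨ cong (_+ n * n) (e₂ (2 * g) n (# (λ y → M y ∧ rich g R y))) ⟩
      n * ((2 * g) * # (λ y → M y ∧ rich g R y)) + n * n ∎))
      where
      open ≤-Reasoning
      M : Fin n → Bool
      M y = Y y ∧ not (R y)
      e₁ : ∀ a → 2 * a ≡ a + a
      e₁ = solve-∀
      e₂ : ∀ q n s → q * n * s ≡ n * (q * s)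
      e₂ = solve-∀
      pt : ∀ y → (2 * g) * # (λ x → R x ∧ (F x y ∧ M y)) ≤ ((2 * g) * n) * ⟦ M y ∧ rich g R y ⟧ + n
      pt y with em (M y ∧ rich g R y)
      ... | inj₁ r = ≤-trans (*-monoʳ-≤ (2 * g) (#≤n (λ x → R x ∧ (F x y ∧ M y)))) (≤-trans (≤-reflexive (trans (sym (*-identityʳ _)) (cong (((2 * g) * n) *_) (sym (⟦⟧-T r))))) (m≤m+n _ n))
      ... | inj₂ ¬r with em (M y)
      ...   | inj₁ my = ≤-trans (*-monoʳ-≤ (2 * g) (#-mono {P = λ x → R x ∧ (F x y ∧ M y)} {Q = λ x → R x ∧ F x y} λ x q → ∧⁺ (∧₁ q) (∧₁ (∧₂ {R x} q)))) (≤-trans (<⇒≤ (≰⇒> λ l → ¬r (∧⁺ my (≤ᵇ⁺ l)))) (m≤n+m n _))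
      ...   | inj₂ ¬my = ≤-trans (≤-reflexive (trans (cong ((2 * g) *_) (#-none {P = λ x → R x ∧ (F x y ∧ M y)} λ x q → ¬my (∧₂ {F x y} (∧₂ {R x} q)))) (*-zeroʳ (2 * g)))) z≤n

    module _ (x : Fin n) (deg : n ≤ γ * # (λ y → Y y ∧ F x y)) where

      reach-dense : ∀ i → n ≤ γ * # (reach g i x)
      reach-dense zero = deg
      reach-dense (suc i) = ≤-trans (reach-dense i) (*-monoʳ-≤ γ (#-mono {P = reach g i x} {Q = reach g (suc i) x} λ y → ∨₁))

      -- Every round adds n / (2g) vertices until fewer than `b` are missing, so `2 * g` rounds
      -- suffice for `reach-all`.
      progress : ∀ i → missing (reach g i x) < b ⊎ i * n ≤ (2 * g) * # (reach g i x)
      progress zero = inj₂ z≤n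
      progress (suc i) with missing (reach g i x) <? b | progress i
      ... | yes p | _ = inj₁ (≤-<-trans (#-mono {P = λ y → Y y ∧ not (reach g (suc i) x y)} {Q = λ y → Y y ∧ not (reach g i x y)} λ y q → ∧⁺ (∧₁ q) (not⁺ λ r → not⁻ (∧₂ {Y y} q) (∨₁ r))) p)
      ... | no ¬p | inj₁ p = ⊥-elim (¬p p)
      ... | no ¬p | inj₂ p = inj₂ (begin
        n + i * n ≤⟨ +-mono-≤ (grow R (reach⊆Y g i x) (reach-dense i) (≮⇒≥ ¬p)) p ⟩
        (2 * g) * # N + (2 * g) * # R ≡⟨ sym (*-distribˡ-+ (2 * g) (# N) (# R)) ⟩
        (2 * g) * (# N + # R) ≤⟨ *-monoʳ-≤ (2 * g) disj ⟩
        (2 * g) * # (reach g (suc i) x) ∎)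
        where
        open ≤-Reasoning
        R = reach g i x
        N : Fin n → Bool
        N y = (Y y ∧ not (R y)) ∧ rich g R y
        disj : # N + # R ≤ # (reach g (suc i) x)
        disj = ≤-trans (≤-reflexive (sym (∑-+ (λ y → ⟦ N y ⟧) (λ y → ⟦ R y ⟧)))) (∑-mono pt)
          where
          pt : ∀ y → ⟦ N y ⟧ + ⟦ R y ⟧ ≤ ⟦ reach g (suc i) x y ⟧
          pt y with em (R y)
          ... | inj₁ r = ≤-trans (≤-reflexive (cong (_+ ⟦ R y ⟧) (⟦⟧-¬T {N y} λ q → not⁻ (∧₂ {Y y} (∧₁ q)) r))) (⟦⟧-mono {R y} {reach g (suc i) x y} ∨₁)
          ... | inj₂ ¬r = ≤-trans (≤-reflexive (trans (cong (⟦ N y ⟧ +_) (⟦⟧-¬T ¬r)) (+-identityʳ _))) (⟦⟧-mono {N y} {reach g (suc i) x y} λ q → ∨₂ {R y} (∧⁺ (∧₁ (∧₁ q)) (∧₂ {Y y ∧ not (R y)} q)))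

      reach-all : missing (reach g (2 * g) x) < b
      reach-all with progress (2 * g)
      ... | inj₁ p = p
      ... | inj₂ p = ≤-trans (s≤s (+-cancelˡ-≤ (# R) _ _ (begin
          # R + missing R ≡⟨ cong (_+ missing R) (#-cong (λ y r → ∧⁺ (reach⊆Y g (2 * g) x y r) r) (λ y q → ∧₂ {Y y} q)) ⟩
          # (λ y → Y y ∧ R y) + missing R ≡⟨ sym (#-split Y R) ⟩
          # Y ≤⟨ #≤n Y ⟩
          n ≤⟨ *-cancelˡ-≤ (2 * g) {{>-nonZero (*-mono-≤ {1} {2} (s≤s z≤n) g>0)}} p ⟩
          # R ≡⟨ sym (+-identityʳ (# R)) ⟩
          # R + 0 ∎))) b>0
        where
        open ≤-Reasoning
        R = reach g (2 * g) x

      -- Fewer than `b` vertices of `Y` are not reached, and 2γb ≤ n, so at least n / (2γ) vertices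
      -- of `B` are reached by many walks. The stop is made in the possibly larger `B′`; `B` is the
      -- part of it where the continuation `h` is known to be large.
      visit-many : ∀ B B′ h c q → 2 * (γ * b) ≤ n → 0 < γ → (∀ y → T (B y) → T (Y y)) → (∀ y → T (B y) → T (B′ y)) → n ≤ γ * # B →
        (∀ y → T (B y) → c ≤ q * h y) →
        n ^ suc (2 * g) * c ≤ (2 * γ * (2 * g) ^ (2 * g)) * q * lzs (2 * g) (visit B′ h) x
      visit-many B B′ h c q small γ>0 B⊆Y B⊆B′ Bdense hB = begin
        n * n ^ L * c ≡⟨ *-assoc n (n ^ L) c ⟩
        n * (n ^ L * c) ≤⟨ *-monoˡ-≤ (n ^ L * c) enough ⟩
        2 * γ * # BR * (n ^ L * c) ≡⟨ *-assoc (2 * γ) (# BR) _ ⟩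
        2 * γ * (# BR * (n ^ L * c)) ≤⟨ *-monoʳ-≤ (2 * γ) (markov BR f (n ^ L * c) each) ⟩
        2 * γ * ∑ f ≡⟨ cong (2 * γ *_) (∑-*ˡ (G * q) _) ⟩
        2 * γ * (G * q * ∑ (λ y → (⟦ B′ y ⟧ * h y) * ending L x y)) ≡⟨ cong (λ s → 2 * γ * (G * q * s)) (sym (lzs-visit L B′ h x)) ⟩
        2 * γ * (G * q * lzs L (visit B′ h) x) ≡⟨ e (2 * γ) G q _ ⟩
        2 * γ * G * q * lzs L (visit B′ h) x ∎
        where
        open ≤-Reasoning
        L = 2 * g
        G = (2 * g) ^ L
        R = reach g L x
        BR : Fin n → Bool
        BR y = B y ∧ R y
        f : Fin n → ℕ
        f y = G * q * ((⟦ B′ y ⟧ * h y) * ending L x y)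
        e : ∀ a G q s → a * (G * q * s) ≡ a * G * q * s
        e = solve-∀
        each : ∀ y → T (BR y) → n ^ L * c ≤ f y
        each y p = ≤-trans (*-mono-≤ (reach-count g L x y g>0 (∧₂ {B y} p)) (hB y (∧₁ p)))
          (≤-reflexive (trans (e′ G (ending L x y) q (h y)) (cong (λ s → G * q * ((s * h y) * ending L x y)) (sym (⟦⟧-T (B⊆B′ y (∧₁ p)))))))
          where
          e′ : ∀ G t q h → G * t * (q * h) ≡ G * q * ((1 * h) * t)
          e′ = solve-∀
        miss : # B ≤ # BR + b
        miss = ≤-trans (≤-reflexive (#-split B R)) (+-monoʳ-≤ (# BR) (≤-trans (#-mono {P = λ y → B y ∧ not (R y)} {Q = λ y → Y y ∧ not (R y)} λ y q → ∧⁺ (B⊆Y y (∧₁ q)) (∧₂ {B y} q)) (<⇒≤ reach-all)))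
        enough : n ≤ 2 * γ * # BR
        enough = +-cancelʳ-≤ n _ _ (begin
          n + n ≤⟨ +-mono-≤ Bdense Bdense ⟩
          γ * # B + γ * # B ≡⟨ sym (e₁ γ (# B)) ⟩
          2 * γ * # B ≤⟨ *-monoʳ-≤ (2 * γ) miss ⟩
          2 * γ * (# BR + b) ≡⟨ e₂ γ (# BR) b ⟩
          2 * γ * # BR + 2 * (γ * b) ≤⟨ +-monoʳ-≤ (2 * γ * # BR) small ⟩
          2 * γ * # BR + n ∎)
          where
          e₁ : ∀ γ s → 2 * γ * s ≡ γ * s + γ * s
          e₁ = solve-∀
          e₂ : ∀ γ r b → 2 * γ * (r + b) ≡ 2 * γ * r + 2 * (γ * b)
          e₂ = solve-∀

-- Resolving lazy walks into genuine closed walks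

module Resolve {n} (F : Fin n → Fin n → Bool) (Y : Fin n → Bool) where
  open LazyWalk F Y public

  -- Schedules of walks: optional moves inside `Y`, and obligatory stops in given sets. `W` weighs
  -- all ways of following a schedule, `V` those of a list of genuine moves.
  data Item : Set where
    lazy : Item
    stop : (Fin n → Bool) → Item

  W : (Fin n → ℕ) → List Item → Fin n → ℕ
  W h [] = h
  W h (lazy ∷ s) = lz (W h s)
  W h (stop B ∷ s) = visit B (W h s)

  V : (Fin n → ℕ) → List (Fin n → Bool) → Fin n → ℕ
  V h [] = h
  V h (B ∷ Bs) = visit B (V h Bs)

  data Resolved : List Item → List (Fin n → Bool) → Set where
    done : Resolved [] []
    stay : ∀ {s Bs} → Resolved s Bs → Resolved (lazy ∷ s) Bs
    move : ∀ {s Bs} → Resolved s Bs → Resolved (lazy ∷ s) (Y ∷ Bs)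
    at : ∀ {s Bs} B → Resolved s Bs → Resolved (stop B ∷ s) (B ∷ Bs)

  -- One resolution of the lazy steps has to serve all closed walks at once, wherever they start.
  -- The choice between staying and moving is therefore made for a linear functional of the weights,
  -- not pointwise.
  record Linear (Φ : (Fin n → Fin n → ℕ) → ℕ) : Set where
    field
      Φ-cong : ∀ {f g} → (∀ a x → f a x ≡ g a x) → Φ f ≡ Φ g
      Φ-+ : ∀ f g → Φ (λ a x → f a x + g a x) ≡ Φ f + Φ g
      Φ-* : ∀ c f → Φ (λ a x → c * f a x) ≡ c * Φ f
  open Linear

  visited : (Fin n → Bool) → ((Fin n → Fin n → ℕ) → ℕ) → (Fin n → Fin n → ℕ) → ℕ
  visited B Φ f = Φ (λ a → visit B (f a))

  visited-linear : ∀ B {Φ} → Linear Φ → Linear (visited B Φ)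
  visited-linear B lin = record
    { Φ-cong = λ e → Φ-cong lin λ a x → ∑-cong λ y → cong (⟦ B y ∧ F x y ⟧ *_) (e a y)
    ; Φ-+ = λ f g → trans (Φ-cong lin λ a x → trans (∑-cong λ y → *-distribˡ-+ ⟦ B y ∧ F x y ⟧ (f a y) (g a y)) (∑-+ _ _)) (Φ-+ lin _ _)
    ; Φ-* = λ c f → trans (Φ-cong lin λ a x → trans (∑-cong λ y → e ⟦ B y ∧ F x y ⟧ c (f a y)) (∑-*ˡ c _)) (Φ-* lin c _) }
    where
    e : ∀ a c b → a * (c * b) ≡ c * (a * b)
    e = solve-∀

  -- Each lazy step either stays (contributing the factor n) or moves; keep the more frequent option.
  resolve : ∀ s (h : Fin n → Fin n → ℕ) {Φ} → Linear Φ → ∃₂ λ Bs k → Resolved s Bs × k + length Bs ≡ length s ×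
    Φ (λ a → W (h a) s) ≤ 2 ^ length s * (n ^ k * Φ (λ a → V (h a) Bs))
  resolve [] h {Φ} lin = [] , 0 , done , refl , ≤-reflexive (trans (sym (+-identityʳ _)) (sym (+-identityʳ _)))
  resolve (stop B ∷ s) h {Φ} lin with resolve s h (visited-linear B lin)
  ... | Bs , k , r , len , le = B ∷ Bs , k , at B r , trans (+-suc k (length Bs)) (cong suc len) ,
    ≤-trans le (*-monoˡ-≤ _ (m≤m+n (2 ^ length s) _))
  resolve (lazy ∷ s) h {Φ} lin with ≤-total (n * Φ (λ a → W (h a) s)) (Φ (λ a → visit Y (W (h a) s)))
    | trans (Φ-+ lin (λ a x → n * W (h a) s x) (λ a → visit Y (W (h a) s))) (cong (_+ Φ (λ a → visit Y (W (h a) s))) (Φ-* lin n (λ a → W (h a) s)))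
  ... | inj₁ p | eq with resolve s h (visited-linear Y lin)
  ...   | Bs , k , r , len , le = Y ∷ Bs , k , move r , trans (+-suc k (length Bs)) (cong suc len) ,
      ≤-trans (≤-reflexive eq) (≤-trans (+-monoˡ-≤ _ p) (≤-trans (+-mono-≤ le le) (≤-reflexive (e (2 ^ length s) _))))
    where
    e : ∀ a b → a * b + a * b ≡ 2 * a * b
    e = solve-∀
  resolve (lazy ∷ s) h {Φ} lin | inj₂ p | eq with resolve s h lin
  ...   | Bs , k , r , len , le = Bs , suc k , stay r , cong suc len ,
      ≤-trans (≤-reflexive eq) (≤-trans (+-monoʳ-≤ _ p) (≤-trans (+-mono-≤ (*-monoʳ-≤ n le) (*-monoʳ-≤ n le)) (≤-reflexive (e n (2 ^ length s) (n ^ k) _))))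
    where
    e : ∀ n a b c → n * (a * (b * c)) + n * (a * (b * c)) ≡ 2 * a * (n * b * c)
    e = solve-∀

  lazies : ℕ → List Item → List Item
  lazies zero s = s
  lazies (suc i) s = lazy ∷ lazies i s

  W-lazies : ∀ h i s x → W h (lazies i s) x ≡ lzs i (W h s) x
  W-lazies h zero s x = refl
  W-lazies h (suc i) s x = lz-cong (W-lazies h i s) x

  length-lazies : ∀ i s → length (lazies i s) ≡ i + length s
  length-lazies zero s = refl
  length-lazies (suc i) s = cong suc (length-lazies i s)

  lookupL : (Bs : List (Fin n → Bool)) → Fin (length Bs) → Fin n → Bool
  lookupL (B ∷ Bs) zero = B
  lookupL (B ∷ Bs) (suc i) = lookupL Bs i

  -- The position of a stop in the resolved walk depends on how many of the preceding lazy steps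
  -- became moves; `k` is that number, and all later positions shift accordingly.
  find : ∀ B i {s Bs} → Resolved (lazies i (stop B ∷ s)) Bs → ∃₂ λ Bs′ k → Resolved s Bs′ × k + suc (length Bs′) ≡ length Bs ×
    (∃ λ (p : Fin (length Bs)) → toℕ p ≡ k × lookupL Bs p ≡ B) ×
    (∀ (p′ : Fin (length Bs′)) → ∃ λ (p : Fin (length Bs)) → toℕ p ≡ k + suc (toℕ p′) × lookupL Bs p ≡ lookupL Bs′ p′)
  find B zero (at {Bs = Bs′} B r) = Bs′ , 0 , r , refl , (zero , refl , refl) , λ p′ → suc p′ , refl , refl
  find B (suc i) (stay r) = find B i r
  find B (suc i) (move r) with find B i r
  ... | Bs′ , k , r′ , len , (p , e , l) , after = Bs′ , suc k , r′ , cong suc len , (suc p , cong suc e , l) ,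
    λ p′ → let q , e′ , l′ = after p′ in suc q , cong suc e′ , l′

  data StopsIn : List Item → Set where
    none : StopsIn []
    lazily : ∀ {s} → StopsIn s → StopsIn (lazy ∷ s)
    stopping : ∀ {s B} → (∀ y → T (B y) → T (Y y)) → StopsIn s → StopsIn (stop B ∷ s)

  lazies-in : ∀ i {s} → StopsIn s → StopsIn (lazies i s)
  lazies-in zero h = h
  lazies-in (suc i) h = lazily (lazies-in i h)

  inY : ∀ {s Bs} → Resolved s Bs → StopsIn s → ∀ p y → T (lookupL Bs p y) → T (Y y)
  inY (stay r) (lazily h) p = inY r h p
  inY (move r) (lazily h) zero y q = q
  inY (move r) (lazily h) (suc p) = inY r h p
  inY (at B r) (stopping b h) zero = b
  inY (at B r) (stopping b h) (suc p) = inY r h p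

  path : Fin n → (Bs : List (Fin n → Bool)) → Vec (Fin n) (length Bs) → Fin n → Bool
  path x [] [] a = F x a
  path x (B ∷ Bs) (y ∷ z) a = (B y ∧ F x y) ∧ path y Bs z a

  V-count : ∀ a Bs x → V (λ v → ⟦ F v a ⟧) Bs x ≡ #ᵛ (length Bs) (λ z → path x Bs z a)
  V-count a [] x = refl
  V-count a (B ∷ Bs) x = ∑-cong λ y → trans (cong (⟦ B y ∧ F x y ⟧ *_) (V-count a Bs y))
    (trans (sym (∑ᵛ-*ˡ (length Bs) ⟦ B y ∧ F x y ⟧ _)) (∑ᵛ-cong (length Bs) λ z → sym (⟦⟧-∧ (B y ∧ F x y) (path y Bs z a))))

  path-in : ∀ x Bs z a → T (path x Bs z a) → ∀ p → T (lookupL Bs p (lookup z p))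
  path-in x (B ∷ Bs) (y ∷ z) a h zero = ∧₁ (∧₁ h)
  path-in x (B ∷ Bs) (y ∷ z) a h (suc p) = path-in y Bs z a (∧₂ h) p

  path-step : ∀ x Bs z a → T (path x Bs z a) → ∀ (p : Fin (length Bs)) → T (F (lookup (x ∷ z) (inject₁ p)) (lookup (x ∷ z) (suc p)))
  path-step x (B ∷ Bs) (y ∷ z) a h zero = ∧₂ (∧₁ h)
  path-step x (B ∷ Bs) (y ∷ z) a h (suc p) = path-step y Bs z a (∧₂ h) p

  path-close : ∀ x Bs z a → T (path x Bs z a) → T (F (lookup (x ∷ z) (fromℕ (length Bs))) a)
  path-close x [] [] a h = h
  path-close x (B ∷ Bs) (y ∷ z) a h = path-close y Bs z a (∧₂ h)

-- Tuples whose entries are far apart along π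

near : ∀ {n} → Perm n → ℕ → Fin n → Fin n → Bool
near π K x y = any {suc K} λ s → (iter π (toℕ s) x == y) ∨ (iter π (toℕ s) y == x)

near-count : ∀ {n} (π : Perm n) K y → # (λ x → near π K x y) ≤ 2 * suc K
near-count π K y = ≤-trans (#-∪-family _ (λ s x → (iter π (toℕ s) x == y) ∨ (iter π (toℕ s) y == x)) (λ x h → any⁻ _ h))
  (≤-trans (∑-bound _ 2 λ s → ≤-trans (#-∪ {Q = λ x → iter π (toℕ s) x == y} {R = λ x → iter π (toℕ s) y == x} λ x h → ∨⁻ h)
    (+-mono-≤ (≤-reflexive (trans (∑-cong λ x → cong (λ v → ⟦ v == y ⟧) (sym (iter-perm-to π (toℕ s) x))) (trans (∑-perm (iter-perm π (toℕ s)) (λ v → ⟦ v == y ⟧)) (one y))))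
              (≤-reflexive (#-single (iter π (toℕ s) y))))) (≤-reflexive (*-comm (suc K) 2)))
  where
  one : ∀ y → # (λ v → v == y) ≡ 1
  one y = trans (#-cong {Q = y ==_} (λ v e → ==⁺ (sym (==⁻ e))) (λ v e → ==⁺ (sym (==⁻ e)))) (#-single y)

near⁺ : ∀ {n} (π : Perm n) K {x y} s → s ≤ K → iter π s x ≡ y ⊎ iter π s y ≡ x → T (near π K x y)
near⁺ π K {x} {y} s le h = any⁺ {suc K} (λ s → (iter π (toℕ s) x == y) ∨ (iter π (toℕ s) y == x)) (fromℕ< (s≤s le))
  (subst (λ t → T ((iter π t x == y) ∨ (iter π t y == x))) (sym (toℕ-fromℕ< (s≤s le))) ([ (λ e → ∨₁ (==⁺ e)) , (λ e → ∨₂ (==⁺ e)) ]′ h))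

crowded : ∀ {n} → Perm n → ℕ → Fin n → ∀ {m} → Vec (Fin n) m → Bool
crowded π K x [] = false
crowded π K x (y ∷ z) = near π K x y ∨ crowded π K x z

crowded-count : ∀ {n} (π : Perm n) K {m} (z : Vec (Fin n) m) → # (λ x → crowded π K x z) ≤ m * (2 * suc K)
crowded-count π K [] = ≤-reflexive (#-none λ _ ())
crowded-count π K (y ∷ z) = ≤-trans (#-∪ {Q = λ x → near π K x y} {R = λ x → crowded π K x z} λ x h → ∨⁻ h) (+-mono-≤ (near-count π K y) (crowded-count π K z))

close : ∀ {n} → Perm n → ℕ → Fin n → ∀ {m} → Vec (Fin n) m → Bool
close π K w [] = false
close π K w (x ∷ z) = crowded π K x (w ∷ z) ∨ close π K w z

-- Union bound over the pairs of entries, `w` included: a vertex has at most 2 (K + 1) vertices near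
-- it.
close-count : ∀ {n} (π : Perm n) K w m → n * #ᵛ m (close π K w) ≤ (m * (m * (2 * suc K))) * n ^ m
close-count {n} π K w zero = ≤-reflexive (trans (cong (n *_) (⟦⟧-¬T {false} λ ())) (*-zeroʳ n))
close-count {n} π K w (suc m) = begin
  n * ∑ (λ x → #ᵛ m (λ z → close π K w (x ∷ z)))
    ≤⟨ *-monoʳ-≤ n (≤-trans (∑-mono λ x → #ᵛ-∪ m {λ z → close π K w (x ∷ z)} {λ z → crowded π K x (w ∷ z)} {close π K w} λ z h → ∨⁻ h) (≤-reflexive (∑-+ _ _))) ⟩
  n * (∑ (λ x → #ᵛ m (λ z → crowded π K x (w ∷ z))) + ∑ {n} (λ _ → #ᵛ m (close π K w)))
    ≤⟨ *-monoʳ-≤ n (+-mono-≤ heads (≤-reflexive (∑-const n (#ᵛ m (close π K w))))) ⟩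
  n * (n ^ m * (suc m * c) + n * #ᵛ m (close π K w)) ≤⟨ *-monoʳ-≤ n (+-monoʳ-≤ (n ^ m * (suc m * c)) (close-count π K w m)) ⟩
  n * (n ^ m * (suc m * c) + m * (m * c) * n ^ m) ≡⟨ e₁ n (n ^ m) m c ⟩
  (suc m * c + m * (m * c)) * (n * n ^ m) ≤⟨ *-monoˡ-≤ (n * n ^ m) (≤-trans (+-monoʳ-≤ (suc m * c) (*-monoʳ-≤ m (*-monoˡ-≤ c (n≤1+n m)))) ≤-refl) ⟩
  (suc m * (suc m * c)) * (n * n ^ m) ∎
  where
  open ≤-Reasoning
  c = 2 * suc K
  e₁ : ∀ n N m c → n * (N * (suc m * c) + m * (m * c) * N) ≡ (suc m * c + m * (m * c)) * (n * N)
  e₁ = solve-∀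
  heads : ∑ (λ x → #ᵛ m (λ z → crowded π K x (w ∷ z))) ≤ n ^ m * (suc m * c)
  heads = ≤-trans (≤-reflexive (∑ᵛ-swap m (λ x z → ⟦ crowded π K x (w ∷ z) ⟧)))
    (≤-trans (∑ᵛ-mono m λ z → crowded-count π K (w ∷ z)) (≤-reflexive (∑ᵛ-const m (suc m * c))))

crowded⁺ : ∀ {n} (π : Perm n) K x {m} (z : Vec (Fin n) m) i → T (near π K x (lookup z i)) → T (crowded π K x z)
crowded⁺ π K x (y ∷ z) zero h = ∨₁ h
crowded⁺ π K x (y ∷ z) (suc i) h = ∨₂ (crowded⁺ π K x z i h)

close⁺-w : ∀ {n} (π : Perm n) K w {m} (z : Vec (Fin n) m) i → T (near π K (lookup z i) w) → T (close π K w z)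
close⁺-w π K w (x ∷ z) zero h = ∨₁ (∨₁ h)
close⁺-w π K w (x ∷ z) (suc i) h = ∨₂ (close⁺-w π K w z i h)

near-sym : ∀ {n} (π : Perm n) K {x y} → T (near π K x y) → T (near π K y x)
near-sym π K {x} {y} h = let s , p = any⁻ _ h in any⁺ (λ s → (iter π (toℕ s) y == x) ∨ (iter π (toℕ s) x == y)) s ([ (λ a → ∨₂ a) , (λ a → ∨₁ a) ]′ (∨⁻ p))

close⁺ : ∀ {n} (π : Perm n) K w {m} (z : Vec (Fin n) m) i i′ → i ≢ i′ → T (near π K (lookup z i) (lookup z i′)) → T (close π K w z)
close⁺ π K w (x ∷ z) zero zero ne h = ⊥-elim (ne refl)
close⁺ π K w (x ∷ z) zero (suc i′) ne h = ∨₁ (∨₂ (crowded⁺ π K x z i′ h))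
close⁺ π K w (x ∷ z) (suc i) zero ne h = ∨₁ (∨₂ (crowded⁺ π K x z i (near-sym π K h)))
close⁺ π K w (x ∷ z) (suc i) (suc i′) ne h = ∨₂ (close⁺ π K w z i i′ (λ e → ne (cong suc e)) h)

-- Merging the cycle of w with another cycle through an expanding set Y

product-bound : ∀ γ g → ℕ
product-bound γ g = 2 * γ * (2 * g) ^ (2 * g)

-- One factor `γ` for the start among the out-neighbours of `w`, one `product-bound` for each of the
-- three stops, and a factor 2 for resolving each of the 3 (2g + 1) items of the schedule.
density-bound : ℕ → ℕ → ℕ
density-bound γ g = γ * (product-bound γ g * (product-bound γ g * product-bound γ g)) * 2 ^ (3 * suc (2 * g))

-- The first summand is what `blow-up` asks for. The second makes the tuples with two entries close
-- along `π`, or one close to `w`, at most half of the closed walks; this halving turns `q` into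
-- `2 * q`.
size-bound : ℕ → ℕ → ℕ
size-bound q m = K-bound (suc m) (2 * q) + (2 * q) * (suc m * (suc m * (2 * suc (K-bound (suc m) (2 * q)))))

-- Covers all lengths up to a maximum, because the length of the closed walk is only known after the
-- lazy steps are resolved, and that depends on the graph.
n-bound : ℕ → ℕ → ℕ
n-bound q zero = size-bound q zero
n-bound q (suc m) = size-bound q (suc m) + n-bound q m

n-bound-≥ : ∀ q m M → m ≤ M → size-bound q m ≤ n-bound q M
n-bound-≥ q m zero z≤n = ≤-refl
n-bound-≥ q m (suc M) le with m≤n⇒m<n∨m≡n le
... | inj₂ refl = m≤m+n _ _
... | inj₁ lt = ≤-trans (n-bound-≥ q m M (≤-pred lt)) (m≤n+m _ _)

record Expander {n} (E : Digraph n) (π : Perm n) (Y : Fin n → Bool) (w : Fin n) (g b γ : ℕ) : Set where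
  F : Fin n → Fin n → Bool
  F x y = E x (to π y)
  open LazyWalk F Y
  field
    factor : ∀ x → T (E x (to π x))
    g>0 : 0 < g
    b>0 : 0 < b
    γ>0 : 0 < γ
    small : 2 * (γ * b) ≤ n
    expand : ∀ R → (∀ y → T (R y) → T (Y y)) → n ≤ γ * # R → b ≤ missing R → n * n ≤ g * leaving R
    out-Y : ∀ x → T (Y x) ⊎ x ≡ w → n ≤ γ * # (λ y → Y y ∧ F x y)
    in-Y : ∀ x → T (Y x) ⊎ x ≡ w → n ≤ γ * # (λ y → Y y ∧ F y x)

record Absorbed {n} (E : Digraph n) (π : Perm n) (Y B : Fin n → Bool) (w : Fin n) : Set where
  field
    σ : Perm n
    inc : π ⊑ σ
    y : Fin n
    y∈B : T (B y)
    joined : Cyc σ w y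
    edges : ∀ x → T (E x (to σ x))
    local : ∀ x → to σ x ≡ to π x ⊎ (x ≡ w ⊎ T (Y x)) × ∃ λ z → (z ≡ w ⊎ T (Y z)) × to σ x ≡ to π z

-- The closed walk starts at an out-neighbour of `w` in `A`, stops at an in-neighbour of `w` in
-- `B₁`, then in `B`, and returns to its start through a last stop in `Y`. In the resulting `Chain`,
-- `j` is the position of the stop in `B₁`; the stop in `B` comes later, so `j` is not last, and it
-- supplies the vertex that joins the cycle of `w`.
module Absorb {n} {E : Digraph n} {π : Perm n} {Y : Fin n → Bool} {w : Fin n} {g b γ : ℕ} (X : Expander E π Y w g b γ)
  (B : Fin n → Bool) (B⊆Y : ∀ y → T (B y) → T (Y y)) (B-dense : n ≤ γ * # B)
  (n-large : n-bound (density-bound γ g) (3 * suc (2 * g)) < n) where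
  open Expander X
  open Resolve F Y
  private
    n>0 : 0 < n
    n>0 = ≤-trans (s≤s z≤n) n-large
    L = 2 * g
    c = product-bound γ g
    q = density-bound γ g
    open Expanding g b γ g>0 b>0 n>0 expand

    A B₁ : Fin n → Bool
    A a = Y a ∧ F w a
    B₁ y = Y y ∧ F y w

    ends : Fin n → Fin n → ℕ
    ends a v = ⟦ F v a ⟧

    s₃ s₂ s₁ : List Item
    s₃ = lazies L (stop Y ∷ [])
    s₂ = lazies L (stop B ∷ s₃)
    s₁ = lazies L (stop B₁ ∷ s₂)

    lower : ∀ h x D D′ s N Q → T (Y x) → (∀ y → T (D y) → T (Y y)) → (∀ y → T (D y) → T (D′ y)) → n ≤ γ * # D →
      (∀ y → T (D y) → N ≤ Q * W h s y) → n ^ suc L * N ≤ c * Q * W h (lazies L (stop D′ ∷ s)) x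
    lower h x D D′ s N Q Yx D⊆Y D⊆D′ dense hyp = ≤-trans
      (visit-many x (out-Y x (inj₁ Yx)) D D′ (W h s) N Q small γ>0 D⊆Y D⊆D′ dense hyp)
      (≤-reflexive (cong (c * Q *_) (sym (W-lazies h L (stop D′ ∷ s) x))))

    lower₃ : ∀ a → T (Y a) → ∀ x → T (Y x) → n ^ suc L * 1 ≤ c * 1 * W (ends a) s₃ x
    lower₃ a Ya x Yx = lower (ends a) x (λ y → Y y ∧ F y a) Y [] 1 1 Yx (λ y → ∧₁) (λ y → ∧₁) (in-Y a (inj₁ Ya))
      λ y p → ≤-reflexive (sym (trans (+-identityʳ _) (⟦⟧-T (∧₂ p))))

    lower₂ : ∀ a → T (Y a) → ∀ x → T (Y x) → n ^ suc L * (n ^ suc L * 1) ≤ c * (c * 1) * W (ends a) s₂ x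
    lower₂ a Ya x Yx = lower (ends a) x B B s₃ _ (c * 1) Yx B⊆Y (λ y p → p) B-dense λ y p → lower₃ a Ya y (B⊆Y y p)

    lower₁ : ∀ a → T (Y a) → ∀ x → T (Y x) → n ^ suc L * (n ^ suc L * (n ^ suc L * 1)) ≤ c * (c * (c * 1)) * W (ends a) s₁ x
    lower₁ a Ya x Yx = lower (ends a) x B₁ B₁ s₂ _ (c * (c * 1)) Yx (λ y → ∧₁) (λ y p → p) (in-Y w (inj₂ refl)) λ y p → lower₂ a Ya y (∧₁ p)

    Φ : (Fin n → Fin n → ℕ) → ℕ
    Φ f = ∑ λ a → ⟦ A a ⟧ * f a a

    Φ-linear : Linear Φ
    Φ-linear = record
      { Φ-cong = λ e → ∑-cong λ a → cong (⟦ A a ⟧ *_) (e a a)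
      ; Φ-+ = λ f g → trans (∑-cong λ a → *-distribˡ-+ ⟦ A a ⟧ (f a a) (g a a)) (∑-+ _ _)
      ; Φ-* = λ k f → trans (∑-cong λ a → e ⟦ A a ⟧ k (f a a)) (∑-*ˡ k _) }
      where
      e : ∀ a c b → a * (c * b) ≡ c * (a * b)
      e = solve-∀

    N³ = n ^ suc L * (n ^ suc L * (n ^ suc L * 1))
    Q³ = c * (c * (c * 1))

    total : n * N³ ≤ γ * (Q³ * Φ (λ a → W (ends a) s₁))
    total = begin
      n * N³ ≤⟨ *-monoˡ-≤ N³ (out-Y w (inj₂ refl)) ⟩
      γ * # A * N³ ≡⟨ *-assoc γ (# A) N³ ⟩
      γ * (# A * N³) ≤⟨ *-monoʳ-≤ γ (markov A (λ a → Q³ * (⟦ A a ⟧ * W (ends a) s₁ a)) N³ λ a p →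
          ≤-trans (lower₁ a (∧₁ p) a (∧₁ p)) (≤-reflexive (cong (Q³ *_) (trans (sym (+-identityʳ _)) (cong (_* W (ends a) s₁ a) (sym (⟦⟧-T p))))))) ⟩
      γ * ∑ (λ a → Q³ * (⟦ A a ⟧ * W (ends a) s₁ a)) ≡⟨ cong (γ *_) (∑-*ˡ Q³ _) ⟩
      γ * (Q³ * Φ (λ a → W (ends a) s₁)) ∎
      where open ≤-Reasoning

    res = resolve s₁ ends Φ-linear
    Bs = proj₁ res
    k = proj₁ (proj₂ res)
    resolved = proj₁ (proj₂ (proj₂ res))
    len-eq = proj₁ (proj₂ (proj₂ (proj₂ res)))
    m = length Bs

    len₁ : length s₁ ≡ 3 * suc L
    len₁ = trans (length-lazies L _) (trans (cong (λ t → L + suc t) (trans (length-lazies L _) (cong (λ t → L + suc t) (length-lazies L _)))) (e L))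
      where
      e : ∀ L → L + suc (L + suc (L + 1)) ≡ 3 * suc L
      e = solve-∀

    len : k + m ≡ 3 * suc L
    len = trans len-eq len₁

    closed : Vec (Fin n) (suc m) → Bool
    closed (a ∷ z) = A a ∧ path a Bs z a

    Φ-closed : Φ (λ a → V (ends a) Bs) ≡ #ᵛ (suc m) closed
    Φ-closed = ∑-cong λ a → trans (cong (⟦ A a ⟧ *_) (V-count a Bs a)) (trans (sym (∑ᵛ-*ˡ m ⟦ A a ⟧ _)) (∑ᵛ-cong m λ z → sym (⟦⟧-∧ (A a) (path a Bs z a))))

    N³-eq : N³ ≡ n ^ k * n ^ m
    N³-eq = trans (e (n ^ suc L)) (trans (^-*-assoc n (suc L) 3) (trans (cong (n ^_) (trans (*-comm (suc L) 3) (sym len))) (^-distribˡ-+-* n k m)))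
      where
      e : ∀ x → x * (x * (x * 1)) ≡ x ^ 3
      e x = refl

    many : n ^ suc m ≤ q * #ᵛ (suc m) closed
    many = *-cancelˡ-≤ (n ^ k) {{m^n≢0 n k {{>-nonZero n>0}}}} (begin
      n ^ k * (n * n ^ m) ≡⟨ e₁ (n ^ k) n (n ^ m) ⟩
      n * (n ^ k * n ^ m) ≡⟨ cong (n *_) (sym N³-eq) ⟩
      n * N³ ≤⟨ total ⟩
      γ * (Q³ * Φ (λ a → W (ends a) s₁)) ≤⟨ *-monoʳ-≤ γ (*-monoʳ-≤ Q³ (proj₂ (proj₂ (proj₂ (proj₂ res))))) ⟩
      γ * (Q³ * (2 ^ length s₁ * (n ^ k * Φ (λ a → V (ends a) Bs)))) ≡⟨ cong₂ (λ l f → γ * (Q³ * (2 ^ l * (n ^ k * f)))) len₁ Φ-closed ⟩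
      γ * (Q³ * (2 ^ (3 * suc L) * (n ^ k * #ᵛ (suc m) closed))) ≡⟨ e₂ γ c (2 ^ (3 * suc L)) (n ^ k) (#ᵛ (suc m) closed) ⟩
      n ^ k * (γ * (c * (c * c)) * 2 ^ (3 * suc L) * #ᵛ (suc m) closed) ∎)
      where
      open ≤-Reasoning
      e₁ : ∀ a n b → a * (n * b) ≡ n * (a * b)
      e₁ = solve-∀
      e₂ : ∀ γ c t a f → γ * (c * (c * (c * 1)) * (t * (a * f))) ≡ a * (γ * (c * (c * c)) * t * f)
      e₂ = solve-∀

    K = K-bound (suc m) (2 * q)

    size : size-bound q m < n
    size = ≤-trans (s≤s (n-bound-≥ q m (3 * suc L) (≤-trans (m≤n+m m k) (≤-reflexive len)))) n-large

    spread : Vec (Fin n) (suc m) → Bool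
    spread z = closed z ∧ not (close π K w z)

    q>0 : 0 < q
    q>0 = n≢0⇒n>0 λ e → <⇒≱ (m^n>0 n {{>-nonZero n>0}} (suc m)) (≤-trans many (≤-reflexive (cong (_* #ᵛ (suc m) closed) e)))

    many-spread : n ^ suc m ≤ 2 * q * #ᵛ (suc m) spread
    many-spread = +-cancelʳ-≤ (n ^ suc m) _ _ (begin
      n ^ suc m + n ^ suc m ≤⟨ +-mono-≤ many many ⟩
      q * #ᵛ (suc m) closed + q * #ᵛ (suc m) closed ≡⟨ sym (e₁ q _) ⟩
      2 * q * #ᵛ (suc m) closed ≤⟨ *-monoʳ-≤ (2 * q) (#ᵛ-∪ (suc m) {closed} {spread} {close π K w} λ z p → [ (λ cl → inj₂ cl) , (λ ¬cl → inj₁ (∧⁺ p (not⁺ ¬cl))) ]′ (em (close π K w z))) ⟩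
      2 * q * (#ᵛ (suc m) spread + #ᵛ (suc m) (close π K w)) ≡⟨ *-distribˡ-+ (2 * q) (#ᵛ (suc m) spread) _ ⟩
      2 * q * #ᵛ (suc m) spread + 2 * q * #ᵛ (suc m) (close π K w) ≤⟨ +-monoʳ-≤ (2 * q * #ᵛ (suc m) spread) few ⟩
      2 * q * #ᵛ (suc m) spread + n ^ suc m ∎)
      where
      open ≤-Reasoning
      e₁ : ∀ q s → 2 * q * s ≡ q * s + q * s
      e₁ = solve-∀
      D = suc m * (suc m * (2 * suc K))
      few : 2 * q * #ᵛ (suc m) (close π K w) ≤ n ^ suc m
      few = *-cancelˡ-≤ n {{>-nonZero n>0}} (begin
        n * (2 * q * #ᵛ (suc m) (close π K w)) ≡⟨ e₂ n (2 * q) _ ⟩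
        2 * q * (n * #ᵛ (suc m) (close π K w)) ≤⟨ *-monoʳ-≤ (2 * q) (close-count π K w (suc m)) ⟩
        2 * q * (D * n ^ suc m) ≡⟨ sym (*-assoc (2 * q) D (n ^ suc m)) ⟩
        2 * q * D * n ^ suc m ≤⟨ *-monoˡ-≤ (n ^ suc m) (≤-trans (m≤n+m (2 * q * D) K) (<⇒≤ size)) ⟩
        n * n ^ suc m ∎)
        where
        e₂ : ∀ n q s → n * (q * s) ≡ q * (n * s)
        e₂ = solve-∀

    blown : BlowUp (suc m) K π spread
    blown = blow-up π (suc m) (2 * q) spread (*-mono-≤ {1} {2} (s≤s z≤n) q>0) n>0 (≤-trans (s≤s (m≤m+n K _)) size) many-spread

  private
    module Assemble (BU : BlowUp (suc m) K π spread) where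
      open BlowUp BU
      u : Fin (suc m) → Fin 4 → Fin n
      u i = lookup U i

      -- A selection with copy `a` at position `i` and copy `b` everywhere else: enough to read off
      -- any relation between two positions of the blow-up.
      choose : Fin (suc m) → Fin 4 → Fin 4 → Fin (suc m) → Fin 4
      choose i a b i′ with i′ ≟ i
      ... | yes _ = a
      ... | no _ = b

      choose-l : ∀ i a b → choose i a b i ≡ a
      choose-l i a b with i ≟ i
      ... | yes _ = refl
      ... | no h = ⊥-elim (h refl)

      choose-r : ∀ i a b i′ → i′ ≢ i → choose i a b i′ ≡ b
      choose-r i a b i′ h with i′ ≟ i
      ... | yes e = ⊥-elim (h e)
      ... | no _ = refl

      at-l : ∀ i a b → lookup (sel U (choose i a b)) i ≡ u i a
      at-l i a b = trans (lookup-sel U _ i) (cong (u i) (choose-l i a b))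

      at-r : ∀ i a b i′ → i′ ≢ i → lookup (sel U (choose i a b)) i′ ≡ u i′ b
      at-r i a b i′ h = trans (lookup-sel U _ i′) (cong (u i′) (choose-r i a b i′ h))

      sel-closed : ∀ ch → T (closed (sel U ch))
      sel-closed ch = ∧₁ (complete ch)

      not-close : ∀ ch → ¬ T (close π K w (sel U ch))
      not-close ch = not⁻ (∧₂ (complete ch))

      separated : ∀ {i i′ a b} s → s ≤ K → iter π s (u i a) ≡ u i′ b → i ≡ i′
      separated {i} {i′} {a} {b} s le e with i ≟ i′
      ... | yes p = p
      ... | no ne = ⊥-elim (not-close (choose i a b) (close⁺ π K w (sel U (choose i a b)) i i′ ne
        (near⁺ π K s le (inj₁ (trans (cong (iter π s) (at-l i a b)) (trans e (sym (at-r i a b i′ λ e′ → ne (sym e′)))))))))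

      far-from-w : ∀ {i a} s → s ≤ K → iter π s (u i a) ≢ w
      far-from-w {i} {a} s le e = not-close (choose i a a) (close⁺-w π K w (sel U (choose i a a)) i
        (near⁺ π K s le (inj₁ (trans (cong (iter π s) (at-l i a a)) e))))

      head-path : ∀ z → T (closed z) → T (A (lookup z zero)) × (∀ (p : Fin m) → T (F (lookup z (inject₁ p)) (lookup z (suc p)))) ×
        T (F (lookup z (fromℕ m)) (lookup z zero)) × (∀ p → T (lookupL Bs p (lookup z (suc p))))
      head-path (a ∷ z) h = ∧₁ h , path-step a Bs z a (∧₂ h) , path-close a Bs z a (∧₂ h) , path-in a Bs z a (∧₂ h)

      picked : ∀ ch → _
      picked ch = head-path (sel U ch) (sel-closed ch)

      found₁ = find B₁ L resolved
      found₂ = find B L (proj₁ (proj₂ (proj₂ found₁)))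
      at₁ = proj₁ (proj₂ (proj₂ (proj₂ (proj₂ found₁))))
      p₁ = proj₁ at₁
      at₂ = proj₁ (proj₂ (proj₂ (proj₂ (proj₂ found₂))))
      at₂′ = proj₂ (proj₂ (proj₂ (proj₂ (proj₂ found₁)))) (proj₁ at₂)
      p₂ = proj₁ at₂′

      p₂-B : lookupL Bs p₂ ≡ B
      p₂-B = trans (proj₂ (proj₂ at₂′)) (proj₂ (proj₂ at₂))

      p₁<p₂ : toℕ p₁ < toℕ p₂
      p₁<p₂ = ≤-trans (s≤s (≤-reflexive (proj₁ (proj₂ at₁)))) (≤-trans (≤-trans (≤-reflexive (+-comm 1 _)) (+-monoʳ-≤ (proj₁ (proj₂ found₁)) (s≤s z≤n))) (≤-reflexive (sym (proj₁ (proj₂ at₂′)))))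

      member : ∀ p a → T (lookupL Bs p (u (suc p) a))
      member p a = subst (λ v → T (lookupL Bs p v)) (at-l (suc p) a a) (proj₂ (proj₂ (proj₂ (picked (choose (suc p) a a)))) p)

      Bs⊆Y : ∀ p y → T (lookupL Bs p y) → T (Y y)
      Bs⊆Y = inY resolved (lazies-in L (stopping (λ y → ∧₁) (lazies-in L (stopping B⊆Y (lazies-in L (stopping (λ y h → h) none))))))

      u∈Y : ∀ i a → T (Y (u i a))
      u∈Y zero a = subst (λ v → T (Y v)) (at-l zero a a) (∧₁ (proj₁ (picked (choose zero a a))))
      u∈Y (suc p) a = Bs⊆Y p _ (member p a)

      m>0 : 0 < m
      m>0 = ≤-trans (s≤s z≤n) (toℕ<n p₁)

      walk : ∀ i a b → T (F (u i a) (u (shift i) b))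
      walk i a b with last? i
      ... | inj₁ refl = subst₂ (λ x y → T (F x y)) (at-l i a b) (trans (at-r i a b zero (λ e → <⇒≢ m>0 (trans (cong toℕ e) (toℕ-fromℕ m)))) (cong (λ k → u k b) (sym (shift-fromℕ m))))
          (proj₁ (proj₂ (proj₂ (picked (choose i a b)))))
      ... | inj₂ (p , refl) = subst₂ (λ x y → T (F x y)) (at-l i a b) (trans (at-r i a b (suc p) (λ e → <⇒≢ (n<1+n (toℕ p)) (trans (sym (toℕ-inject₁ p)) (cong toℕ (sym e))))) (cong (λ k → u k b) (sym (shift-inject₁ p))))
          (proj₁ (proj₂ (picked (choose i a b))) p)

      enter : ∀ a → T (F w (u zero a))
      enter a = subst (λ v → T (F w v)) (at-l zero a a) (∧₂ (proj₁ (picked (choose zero a a))))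

      leave : ∀ a → T (F (u (suc p₁) a) w)
      leave a = ∧₂ (subst (λ D → T (D (u (suc p₁) a))) (proj₂ (proj₂ at₁)) (member p₁ a))

      chain : Chain E π K m
      chain = record
        { U = u ; w = w ; j = suc p₁ ; j≢last = λ e → <⇒≢ (≤-trans (s≤s p₁<p₂) (toℕ<n p₂)) (trans (cong toℕ e) (toℕ-fromℕ m))
        ; factor = factor ; U-inj = λ {i} → distinct i ; separated = separated ; far-from-w = far-from-w
        ; linked = linked ; walk = walk ; enter = enter ; leave = leave }

      open ChainMerge (chain-merge chain)

      inside : ∀ {x} → x ≡ w ⊎ (∃₂ λ i a → x ≡ u i a) → x ≡ w ⊎ T (Y x)
      inside (inj₁ e) = inj₁ e
      inside (inj₂ (i , a , refl)) = inj₂ (u∈Y i a)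

      absorbed : Absorbed E π Y B w
      absorbed = record
        { σ = σ ; inc = inc ; y = u (suc p₂) (suc zero) ; y∈B = subst (λ D → T (D (u (suc p₂) (suc zero)))) p₂-B (member p₂ (suc zero))
        ; joined = joined (suc p₂) zero ; edges = edges
        ; local = λ x → [ inj₁ , (λ { (ix , z , iz , e) → inj₂ (inside ix , z , inside iz , e) }) ]′ (local x) }

  absorb : Absorbed E π Y B w
  absorb = Assemble.absorbed blown

-- Regular digraphs and sparse cuts

record RegularGraph {n} (E : Digraph n) (d : ℕ) : Set where
  field
    out-deg : ∀ u → # (E u) ≡ d
    in-deg : ∀ v → # (λ u → E u v) ≡ d

reverse : ∀ {n} → Digraph n → Digraph n
reverse E u v = E v u

reverse-regular : ∀ {n} {E : Digraph n} {d} → RegularGraph E d → RegularGraph (reverse E) d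
reverse-regular R = record { out-deg = RegularGraph.in-deg R ; in-deg = RegularGraph.out-deg R }

halve : ∀ d q p y → 0 < d → q * d ≤ p * q + y * d → 2 * p ≤ d → q ≤ 2 * y
halve d q p y d>0 h p≤ = *-cancelʳ-≤ q (2 * y) d {{>-nonZero d>0}} (+-cancelˡ-≤ (q * d) _ _ (begin
  q * d + q * d ≤⟨ +-mono-≤ h h ⟩
  p * q + y * d + (p * q + y * d) ≡⟨ e p q y d ⟩
  2 * p * q + 2 * y * d ≤⟨ +-monoˡ-≤ (2 * y * d) (*-monoˡ-≤ q p≤) ⟩
  d * q + 2 * y * d ≡⟨ cong (_+ 2 * y * d) (*-comm d q) ⟩
  q * d + 2 * y * d ∎))
  where
  open ≤-Reasoning
  e : ∀ p q y d → p * q + y * d + (p * q + y * d) ≡ 2 * p * q + 2 * y * d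
  e = solve-∀

module Sparse {n} {E : Digraph n} {d} (R : RegularGraph E d) (d>0 : 0 < d) where
  open RegularGraph R

  out-edges : ∀ P → #₂ (λ u v → P u ∧ E u v) ≡ # P * d
  out-edges P = #₂-rows P E d out-deg

  in-edges : ∀ Q → #₂ (λ u v → E u v ∧ Q v) ≡ # Q * d
  in-edges Q = trans (#₂-swap (λ u v → E u v ∧ Q v)) (trans (#₂-cong (λ v u h → ∧⁺ (∧₂ h) (∧₁ h)) (λ v u h → ∧⁺ (∧₂ h) (∧₁ h))) (#₂-rows Q (λ v u → E u v) d in-deg))

  -- Of the d edges into each vertex of `Q`, at most d / 2 start in `P`, so at least half of all
  -- edges into `Q` are bad.
  few-heads : ∀ (P Q : Fin n → Bool) (Bad : Fin n → Fin n → Bool) y → (∀ u v → T (E u v) → T (Q v) → T (P u) ⊎ T (Bad u v)) →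
    #₂ Bad ≤ y * d → 2 * # P ≤ d → # Q ≤ 2 * y
  few-heads P Q Bad y h bad p = halve d (# Q) (# P) y d>0 (begin
    # Q * d ≡⟨ sym (in-edges Q) ⟩
    #₂ (λ u v → E u v ∧ Q v) ≤⟨ #₂-∪ {Q = λ u v → P u ∧ Q v} {R = Bad} (λ u v e → [ (λ pu → inj₁ (∧⁺ pu (∧₂ e))) , inj₂ ]′ (h u v (∧₁ e) (∧₂ e))) ⟩
    #₂ (λ u v → P u ∧ Q v) + #₂ Bad ≤⟨ +-mono-≤ (≤-reflexive (#₂-× P Q)) bad ⟩
    # P * # Q + y * d ∎) p
    where open ≤-Reasoning

few-tails : ∀ {n} {E : Digraph n} {d} (R : RegularGraph E d) (d>0 : 0 < d) (P Q : Fin n → Bool) (Bad : Fin n → Fin n → Bool) y →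
  (∀ u v → T (E u v) → T (P u) → T (Q v) ⊎ T (Bad u v)) → #₂ Bad ≤ y * d → 2 * # Q ≤ d → # P ≤ 2 * y
few-tails R d>0 P Q Bad y h bad q = Sparse.few-heads (reverse-regular R) d>0 Q P (λ v u → Bad u v) y (λ v u e p → h u v e p)
  (≤-trans (≤-reflexive (sym (#₂-swap Bad))) bad) q

-- Out-vertices and in-vertices are labelled separately: an edge u → v is internal when cS u = cT v.
record Frame {n} (E : Digraph n) (d k x h : ℕ) : Set where
  field
    cS cT : Fin n → Fin k
  cross : Fin n → Fin n → Bool
  cross u v = E u v ∧ not (cS u == cT v)
  cut : Fin k → (Fin n → Bool) → (Fin n → Bool) → Fin n → Fin n → Bool
  cut i S S′ u v = (E u v ∧ ((cS u == i) ∧ (cT v == i))) ∧ ((S u ∧ not (S′ v)) ∨ (not (S u) ∧ S′ v))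
  field
    cross-few : #₂ cross ≤ x * d
    large : ∀ i → d ≤ 2 * # (λ u → cS u == i)
    robust : ∀ i S S′ → #₂ (cut i S S′) ≤ h * d → 2 * # (λ u → (cS u == i) ∧ S u) < d ⊎ 2 * # (λ u → (cS u == i) ∧ not (S u)) < d

search₂ : ∀ {m} (C : (Fin m → Bool) → (Fin m → Bool) → Set) → (∀ S S′ → Dec (C S S′)) →
  (∀ S S′ P P′ → (∀ x → S x ≡ P x) → (∀ x → S′ x ≡ P′ x) → C S S′ → C P P′) →
  (∃₂ λ S S′ → C S S′) ⊎ (∀ S S′ → ¬ C S S′)
search₂ {m} C C? ext with search (λ S → ∃ λ S′ → C S S′) inner (λ S P e (S′ , c) → S′ , ext S S′ P S′ e (λ _ → refl) c)
  where
  inner : ∀ S → Dec (∃ λ S′ → C S S′)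
  inner S with search (C S) (C? S) (λ S′ P′ e c → ext S S′ S P′ (λ _ → refl) e c)
  ... | inj₁ p = yes p
  ... | inj₂ h = no λ (S′ , c) → h S′ c
... | inj₁ (S , S′ , c) = inj₁ (S , S′ , c)
... | inj₂ h = inj₂ λ S S′ c → h S (S′ , c)

-- Splitting along a sparse cut turns its edges into cross edges, so the budgets have to grow by
-- `x k + h k ≤ x (suc k)`. A frame is reached when no class has a sparse cut any more.
module Partition {n} {E : Digraph n} {d} (n≤ : n ≤ 4 * d + 1) (d>2 : 2 < d) (x h : ℕ → ℕ) (next : ∀ k → x k + h k ≤ x (suc k)) where

  record Pre (k : ℕ) : Set where
    field
      cS cT : Fin n → Fin k
      cross-few : #₂ (λ u v → E u v ∧ not (cS u == cT v)) ≤ x k * d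
      large : ∀ i → d ≤ 2 * # (λ u → cS u == i)

  module _ {k} (P : Pre k) where
    open Pre P
    cutP : Fin k → (Fin n → Bool) → (Fin n → Bool) → Fin n → Fin n → Bool
    cutP i S S′ u v = (E u v ∧ ((cS u == i) ∧ (cT v == i))) ∧ ((S u ∧ not (S′ v)) ∨ (not (S u) ∧ S′ v))

    Sparse-cut : Fin k → (Fin n → Bool) → (Fin n → Bool) → Set
    Sparse-cut i S S′ = #₂ (cutP i S S′) ≤ h k * d × d ≤ 2 * # (λ u → (cS u == i) ∧ S u) × d ≤ 2 * # (λ u → (cS u == i) ∧ not (S u))

    Sparse-cut-ext : ∀ i S S′ P P′ → (∀ x → S x ≡ P x) → (∀ x → S′ x ≡ P′ x) → Sparse-cut i S S′ → Sparse-cut i P P′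
    Sparse-cut-ext i S S′ P P′ e e′ (c , l , l′) =
      subst (_≤ h k * d) (∑-cong λ u → ∑-cong λ v → cong₂ (λ s s′ → ⟦ (E u v ∧ ((cS u == i) ∧ (cT v == i))) ∧ ((s ∧ not s′) ∨ (not s ∧ s′)) ⟧) (e u) (e′ v)) c ,
      subst (λ c → d ≤ 2 * c) (∑-cong λ u → cong (λ s → ⟦ (cS u == i) ∧ s ⟧) (e u)) l ,
      subst (λ c → d ≤ 2 * c) (∑-cong λ u → cong (λ s → ⟦ (cS u == i) ∧ not s ⟧) (e u)) l′

    sparse-cut? : ∀ i → Dec (∃₂ λ S S′ → Sparse-cut i S S′)
    sparse-cut? i with search₂ (Sparse-cut i) (λ S S′ → (_ ≤? _) ×-dec ((_ ≤? _) ×-dec (_ ≤? _))) (Sparse-cut-ext i)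
    ... | inj₁ p = yes p
    ... | inj₂ none = no λ (S , S′ , c) → none S S′ c

    relabel : Bool → Fin k → Fin (suc k)
    relabel true c = zero
    relabel false c = suc c

    module Split (i : Fin k) (S S′ : Fin n → Bool) (sparse : Sparse-cut i S S′) where
      cS′ cT′ : Fin n → Fin (suc k)
      cS′ u = relabel ((cS u == i) ∧ S u) (cS u)
      cT′ v = relabel ((cT v == i) ∧ S′ v) (cT v)

      relabel-cases : ∀ b (c : Fin k) → T b × relabel b c ≡ zero ⊎ ¬ T b × relabel b c ≡ suc c
      relabel-cases true c = inj₁ (tt , refl)
      relabel-cases false c = inj₂ ((λ ()) , refl)

      split-cross : ∀ u v → T (E u v ∧ not (cS′ u == cT′ v)) → T (E u v ∧ not (cS u == cT v)) ⊎ T (cutP i S S′ u v)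
      split-cross u v p with em (cS u == cT v)
      ... | inj₂ ne = inj₁ (∧⁺ (∧₁ p) (not⁺ ne))
      ... | inj₁ eq with relabel-cases ((cS u == i) ∧ S u) (cS u) | relabel-cases ((cT v == i) ∧ S′ v) (cT v)
      ...   | inj₁ (_ , e) | inj₁ (_ , e′) = ⊥-elim (not⁻ (∧₂ p) (==⁺ (trans e (sym e′))))
      ...   | inj₂ (_ , e) | inj₂ (_ , e′) = ⊥-elim (not⁻ (∧₂ p) (==⁺ (trans e (trans (cong suc (==⁻ eq)) (sym e′)))))
      ...   | inj₁ (q , _) | inj₂ (q′ , _) = inj₂ (∧⁺ (∧⁺ (∧₁ p) (∧⁺ (∧₁ q) ti)) (∨₁ (∧⁺ (∧₂ q) (not⁺ λ s → q′ (∧⁺ ti s)))))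
        where
        ti : T (cT v == i)
        ti = ==⁺ (trans (sym (==⁻ eq)) (==⁻ (∧₁ q)))
      ...   | inj₂ (q , _) | inj₁ (q′ , _) = inj₂ (∧⁺ (∧⁺ (∧₁ p) (∧⁺ si (∧₁ q′))) (∨₂ (∧⁺ (not⁺ λ s → q (∧⁺ si s)) (∧₂ q′))))
        where
        si : T (cS u == i)
        si = ==⁺ (trans (==⁻ eq) (==⁻ (∧₁ q′)))

      split-large : ∀ j → d ≤ 2 * # (λ u → cS′ u == j)
      split-large zero = ≤-trans (proj₁ (proj₂ sparse)) (*-monoʳ-≤ 2 (#-mono λ u p → new u p))
        where
        new : ∀ u → T ((cS u == i) ∧ S u) → T (cS′ u == zero)
        new u p with relabel-cases ((cS u == i) ∧ S u) (cS u)
        ... | inj₁ (_ , e) = ==⁺ e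
        ... | inj₂ (q , _) = ⊥-elim (q p)
      split-large (suc j) with j ≟ i
      ... | yes refl = ≤-trans (proj₂ (proj₂ sparse)) (*-monoʳ-≤ 2 (#-mono λ u p → old u p))
        where
        old : ∀ u → T ((cS u == i) ∧ not (S u)) → T (cS′ u == suc i)
        old u p with relabel-cases ((cS u == i) ∧ S u) (cS u)
        ... | inj₁ (q , _) = ⊥-elim (not⁻ (∧₂ p) (∧₂ q))
        ... | inj₂ (_ , e) = ==⁺ (trans e (cong suc (==⁻ (∧₁ p))))
      ... | no ne = ≤-trans (large j) (*-monoʳ-≤ 2 (#-mono λ u p → old u p))
        where
        old : ∀ u → T (cS u == j) → T (cS′ u == suc j)
        old u p with relabel-cases ((cS u == i) ∧ S u) (cS u)
        ... | inj₁ (q , _) = ⊥-elim (ne (trans (sym (==⁻ p)) (==⁻ (∧₁ q))))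
        ... | inj₂ (_ , e) = ==⁺ (trans e (cong suc (==⁻ p)))

      split : Pre (suc k)
      split = record
        { cS = cS′ ; cT = cT′
        ; cross-few = ≤-trans (#₂-∪ split-cross) (≤-trans (+-mono-≤ cross-few (proj₁ sparse)) (≤-trans (≤-reflexive (sym (*-distribʳ-+ d (x k) (h k)))) (*-monoˡ-≤ d (next k))))
        ; large = split-large }

    -- Classes with at least d / 2 out-vertices give k d ≤ 2n ≤ 8d + 2, which is below 9d as d > 2.
    few-parts : k ≤ 8
    few-parts = ≮⇒≥ λ k>8 → <⇒≱ (big d d>2) (begin
      9 * d ≤⟨ *-monoˡ-≤ d k>8 ⟩
      k * d ≡⟨ sym (∑-const k d) ⟩
      ∑ {k} (λ _ → d) ≤⟨ ∑-mono large ⟩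
      ∑ (λ i → 2 * # (λ u → cS u == i)) ≡⟨ ∑-*ˡ 2 _ ⟩
      2 * ∑ (λ i → # (λ u → cS u == i)) ≡⟨ cong (2 *_) (∑-swap (λ i u → ⟦ cS u == i ⟧)) ⟩
      2 * ∑ (λ u → # (λ i → cS u == i)) ≡⟨ cong (2 *_) (trans (∑-cong λ u → #-single (cS u)) (trans (∑-const n 1) (*-identityʳ n))) ⟩
      2 * n ≤⟨ *-monoʳ-≤ 2 n≤ ⟩
      2 * (4 * d + 1) ∎)
      where
      open ≤-Reasoning
      big : ∀ d → 2 < d → 2 * (4 * d + 1) < 9 * d
      big d p = ≤-trans (≤-trans (≤-reflexive (e d)) (+-monoʳ-≤ (8 * d) p)) (≤-reflexive (e′ d))
        where
        e : ∀ d → suc (2 * (4 * d + 1)) ≡ 8 * d + 3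
        e = solve-∀
        e′ : ∀ d → 8 * d + d ≡ 9 * d
        e′ = solve-∀

  refine : ∀ fuel k → 9 ≤ k + fuel → Pre k → ∃ λ k′ → k′ ≤ 8 × Frame E d k′ (x k′) (h k′)
  refine fuel k le P with any? (sparse-cut? P)
  ... | no none = k , few-parts P , record
        { cS = Pre.cS P ; cT = Pre.cT P ; cross-few = Pre.cross-few P ; large = Pre.large P
        ; robust = λ i S S′ c → decide i S S′ c }
    where
    decide : ∀ i S S′ → #₂ (cutP P i S S′) ≤ h k * d → 2 * # (λ u → (Pre.cS P u == i) ∧ S u) < d ⊎ 2 * # (λ u → (Pre.cS P u == i) ∧ not (S u)) < d
    decide i S S′ c with d ≤? 2 * # (λ u → (Pre.cS P u == i) ∧ S u) | d ≤? 2 * # (λ u → (Pre.cS P u == i) ∧ not (S u))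
    ... | no p | _ = inj₁ (≰⇒> p)
    ... | yes _ | no p = inj₂ (≰⇒> p)
    ... | yes p | yes q = ⊥-elim (none (i , S , S′ , c , p , q))
  refine zero k le P | yes _ = ⊥-elim (<⇒≱ (≤-trans (s≤s (few-parts P)) ≤-refl) (≤-trans le (≤-reflexive (+-identityʳ k))))
  refine (suc fuel) k le P | yes (i , S , S′ , c) = refine fuel (suc k) (≤-trans le (≤-reflexive (+-suc k fuel))) (Split.split P i S S′ c)

  partition : d ≤ 2 * n → ∃ λ k → k ≤ 8 × Frame E d k (x k) (h k)
  partition d≤ = refine 8 1 ≤-refl (record
    { cS = λ _ → zero ; cT = λ _ → zero
    ; cross-few = ≤-trans (≤-reflexive (trans (∑-cong λ u → #-none λ v p → not⁻ (∧₂ p) tt) (trans (∑-const n 0) (*-zeroʳ n)))) z≤n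
    ; large = λ { zero → ≤-trans d≤ (*-monoʳ-≤ 2 (≤-reflexive (sym (#-all n)))) } })

-- Class labels and rematching

-- What matters for matching a vertex is where many of its edges go. An exceptional vertex may have
-- such edges in several classes, or too few in its own, so labels are a relation and not a
-- function; a compatible pair can be matched through a common label.
record Labelling {n} {E : Digraph n} {d k x h} (Fr : Frame E d k x h) (V a : ℕ) : Set where
  open Frame Fr
  field
    LS LT : Fin n → Fin k → Bool
    thick-S : ∀ u i → T (LS u i) → d ≤ V * # (λ v → E u v ∧ (cT v == i))
    thick-T : ∀ v i → T (LT v i) → d ≤ V * # (λ u → E u v ∧ (cS u == i))
    typical-S : # (λ u → not (LS u (cS u))) ≤ a
    typical-T : # (λ v → not (LT v (cT v))) ≤ a
  compat : Fin n → Fin n → Bool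
  compat u v = any λ i → LS u i ∧ LT v i

  compat⁺ : ∀ {u v} i → T (LS u i) → T (LT v i) → T (compat u v)
  compat⁺ {u} {v} i p q = any⁺ (λ i → LS u i ∧ LT v i) i (∧⁺ p q)

  compat⁻ : ∀ {u v} → T (compat u v) → ∃ λ i → T (LS u i) × T (LT v i)
  compat⁻ {u} {v} h = let i , p = any⁻ (λ i → LS u i ∧ LT v i) h in i , ∧₁ p , ∧₂ p

#-excess₃ : ∀ {n} (P A B C : Fin n → Bool) a b c → # A ≤ a → # B ≤ b → # C ≤ c → a + (b + c) < # P →
  ∃ λ x → T (P x) × ¬ T (A x) × ¬ T (B x) × ¬ T (C x)
#-excess₃ P A B C a b c ha hb hc lt with #-excess P (λ x → A x ∨ (B x ∨ C x))
    (≤-<-trans (≤-trans (#-∪ {Q = A} {R = λ x → B x ∨ C x} λ x → ∨⁻) (+-mono-≤ ha (≤-trans (#-∪ {Q = B} {R = C} λ x → ∨⁻) (+-mono-≤ hb hc)))) lt)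
... | x , p , q = x , p , (λ y → q (∨₁ y)) , (λ y → q (∨₂ (∨₁ y))) , (λ y → q (∨₂ (∨₂ y)))

not-not : ∀ {b} → ¬ T (not b) → T b
not-not {b} h with em b
... | inj₁ p = p
... | inj₂ ¬p = ⊥-elim (h (not⁺ ¬p))

-- A permutation whose pairs off the forced set are only compatible (not necessarily edges) becomes a
-- genuine 1-factor: robustness makes every violation of Hall's condition a union of classes.
module Rematch {n} {E : Digraph n} {d k x h V a} (R : RegularGraph E d) (Fr : Frame E d k x h) (La : Labelling Fr V a)
  (d>0 : 0 < d) (x≤a : x ≤ a) (8a≤h : 8 * a ≤ h) (20a≤d : 20 * a ≤ d) (12aV<d : V * (12 * a) < d)
  (forced : Fin n → Bool) (few-forced : # forced ≤ a) (π : Perm n)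
  (compatible : ∀ u → ¬ T (forced u) → T (Labelling.compat La u (to π u))) where
  open RegularGraph R
  open Frame Fr
  open Labelling La
  open Sparse R d>0

  -- In-vertices are addressed through `π`: the index `v` stands for `to π v`. Forced pairs then lie
  -- on the diagonal and stay matched.
  J : Fin n → Fin n → Bool
  J u v = ((u == v) ∧ forced u) ∨ ((not (forced u) ∧ not (forced v)) ∧ (E u (to π v) ∧ compat u (to π v)))

  J-free : ∀ {u v} → ¬ T (forced u) → ¬ T (forced v) → T (E u (to π v)) → T (compat u (to π v)) → T (J u v)
  J-free fu fv e c = ∨₂ (∧⁺ (∧⁺ (not⁺ fu) (not⁺ fv)) (∧⁺ e c))

  J-free⁻ : ∀ {u v} → ¬ T (forced u) → T (J u v) → ¬ T (forced v) × T (E u (to π v)) × T (compat u (to π v))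
  J-free⁻ fu j with ∨⁻ j
  ... | inj₁ p = ⊥-elim (fu (∧₂ p))
  ... | inj₂ p = not⁻ (∧₂ (∧₁ p)) , ∧₁ (∧₂ p) , ∧₂ (∧₂ p)

  head-forced : Fin n → Bool
  head-forced v = forced (from π v)

  few-heads-forced : # head-forced ≤ a
  few-heads-forced = ≤-trans (≤-reflexive (#-perm (inverse π) forced)) few-forced

  incompatible-few : #₂ (λ u v → E u v ∧ not (compat u v)) ≤ (x + (a + a)) * d
  incompatible-few = begin
    #₂ (λ u v → E u v ∧ not (compat u v)) ≤⟨ #₂-∪ {Q = cross} {R = λ u v → (not (LS u (cS u)) ∧ E u v) ∨ (E u v ∧ not (LT v (cT v)))} cases ⟩
    #₂ cross + #₂ (λ u v → (not (LS u (cS u)) ∧ E u v) ∨ (E u v ∧ not (LT v (cT v))))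
      ≤⟨ +-mono-≤ cross-few (#₂-∪ {Q = λ u v → not (LS u (cS u)) ∧ E u v} {R = λ u v → E u v ∧ not (LT v (cT v))} (λ u v → ∨⁻)) ⟩
    x * d + (#₂ (λ u v → not (LS u (cS u)) ∧ E u v) + #₂ (λ u v → E u v ∧ not (LT v (cT v))))
      ≡⟨ cong (x * d +_) (cong₂ _+_ (out-edges (λ u → not (LS u (cS u)))) (in-edges (λ v → not (LT v (cT v))))) ⟩
    x * d + (# (λ u → not (LS u (cS u))) * d + # (λ v → not (LT v (cT v))) * d)
      ≤⟨ +-monoʳ-≤ (x * d) (+-mono-≤ (*-monoˡ-≤ d typical-S) (*-monoˡ-≤ d typical-T)) ⟩
    x * d + (a * d + a * d) ≡⟨ e x a d ⟩
    (x + (a + a)) * d ∎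
    where
    open ≤-Reasoning
    e : ∀ x a d → x * d + (a * d + a * d) ≡ (x + (a + a)) * d
    e = solve-∀
    cases : ∀ u v → T (E u v ∧ not (compat u v)) → T (cross u v) ⊎ T ((not (LS u (cS u)) ∧ E u v) ∨ (E u v ∧ not (LT v (cT v))))
    cases u v p with em (cS u == cT v) | em (LS u (cS u)) | em (LT v (cT v))
    ... | inj₂ ne | _ | _ = inj₁ (∧⁺ (∧₁ p) (not⁺ ne))
    ... | inj₁ _ | inj₂ l | _ = inj₂ (∨₁ (∧⁺ (not⁺ l) (∧₁ p)))
    ... | inj₁ _ | inj₁ _ | inj₂ l = inj₂ (∨₂ (∧⁺ (∧₁ p) (not⁺ l)))
    ... | inj₁ eq | inj₁ l | inj₁ l′ = ⊥-elim (not⁻ (∧₂ p) (compat⁺ (cS u) l (subst (λ i → T (LT v i)) (sym (==⁻ eq)) l′)))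

  -- An edge leaving a violating `S` to a vertex outside its neighbourhood `Tv` has a forced head or
  -- incompatible ends, so there are few. As all degrees are equal and `Tv` is smaller than `S`, no
  -- more edges enter. Robustness then puts almost all or almost none of each class into this cut,
  -- hence labels alone decide what belongs to it, and the compatible pairs of `π` inject `S` into
  -- its neighbourhood after all.
  module Violation (S : Fin n → Bool) (S-free : ∀ u → T (S u) → ¬ T (forced u)) (few : # (N⁺ J S) < # S) where
    Tv : Fin n → Bool
    Tv v = N⁺ J S (from π v)

    #Tv : # Tv ≡ # (N⁺ J S)
    #Tv = #-perm (inverse π) (N⁺ J S)

    Tv⁺ : ∀ {u v} → T (S u) → ¬ T (head-forced v) → T (E u v) → T (compat u v) → T (Tv v)
    Tv⁺ {u} {v} s f e c = N⁺-intro J S s (J-free (S-free u s) f (subst (λ z → T (E u z)) (sym (to-from π v)) e) (subst (λ z → T (compat u z)) (sym (to-from π v)) c))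

    Out In : Fin n → Fin n → Bool
    Out u v = (S u ∧ E u v) ∧ not (Tv v)
    In u v = (E u v ∧ Tv v) ∧ not (S u)

    Out-few : #₂ Out ≤ (4 * a) * d
    Out-few = begin
      #₂ Out ≤⟨ #₂-∪ {Q = λ u v → E u v ∧ head-forced v} {R = λ u v → E u v ∧ not (compat u v)} cases ⟩
      #₂ (λ u v → E u v ∧ head-forced v) + #₂ (λ u v → E u v ∧ not (compat u v)) ≤⟨ +-mono-≤ (≤-reflexive (in-edges head-forced)) incompatible-few ⟩
      # head-forced * d + (x + (a + a)) * d ≤⟨ +-mono-≤ (*-monoˡ-≤ d few-heads-forced) (*-monoˡ-≤ d (+-monoˡ-≤ (a + a) x≤a)) ⟩
      a * d + (a + (a + a)) * d ≡⟨ e a d ⟩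
      4 * a * d ∎
      where
      open ≤-Reasoning
      e : ∀ a d → a * d + (a + (a + a)) * d ≡ 4 * a * d
      e = solve-∀
      cases : ∀ u v → T (Out u v) → T (E u v ∧ head-forced v) ⊎ T (E u v ∧ not (compat u v))
      cases u v p with em (head-forced v) | em (compat u v)
      ... | inj₁ f | _ = inj₁ (∧⁺ (∧₂ (∧₁ p)) f)
      ... | inj₂ f | inj₂ c = inj₂ (∧⁺ (∧₂ (∧₁ p)) (not⁺ c))
      ... | inj₂ f | inj₁ c = ⊥-elim (not⁻ (∧₂ p) (Tv⁺ (∧₁ (∧₁ p)) f (∧₂ (∧₁ p)) c))

    In≤Out : #₂ In ≤ #₂ Out
    In≤Out = +-cancelˡ-≤ (#₂ (λ u v → (E u v ∧ Tv v) ∧ S u)) _ _ (begin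
      #₂ (λ u v → (E u v ∧ Tv v) ∧ S u) + #₂ In ≡⟨ sym (#₂-split (λ u v → E u v ∧ Tv v) (λ u v → S u)) ⟩
      #₂ (λ u v → E u v ∧ Tv v) ≡⟨ in-edges Tv ⟩
      # Tv * d ≤⟨ *-monoˡ-≤ d (≤-trans (≤-reflexive #Tv) (<⇒≤ few)) ⟩
      # S * d ≡⟨ sym (out-edges S) ⟩
      #₂ (λ u v → S u ∧ E u v) ≡⟨ #₂-split (λ u v → S u ∧ E u v) (λ u v → Tv v) ⟩
      #₂ (λ u v → (S u ∧ E u v) ∧ Tv v) + #₂ Out ≡⟨ cong (_+ #₂ Out) (#₂-cong (λ u v p → ∧⁺ (∧⁺ (∧₂ (∧₁ p)) (∧₂ p)) (∧₁ (∧₁ p))) (λ u v p → ∧⁺ (∧⁺ (∧₂ p) (∧₁ (∧₁ p))) (∧₂ (∧₁ p)))) ⟩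
      #₂ (λ u v → (E u v ∧ Tv v) ∧ S u) + #₂ Out ∎)
      where open ≤-Reasoning

    cut-few : ∀ i → #₂ (cut i S Tv) ≤ h * d
    cut-few i = begin
      #₂ (cut i S Tv) ≤⟨ #₂-∪ {Q = Out} {R = In} (λ u v p → [ (λ q → inj₁ (∧⁺ (∧⁺ (∧₁ q) (∧₁ (∧₁ p))) (∧₂ q))) , (λ q → inj₂ (∧⁺ (∧⁺ (∧₁ (∧₁ p)) (∧₂ q)) (∧₁ q))) ]′ (∨⁻ (∧₂ p))) ⟩
      #₂ Out + #₂ In ≤⟨ +-mono-≤ Out-few (≤-trans In≤Out Out-few) ⟩
      4 * a * d + 4 * a * d ≡⟨ e a d ⟩
      8 * a * d ≤⟨ *-monoˡ-≤ d 8a≤h ⟩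
      h * d ∎
      where
      open ≤-Reasoning
      e : ∀ a d → 4 * a * d + 4 * a * d ≡ 8 * a * d
      e = solve-∀

    with-cross : ∀ (B : Fin n → Fin n → Bool) → #₂ B ≤ (4 * a) * d → #₂ (λ u v → B u v ∨ cross u v) ≤ (5 * a) * d
    with-cross B le = ≤-trans (#₂-∪ {Q = B} {R = cross} λ u v → ∨⁻) (≤-trans (+-mono-≤ le (≤-trans cross-few (*-monoˡ-≤ d x≤a))) (≤-reflexive (e a d)))
      where
      e : ∀ a d → 4 * a * d + a * d ≡ 5 * a * d
      e = solve-∀

    Big : Fin k → Set
    Big i = ¬ (2 * # (λ u → (cS u == i) ∧ S u) < d)

    10a : 2 * (5 * a) ≡ 10 * a
    10a = sym (*-assoc 2 5 a)

    T-small : ∀ i → ¬ Big i → # (λ v → (cT v == i) ∧ Tv v) ≤ 10 * a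
    T-small i small = ≤-trans (few-heads (λ u → (cS u == i) ∧ S u) (λ v → (cT v == i) ∧ Tv v) (λ u v → In u v ∨ cross u v) (5 * a) cases
      (with-cross In (≤-trans In≤Out Out-few)) (≮⇒≥ λ l → small λ l′ → <⇒≱ l (<⇒≤ l′))) (≤-reflexive 10a)
      where
      cases : ∀ u v → T (E u v) → T ((cT v == i) ∧ Tv v) → T ((cS u == i) ∧ S u) ⊎ T (In u v ∨ cross u v)
      cases u v e q with em (S u) | em (cS u == cT v)
      ... | inj₂ s | _ = inj₂ (∨₁ (∧⁺ (∧⁺ e (∧₂ q)) (not⁺ s)))
      ... | inj₁ s | inj₂ ne = inj₂ (∨₂ (∧⁺ e (not⁺ ne)))
      ... | inj₁ s | inj₁ eq = inj₁ (∧⁺ (==⁺ (trans (==⁻ eq) (==⁻ (∧₁ q)))) s)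

    -- Robustness bounds the missing part of the class only by d / 2. Passing to heads with
    -- `few-heads` and back with `few-tails` improves this to `10 * a`: twice the `4 * a` from the
    -- cut plus `a` from cross edges.
    S-small : ∀ i → Big i → # (λ u → (cS u == i) ∧ not (S u)) ≤ 10 * a
    S-small i big = ≤-trans (few-tails R d>0 (λ u → (cS u == i) ∧ not (S u)) (λ v → (cT v == i) ∧ not (Tv v)) (λ u v → In u v ∨ cross u v) (5 * a) cases₂
      (with-cross In (≤-trans In≤Out Out-few)) (≤-trans (*-monoʳ-≤ 2 T-most) (≤-trans (≤-reflexive (sym (*-assoc 2 10 a))) 20a≤d))) (≤-reflexive 10a)
      where
      half : 2 * # (λ u → (cS u == i) ∧ not (S u)) ≤ d
      half = [ (λ l → ⊥-elim (big l)) , <⇒≤ ]′ (robust i S Tv (cut-few i))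
      cases₁ : ∀ u v → T (E u v) → T ((cT v == i) ∧ not (Tv v)) → T ((cS u == i) ∧ not (S u)) ⊎ T (Out u v ∨ cross u v)
      cases₁ u v e q with em (S u) | em (cS u == cT v)
      ... | inj₁ s | _ = inj₂ (∨₁ (∧⁺ (∧⁺ s e) (∧₂ q)))
      ... | inj₂ s | inj₂ ne = inj₂ (∨₂ (∧⁺ e (not⁺ ne)))
      ... | inj₂ s | inj₁ eq = inj₁ (∧⁺ (==⁺ (trans (==⁻ eq) (==⁻ (∧₁ q)))) (not⁺ s))
      T-most : # (λ v → (cT v == i) ∧ not (Tv v)) ≤ 10 * a
      T-most = ≤-trans (few-heads (λ u → (cS u == i) ∧ not (S u)) (λ v → (cT v == i) ∧ not (Tv v)) (λ u v → Out u v ∨ cross u v) (5 * a) cases₁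
        (with-cross Out Out-few) half) (≤-reflexive 10a)
      cases₂ : ∀ u v → T (E u v) → T ((cS u == i) ∧ not (S u)) → T ((cT v == i) ∧ not (Tv v)) ⊎ T (In u v ∨ cross u v)
      cases₂ u v e q with em (Tv v) | em (cS u == cT v)
      ... | inj₁ t | _ = inj₂ (∨₁ (∧⁺ (∧⁺ e t) (∧₂ q)))
      ... | inj₂ t | inj₂ ne = inj₂ (∨₂ (∧⁺ e (not⁺ ne)))
      ... | inj₂ t | inj₁ eq = inj₁ (∧⁺ (==⁺ (trans (sym (==⁻ eq)) (==⁻ (∧₁ q)))) (not⁺ t))

    thick : ∀ c → d ≤ V * c → 10 * a + (a + a) < c
    thick c le = ≰⇒> λ l → <⇒≱ 12aV<d (≤-trans le (*-monoʳ-≤ V (≤-trans l (≤-reflexive (e a)))))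
      where
      e : ∀ a → 10 * a + (a + a) ≡ 12 * a
      e = solve-∀

    -- The label gives `u` at least d / V out-neighbours in class `i`, more than all exceptional
    -- ones together. A remaining one belongs to `Tv`, which is impossible if `Tv` is small in that
    -- class.
    labels-big : ∀ u i → T (S u) → T (LS u i) → Big i
    labels-big u i s l small = go (#-excess₃ (λ v → E u v ∧ (cT v == i)) (λ v → (cT v == i) ∧ Tv v) head-forced (λ v → not (LT v (cT v)))
      (10 * a) a a (T-small i λ b → b small) few-heads-forced typical-T (thick _ (thick-S u i l)))
      where
      go : (∃ λ v → T (E u v ∧ (cT v == i)) × ¬ T ((cT v == i) ∧ Tv v) × ¬ T (head-forced v) × ¬ T (not (LT v (cT v)))) → ⊥
      go (v , p , ¬t , ¬f , ¬l) = ¬t (∧⁺ (∧₂ p) (Tv⁺ s ¬f (∧₁ p) (compat⁺ i l (subst (λ j → T (LT v j)) (==⁻ (∧₂ p)) (not-not ¬l)))))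

    reached : ∀ v i → ¬ T (head-forced v) → Big i → T (LT v i) → T (Tv v)
    reached v i f big l = go (#-excess₃ (λ u → E u v ∧ (cS u == i)) (λ u → (cS u == i) ∧ not (S u)) (λ u → not (LS u (cS u))) (λ _ → false)
      (10 * a) a a (S-small i big) typical-S (≤-trans (≤-reflexive (#-none λ _ ())) z≤n) (thick _ (thick-T v i l)))
      where
      go : (∃ λ u → T (E u v ∧ (cS u == i)) × ¬ T ((cS u == i) ∧ not (S u)) × ¬ T (not (LS u (cS u))) × ¬ T false) → T (Tv v)
      go (u , p , ¬s , ¬l , _) = Tv⁺ (not-not λ s → ¬s (∧⁺ (∧₂ p) s)) f (∧₁ p) (compat⁺ i (subst (λ j → T (LS u j)) (==⁻ (∧₂ p)) (not-not ¬l)) l)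

    absurd : ⊥
    absurd = <⇒≱ few (#-mono λ u s → let i , l , l′ = compat⁻ (compatible u (S-free u s)) in
      subst (λ z → T (N⁺ J S z)) (from-to π u) (reached (to π u) i (subst (λ z → ¬ T (forced z)) (sym (from-to π u)) (S-free u s)) (labels-big u i s l) l′))

  hall-condition : ∀ S → # S ≤ # (N⁺ J S)
  hall-condition S = begin
    # S ≡⟨ #-split S forced ⟩
    # (λ u → S u ∧ forced u) + # S₁ ≤⟨ +-mono-≤ (#-mono λ u p → ∧⁺ (N⁺-intro J S (∧₁ p) (∨₁ (∧⁺ (==⁺ {x = u} refl) (∧₂ p)))) (∧₂ p)) free ⟩
    # (λ v → N⁺ J S v ∧ forced v) + # (N⁺ J S₁) ≤⟨ +-monoʳ-≤ (# (λ v → N⁺ J S v ∧ forced v)) (#-mono λ v p → let u , s , j = N⁺-elim J S₁ p in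
         ∧⁺ (N⁺-intro J S (∧₁ s) j) (not⁺ (proj₁ (J-free⁻ (not⁻ (∧₂ s)) j)))) ⟩
    # (λ v → N⁺ J S v ∧ forced v) + # (λ v → N⁺ J S v ∧ not (forced v)) ≡⟨ sym (#-split (N⁺ J S) forced) ⟩
    # (N⁺ J S) ∎
    where
    open ≤-Reasoning
    S₁ : Fin n → Bool
    S₁ u = S u ∧ not (forced u)
    free : # S₁ ≤ # (N⁺ J S₁)
    free = ≮⇒≥ λ lt → Violation.absurd S₁ (λ u s → not⁻ (∧₂ s)) lt

  rematch : ∃ λ (σ : Perm n) → (∀ u → T (forced u) → to σ u ≡ to π u) × (∀ u → ¬ T (forced u) → T (E u (to σ u)) × T (compat u (to σ u)))
  rematch = build (hall J hall-condition)
    where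
    build : (∃ λ (τ : Perm n) → ∀ u → T (J u (to τ u))) → _
    build (τ , ok) = record { to = to π ∘ to τ ; from = from τ ∘ from π
                            ; to-from = λ v → trans (cong (to π) (to-from τ (from π v))) (to-from π v)
                            ; from-to = λ v → trans (cong (from τ) (from-to π (to τ v))) (from-to τ v) } ,
      (λ u f → [ (λ p → cong (to π) (sym (==⁻ (∧₁ p)))) , (λ p → ⊥-elim (not⁻ (∧₁ (∧₁ p)) f)) ]′ (∨⁻ (ok u))) ,
      λ u f → proj₂ (J-free⁻ f (ok u))

-- Making every class lie on a single cycle

#₂-pos : ∀ {m n} (P : Fin m → Fin n → Bool) x y → T (P x y) → 1 ≤ #₂ P
#₂-pos P x y p = ≤-trans (#-pos (P x) y p) (∑-≥ (λ x → # (P x)) x)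

#₂-strict : ∀ {m n} (P Q : Fin m → Fin n → Bool) → (∀ x y → T (P x y) → T (Q x y)) → ∀ x y → T (Q x y) → ¬ T (P x y) → #₂ P < #₂ Q
#₂-strict P Q P⊆Q x y q ¬p = begin
  suc (#₂ P) ≡⟨ +-comm 1 (#₂ P) ⟩
  #₂ P + 1 ≤⟨ +-mono-≤ (#₂-mono λ x y p → ∧⁺ (P⊆Q x y p) p) (#₂-pos (λ x y → Q x y ∧ not (P x y)) x y (∧⁺ q (not⁺ ¬p))) ⟩
  #₂ (λ x y → Q x y ∧ P x y) + #₂ (λ x y → Q x y ∧ not (P x y)) ≡⟨ sym (#₂-split Q P) ⟩
  #₂ Q ∎
  where open ≤-Reasoning

-- `f` bounds the misfits: forced vertices, untypical tails and untypical heads contribute `a` each,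
-- vertices with a foreign label `V * x` on either side. The fields express the hierarchy of `x`,
-- `a`, `h` and `d` for fixed constants `V` and `g`.
record Scale (n d x a h V g : ℕ) : Set where
  f : ℕ
  f = 3 * a + 2 * (V * x)
  field
    d>0 : 0 < d
    h>0 : 0 < h
    V>0 : 0 < V
    d≤n : d ≤ n
    n≤5d : n ≤ 5 * d
    x≤a : x ≤ a
    8f≤h : 8 * f ≤ h
    200Vh≤d : 200 * (V * h) ≤ d
    200d≤gh : 200 * d ≤ g * h
    n-large : n-bound (density-bound (20 * V) g) (3 * suc (2 * g)) < n

  a≤f : a ≤ f
  a≤f = ≤-trans (m≤m+n a _) (m≤m+n (3 * a) _)

  h≤Vh : h ≤ V * h
  h≤Vh = m≤n*m h V {{>-nonZero V>0}}

  g>0 : 0 < g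
  g>0 = n≢0⇒n>0 λ { refl → <⇒≱ (*-mono-≤ {1} {200} (s≤s z≤n) d>0) 200d≤gh }

  cVh≤d : ∀ c → c ≤ 200 → c * (V * h) ≤ d
  cVh≤d c le = ≤-trans (*-monoˡ-≤ (V * h) le) 200Vh≤d

  ch≤d : ∀ c → c ≤ 200 → c * h ≤ d
  ch≤d c le = ≤-trans (*-monoʳ-≤ c h≤Vh) (cVh≤d c le)

-- Exchanging images within `good c` keeps compatibility, because all these vertices and images
-- carry the label `c`. The core keeps only those that also belong to class `c`, to which robustness
-- applies.
record Factor {n} {E : Digraph n} {d k x h V a} {Fr : Frame E d k x h} (La : Labelling Fr V a) (forced : Fin n → Bool) (π : Perm n) : Set where
  open Frame Fr
  open Labelling La
  field
    edge : ∀ u → T (E u (to π u))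
    compatible : ∀ u → ¬ T (forced u) → T (compat u (to π u))
  good : Fin k → Fin n → Bool
  good c u = not (forced u) ∧ (LS u c ∧ LT (to π u) c)
  core : Fin k → Fin n → Bool
  core c u = good c u ∧ ((cS u == c) ∧ (cT (to π u) == c))

module Cores {n} {E : Digraph n} {d k x h V a g} (R : RegularGraph E d) (Fr : Frame E d k x h) (La : Labelling Fr V a)
  (Sc : Scale n d x a h V g) (forced : Fin n → Bool) (few-forced : # forced ≤ a) where
  open RegularGraph R
  open Frame Fr
  open Labelling La
  open Scale Sc
  open Sparse R d>0

  flex-S flex-T : Fin n → Bool
  flex-S u = any λ i → LS u i ∧ not (cS u == i)
  flex-T v = any λ i → LT v i ∧ not (cT v == i)

  -- A foreign label requires at least d / V cross edges at the vertex, and there are at most x d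
  -- cross edges.
  flex-S-few : # flex-S ≤ V * x
  flex-S-few = *-cancelʳ-≤ (# flex-S) (V * x) d {{>-nonZero d>0}} (begin
    # flex-S * d ≤⟨ markov flex-S (λ u → V * # (cross u)) d thick ⟩
    ∑ (λ u → V * # (cross u)) ≡⟨ ∑-*ˡ V _ ⟩
    V * #₂ cross ≤⟨ *-monoʳ-≤ V cross-few ⟩
    V * (x * d) ≡⟨ sym (*-assoc V x d) ⟩
    V * x * d ∎)
    where
    open ≤-Reasoning
    thick : ∀ u → T (flex-S u) → d ≤ V * # (cross u)
    thick u p = let i , q = any⁻ _ p in ≤-trans (thick-S u i (∧₁ q)) (*-monoʳ-≤ V (#-mono λ v r → ∧⁺ (∧₁ r) (not⁺ λ s → not⁻ (∧₂ q) (==⁺ (trans (==⁻ s) (==⁻ (∧₂ r)))))))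

  flex-T-few : # flex-T ≤ V * x
  flex-T-few = *-cancelʳ-≤ (# flex-T) (V * x) d {{>-nonZero d>0}} (begin
    # flex-T * d ≤⟨ markov flex-T (λ v → V * # (λ u → cross u v)) d thick ⟩
    ∑ (λ v → V * # (λ u → cross u v)) ≡⟨ ∑-*ˡ V _ ⟩
    V * ∑ (λ v → # (λ u → cross u v)) ≡⟨ cong (V *_) (sym (#₂-swap cross)) ⟩
    V * #₂ cross ≤⟨ *-monoʳ-≤ V cross-few ⟩
    V * (x * d) ≡⟨ sym (*-assoc V x d) ⟩
    V * x * d ∎)
    where
    open ≤-Reasoning
    thick : ∀ v → T (flex-T v) → d ≤ V * # (λ u → cross u v)
    thick v p = let i , q = any⁻ _ p in ≤-trans (thick-T v i (∧₁ q)) (*-monoʳ-≤ V (#-mono λ u r → ∧⁺ (∧₁ r) (not⁺ λ s → not⁻ (∧₂ q) (==⁺ (trans (sym (==⁻ s)) (==⁻ (∧₂ r)))))))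

  module Misfits (π : Perm n) (Fa : Factor La forced π) where
    open Factor Fa

    misfit : Fin n → Bool
    misfit u = forced u ∨ (not (LS u (cS u)) ∨ (not (LT (to π u) (cT (to π u))) ∨ (flex-S u ∨ flex-T (to π u))))

    misfit-few : # misfit ≤ f
    misfit-few = ≤-trans (#-∪ {Q = forced} λ u → ∨⁻) (≤-trans (+-mono-≤ few-forced
      (≤-trans (#-∪ {Q = λ u → not (LS u (cS u))} λ u → ∨⁻) (+-mono-≤ typical-S
      (≤-trans (#-∪ {Q = λ u → not (LT (to π u) (cT (to π u)))} λ u → ∨⁻) (+-mono-≤ (≤-trans (≤-reflexive (#-perm π (λ v → not (LT v (cT v))))) typical-T)
      (≤-trans (#-∪ {Q = flex-S} λ u → ∨⁻) (+-mono-≤ flex-S-few (≤-trans (≤-reflexive (#-perm π flex-T)) flex-T-few)))))))) (≤-reflexive (e a (V * x))))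
      where
      e : ∀ a y → a + (a + (a + (y + y))) ≡ 3 * a + 2 * y
      e = solve-∀

    -- Outside the misfits a vertex and its image carry the label of their own class and no other,
    -- so a common label means a common class.
    fits : ∀ u → ¬ T (misfit u) → cT (to π u) ≡ cS u × T (core (cS u) u)
    fits u h = go (compat⁻ (compatible u unforced))
      where
      unforced : ¬ T (forced u)
      unforced p = h (∨₁ p)
      go : (∃ λ i → T (LS u i) × T (LT (to π u) i)) → cT (to π u) ≡ cS u × T (core (cS u) u)
      go (i , p , q) = trans et (sym es) , ∧⁺ (∧⁺ (not⁺ unforced) (∧⁺ (subst (λ j → T (LS u j)) (sym es) p) (subst (λ j → T (LT (to π u) j)) (sym es) q)))
          (∧⁺ (==⁺ {x = cS u} refl) (==⁺ (trans et (sym es))))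
        where
        es : cS u ≡ i
        es = ==⁻ (not-not λ ne → h (∨₂ (∨₂ (∨₂ (∨₁ (any⁺ (λ i → LS u i ∧ not (cS u == i)) i (∧⁺ p ne)))))))
        et : cT (to π u) ≡ i
        et = ==⁻ (not-not λ ne → h (∨₂ (∨₂ (∨₂ (∨₂ (any⁺ (λ i → LT (to π u) i ∧ not (cT (to π u) == i)) i (∧⁺ q ne)))))))

    missing-S : ∀ c → # (λ u → (cS u == c) ∧ not (core c u)) ≤ f
    missing-S c = ≤-trans (#-mono λ u p → not-not λ m → not⁻ (∧₂ p) (subst (λ j → T (core j u)) (==⁻ (∧₁ p)) (proj₂ (fits u (not⁻ m))))) misfit-few

    missing-T : ∀ c → # (λ v → (cT v == c) ∧ not (core c (from π v))) ≤ f
    missing-T c = ≤-trans (#-mono λ v p → not-not λ m → not⁻ (∧₂ p)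
      (subst (λ j → T (core j (from π v))) (trans (sym (proj₁ (fits (from π v) (not⁻ m)))) (trans (cong cT (to-from π v)) (==⁻ (∧₁ p)))) (proj₂ (fits (from π v) (not⁻ m)))))
      (≤-trans (≤-reflexive (#-perm (inverse π) misfit)) misfit-few)

    thick-core : ∀ s t → d ≤ V * s → s ≤ t + f → n ≤ 10 * V * t
    thick-core s t le st = ≤-trans n≤5d (≤-trans (*-monoʳ-≤ 5 two) (≤-reflexive (e V t)))
      where
      open ≤-Reasoning
      e : ∀ V t → 5 * (2 * V * t) ≡ 10 * V * t
      e = solve-∀
      two : d ≤ 2 * V * t
      two = +-cancelʳ-≤ d _ _ (begin
        d + d ≤⟨ +-mono-≤ le le ⟩
        V * s + V * s ≡⟨ e₁ V s ⟩
        2 * V * s ≤⟨ *-monoʳ-≤ (2 * V) st ⟩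
        2 * V * (t + f) ≡⟨ e₂ V t f ⟩
        2 * V * t + 2 * (V * f) ≤⟨ +-monoʳ-≤ (2 * V * t) (≤-trans (*-monoʳ-≤ 2 (*-monoʳ-≤ V (≤-trans (m≤n*m f 8) 8f≤h))) (cVh≤d 2 (s≤s (s≤s z≤n)))) ⟩
        2 * V * t + d ∎)
        where
        e₁ : ∀ V s → V * s + V * s ≡ 2 * V * s
        e₁ = solve-∀
        e₂ : ∀ V t f → 2 * V * (t + f) ≡ 2 * V * t + 2 * (V * f)
        e₂ = solve-∀

    module _ (c : Fin k) where
      Y : Fin n → Bool
      Y = core c
      F : Fin n → Fin n → Bool
      F u v = E u (to π v)
      open LazyWalk F Y using (missing; leaving)

      out-core : ∀ u → T (LS u c) → n ≤ 10 * V * # (λ y → Y y ∧ F u y)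
      out-core u l = thick-core _ _ (thick-S u c l) (begin
        # (λ v → E u v ∧ (cT v == c)) ≤⟨ #-∪ {Q = λ v → Y (from π v) ∧ E u v} {R = λ v → (cT v == c) ∧ not (Y (from π v))}
             (λ v p → [ (λ y → inj₁ (∧⁺ y (∧₁ p))) , (λ y → inj₂ (∧⁺ (∧₂ p) (not⁺ y))) ]′ (em (Y (from π v)))) ⟩
        # (λ v → Y (from π v) ∧ E u v) + # (λ v → (cT v == c) ∧ not (Y (from π v))) ≤⟨ +-monoʳ-≤ _ (missing-T c) ⟩
        # (λ v → Y (from π v) ∧ E u v) + f ≡⟨ cong (_+ f) (trans (sym (#-perm π (λ v → Y (from π v) ∧ E u v))) (∑-cong λ y → cong (λ z → ⟦ Y z ∧ F u y ⟧) (from-to π y))) ⟩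
        # (λ y → Y y ∧ F u y) + f ∎)
        where open ≤-Reasoning

      in-core : ∀ u → T (LT (to π u) c) → n ≤ 10 * V * # (λ y → Y y ∧ F y u)
      in-core u l = thick-core _ _ (thick-T (to π u) c l) (≤-trans (#-∪ {Q = λ y → Y y ∧ F y u} {R = λ y → (cS y == c) ∧ not (Y y)}
        (λ y p → [ (λ q → inj₁ (∧⁺ q (∧₁ p))) , (λ q → inj₂ (∧⁺ (∧₂ p) (not⁺ q))) ]′ (em (Y y)))) (+-monoʳ-≤ _ (missing-S c)))

      -- With few edges leaving `P` inside the core, `P` and the set of its `π`-images form a sparse
      -- cut of class `c`. Robustness makes one side of it smaller than d / 2, and `few-heads` and
      -- `few-tails` sharpen this to `2 * h` or `4 * h`: the first contradicts `P-dense`, the second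
      -- the `4 * h + 1` missing vertices.
      module Expansion (P : Fin n → Bool) (P⊆Y : ∀ u → T (P u) → T (Y u)) (P-dense : n ≤ 20 * V * # P) (P-missing : 4 * h + 1 ≤ missing P)
        (few : g * leaving P < n * n) where
        P′ : Fin n → Bool
        P′ v = P (from π v)

        Out In : Fin n → Fin n → Bool
        Out u v = (P u ∧ E u v) ∧ not (P′ v)
        In u v = (E u v ∧ P′ v) ∧ not (P u)

        #P′ : # P′ ≡ # P
        #P′ = #-perm (inverse π) P

        In≡Out : #₂ In ≡ #₂ Out
        In≡Out = +-cancelˡ-≡ (#₂ (λ u v → (E u v ∧ P′ v) ∧ P u)) _ _ (begin
          #₂ (λ u v → (E u v ∧ P′ v) ∧ P u) + #₂ In ≡⟨ sym (#₂-split (λ u v → E u v ∧ P′ v) (λ u v → P u)) ⟩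
          #₂ (λ u v → E u v ∧ P′ v) ≡⟨ in-edges P′ ⟩
          # P′ * d ≡⟨ cong (_* d) #P′ ⟩
          # P * d ≡⟨ sym (out-edges P) ⟩
          #₂ (λ u v → P u ∧ E u v) ≡⟨ #₂-split (λ u v → P u ∧ E u v) (λ u v → P′ v) ⟩
          #₂ (λ u v → (P u ∧ E u v) ∧ P′ v) + #₂ Out ≡⟨ cong (_+ #₂ Out) (#₂-cong (λ u v p → ∧⁺ (∧⁺ (∧₂ (∧₁ p)) (∧₂ p)) (∧₁ (∧₁ p))) (λ u v p → ∧⁺ (∧⁺ (∧₂ p) (∧₁ (∧₁ p))) (∧₂ (∧₁ p)))) ⟩
          #₂ (λ u v → (E u v ∧ P′ v) ∧ P u) + #₂ Out ∎)
          where open ≡-Reasoning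

        P-class : ∀ u → T (P u) → cS u ≡ c
        P-class u p = ==⁻ (∧₁ (∧₂ (P⊆Y u p)))

        leaving′ : #₂ (λ u v → (P u ∧ E u v) ∧ (Y (from π v) ∧ not (P′ v))) ≡ leaving P
        leaving′ = ∑-cong λ u → trans (sym (#-perm π (λ v → (P u ∧ E u v) ∧ (Y (from π v) ∧ not (P′ v))))) (#-cong
          (λ y p → ∧⁺ (∧₁ (∧₁ p)) (∧⁺ (∧₂ (∧₁ p)) (subst (λ z → T (Y z ∧ not (P z))) (from-to π y) (∧₂ p))))
          (λ y p → ∧⁺ (∧⁺ (∧₁ p) (∧₁ (∧₂ p))) (subst (λ z → T (Y z ∧ not (P z))) (sym (from-to π y)) (∧₂ (∧₂ p)))))

        Out-bound : #₂ Out ≤ leaving P + (f + x) * d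
        Out-bound = begin
          #₂ Out ≤⟨ #₂-∪ {Q = λ u v → (P u ∧ E u v) ∧ (Y (from π v) ∧ not (P′ v))} {R = λ u v → (E u v ∧ ((cT v == c) ∧ not (Y (from π v)))) ∨ cross u v} cases ⟩
          #₂ (λ u v → (P u ∧ E u v) ∧ (Y (from π v) ∧ not (P′ v))) + #₂ (λ u v → (E u v ∧ ((cT v == c) ∧ not (Y (from π v)))) ∨ cross u v)
            ≤⟨ +-mono-≤ (≤-reflexive leaving′) (≤-trans (#₂-∪ {Q = λ u v → E u v ∧ ((cT v == c) ∧ not (Y (from π v)))} {R = cross} λ u v → ∨⁻)
                 (+-mono-≤ (≤-trans (≤-reflexive (in-edges (λ v → (cT v == c) ∧ not (Y (from π v))))) (*-monoˡ-≤ d (missing-T c))) cross-few)) ⟩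
          leaving P + (f * d + x * d) ≡⟨ cong (leaving P +_) (sym (*-distribʳ-+ d f x)) ⟩
          leaving P + (f + x) * d ∎
          where
          open ≤-Reasoning
          cases : ∀ u v → T (Out u v) → T ((P u ∧ E u v) ∧ (Y (from π v) ∧ not (P′ v))) ⊎ T ((E u v ∧ ((cT v == c) ∧ not (Y (from π v)))) ∨ cross u v)
          cases u v p with em (Y (from π v)) | em (cS u == cT v)
          ... | inj₁ y | _ = inj₁ (∧⁺ (∧₁ p) (∧⁺ y (∧₂ p)))
          ... | inj₂ y | inj₂ ne = inj₂ (∨₂ (∧⁺ (∧₂ (∧₁ p)) (not⁺ ne)))
          ... | inj₂ y | inj₁ eq = inj₂ (∨₁ (∧⁺ (∧₂ (∧₁ p)) (∧⁺ (==⁺ (trans (sym (==⁻ eq)) (P-class u (∧₁ (∧₁ p))))) (not⁺ y))))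

        leaving-few : 8 * leaving P ≤ h * d
        leaving-few = *-cancelˡ-≤ (25 * d) {{>-nonZero (*-mono-≤ {1} {25} (s≤s z≤n) d>0)}} (begin
          25 * d * (8 * leaving P) ≡⟨ e₁ d (leaving P) ⟩
          200 * d * leaving P ≤⟨ *-monoˡ-≤ (leaving P) 200d≤gh ⟩
          g * h * leaving P ≡⟨ e₂ g h (leaving P) ⟩
          h * (g * leaving P) ≤⟨ *-monoʳ-≤ h (≤-trans (<⇒≤ few) (*-mono-≤ n≤5d n≤5d)) ⟩
          h * (5 * d * (5 * d)) ≡⟨ e₃ h d ⟩
          25 * d * (h * d) ∎)
          where
          open ≤-Reasoning
          e₁ : ∀ d l → 25 * d * (8 * l) ≡ 200 * d * l
          e₁ = solve-∀
          e₂ : ∀ g h l → g * h * l ≡ h * (g * l)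
          e₂ = solve-∀
          e₃ : ∀ h d → h * (5 * d * (5 * d)) ≡ 25 * d * (h * d)
          e₃ = solve-∀

        Out-eighth : 8 * #₂ Out ≤ 3 * (h * d)
        Out-eighth = begin
          8 * #₂ Out ≤⟨ *-monoʳ-≤ 8 Out-bound ⟩
          8 * (leaving P + (f + x) * d) ≡⟨ e₁ (leaving P) (f + x) d ⟩
          8 * leaving P + 8 * (f + x) * d ≤⟨ +-mono-≤ leaving-few (*-monoˡ-≤ d (*-monoʳ-≤ 8 (+-monoʳ-≤ f (≤-trans x≤a a≤f)))) ⟩
          h * d + 8 * (f + f) * d ≡⟨ cong (h * d +_) (cong (_* d) (e₂ f)) ⟩
          h * d + 2 * (8 * f) * d ≤⟨ +-monoʳ-≤ (h * d) (*-monoˡ-≤ d (*-monoʳ-≤ 2 8f≤h)) ⟩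
          h * d + 2 * h * d ≡⟨ e₃ h d ⟩
          3 * (h * d) ∎
          where
          open ≤-Reasoning
          e₁ : ∀ l y d → 8 * (l + y * d) ≡ 8 * l + 8 * y * d
          e₁ = solve-∀
          e₂ : ∀ f → 8 * (f + f) ≡ 2 * (8 * f)
          e₂ = solve-∀
          e₃ : ∀ h d → h * d + 2 * h * d ≡ 3 * (h * d)
          e₃ = solve-∀

        Out-few : 2 * #₂ Out ≤ h * d
        Out-few = *-cancelˡ-≤ 4 (≤-trans (≤-reflexive (e₁ (#₂ Out))) (≤-trans Out-eighth (*-monoˡ-≤ (h * d) {3} {4} (s≤s (s≤s (s≤s z≤n))))))
          where
          e₁ : ∀ o → 4 * (2 * o) ≡ 8 * o
          e₁ = solve-∀

        Out≤ : #₂ Out ≤ h * d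
        Out≤ = ≤-trans (m≤n*m (#₂ Out) 2) Out-few

        cut-few : #₂ (cut c P P′) ≤ h * d
        cut-few = ≤-trans (#₂-∪ {Q = Out} {R = In} (λ u v p → [ (λ q → inj₁ (∧⁺ (∧⁺ (∧₁ q) (∧₁ (∧₁ p))) (∧₂ q))) , (λ q → inj₂ (∧⁺ (∧⁺ (∧₁ (∧₁ p)) (∧₂ q)) (∧₁ q))) ]′ (∨⁻ (∧₂ p))))
          (≤-trans (≤-reflexive (trans (cong (#₂ Out +_) In≡Out) (cong (#₂ Out +_) (sym (+-identityʳ _))))) Out-few)

        x≤h : x ≤ h
        x≤h = ≤-trans x≤a (≤-trans a≤f (≤-trans (m≤n*m f 8) 8f≤h))

        with-cross : ∀ B → #₂ B ≤ h * d → #₂ (λ u v → B u v ∨ cross u v) ≤ (2 * h) * d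
        with-cross B le = ≤-trans (#₂-∪ {Q = B} {R = cross} λ u v → ∨⁻) (≤-trans (+-mono-≤ le (≤-trans cross-few (*-monoˡ-≤ d x≤h))) (≤-reflexive (e h d)))
          where
          e : ∀ h d → h * d + h * d ≡ 2 * h * d
          e = solve-∀

        In≤ : #₂ In ≤ h * d
        In≤ = ≤-trans (≤-reflexive In≡Out) Out≤

        case₁ : 2 * # (λ u → (cS u == c) ∧ P u) < d → ⊥
        case₁ lt = <⇒≱ (*-mono-≤ {1} {V * h} (*-mono-≤ V>0 h>0) (s≤s {0} {159} z≤n)) (+-cancelˡ-≤ (40 * (V * h)) _ _ (begin
          40 * (V * h) + V * h * 160 ≡⟨ e₁ (V * h) ⟩
          200 * (V * h) ≤⟨ ≤-trans 200Vh≤d d≤n ⟩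
          n ≤⟨ P-dense ⟩
          20 * V * # P ≤⟨ *-monoʳ-≤ (20 * V) tiny ⟩
          20 * V * (2 * h) ≡⟨ e₂ V h ⟩
          40 * (V * h) ≡⟨ sym (+-identityʳ _) ⟩
          40 * (V * h) + 0 ∎))
          where
          open ≤-Reasoning
          e₁ : ∀ y → 40 * y + y * 160 ≡ 200 * y
          e₁ = solve-∀
          e₂ : ∀ V h → 20 * V * (2 * h) ≡ 40 * (V * h)
          e₂ = solve-∀
          tiny : # P ≤ 2 * h
          tiny = ≤-trans (≤-reflexive (sym #P′)) (few-heads (λ u → (cS u == c) ∧ P u) P′ In h
            (λ u v e q → [ (λ p → inj₁ (∧⁺ (==⁺ (P-class u p)) p)) , (λ p → inj₂ (∧⁺ (∧⁺ e q) (not⁺ p))) ]′ (em (P u))) In≤ (<⇒≤ lt))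

        4h : 2 * (2 * h) ≡ 4 * h
        4h = sym (*-assoc 2 2 h)

        case₂ : 2 * # (λ u → (cS u == c) ∧ not (P u)) < d → ⊥
        case₂ lt = <⇒≱ (≤-trans (≤-reflexive (+-comm 1 (4 * h))) P-missing) (≤-trans (#-mono λ u p → ∧⁺ (∧₁ (∧₂ (∧₁ p))) (∧₂ p)) rest)
          where
          cases₁ : ∀ u v → T (E u v) → T ((cT v == c) ∧ not (P′ v)) → T ((cS u == c) ∧ not (P u)) ⊎ T (Out u v ∨ cross u v)
          cases₁ u v e q with em (P u) | em (cS u == cT v)
          ... | inj₁ p | _ = inj₂ (∨₁ (∧⁺ (∧⁺ p e) (∧₂ q)))
          ... | inj₂ p | inj₂ ne = inj₂ (∨₂ (∧⁺ e (not⁺ ne)))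
          ... | inj₂ p | inj₁ eq = inj₁ (∧⁺ (==⁺ (trans (==⁻ eq) (==⁻ (∧₁ q)))) (not⁺ p))
          cases₂ : ∀ u v → T (E u v) → T ((cS u == c) ∧ not (P u)) → T ((cT v == c) ∧ not (P′ v)) ⊎ T (In u v ∨ cross u v)
          cases₂ u v e q with em (P′ v) | em (cS u == cT v)
          ... | inj₁ p | _ = inj₂ (∨₁ (∧⁺ (∧⁺ e p) (∧₂ q)))
          ... | inj₂ p | inj₂ ne = inj₂ (∨₂ (∧⁺ e (not⁺ ne)))
          ... | inj₂ p | inj₁ eq = inj₁ (∧⁺ (==⁺ (trans (sym (==⁻ eq)) (==⁻ (∧₁ q)))) (not⁺ p))
          heads : # (λ v → (cT v == c) ∧ not (P′ v)) ≤ 4 * h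
          heads = ≤-trans (few-heads _ _ (λ u v → Out u v ∨ cross u v) (2 * h) cases₁ (with-cross Out Out≤) (<⇒≤ lt)) (≤-reflexive 4h)
          8≤200 : 8 ≤ 200
          8≤200 = m≤m+n 8 192
          rest : # (λ u → (cS u == c) ∧ not (P u)) ≤ 4 * h
          rest = ≤-trans (few-tails R d>0 _ _ (λ u v → In u v ∨ cross u v) (2 * h) cases₂ (with-cross In In≤)
            (≤-trans (*-monoʳ-≤ 2 heads) (≤-trans (≤-reflexive (sym (*-assoc 2 4 h))) (ch≤d 8 8≤200)))) (≤-reflexive 4h)

        absurd : ⊥
        absurd = [ case₁ , case₂ ]′ (robust c P P′ cut-few)

      expander : ∀ w → T (good c w) → Expander E π Y w g (4 * h + 1) (20 * V)
      expander w gw = record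
        { factor = edge ; g>0 = g>0 ; b>0 = ≤-trans (s≤s z≤n) (≤-reflexive (+-comm 1 (4 * h))) ; γ>0 = *-mono-≤ {1} {20} (s≤s z≤n) V>0
        ; small = ≤-trans (*-monoʳ-≤ 2 (*-monoʳ-≤ (20 * V) (≤-trans (+-monoʳ-≤ (4 * h) h>0) (≤-reflexive (e₁ h))))) (≤-trans (≤-reflexive (e₂ V h)) (≤-trans 200Vh≤d d≤n))
        ; expand = λ P P⊆Y dense miss → ≮⇒≥ λ lt → Expansion.absurd P P⊆Y dense miss lt
        ; out-Y = λ u p → ≤-trans (out-core u (labelS u p)) (*-monoˡ-≤ _ (*-monoˡ-≤ V (m≤m+n 10 10)))
        ; in-Y = λ u p → ≤-trans (in-core u (labelT u p)) (*-monoˡ-≤ _ (*-monoˡ-≤ V (m≤m+n 10 10))) }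
        where
        e₁ : ∀ h → 4 * h + h ≡ 5 * h
        e₁ = solve-∀
        e₂ : ∀ V h → 2 * (20 * V * (5 * h)) ≡ 200 * (V * h)
        e₂ = solve-∀
        labelS : ∀ u → T (Y u) ⊎ u ≡ w → T (LS u c)
        labelS u (inj₁ p) = ∧₁ (∧₂ (∧₁ p))
        labelS u (inj₂ refl) = ∧₁ (∧₂ gw)
        labelT : ∀ u → T (Y u) ⊎ u ≡ w → T (LT (to π u) c)
        labelT u (inj₁ p) = ∧₂ (∧₂ (∧₁ p))
        labelT u (inj₂ refl) = ∧₂ (∧₂ gw)

      core-dense : ∀ w → T (good c w) → n ≤ 10 * V * # Y
      core-dense w gw = ≤-trans (out-core w (∧₁ (∧₂ gw))) (*-monoʳ-≤ (10 * V) (#-mono λ y → ∧₁))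
  record Enlarged (π : Perm n) : Set where
    field
      σ : Perm n
      factor : Factor La forced σ
      keeps : ∀ u → T (forced u) → to σ u ≡ to π u
      inc : π ⊑ σ
      x₀ y₀ : Fin n
      new : Cyc σ x₀ y₀
      old : ¬ Cyc π x₀ y₀

  module _ (π : Perm n) (Fa : Factor La forced π) (c : Fin k) where
    open Factor Fa
    open Misfits π Fa

    enlarge-at : ∀ w → T (good c w) → # (core c) ≤ 2 * # (λ y → core c y ∧ not (cyc π w y)) → Enlarged π
    enlarge-at w gw half = build (Absorb.absorb (expander c w gw) B (λ y → ∧₁) B-dense n-large)
      where
      B : Fin n → Bool
      B y = core c y ∧ not (cyc π w y)
      B-dense : n ≤ 20 * V * # B
      B-dense = ≤-trans (core-dense c w gw) (≤-trans (*-monoʳ-≤ (10 * V) half) (≤-reflexive (e V (# B))))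
        where
        e : ∀ V s → 10 * V * (2 * s) ≡ 20 * V * s
        e = solve-∀
      build : Absorbed E π (core c) B w → Enlarged π
      build Ab = record
        { σ = σ ; factor = record { edge = edges ; compatible = λ u fu → compat′ u fu (local u) }
        ; keeps = λ u fu → keep u fu (local u) ; inc = inc ; x₀ = w ; y₀ = y ; new = joined ; old = λ p → not⁻ (∧₂ y∈B) (cyc⁺ π p) }
        where
        open Absorbed Ab
        inside : ∀ {u} → u ≡ w ⊎ T (core c u) → T (good c u)
        inside (inj₁ refl) = gw
        inside (inj₂ p) = ∧₁ p
        compat′ : ∀ u → ¬ T (forced u) → (to σ u ≡ to π u ⊎ (u ≡ w ⊎ T (core c u)) × ∃ λ z → (z ≡ w ⊎ T (core c z)) × to σ u ≡ to π z) → T (compat u (to σ u))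
        compat′ u fu (inj₁ e) = subst (λ v → T (compat u v)) (sym e) (compatible u fu)
        compat′ u fu (inj₂ (iu , z , iz , e)) = subst (λ v → T (compat u v)) (sym e) (compat⁺ c (∧₁ (∧₂ (inside iu))) (∧₂ (∧₂ (inside iz))))
        keep : ∀ u → T (forced u) → (to σ u ≡ to π u ⊎ (u ≡ w ⊎ T (core c u)) × ∃ λ z → (z ≡ w ⊎ T (core c z)) × to σ u ≡ to π z) → to σ u ≡ to π u
        keep u fu (inj₁ e) = e
        keep u fu (inj₂ (iu , _)) = ⊥-elim (not⁻ (∧₁ (inside iu)) fu)

    -- Every core vertex lies off the cycle of `u` or off that of `v`, so one of the two cycles
    -- misses at least half of the core; its vertex takes the role of `w`.
    enlarge : ∀ u v → T (good c u) → T (good c v) → ¬ Cyc π u v → Enlarged π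
    enlarge u v gu gv ¬uv = [ (λ le → enlarge-at v gv (≤-trans halves (twice le))) , (λ le → enlarge-at u gu (≤-trans halves (twice′ le))) ]′
        (≤-total (# (λ y → core c y ∧ not (cyc π u y))) (# (λ y → core c y ∧ not (cyc π v y))))
      where
      halves : # (core c) ≤ # (λ y → core c y ∧ not (cyc π u y)) + # (λ y → core c y ∧ not (cyc π v y))
      halves = #-∪ λ y p → [ (λ uy → inj₂ (∧⁺ p (not⁺ λ vy → ¬uv (Cyc-trans π (cyc⁻ π uy) (Cyc-sym π (cyc⁻ π vy)))))) , (λ ¬uy → inj₁ (∧⁺ p (not⁺ ¬uy))) ]′ (em (cyc π u y))
      twice : ∀ {s t} → s ≤ t → s + t ≤ 2 * t
      twice {s} {t} le = ≤-trans (+-monoˡ-≤ t le) (≤-reflexive (cong (t +_) (sym (+-identityʳ t))))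
      twice′ : ∀ {s t} → t ≤ s → s + t ≤ 2 * s
      twice′ {s} {t} le = ≤-trans (+-monoʳ-≤ s le) (≤-reflexive (cong (s +_) (sym (+-identityʳ s))))

  record Saturated (π : Perm n) : Set where
    field
      σ : Perm n
      factor : Factor La forced σ
      keeps : ∀ u → T (forced u) → to σ u ≡ to π u
      one-cycle : ∀ c u v → T (Factor.good factor c u) → T (Factor.good factor c v) → Cyc σ u v

  -- The number of pairs on a common cycle grows with every enlargement and never exceeds n², which
  -- bounds the number of rounds.
  saturate : (π : Perm n) → Factor La forced π → Saturated π
  saturate π Fa = go (n * n) π Fa (m≤m+n (n * n) _)
    where
    Φ : Perm n → ℕ
    Φ π = #₂ (cyc π)
    Φ≤ : ∀ π → Φ π ≤ n * n
    Φ≤ π = ∑-bound _ n λ u → #≤n (cyc π u)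
    go : ∀ fuel π → Factor La forced π → n * n ≤ fuel + Φ π → Saturated π
    step : ∀ fuel π → n * n ≤ fuel + Φ π → Enlarged π → Saturated π
    go fuel π Fa le = decide (any? λ c → any? λ u → any? λ v → (T? (Factor.good Fa c u) ×-dec T? (Factor.good Fa c v)) ×-dec ¬? (Cyc? π u v))
      where
      decide : Dec (∃ λ c → ∃ λ u → ∃ λ v → (T (Factor.good Fa c u) × T (Factor.good Fa c v)) × ¬ Cyc π u v) → Saturated π
      decide (yes (c , u , v , (gu , gv) , ¬uv)) = step fuel π le (enlarge π Fa c u v gu gv ¬uv)
      decide (no none) = record { σ = π ; factor = Fa ; keeps = λ _ _ → refl ; one-cycle = λ c u v gu gv → stable c u v gu gv }
        where
        stable : ∀ c u v → T (Factor.good Fa c u) → T (Factor.good Fa c v) → Cyc π u v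
        stable c u v gu gv with Cyc? π u v
        ... | yes p = p
        ... | no ¬p = ⊥-elim (none (c , u , v , (gu , gv) , ¬p))
    step fuel π le En = next fuel le
      where
      open Enlarged En
      more : Φ π < Φ σ
      more = #₂-strict (cyc π) (cyc σ) (λ u v p → cyc⁺ σ (inc u v (cyc⁻ π p))) x₀ y₀ (cyc⁺ σ new) (λ p → old (cyc⁻ π p))
      next : ∀ fuel → n * n ≤ fuel + Φ π → Saturated π
      next zero le = ⊥-elim (<⇒≱ more (≤-trans (Φ≤ σ) le))
      next (suc fuel) le = record { σ = Saturated.σ S ; factor = Saturated.factor S ; keeps = λ u fu → trans (Saturated.keeps S u fu) (keeps u fu) ; one-cycle = Saturated.one-cycle S }
        where
        S = go fuel σ factor (≤-trans le (≤-trans (≤-reflexive (sym (+-suc fuel (Φ π)))) (+-monoʳ-≤ fuel more)))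

-- Choosing the edges between classes

module Initial {n} {E : Digraph n} {d k x h} (R : RegularGraph E d) (Fr : Frame E d k x h) (V a : ℕ)
  (d>0 : 0 < d) (V-large : 36 * 2 ^ k < V) (k<V : k < V) (2Vx≤d : 2 * (V * x) ≤ d) (2x≤a : 2 * x ≤ a) where
  open RegularGraph R
  open Frame Fr
  open Sparse R d>0

  to-class from-class : Fin n → Fin k → ℕ
  to-class u i = # λ v → E u v ∧ (cT v == i)
  from-class v i = # λ u → E u v ∧ (cS u == i)

  LS LT : Fin n → Fin k → Bool
  LS u i = d ≤ᵇ′ V * to-class u i
  LT v i = d ≤ᵇ′ V * from-class v i

  V≥2 : 2 ≤ V
  V≥2 = ≤-trans (s≤s (≤-trans (s≤s z≤n) (m≤m*n 36 (2 ^ k) {{m^n≢0 2 k}}))) V-large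

  -- A vertex without the label of its own class has at most d / 2 edges into that class, hence at
  -- least d / 2 cross edges.
  typical-S : # (λ u → not (LS u (cS u))) ≤ 2 * x
  typical-S = *-cancelʳ-≤ _ (2 * x) d {{>-nonZero d>0}} (begin
    # (λ u → not (LS u (cS u))) * d ≤⟨ markov _ (λ u → 2 * # (cross u)) d thin ⟩
    ∑ (λ u → 2 * # (cross u)) ≡⟨ ∑-*ˡ 2 _ ⟩
    2 * #₂ cross ≤⟨ *-monoʳ-≤ 2 cross-few ⟩
    2 * (x * d) ≡⟨ sym (*-assoc 2 x d) ⟩
    2 * x * d ∎)
    where
    open ≤-Reasoning
    thin : ∀ u → T (not (LS u (cS u))) → d ≤ 2 * # (cross u)
    thin u p = +-cancelˡ-≤ d _ _ (begin
      d + d ≡⟨ cong₂ _+_ (sym (out-deg u)) (sym (out-deg u)) ⟩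
      # (E u) + # (E u) ≤⟨ +-mono-≤ split split ⟩
      (to-class u (cS u) + # (cross u)) + (to-class u (cS u) + # (cross u)) ≡⟨ e (to-class u (cS u)) (# (cross u)) ⟩
      2 * to-class u (cS u) + 2 * # (cross u) ≤⟨ +-monoˡ-≤ _ (≤-trans (*-monoˡ-≤ _ V≥2) (<⇒≤ (≰⇒> λ l → not⁻ p (≤ᵇ⁺ l)))) ⟩
      d + 2 * # (cross u) ∎)
      where
      e : ∀ s t → (s + t) + (s + t) ≡ 2 * s + 2 * t
      e = solve-∀
      split : # (E u) ≤ to-class u (cS u) + # (cross u)
      split = #-∪ λ v q → [ (λ s → inj₁ (∧⁺ q (==⁺ (sym (==⁻ s))))) , (λ s → inj₂ (∧⁺ q (not⁺ s))) ]′ (em (cS u == cT v))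

  typical-T : # (λ v → not (LT v (cT v))) ≤ 2 * x
  typical-T = *-cancelʳ-≤ _ (2 * x) d {{>-nonZero d>0}} (begin
    # (λ v → not (LT v (cT v))) * d ≤⟨ markov _ (λ v → 2 * # (λ u → cross u v)) d thin ⟩
    ∑ (λ v → 2 * # (λ u → cross u v)) ≡⟨ ∑-*ˡ 2 _ ⟩
    2 * ∑ (λ v → # (λ u → cross u v)) ≡⟨ cong (2 *_) (sym (#₂-swap cross)) ⟩
    2 * #₂ cross ≤⟨ *-monoʳ-≤ 2 cross-few ⟩
    2 * (x * d) ≡⟨ sym (*-assoc 2 x d) ⟩
    2 * x * d ∎)
    where
    open ≤-Reasoning
    thin : ∀ v → T (not (LT v (cT v))) → d ≤ 2 * # (λ u → cross u v)
    thin v p = +-cancelˡ-≤ d _ _ (begin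
      d + d ≡⟨ cong₂ _+_ (sym (in-deg v)) (sym (in-deg v)) ⟩
      # (λ u → E u v) + # (λ u → E u v) ≤⟨ +-mono-≤ split split ⟩
      (from-class v (cT v) + # (λ u → cross u v)) + (from-class v (cT v) + # (λ u → cross u v)) ≡⟨ e (from-class v (cT v)) (# (λ u → cross u v)) ⟩
      2 * from-class v (cT v) + 2 * # (λ u → cross u v) ≤⟨ +-monoˡ-≤ _ (≤-trans (*-monoˡ-≤ _ V≥2) (<⇒≤ (≰⇒> λ l → not⁻ p (≤ᵇ⁺ l)))) ⟩
      d + 2 * # (λ u → cross u v) ∎)
      where
      e : ∀ s t → (s + t) + (s + t) ≡ 2 * s + 2 * t
      e = solve-∀
      split : # (λ u → E u v) ≤ from-class v (cT v) + # (λ u → cross u v)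
      split = #-∪ λ u q → [ (λ s → inj₁ (∧⁺ q s)) , (λ s → inj₂ (∧⁺ q (not⁺ s))) ]′ (em (cS u == cT v))

  labelling : Labelling Fr V a
  labelling = record
    { LS = LS ; LT = LT ; thick-S = λ u i → ≤ᵇ⁻ ; thick-T = λ v i → ≤ᵇ⁻
    ; typical-S = ≤-trans typical-S 2x≤a ; typical-T = ≤-trans typical-T 2x≤a }

  open Labelling labelling using (compat; compat⁺; compat⁻)

  partition-sum : ∀ (P : Fin n → Bool) (c : Fin n → Fin k) → ∑ (λ i → # (λ v → P v ∧ (c v == i))) ≡ # P
  partition-sum P c = trans (∑-swap (λ i v → ⟦ P v ∧ (c v == i) ⟧)) (∑-cong λ v → trans (∑-cong λ i → ⟦⟧-∧ (P v) (c v == i))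
    (trans (∑-*ˡ ⟦ P v ⟧ (λ i → ⟦ c v == i ⟧)) (trans (cong (⟦ P v ⟧ *_) (#-single (c v))) (*-identityʳ _))))

  -- Fewer than `V` classes share the d edges, so one of them receives at least d / V.
  some-label : ∀ (P : Fin n → Bool) (c : Fin n → Fin k) → # P ≡ d → ∃ λ i → d ≤ V * # (λ v → P v ∧ (c v == i))
  some-label P c deg = decide (any? λ i → d ≤? V * # (λ v → P v ∧ (c v == i)))
    where
    open ≤-Reasoning
    decide : Dec (∃ λ i → d ≤ V * # (λ v → P v ∧ (c v == i))) → ∃ λ i → d ≤ V * # (λ v → P v ∧ (c v == i))
    decide (yes p) = p
    decide (no none) = ⊥-elim (<⇒≱ k<V (*-cancelʳ-≤ V k d {{>-nonZero d>0}} (begin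
      V * d ≡⟨ cong (V *_) (sym (trans (partition-sum P c) deg)) ⟩
      V * ∑ (λ i → # (λ v → P v ∧ (c v == i))) ≡⟨ sym (∑-*ˡ V _) ⟩
      ∑ (λ i → V * # (λ v → P v ∧ (c v == i))) ≤⟨ ∑-bound _ d (λ i → <⇒≤ (≰⇒> λ l → none (i , l))) ⟩
      k * d ∎)))

  some-S : ∀ u → ∃ λ i → T (LS u i)
  some-S u = let i , l = some-label (E u) cT (out-deg u) in i , ≤ᵇ⁺ l

  some-T : ∀ v → ∃ λ i → T (LT v i)
  some-T v = let i , l = some-label (λ u → E u v) cS (in-deg v) in i , ≤ᵇ⁺ l

  -- The edges that a matching within labels cannot use; only they can compensate for an imbalance
  -- between classes.
  K : Fin n → Fin n → Bool
  K u v = E u v ∧ not (compat u v)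

  spread-bound : ∀ (P : Fin n → Bool) (c : Fin n → Fin k) (L : Fin k → Bool) → (∀ i → ¬ T (L i) → V * # (λ v → P v ∧ (c v == i)) ≤ d) →
    V * # (λ v → P v ∧ not (L (c v))) ≤ k * d
  spread-bound P c L thin = begin
    V * # (λ v → P v ∧ not (L (c v))) ≡⟨ cong (V *_) (sym (partition-sum (λ v → P v ∧ not (L (c v))) c)) ⟩
    V * ∑ (λ i → # (λ v → (P v ∧ not (L (c v))) ∧ (c v == i))) ≡⟨ sym (∑-*ˡ V _) ⟩
    ∑ (λ i → V * # (λ v → (P v ∧ not (L (c v))) ∧ (c v == i))) ≤⟨ ∑-bound _ d each ⟩
    k * d ∎
    where
    open ≤-Reasoning
    each : ∀ i → V * # (λ v → (P v ∧ not (L (c v))) ∧ (c v == i)) ≤ d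
    each i with em (L i)
    ... | inj₂ ¬l = ≤-trans (*-monoʳ-≤ V (#-mono λ v p → ∧⁺ (∧₁ (∧₁ p)) (∧₂ p))) (thin i ¬l)
    ... | inj₁ l = ≤-trans (≤-reflexive (trans (cong (V *_) (#-none λ v p → not⁻ (∧₂ (∧₁ p)) (subst (λ j → T (L j)) (sym (==⁻ (∧₂ p))) l))) (*-zeroʳ V))) z≤n

  -- An incompatible edge at a vertex goes to a class that is not among its labels, at most d / V
  -- edges for each of the k classes, or to one of at most `2 * x` untypical vertices. Such degrees
  -- are a small fraction of d, which is what makes a greedy choice of disjoint edges possible.
  K-degree : ∀ s → V * s ≤ k * d → ∀ t → t ≤ s + 2 * x → V * t ≤ suc k * d
  K-degree s le t ts = begin
    V * t ≤⟨ *-monoʳ-≤ V ts ⟩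
    V * (s + 2 * x) ≡⟨ e V s x ⟩
    V * s + 2 * (V * x) ≤⟨ +-mono-≤ le 2Vx≤d ⟩
    k * d + d ≡⟨ +-comm (k * d) d ⟩
    suc k * d ∎
    where
    open ≤-Reasoning
    e : ∀ V s x → V * (s + 2 * x) ≡ V * s + 2 * (V * x)
    e = solve-∀

  K-out : ∀ u → V * # (K u) ≤ suc k * d
  K-out u = K-degree _ (spread-bound (E u) cT (LS u) λ i ¬l → <⇒≤ (≰⇒> λ l → ¬l (≤ᵇ⁺ l))) _
    (≤-trans (#-∪ {Q = λ v → E u v ∧ not (LS u (cT v))} {R = λ v → not (LT v (cT v))} cases) (+-monoʳ-≤ _ typical-T))
    where
    cases : ∀ v → T (K u v) → T (E u v ∧ not (LS u (cT v))) ⊎ T (not (LT v (cT v)))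
    cases v p with em (LS u (cT v))
    ... | inj₂ ¬l = inj₁ (∧⁺ (∧₁ p) (not⁺ ¬l))
    ... | inj₁ l = inj₂ (not⁺ λ l′ → not⁻ (∧₂ p) (compat⁺ (cT v) l l′))

  K-in : ∀ v → V * # (λ u → K u v) ≤ suc k * d
  K-in v = K-degree _ (spread-bound (λ u → E u v) cS (LT v) λ i ¬l → <⇒≤ (≰⇒> λ l → ¬l (≤ᵇ⁺ l))) _
    (≤-trans (#-∪ {Q = λ u → E u v ∧ not (LT v (cS u))} {R = λ u → not (LS u (cS u))} cases) (+-monoʳ-≤ _ typical-S))
    where
    cases : ∀ u → T (K u v) → T (E u v ∧ not (LT v (cS u))) ⊎ T (not (LS u (cS u)))
    cases u p with em (LT v (cS u))
    ... | inj₂ ¬l = inj₁ (∧⁺ (∧₁ p) (not⁺ ¬l))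
    ... | inj₁ l = inj₂ (not⁺ λ l′ → not⁻ (∧₂ p) (compat⁺ (cS u) l′ l))

  K-few : #₂ K ≤ (5 * x) * d
  K-few = begin
    #₂ K ≤⟨ #₂-∪ {Q = cross} {R = λ u v → (not (LS u (cS u)) ∧ E u v) ∨ (E u v ∧ not (LT v (cT v)))} cases ⟩
    #₂ cross + #₂ (λ u v → (not (LS u (cS u)) ∧ E u v) ∨ (E u v ∧ not (LT v (cT v))))
      ≤⟨ +-mono-≤ cross-few (#₂-∪ {Q = λ u v → not (LS u (cS u)) ∧ E u v} {R = λ u v → E u v ∧ not (LT v (cT v))} (λ u v → ∨⁻)) ⟩
    x * d + (#₂ (λ u v → not (LS u (cS u)) ∧ E u v) + #₂ (λ u v → E u v ∧ not (LT v (cT v))))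
      ≡⟨ cong (x * d +_) (cong₂ _+_ (out-edges (λ u → not (LS u (cS u)))) (in-edges (λ v → not (LT v (cT v))))) ⟩
    x * d + (# (λ u → not (LS u (cS u))) * d + # (λ v → not (LT v (cT v))) * d)
      ≤⟨ +-monoʳ-≤ (x * d) (+-mono-≤ (*-monoˡ-≤ d typical-S) (*-monoˡ-≤ d typical-T)) ⟩
    x * d + (2 * x * d + 2 * x * d) ≡⟨ e x d ⟩
    5 * x * d ∎
    where
    open ≤-Reasoning
    e : ∀ x d → x * d + (2 * x * d + 2 * x * d) ≡ 5 * x * d
    e = solve-∀
    cases : ∀ u v → T (K u v) → T (cross u v) ⊎ T ((not (LS u (cS u)) ∧ E u v) ∨ (E u v ∧ not (LT v (cT v))))
    cases u v p with em (cS u == cT v) | em (LS u (cS u)) | em (LT v (cT v))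
    ... | inj₂ ne | _ | _ = inj₁ (∧⁺ (∧₁ p) (not⁺ ne))
    ... | inj₁ _ | inj₂ l | _ = inj₂ (∨₁ (∧⁺ (not⁺ l) (∧₁ p)))
    ... | inj₁ _ | inj₁ _ | inj₂ l = inj₂ (∨₂ (∧⁺ (∧₁ p) (not⁺ l)))
    ... | inj₁ eq | inj₁ l | inj₁ l′ = ⊥-elim (not⁻ (∧₂ p) (compat⁺ (cS u) l (subst (λ i → T (LT v i)) (sym (==⁻ eq)) l′)))

  -- For a set I of classes: out-vertices with all labels in I, and in-vertices with some label in I.
  inside touching : (Fin k → Bool) → Fin n → Bool
  inside I u = all λ i → not (LS u i) ∨ I i
  touching I v = any λ i → LT v i ∧ I i

  inside⁺ : ∀ I u → (∀ i → T (LS u i) → T (I i)) → T (inside I u)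
  inside⁺ I u f = all⁺ _ λ i → [ (λ l → ∨₂ (f i l)) , (λ l → ∨₁ (not⁺ l)) ]′ (em (LS u i))

  inside⁻ : ∀ I u → T (inside I u) → ∀ i → T (LS u i) → T (I i)
  inside⁻ I u p i l = [ (λ ¬l → ⊥-elim (not⁻ ¬l l)) , id ]′ (∨⁻ (all⁻ _ p i))

  touching⁺ : ∀ I v i → T (LT v i) → T (I i) → T (touching I v)
  touching⁺ I v i l p = any⁺ _ i (∧⁺ l p)

  touching⁻ : ∀ I v → T (touching I v) → ∃ λ i → T (LT v i) × T (I i)
  touching⁻ I v p = let i , q = any⁻ _ p in i , ∧₁ q , ∧₂ q

  -- Vertices in `touching I` absorb only d edges each, and every edge from `inside I` to a vertex
  -- not touching `I` is incompatible.
  leaving-edges : ∀ I → # (inside I) * d ≤ # (touching I) * d + #₂ (λ u v → K u v ∧ (inside I u ∧ not (touching I v)))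
  leaving-edges I = begin
    # (inside I) * d ≡⟨ sym (out-edges (inside I)) ⟩
    #₂ (λ u v → inside I u ∧ E u v) ≤⟨ #₂-∪ {Q = λ u v → E u v ∧ touching I v} {R = λ u v → K u v ∧ (inside I u ∧ not (touching I v))} cases ⟩
    #₂ (λ u v → E u v ∧ touching I v) + #₂ (λ u v → K u v ∧ (inside I u ∧ not (touching I v))) ≡⟨ cong (_+ #₂ (λ u v → K u v ∧ (inside I u ∧ not (touching I v)))) (in-edges (touching I)) ⟩
    # (touching I) * d + #₂ (λ u v → K u v ∧ (inside I u ∧ not (touching I v))) ∎
    where
    open ≤-Reasoning
    cases : ∀ u v → T (inside I u ∧ E u v) → T (E u v ∧ touching I v) ⊎ T (K u v ∧ (inside I u ∧ not (touching I v)))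
    cases u v p with em (touching I v)
    ... | inj₁ t = inj₁ (∧⁺ (∧₂ p) t)
    ... | inj₂ ¬t = inj₂ (∧⁺ (∧⁺ (∧₂ p) (not⁺ λ c → let i , l , l′ = compat⁻ c in ¬t (touching⁺ I v i l′ (inside⁻ I u (∧₁ p) i l)))) (∧⁺ (∧₁ p) (not⁺ ¬t)))

  -- The excess provides (r + 1) d incompatible edges leaving `I`. At most 2 * 2^k (r + 1) vertices
  -- are in use, each with at most 9d / V such edges in either direction; together they block fewer
  -- than (r + 1) d edges once `V` exceeds 36 * 2^k.
  free-edge : ∀ I r c (U : Fin n → Bool) → # U ≤ 2 * c → c ≤ 2 ^ k * suc r → # (touching I) + suc r ≤ # (inside I) → k ≤ 8 →
    ∃₂ λ u v → T (K u v) × T (inside I u) × ¬ T (touching I v) × ¬ T (U u) × ¬ T (U v)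
  free-edge I r c U Uc cr gap k≤8 = found (#₂-∃ free (n≢0⇒n>0 λ z → <⇒≱ total (≤-trans (≤-reflexive (trans (cong (λ y → V * (y + T₂)) z) refl)) touched)))
    where
    open ≤-Reasoning
    KI free : Fin n → Fin n → Bool
    KI u v = K u v ∧ (inside I u ∧ not (touching I v))
    free u v = KI u v ∧ (not (U u) ∧ not (U v))
    T₂ : ℕ
    T₂ = #₂ (λ u v → U u ∧ K u v) + #₂ (λ v u → U v ∧ K u v)
    found : (∃₂ λ u v → T (free u v)) → _
    found (u , v , p) = u , v , ∧₁ (∧₁ p) , ∧₁ (∧₂ (∧₁ p)) , not⁻ (∧₂ (∧₂ (∧₁ p))) , not⁻ (∧₁ (∧₂ p)) , not⁻ (∧₂ (∧₂ p))
    many : suc r * d ≤ #₂ KI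
    many = +-cancelˡ-≤ (# (touching I) * d) _ _ (begin
      # (touching I) * d + suc r * d ≡⟨ sym (*-distribʳ-+ d (# (touching I)) (suc r)) ⟩
      (# (touching I) + suc r) * d ≤⟨ *-monoˡ-≤ d gap ⟩
      # (inside I) * d ≤⟨ leaving-edges I ⟩
      # (touching I) * d + #₂ KI ∎)
    split : #₂ KI ≤ #₂ free + T₂
    split = ≤-trans (#₂-∪ {Q = free} {R = λ u v → (U u ∧ K u v) ∨ (U v ∧ K u v)} cases)
      (+-monoʳ-≤ (#₂ free) (≤-trans (#₂-∪ {Q = λ u v → U u ∧ K u v} {R = λ u v → U v ∧ K u v} λ u v → ∨⁻) (+-monoʳ-≤ _ (≤-reflexive (#₂-swap (λ u v → U v ∧ K u v))))))
      where
      cases : ∀ u v → T (KI u v) → T (free u v) ⊎ T ((U u ∧ K u v) ∨ (U v ∧ K u v))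
      cases u v p with em (U u) | em (U v)
      ... | inj₁ q | _ = inj₂ (∨₁ (∧⁺ q (∧₁ p)))
      ... | inj₂ _ | inj₁ q = inj₂ (∨₂ (∧⁺ q (∧₁ p)))
      ... | inj₂ q | inj₂ q′ = inj₁ (∧⁺ p (∧⁺ (not⁺ q) (not⁺ q′)))
    weighted : ∀ (W : Fin n → Fin n → Bool) → (∀ u → V * # (W u) ≤ suc k * d) → V * #₂ (λ u v → U u ∧ W u v) ≤ # U * (suc k * d)
    weighted W deg = ≤-trans (≤-reflexive (sym (∑-*ˡ V _))) (≤-trans (∑-mono λ u → row u) (≤-reflexive (∑-*ʳ (suc k * d) (λ u → ⟦ U u ⟧))))
      where
      row : ∀ u → V * # (λ v → U u ∧ W u v) ≤ ⟦ U u ⟧ * (suc k * d)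
      row u with em (U u)
      ... | inj₁ q = ≤-trans (*-monoʳ-≤ V (#-mono λ v → ∧₂)) (≤-trans (deg u) (≤-reflexive (trans (sym (+-identityʳ _)) (cong (_* (suc k * d)) (sym (⟦⟧-T q))))))
      ... | inj₂ q = ≤-trans (≤-reflexive (trans (cong (V *_) (#-none λ v p → q (∧₁ p))) (*-zeroʳ V))) z≤n
    touched : V * T₂ ≤ 36 * 2 ^ k * (suc r * d)
    touched = begin
      V * T₂ ≡⟨ *-distribˡ-+ V _ _ ⟩
      V * #₂ (λ u v → U u ∧ K u v) + V * #₂ (λ v u → U v ∧ K u v) ≤⟨ +-mono-≤ (weighted K K-out) (weighted (λ v u → K u v) K-in) ⟩
      # U * (suc k * d) + # U * (suc k * d) ≡⟨ e₁ (# U) (suc k * d) ⟩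
      2 * # U * (suc k * d) ≤⟨ *-mono-≤ (*-monoʳ-≤ 2 (≤-trans Uc (*-monoʳ-≤ 2 cr))) (*-monoˡ-≤ d (s≤s k≤8)) ⟩
      2 * (2 * (2 ^ k * suc r)) * (9 * d) ≡⟨ e₂ (2 ^ k) (suc r) d ⟩
      36 * 2 ^ k * (suc r * d) ∎
      where
      e₁ : ∀ u y → u * y + u * y ≡ 2 * u * y
      e₁ = solve-∀
      e₂ : ∀ p r d → 2 * (2 * (p * r)) * (9 * d) ≡ 36 * p * (r * d)
      e₂ = solve-∀
    total : 36 * 2 ^ k * (suc r * d) < V * (#₂ free + T₂)
    total = ≤-trans (*-monoˡ-< (suc r * d) {{>-nonZero (*-mono-≤ {1} {suc r} (s≤s z≤n) d>0)}} V-large) (*-monoʳ-≤ V (≤-trans many split))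

  -- Vertex-disjoint edges u → ι u of K, one for each tail u; c bounds their number.
  record Selection (c : ℕ) : Set where
    field
      ι : Perm n
      tail used : Fin n → Bool
      used-few : # used ≤ 2 * c
      tail-few : # tail ≤ c
      tail-used : ∀ u → T (tail u) → T (used u)
      head-used : ∀ u → T (tail u) → T (used (to ι u))
      edge : ∀ u → T (tail u) → T (K u (to ι u))
      apart : ∀ u → T (tail u) → ¬ T (tail (to ι u))
    leaving-tail : (Fin k → Bool) → Fin n → Bool
    leaving-tail I u = tail u ∧ (inside I u ∧ not (touching I (to ι u)))
    Served : (Fin k → Bool) → ℕ → Set
    Served I r = # (inside I) ≤ # (touching I) + # (leaving-tail I) ⊎ r ≤ # (leaving-tail I)
  open Selection

  infix 4 _⊴_
  _⊴_ : ∀ {c c′} → Selection c → Selection c′ → Set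
  s ⊴ s′ = ∀ u → T (tail s u) → T (tail s′ u) × to (ι s′) u ≡ to (ι s) u

  leaving-mono : ∀ {c c′} (s : Selection c) (s′ : Selection c′) → s ⊴ s′ → ∀ I u → T (leaving-tail s I u) → T (leaving-tail s′ I u)
  leaving-mono s s′ le I u p = ∧⁺ (proj₁ (le u (∧₁ p))) (∧⁺ (∧₁ (∧₂ p)) (subst (λ v → T (not (touching I v))) (sym (proj₂ (le u (∧₁ p)))) (∧₂ (∧₂ p))))

  served-mono : ∀ {c c′} (s : Selection c) (s′ : Selection c′) → s ⊴ s′ → ∀ I r → Served s I r → Served s′ I r
  served-mono s s′ le I r (inj₁ p) = inj₁ (≤-trans p (+-monoʳ-≤ (# (touching I)) (#-mono (leaving-mono s s′ le I))))
  served-mono s s′ le I r (inj₂ p) = inj₂ (≤-trans p (#-mono (leaving-mono s s′ le I)))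

  module Extend {c} (s : Selection c) (p q : Fin n) (pq : T (K p q)) (p-new : ¬ T (used s p)) (q-new : ¬ T (used s q)) (p≢q : p ≢ q) where
    ι′ : Perm n
    ι′ = swap p (from (ι s) q) (ι s)
    ι′-p : to ι′ p ≡ q
    ι′-p = trans (cong (to (ι s)) (transpose-l p (from (ι s) q))) (to-from (ι s) q)
    ι′-old : ∀ u → T (tail s u) → to ι′ u ≡ to (ι s) u
    ι′-old u t = cong (to (ι s)) (transpose-o (λ e → p-new (subst (λ z → T (used s z)) e (tail-used s u t)))
      (λ e → q-new (subst (λ z → T (used s z)) (trans (cong (to (ι s)) e) (to-from (ι s) q)) (head-used s u t))))
    tail′ used′ : Fin n → Bool
    tail′ u = (p == u) ∨ tail s u
    used′ u = (p == u) ∨ ((q == u) ∨ used s u)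
    e₂ : ∀ c → 1 + (1 + 2 * c) ≡ 2 * suc c
    e₂ = solve-∀
    used-tail-s : ∀ u → T (used s u) → T (used′ u)
    used-tail-s u h = ∨₂ (∨₂ h)
    by-tail : ∀ (Z : Fin n → Set) → Z p → (∀ u → T (tail s u) → Z u) → ∀ u → T (tail′ u) → Z u
    by-tail Z zp zs u h = [ (λ e → subst Z (==⁻ e) zp) , zs u ]′ (∨⁻ h)
    extended : Selection (suc c)
    extended = record
      { ι = ι′ ; tail = tail′ ; used = used′
      ; used-few = ≤-trans (#-∪ {Q = p ==_} λ u → ∨⁻) (≤-trans (+-mono-≤ (≤-reflexive (#-single p)) (≤-trans (#-∪ {Q = q ==_} λ u → ∨⁻) (+-mono-≤ (≤-reflexive (#-single q)) (used-few s)))) (≤-reflexive (e₂ c)))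
      ; tail-few = ≤-trans (#-∪ {Q = p ==_} λ u → ∨⁻) (+-mono-≤ (≤-reflexive (#-single p)) (tail-few s))
      ; tail-used = by-tail (λ u → T (used′ u)) (∨₁ (==⁺ {x = p} refl)) (λ u t → used-tail-s u (tail-used s u t))
      ; head-used = by-tail (λ u → T (used′ (to ι′ u))) (∨₂ (∨₁ (==⁺ (sym ι′-p)))) (λ u t → subst (λ z → T (used′ z)) (sym (ι′-old u t)) (used-tail-s _ (head-used s u t)))
      ; edge = by-tail (λ u → T (K u (to ι′ u))) (subst (λ z → T (K p z)) (sym ι′-p) pq) (λ u t → subst (λ z → T (K u z)) (sym (ι′-old u t)) (edge s u t))
      ; apart = by-tail (λ u → ¬ T (tail′ (to ι′ u)))
          (λ h → [ (λ e → p≢q (trans (==⁻ e) ι′-p)) , (λ t → q-new (subst (λ z → T (used s z)) ι′-p (tail-used s _ t))) ]′ (∨⁻ h))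
          (λ u t h → [ (λ e → p-new (subst (λ z → T (used s z)) (trans (sym (ι′-old u t)) (sym (==⁻ e))) (head-used s u t))) , (λ t′ → apart s u t (subst (λ z → T (tail s z)) (ι′-old u t) t′)) ]′ (∨⁻ h)) }
    extended-⊵ : s ⊴ extended
    extended-⊵ u t = ∨₂ t , ι′-old u t

    more-leaving : ∀ I → T (inside I p) → ¬ T (touching I q) → suc (# (leaving-tail s I)) ≤ # (leaving-tail extended I)
    more-leaving I pi qt = begin
      suc (# (leaving-tail s I)) ≡⟨ +-comm 1 _ ⟩
      # (leaving-tail s I) + 1 ≤⟨ +-mono-≤ (#-mono λ u h → ∧⁺ (leaving-mono s extended extended-⊵ I u h) (not⁺ λ e → p-new (subst (λ z → T (used s z)) (sym (==⁻ e)) (tail-used s u (∧₁ h)))))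
           (≤-reflexive (sym (trans (#-cong (λ u h → ∧₂ h) (λ u e → ∧⁺ (subst (λ z → T (leaving-tail extended I z)) (==⁻ e) new) e)) (#-single p)))) ⟩
      # (λ u → leaving-tail extended I u ∧ not (p == u)) + # (λ u → leaving-tail extended I u ∧ (p == u)) ≡⟨ +-comm (# (λ u → leaving-tail extended I u ∧ not (p == u))) _ ⟩
      # (λ u → leaving-tail extended I u ∧ (p == u)) + # (λ u → leaving-tail extended I u ∧ not (p == u)) ≡⟨ sym (#-split (leaving-tail extended I) (p ==_)) ⟩
      # (leaving-tail extended I) ∎
      where
      open ≤-Reasoning
      new : T (leaving-tail extended I p)
      new = ∧⁺ (∨₁ (==⁺ {x = p} refl)) (∧⁺ pi (subst (λ z → T (not (touching I z))) (sym ι′-p) (not⁺ qt)))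

  subsets : ∀ k → List (Vec Bool k)
  subsets zero = [] ∷ []
  subsets (suc k) = map (true ∷_) (subsets k) ++ map (false ∷_) (subsets k)

  subsets-complete : ∀ {k} (v : Vec Bool k) → v ∈ subsets k
  subsets-complete [] = here refl
  subsets-complete (true ∷ v) = ∈-++⁺ˡ (∈-map⁺ (true ∷_) (subsets-complete v))
  subsets-complete {suc k} (false ∷ v) = ∈-++⁺ʳ (map (true ∷_) (subsets k)) (∈-map⁺ (false ∷_) (subsets-complete v))

  subsets-length : ∀ k → length (subsets k) ≡ 2 ^ k
  subsets-length zero = refl
  subsets-length (suc k) = trans (length-++ (map (true ∷_) (subsets k))) (cong₂ _+_ (trans (length-map _ (subsets k)) (subsets-length k))
    (trans (length-map _ (subsets k)) (trans (subsets-length k) (sym (+-identityʳ _)))))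

  module Loop (k≤8 : k ≤ 8) (no-loops : ∀ u → ¬ T (E u u)) where

    serve : ∀ r {c} (s : Selection c) I → suc c ≤ 2 ^ k * suc r → Served s I r → ∃₂ λ c′ (s′ : Selection c′) → c′ ≤ suc c × s ⊴ s′ × Served s′ I (suc r)
    serve r {c} s I cr (inj₁ p) = c , s , n≤1+n c , (λ u t → t , refl) , inj₁ p
    serve r {c} s I cr (inj₂ p) = decide (suc r ≤? # (leaving-tail s I)) (# (inside I) ≤? # (touching I) + # (leaving-tail s I))
      where
      decide : Dec (suc r ≤ # (leaving-tail s I)) → Dec (# (inside I) ≤ # (touching I) + # (leaving-tail s I)) → ∃₂ λ c′ (s′ : Selection c′) → c′ ≤ suc c × s ⊴ s′ × Served s′ I (suc r)
      decide (yes q) _ = c , s , n≤1+n c , (λ u t → t , refl) , inj₂ q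
      decide (no _) (yes q) = c , s , n≤1+n c , (λ u t → t , refl) , inj₁ q
      decide (no _) (no q) = add (free-edge I r c (used s) (used-few s) (≤-trans (n≤1+n c) cr)
          (≤-trans (≤-reflexive (+-suc (# (touching I)) r)) (≤-trans (s≤s (+-monoʳ-≤ (# (touching I)) p)) (≰⇒> q))) k≤8)
        where
        add : (∃₂ λ u v → T (K u v) × T (inside I u) × ¬ T (touching I v) × ¬ T (used s u) × ¬ T (used s v)) → ∃₂ λ c′ (s′ : Selection c′) → c′ ≤ suc c × s ⊴ s′ × Served s′ I (suc r)
        add (u , v , kuv , iu , tv , nu , nv) = suc c , X.extended , ≤-refl , X.extended-⊵ , inj₂ (≤-trans (s≤s p) (X.more-leaving I iu tv))
          where
          module X = Extend s u v kuv nu nv (λ e → no-loops u (subst (λ z → T (E u z)) (sym e) (∧₁ kuv)))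

    -- A round raises the target from r to r + 1 and adds at most one edge for each of the 2^k sets
    -- of classes. So `c` stays below the bound that `free-edge` tolerates.
    serve-all : ∀ r (Is : List (Vec Bool k)) {c} (s : Selection c) → length Is + c ≤ 2 ^ k * suc r → (∀ v → Served s (lookup v) r) →
      ∃₂ λ c′ (s′ : Selection c′) → c′ ≤ length Is + c × s ⊴ s′ × (∀ v → v ∈ Is → Served s′ (lookup v) (suc r))
    serve-all r [] {c} s cr h = c , s , ≤-refl , (λ u t → t , refl) , λ v ()
    serve-all r (I ∷ Is) {c} s cr h = next (serve r s (lookup I) (≤-trans (s≤s (m≤n+m c (length Is))) cr) (h I))
      where
      next : (∃₂ λ c′ (s′ : Selection c′) → c′ ≤ suc c × s ⊴ s′ × Served s′ (lookup I) (suc r)) → _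
      next (c₁ , s₁ , le₁ , inc₁ , done₁) = rest (serve-all r Is s₁ (≤-trans le₂ cr) λ v → served-mono s s₁ inc₁ (lookup v) r (h v))
        where
        le₂ : length Is + c₁ ≤ suc (length Is) + c
        le₂ = ≤-trans (+-monoʳ-≤ (length Is) le₁) (≤-reflexive (+-suc (length Is) c))
        rest : (∃₂ λ c′ (s′ : Selection c′) → c′ ≤ length Is + c₁ × s₁ ⊴ s′ × (∀ v → v ∈ Is → Served s′ (lookup v) (suc r))) →
          ∃₂ λ c′ (s′ : Selection c′) → c′ ≤ suc (length Is) + c × s ⊴ s′ × (∀ v → v ∈ I ∷ Is → Served s′ (lookup v) (suc r))
        rest (c₂ , s₂ , le₃ , inc₂ , done₂) = c₂ , s₂ , ≤-trans le₃ le₂ ,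
          (λ u t → let t₁ , e₁ = inc₁ u t ; t₂ , e₂ = inc₂ u t₁ in t₂ , trans e₂ e₁) ,
          λ { v (here refl) → served-mono s₁ s₂ inc₂ (lookup I) (suc r) done₁ ; v (there m) → done₂ v m }

    -- r is the largest excess of out-vertices over in-vertices among all sets of classes (0 if there is none).
    record Complete : Set where
      field
        r c : ℕ
        s : Selection c
        c≤ : c ≤ 2 ^ k * r
        saturated : ∀ v → # (inside (lookup v)) ≤ # (touching (lookup v)) + # (leaving-tail s (lookup v))
        witness : r ≡ 0 ⊎ ∃ λ v → # (touching (lookup v)) + r ≤ # (inside (lookup v))

    -- A set that is still unbalanced has at least r leaving edges already, so its excess is at
    -- least r + 1 and it witnesses the next round. As no excess exceeds n, the rounds end.
    complete-from : ∀ fuel r {c} (s : Selection c) → c ≤ 2 ^ k * r → n < fuel + r → (∀ v → Served s (lookup v) r) →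
      (r ≡ 0 ⊎ ∃ λ v → # (touching (lookup v)) + r ≤ # (inside (lookup v))) → Complete
    complete-from fuel r {c} s cr nr h wit = decide (anySubset? λ v → ¬? (# (inside (lookup v)) ≤? # (touching (lookup v)) + # (leaving-tail s (lookup v))))
      where
      decide : Dec (∃ λ v → ¬ (# (inside (lookup v)) ≤ # (touching (lookup v)) + # (leaving-tail s (lookup v)))) → Complete
      decide (no none) = record { r = r ; c = c ; s = s ; c≤ = cr ; saturated = λ v → stable v ; witness = wit }
        where
        stable : ∀ v → # (inside (lookup v)) ≤ # (touching (lookup v)) + # (leaving-tail s (lookup v))
        stable v with # (inside (lookup v)) ≤? # (touching (lookup v)) + # (leaving-tail s (lookup v))
        ... | yes p = p
        ... | no ¬p = ⊥-elim (none (v , ¬p))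
      decide (yes (v , ¬p)) = next fuel nr (h v)
        where
        next : ∀ fuel → n < fuel + r → Served s (lookup v) r → Complete
        next fuel nr (inj₁ p) = ⊥-elim (¬p p)
        next zero nr (inj₂ p) = ⊥-elim (<⇒≱ nr (≤-trans p (#≤n _)))
        next (suc fuel) nr (inj₂ p) = again (serve-all r (subsets k) s (≤-trans (+-mono-≤ (≤-reflexive (subsets-length k)) cr) (≤-reflexive (sym (*-suc (2 ^ k) r)))) h)
          where
          again : (∃₂ λ c′ (s′ : Selection c′) → c′ ≤ length (subsets k) + c × s ⊴ s′ × (∀ v → v ∈ subsets k → Served s′ (lookup v) (suc r))) → Complete
          again (c′ , s′ , le , inc , done) = complete-from fuel (suc r) s′ (≤-trans le (≤-trans (+-mono-≤ (≤-reflexive (subsets-length k)) cr) (≤-reflexive (sym (*-suc (2 ^ k) r)))))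
            (≤-trans nr (≤-reflexive (sym (+-suc fuel r)))) (λ v → done v (subsets-complete v))
            (inj₂ (v , ≤-trans (≤-reflexive (+-suc _ r)) (≤-trans (s≤s (+-monoʳ-≤ (# (touching (lookup v))) p)) (≰⇒> ¬p))))

    complete : Complete
    complete = complete-from (suc n) 0 {0} (record
      { ι = idPerm ; tail = λ _ → false ; used = λ _ → false ; used-few = ≤-reflexive (#-none λ _ ()) ; tail-few = ≤-reflexive (#-none λ _ ())
      ; tail-used = λ _ () ; head-used = λ _ () ; edge = λ _ () ; apart = λ _ () }) z≤n (≤-reflexive (sym (+-identityʳ _))) (λ v → inj₂ z≤n) (inj₁ refl)

    -- An excess of r forces r d incompatible edges out of the witness, and there are at most 5 x d
    -- of them in all.
    r-bound : ∀ (C : Complete) → Complete.r C ≤ 5 * x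
    r-bound C = [ (λ e → ≤-trans (≤-reflexive e) z≤n) , bound ]′ (Complete.witness C)
      where
      open Complete C
      bound : (∃ λ v → # (touching (lookup v)) + r ≤ # (inside (lookup v))) → r ≤ 5 * x
      bound (v , gap) = *-cancelʳ-≤ r (5 * x) d {{>-nonZero d>0}} (+-cancelˡ-≤ (# (touching I) * d) _ _ (begin
        # (touching I) * d + r * d ≡⟨ sym (*-distribʳ-+ d (# (touching I)) r) ⟩
        (# (touching I) + r) * d ≤⟨ *-monoˡ-≤ d gap ⟩
        # (inside I) * d ≤⟨ leaving-edges I ⟩
        # (touching I) * d + #₂ (λ u v → K u v ∧ (inside I u ∧ not (touching I v))) ≤⟨ +-monoʳ-≤ (# (touching I) * d) (≤-trans (#₂-mono λ u v → ∧₁) K-few) ⟩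
        # (touching I) * d + 5 * x * d ∎))
        where
        open ≤-Reasoning
        I = lookup v

    module Pseudo (C : Complete) where
      open Complete C
      J : Fin n → Fin n → Bool
      J u v = compat u v ∨ (tail s u ∧ (to (ι s) u == v))

      -- Let `I` be the set of labels occurring in `S`. All of `touching I` is compatible with
      -- something in `S`, and the heads of the leaving edges with tails in `S` are further
      -- neighbours. On the other side `inside I` contains `S` and the remaining leaving tails, so
      -- Hall's condition follows from the balance of `I`.
      hall-J : ∀ S → # S ≤ # (N⁺ J S)
      hall-J S = +-cancelʳ-≤ (# (λ u → tails u ∧ not (S u))) _ _ (begin
        # S + # (λ u → tails u ∧ not (S u)) ≤⟨ disjoint ⟩
        # (inside I) ≤⟨ saturated v ⟩
        # (touching I) + # tails ≡⟨ cong (# (touching I) +_) (#-split tails S) ⟩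
        # (touching I) + (# (λ u → tails u ∧ S u) + # (λ u → tails u ∧ not (S u))) ≡⟨ sym (+-assoc (# (touching I)) _ _) ⟩
        # (touching I) + # (λ u → tails u ∧ S u) + # (λ u → tails u ∧ not (S u)) ≤⟨ +-monoˡ-≤ (# (λ u → tails u ∧ not (S u))) covers ⟩
        # (N⁺ J S) + # (λ u → tails u ∧ not (S u)) ∎)
        where
        open ≤-Reasoning
        v : Vec Bool k
        v = tabulate λ i → any λ u → S u ∧ LS u i
        I : Fin k → Bool
        I = lookup v
        I⁺ : ∀ {u i} → T (S u) → T (LS u i) → T (I i)
        I⁺ {u} {i} su l = subst T (sym (lookup∘tabulate (λ i → any λ u → S u ∧ LS u i) i)) (any⁺ (λ u → S u ∧ LS u i) u (∧⁺ su l))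
        I⁻ : ∀ {i} → T (I i) → ∃ λ u → T (S u) × T (LS u i)
        I⁻ {i} p = let u , q = any⁻ (λ u → S u ∧ LS u i) (subst T (lookup∘tabulate (λ i → any λ u → S u ∧ LS u i) i) p) in u , ∧₁ q , ∧₂ q
        tails : Fin n → Bool
        tails = leaving-tail s I
        disjoint : # S + # (λ u → tails u ∧ not (S u)) ≤ # (inside I)
        disjoint = ≤-trans (+-mono-≤ (#-mono {Q = λ u → inside I u ∧ S u} λ u su → ∧⁺ (inside⁺ I u λ i l → I⁺ su l) su) (#-mono {Q = λ u → inside I u ∧ not (S u)} λ u p → ∧⁺ (∧₁ (∧₂ (∧₁ p))) (∧₂ p)))
          (≤-reflexive (sym (#-split (inside I) S)))
        heads : Fin n → Bool
        heads v = tails (from (ι s) v) ∧ S (from (ι s) v)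
        covers : # (touching I) + # (λ u → tails u ∧ S u) ≤ # (N⁺ J S)
        covers = begin
          # (touching I) + # (λ u → tails u ∧ S u) ≡⟨ cong (# (touching I) +_) (sym (#-perm (inverse (ι s)) (λ u → tails u ∧ S u))) ⟩
          # (touching I) + # heads ≤⟨ +-mono-≤ (#-mono λ v t → ∧⁺ (touch v t) t) (#-mono λ v p → ∧⁺ (head v p) (away v p)) ⟩
          # (λ v → N⁺ J S v ∧ touching I v) + # (λ v → N⁺ J S v ∧ not (touching I v)) ≡⟨ sym (#-split (N⁺ J S) (touching I)) ⟩
          # (N⁺ J S) ∎
          where
          touch : ∀ v → T (touching I v) → T (N⁺ J S v)
          touch v t = let i , l , p = touching⁻ I v t ; u , su , l′ = I⁻ p in N⁺-intro J S su (∨₁ (compat⁺ i l′ l))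
          head : ∀ v → T (heads v) → T (N⁺ J S v)
          head v p = N⁺-intro J S (∧₂ p) (∨₂ (∧⁺ (∧₁ (∧₁ p)) (==⁺ (to-from (ι s) v))))
          away : ∀ v → T (heads v) → T (not (touching I v))
          away v p = subst (λ z → T (not (touching I z))) (to-from (ι s) v) (∧₂ (∧₂ (∧₁ p)))

      pseudo : ∃ λ (π : Perm n) → ∀ u → T (J u (to π u))
      pseudo = hall J hall-J

-- Hamilton cycles from permutations with a single cycle

single-cycle⇒Hamilton : ∀ {n} (E : Digraph n) (σ : Perm n) → 0 < n → (∀ u → T (E u (to σ u))) → (∀ u v → Cyc σ u v) → HamiltonCycle E
single-cycle⇒Hamilton {suc m} E σ _ edge conn = mk↔ₛ′ (from ρ) (to ρ) (from-to ρ) (to-from ρ) ,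
    (λ i → subst₂ (λ a b → T (E a b)) (walk (inject₁ i)) (trans (next i) (walk (suc i))) (edge _)) ,
    subst₂ (λ a b → T (E a b)) (walk (fromℕ m)) (trans closing (walk zero)) (edge _)
  where
  n = suc m
  x₀ : Fin n
  x₀ = zero
  f : Fin n → Fin n
  f i = iter σ (toℕ i) x₀
  index : ∀ y → ∃ λ i → f i ≡ y
  index y with conn x₀ y | period σ x₀
  ... | t , e | r , r<n , p = fromℕ< lt , trans (cong (λ s → iter σ s x₀) (toℕ-fromℕ< lt)) (trans (sym red) e)
    where
    lt : t % suc r < n
    lt = ≤-trans (m%n<n t (suc r)) r<n
    red : iter σ t x₀ ≡ iter σ (t % suc r) x₀
    red = trans (cong (λ s → iter σ s x₀) (trans (m≡m%n+[m/n]*n t (suc r)) (+-comm (t % suc r) _)))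
      (trans (iter-+ σ (t / suc r * suc r) (t % suc r) x₀) (cong (iter σ (t % suc r)) (iter-multiple σ (suc r) x₀ p (t / suc r))))
  g : Fin n → Fin n
  g y = proj₁ (index y)
  g-inj : ∀ {y z} → g y ≡ g z → y ≡ z
  g-inj {y} {z} e = trans (sym (proj₂ (index y))) (trans (cong f e) (proj₂ (index z)))
  ρ = proj₁ (injection⇒Perm g g-inj)
  ρ-g : ∀ y → to ρ y ≡ g y
  ρ-g = proj₂ (injection⇒Perm g g-inj)
  walk : ∀ i → f i ≡ from ρ i
  walk i = trans (cong f (trans (sym (to-from ρ i)) (ρ-g (from ρ i)))) (proj₂ (index (from ρ i)))
  f-inj : ∀ {i j} → f i ≡ f j → i ≡ j
  f-inj {i} {j} e = trans (sym (to-from ρ i)) (trans (cong (to ρ) (trans (sym (walk i)) (trans e (walk j)))) (to-from ρ j))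
  next : ∀ i → to σ (f (inject₁ i)) ≡ f (suc i)
  next i = trans (cong (λ t → to σ (iter σ t x₀)) (toℕ-inject₁ i)) (sym (iter-suc σ (toℕ i) x₀))
  -- The period of `x₀` is exactly n, because the first n iterates are distinct.
  closing : to σ (f (fromℕ m)) ≡ f zero
  closing with period σ x₀
  ... | r , r<n , p with m≤n⇒m<n∨m≡n r<n
  ...   | inj₁ lt = ⊥-elim (0≢suc (trans (cong toℕ (f-inj {zero} {fromℕ< lt} (trans (sym p) (cong (λ t → iter σ t x₀) (sym (toℕ-fromℕ< lt)))))) (toℕ-fromℕ< lt)))
    where
    0≢suc : ∀ {a} → 0 ≢ suc a
    0≢suc ()
  ...   | inj₂ e = trans (cong (λ t → to σ (iter σ t x₀)) (trans (toℕ-fromℕ m) (suc-injective (sym e)))) (trans (sym (iter-suc σ r x₀)) p)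

-- A forced edge p → q leading from class α to class β joins the cycles of the two classes.
record Bridge {n} {E : Digraph n} {d k x h V a} {Fr : Frame E d k x h} (La : Labelling Fr V a) : Set where
  open Labelling La
  field
    forced : Fin n → Bool
    few-forced : # forced ≤ a
    π : Perm n
    forced-edge : ∀ u → T (forced u) → T (E u (to π u))
    compatible : ∀ u → ¬ T (forced u) → T (compat u (to π u))
    apart : ∀ u → T (forced u) → ¬ T (forced (to π u))
    α β : Fin k
    two : ∀ c → c ≡ α ⊎ c ≡ β
    p : Fin n
    p-forced : T (forced p)
    p-start : ∀ u → T (forced u) → to π u ≢ p
    p-class : ∀ c → T (LT p c) → c ≡ α
    q-class : ∀ c → T (LS (to π p) c) → c ≡ β

module Scaled {n d x a h V g} (Sc : Scale n d x a h V g) where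
  open Scale Sc

  a≤h : a ≤ h
  a≤h = ≤-trans a≤f (≤-trans (m≤n*m f 8) 8f≤h)

  8a≤h : 8 * a ≤ h
  8a≤h = ≤-trans (*-monoʳ-≤ 8 a≤f) 8f≤h

  20a≤d : 20 * a ≤ d
  20a≤d = ≤-trans (*-monoʳ-≤ 20 a≤h) (ch≤d 20 (m≤m+n 20 180))

  12aV<d : V * (12 * a) < d
  12aV<d = ≤-trans (s≤s (≤-trans (≤-reflexive (e V a)) (*-monoʳ-≤ 12 (*-monoʳ-≤ V a≤h)))) (≤-trans (+-monoˡ-≤ (12 * (V * h)) (*-mono-≤ V>0 h>0)) (cVh≤d 13 (m≤m+n 13 187)))
    where
    e : ∀ V a → V * (12 * a) ≡ 12 * (V * a)
    e = solve-∀

  n>0 : 0 < n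
  n>0 = ≤-trans (s≤s z≤n) n-large

-- From a bridge to a Hamilton cycle

module Finish {n} {E : Digraph n} {d k x h V a g} (R : RegularGraph E d) {Fr : Frame E d k x h} (La : Labelling Fr V a)
  (Sc : Scale n d x a h V g) (Br : Bridge La) where
  open Labelling La
  open Scale Sc
  open Scaled Sc
  open Bridge Br
  open Cores R Fr La Sc forced few-forced

  rematched = Rematch.rematch R Fr La d>0 x≤a 8a≤h 20a≤d 12aV<d forced few-forced π compatible

  record First : Set where
    field
      σ₁ : Perm n
      keeps₁ : ∀ u → T (forced u) → to σ₁ u ≡ to π u
      factor₁ : Factor La forced σ₁

  first : First
  first = record
    { σ₁ = proj₁ rematched ; keeps₁ = proj₁ (proj₂ rematched)
    ; factor₁ = record { edge = λ u → [ (λ f → subst (λ v → T (E u v)) (sym (proj₁ (proj₂ rematched) u f)) (forced-edge u f)) , (λ f → proj₁ (proj₂ (proj₂ rematched) u f)) ]′ (em (forced u))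
                       ; compatible = λ u f → proj₂ (proj₂ (proj₂ rematched) u f) } }

  module Last (Fi : First) (Sa : Saturated (First.σ₁ Fi)) where
    open First Fi
    open Saturated Sa
    open Factor factor using (good; edge) renaming (compatible to compatible′)

    kept : ∀ u → T (forced u) → to σ u ≡ to π u
    kept u f = trans (keeps u f) (keeps₁ u f)

    u₀ q : Fin n
    u₀ = from σ p
    q = to π p

    u₀-free : ¬ T (forced u₀)
    u₀-free f = p-start u₀ f (trans (sym (kept u₀ f)) (to-from σ p))

    good-some : ∀ u → ¬ T (forced u) → ∃ λ c → T (good c u) × T (LS u c) × T (LT (to σ u) c)
    good-some u f = let c , l , l′ = compat⁻ (compatible′ u f) in c , ∧⁺ (not⁺ f) (∧⁺ l l′) , l , l′

    u₀-good : T (good α u₀)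
    u₀-good = go (good-some u₀ u₀-free)
      where
      go : (∃ λ c → T (good c u₀) × T (LS u₀ c) × T (LT (to σ u₀) c)) → T (good α u₀)
      go (c , gd , _ , l) = subst (λ c → T (good c u₀)) (p-class c (subst (λ v → T (LT v c)) (to-from σ p) l)) gd

    q-good : T (good β q)
    q-good = go (good-some q (apart p p-forced))
      where
      go : (∃ λ c → T (good c q) × T (LS q c) × T (LT (to σ q) c)) → T (good β q)
      go (c , gd , l , _) = subst (λ c → T (good c q)) (q-class c l) gd

    -- `σ` runs from `u₀` through `p` to `q`. The first is good for `α` and the last for `β`, so the
    -- forced edge glues the cycles of the two classes.
    u₀~q : Cyc σ u₀ q
    u₀~q = 2 , trans (cong (to σ) (to-from σ p)) (kept p p-forced)

    good~q : ∀ c u → T (good c u) → Cyc σ u q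
    good~q c u gd with two c
    ... | inj₁ refl = Cyc-trans σ (one-cycle α u u₀ gd u₀-good) u₀~q
    ... | inj₂ refl = one-cycle β u q gd q-good

    free~q : ∀ u → ¬ T (forced u) → Cyc σ u q
    free~q u f = let c , gd , _ = good-some u f in good~q c u gd

    all~q : ∀ u → Cyc σ u q
    all~q u = [ (λ f → Cyc-trans σ (Cyc-step σ u) (free~q (to σ u) (subst (λ v → ¬ T (forced v)) (sym (kept u f)) (apart u f)))) , free~q u ]′ (em (forced u))

    hamilton : HamiltonCycle E
    hamilton = single-cycle⇒Hamilton E σ n>0 edge λ u v → Cyc-trans σ (all~q u) (Cyc-sym σ (all~q v))

  hamilton : HamiltonCycle E
  hamilton = Last.hamilton first (saturate (First.σ₁ first) (First.factor₁ first))

-- Two cycles: both sides are nearly regular tournaments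

#₂-disjoint : ∀ {m n} {A B Q : Fin m → Fin n → Bool} → (∀ x y → T (A x y) → T (Q x y)) → (∀ x y → T (B x y) → T (Q x y)) →
  (∀ x y → T (A x y) → ¬ T (B x y)) → #₂ A + #₂ B ≤ #₂ Q
#₂-disjoint {A = A} {B} {Q} hA hB dis = ≤-trans (+-mono-≤ (#₂-mono λ x y p → ∧⁺ (hA x y p) p) (#₂-mono λ x y p → ∧⁺ (hB x y p) (not⁺ λ q → dis x y q p)))
  (≤-reflexive (sym (#₂-split Q A)))

#₂-disjoint₃ : ∀ {m n} {A B C Q : Fin m → Fin n → Bool} → (∀ x y → T (A x y) → T (Q x y)) → (∀ x y → T (B x y) → T (Q x y)) → (∀ x y → T (C x y) → T (Q x y)) →
  (∀ x y → T (A x y) → ¬ T (B x y)) → (∀ x y → T (A x y) → ¬ T (C x y)) → (∀ x y → T (B x y) → ¬ T (C x y)) → #₂ A + (#₂ B + #₂ C) ≤ #₂ Q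
#₂-disjoint₃ {A = A} {B} {C} hA hB hC ab ac bc = ≤-trans (+-monoʳ-≤ (#₂ A) (#₂-disjoint {Q = λ x y → B x y ∨ C x y} (λ x y → ∨₁) (λ x y → ∨₂) bc))
  (#₂-disjoint hA (λ x y p → [ hB x y , hC x y ]′ (∨⁻ p)) (λ x y p q → [ ab x y p , ac x y p ]′ (∨⁻ q)))

#₂-diag : ∀ {n} (Z : Fin n → Bool) → #₂ (λ u v → Z u ∧ (u == v)) ≡ # Z
#₂-diag Z = trans (#₂-rows Z _==_ 1 #-single) (*-identityʳ (# Z))

module Crossing {n} {E : Digraph n} {d} (R : RegularGraph E d) (d>0 : 0 < d) (oriented : ∀ u v → T (E u v) → ¬ T (E v u)) (Z : Fin n → Bool) where
  open RegularGraph R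
  open Sparse R d>0

  In Out Back : Fin n → Fin n → Bool
  In u v = (Z u ∧ E u v) ∧ Z v
  Out u v = (Z u ∧ E u v) ∧ not (Z v)
  Back u v = (E u v ∧ Z v) ∧ not (Z u)

  total : # Z * d ≡ #₂ In + #₂ Out
  total = trans (sym (out-edges Z)) (#₂-split (λ u v → Z u ∧ E u v) (λ u v → Z v))

  balance : #₂ Back ≡ #₂ Out
  balance = +-cancelˡ-≡ (#₂ In) _ _ (trans (cong (_+ #₂ Back) (#₂-cong (λ u v p → ∧⁺ (∧⁺ (∧₂ (∧₁ p)) (∧₂ p)) (∧₁ (∧₁ p))) (λ u v p → ∧⁺ (∧⁺ (∧₂ p) (∧₁ (∧₁ p))) (∧₂ (∧₁ p)))))
    (trans (sym (#₂-split (λ u v → E u v ∧ Z v) (λ u v → Z u))) (trans (in-edges Z) total)))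

  transposed : #₂ (λ u v → In v u) ≡ #₂ In
  transposed = sym (#₂-swap In)

  tournament : #₂ In + (#₂ In + # Z) ≤ # Z * # Z
  tournament = ≤-trans (≤-reflexive (cong (#₂ In +_) (cong₂ _+_ (sym transposed) (sym (#₂-diag Z)))))
    (≤-trans (#₂-disjoint₃ {A = In} {B = λ u v → In v u} {C = λ u v → Z u ∧ (u == v)} {Q = λ u v → Z u ∧ Z v}
      (λ u v p → ∧⁺ (∧₁ (∧₁ p)) (∧₂ p)) (λ u v p → ∧⁺ (∧₂ p) (∧₁ (∧₁ p))) (λ u v p → ∧⁺ (∧₁ p) (subst (λ z → T (Z z)) (==⁻ (∧₂ p)) (∧₁ p)))
      (λ u v p q → oriented u v (∧₂ (∧₁ p)) (∧₂ (∧₁ q)))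
      (λ u v p q → loop u v (∧₂ (∧₁ p)) (==⁻ (∧₂ q))) (λ u v p q → loop v u (∧₂ (∧₁ p)) (sym (==⁻ (∧₂ q)))))
      (≤-reflexive (#₂-× Z Z)))
    where
    loop : ∀ u v → T (E u v) → u ≡ v → ⊥
    loop u .u e refl = oriented u u e e

  strangers : Fin n → Fin n → Bool
  strangers u v = (Z u ∧ Z v) ∧ (not (E u v) ∧ not (E v u))

  -- `Z` has hardly more than 2d vertices and most of the d out-edges at each stay inside, so the
  -- adjacent ordered pairs nearly exhaust all pairs in `Z`.
  strangers-few : ∀ s X → # Z ≤ 2 * d + s → #₂ Out ≤ X * d → #₂ strangers ≤ # Z * s + 2 * (X * d)
  strangers-few s X size out = +-cancelˡ-≤ (2 * (# Z * d)) _ _ (begin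
    2 * (# Z * d) + #₂ strangers ≡⟨ cong (λ t → 2 * t + #₂ strangers) total ⟩
    2 * (#₂ In + #₂ Out) + #₂ strangers ≡⟨ e₁ (#₂ In) (#₂ Out) (#₂ strangers) ⟩
    (#₂ In + (#₂ In + #₂ strangers)) + 2 * #₂ Out ≤⟨ +-mono-≤ disjoint (*-monoʳ-≤ 2 out) ⟩
    # Z * # Z + 2 * (X * d) ≤⟨ +-monoˡ-≤ (2 * (X * d)) (*-monoʳ-≤ (# Z) size) ⟩
    # Z * (2 * d + s) + 2 * (X * d) ≡⟨ e₂ (# Z) d s (2 * (X * d)) ⟩
    2 * (# Z * d) + (# Z * s + 2 * (X * d)) ∎)
    where
    open ≤-Reasoning
    e₁ : ∀ i o s → 2 * (i + o) + s ≡ (i + (i + s)) + 2 * o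
    e₁ = solve-∀
    e₂ : ∀ z d s y → z * (2 * d + s) + y ≡ 2 * (z * d) + (z * s + y)
    e₂ = solve-∀
    disjoint : #₂ In + (#₂ In + #₂ strangers) ≤ # Z * # Z
    disjoint = ≤-trans (≤-reflexive (cong (λ t → #₂ In + (t + #₂ strangers)) (sym transposed)))
      (≤-trans (#₂-disjoint₃ {A = In} {B = λ u v → In v u} {C = strangers} {Q = λ u v → Z u ∧ Z v}
        (λ u v p → ∧⁺ (∧₁ (∧₁ p)) (∧₂ p)) (λ u v p → ∧⁺ (∧₂ p) (∧₁ (∧₁ p))) (λ u v p → ∧₁ p)
        (λ u v p q → oriented u v (∧₂ (∧₁ p)) (∧₂ (∧₁ q)))
        (λ u v p q → not⁻ (∧₁ (∧₂ q)) (∧₂ (∧₁ p))) (λ u v p q → not⁻ (∧₂ (∧₂ q)) (∧₂ (∧₁ p))))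
        (≤-reflexive (#₂-× Z Z)))

  -- With 2d = m + q: the bound m (2d + 1 - m) ≤ 2 e becomes m q + m ≤ 2 e.
  exact : ∀ q → 2 * d ≡ # Z + q → # Z * q + # Z ≤ 2 * #₂ Out
  exact q eq = +-cancelˡ-≤ (# Z * # Z) _ _ (begin
    # Z * # Z + (# Z * q + # Z) ≡⟨ e₁ (# Z) q ⟩
    (# Z + q) * # Z + # Z ≡⟨ cong (λ t → t * # Z + # Z) (sym eq) ⟩
    2 * d * # Z + # Z ≡⟨ e₂ d (# Z) ⟩
    2 * (# Z * d) + # Z ≡⟨ cong (λ t → 2 * t + # Z) total ⟩
    2 * (#₂ In + #₂ Out) + # Z ≡⟨ e₃ (#₂ In) (#₂ Out) (# Z) ⟩
    (#₂ In + (#₂ In + # Z)) + 2 * #₂ Out ≤⟨ +-monoˡ-≤ _ tournament ⟩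
    # Z * # Z + 2 * #₂ Out ∎)
    where
    open ≤-Reasoning
    e₁ : ∀ m q → m * m + (m * q + m) ≡ (m + q) * m + m
    e₁ = solve-∀
    e₂ : ∀ d m → 2 * d * m + m ≡ 2 * (m * d) + m
    e₂ = solve-∀
    e₃ : ∀ i o m → 2 * (i + o) + m ≡ (i + (i + m)) + 2 * o
    e₃ = solve-∀

  -- In the bound m q + m ≤ 2e of `exact`, with m + q = 2d and m ≥ 1, the left side is at least q +
  -- m = 2d.
  many-crossing : 1 ≤ # Z → # Z ≤ 2 * d → d ≤ #₂ Out
  many-crossing m≥1 m≤ = go (m≤n⇒∃[o]m+o≡n m≤)
    where
    go : (∃ λ q → # Z + q ≡ 2 * d) → d ≤ #₂ Out
    go (q , eq) = *-cancelˡ-≤ 2 (begin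
      2 * d ≡⟨ sym eq ⟩
      # Z + q ≡⟨ +-comm (# Z) q ⟩
      q + # Z ≤⟨ +-monoˡ-≤ (# Z) (m≤n*m q (# Z) {{>-nonZero m≥1}}) ⟩
      # Z * q + # Z ≤⟨ exact q (sym eq) ⟩
      2 * #₂ Out ∎)
      where open ≤-Reasoning

  -- From `exact`, m q ≤ 2 X d, and m ≥ d / 4 turns this into q ≤ 8 X.
  nearly-2d : ∀ X → d ≤ 4 * # Z → # Z ≤ 2 * d → #₂ Out ≤ X * d → 2 * d ≤ # Z + 8 * X
  nearly-2d X big m≤ out = go (m≤n⇒∃[o]m+o≡n m≤)
    where
    go : (∃ λ q → # Z + q ≡ 2 * d) → 2 * d ≤ # Z + 8 * X
    go (q , eq) = ≤-trans (≤-reflexive (sym eq)) (+-monoʳ-≤ (# Z) (*-cancelʳ-≤ q (8 * X) d {{>-nonZero d>0}} (begin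
      q * d ≤⟨ *-monoʳ-≤ q big ⟩
      q * (4 * # Z) ≡⟨ e₁ q (# Z) ⟩
      4 * (# Z * q) ≤⟨ *-monoʳ-≤ 4 (≤-trans (m≤m+n _ (# Z)) (exact q (sym eq))) ⟩
      4 * (2 * #₂ Out) ≤⟨ *-monoʳ-≤ 4 (*-monoʳ-≤ 2 out) ⟩
      4 * (2 * (X * d)) ≡⟨ e₂ X d ⟩
      8 * X * d ∎)))
      where
      open ≤-Reasoning
      e₁ : ∀ q m → q * (4 * m) ≡ 4 * (m * q)
      e₁ = solve-∀
      e₂ : ∀ X d → 4 * (2 * (X * d)) ≡ 8 * X * d
      e₂ = solve-∀

-- Two classes on the same side would be joined by many cross edges.
module OneClass {n} {E : Digraph n} {d k x h} (R : RegularGraph E d) (Fr : Frame E d k x h) (d>0 : 0 < d) (oriented : ∀ u v → T (E u v) → ¬ T (E v u))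
  (Z : Fin n → Bool) (s X f : ℕ) (n≤5d : n ≤ 5 * d) (size : # Z ≤ 2 * d + s) (out : #₂ (Crossing.Out R d>0 oriented Z) ≤ X * d)
  (tiny : 64 * (5 * s + 2 * X + 2 * x) < d) (8f≤d : 8 * f ≤ d) (A B : Fin n → Bool) (i j : Fin k) (i≢j : i ≢ j)
  (A⊆ : ∀ u → T (A u) → T (Z u) × Frame.cS Fr u ≡ i) (B⊆ : ∀ u → T (B u) → T (Z u) × Frame.cS Fr u ≡ j)
  (A-large : d ≤ 2 * # A + 2 * f) (B-large : d ≤ 2 * # B + 2 * f) where
  open Frame Fr
  open Crossing R d>0 oriented Z

  Y = 5 * s + 2 * X + 2 * x

  pairs-few : ∀ (P Q : Fin n → Bool) → (∀ u → T (P u) → T (Z u)) → (∀ u → T (Q u) → T (Z u)) →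
    (∀ u v → T (P u) → T (Q v) → cS u ≢ cT v × cS v ≢ cT u) → # P * # Q ≤ Y * d
  pairs-few P Q P⊆ Q⊆ far = begin
    # P * # Q ≡⟨ sym (#₂-× P Q) ⟩
    #₂ (λ u v → P u ∧ Q v) ≤⟨ #₂-∪ {Q = strangers} {R = λ u v → cross u v ∨ cross v u} cases ⟩
    #₂ strangers + #₂ (λ u v → cross u v ∨ cross v u) ≤⟨ +-mono-≤ (strangers-few s X size out) (≤-trans (#₂-∪ {Q = cross} {R = λ u v → cross v u} λ u v → ∨⁻)
         (+-mono-≤ cross-few (≤-trans (≤-reflexive (sym (#₂-swap cross))) cross-few))) ⟩
    (# Z * s + 2 * (X * d)) + (x * d + x * d) ≤⟨ +-monoˡ-≤ (x * d + x * d) (+-monoˡ-≤ (2 * (X * d)) (*-monoˡ-≤ s (≤-trans (#≤n Z) n≤5d))) ⟩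
    (5 * d * s + 2 * (X * d)) + (x * d + x * d) ≡⟨ e d s X x ⟩
    Y * d ∎
    where
    open ≤-Reasoning
    e : ∀ d s X x → (5 * d * s + 2 * (X * d)) + (x * d + x * d) ≡ (5 * s + 2 * X + 2 * x) * d
    e = solve-∀
    cases : ∀ u v → T (P u ∧ Q v) → T (strangers u v) ⊎ T (cross u v ∨ cross v u)
    cases u v p with em (E u v) | em (E v u)
    ... | inj₁ e | _ = inj₂ (∨₁ (∧⁺ e (not⁺ λ q → proj₁ (far u v (∧₁ p) (∧₂ p)) (==⁻ q))))
    ... | inj₂ _ | inj₁ e = inj₂ (∨₂ (∧⁺ e (not⁺ λ q → proj₂ (far u v (∧₁ p) (∧₂ p)) (==⁻ q))))
    ... | inj₂ e | inj₂ e′ = inj₁ (∧⁺ (∧⁺ (P⊆ u (∧₁ p)) (Q⊆ v (∧₂ p))) (∧⁺ (not⁺ e) (not⁺ e′)))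

  not-both : ∀ (P Q : Fin n → Bool) → # P * # Q ≤ Y * d → d ≤ 8 * # P → d ≤ 8 * # Q → ⊥
  not-both P Q few p q = <⇒≱ tiny (*-cancelʳ-≤ d (64 * Y) d {{>-nonZero d>0}} (begin
    d * d ≤⟨ *-mono-≤ p q ⟩
    8 * # P * (8 * # Q) ≡⟨ e₁ (# P) (# Q) ⟩
    64 * (# P * # Q) ≤⟨ *-monoʳ-≤ 64 few ⟩
    64 * (Y * d) ≡⟨ sym (*-assoc 64 Y d) ⟩
    64 * Y * d ∎))
    where
    open ≤-Reasoning
    e₁ : ∀ p q → 8 * p * (8 * q) ≡ 64 * (p * q)
    e₁ = solve-∀

  -- Two vertices of `G₁₀`, or two of `G₀₁`, are joined only by cross edges, so both sets are small.
  -- Most of `A` is therefore in `G₁₁` and most of `B` in `G₀₀`; but edges between these two are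
  -- cross edges as well, while almost all pairs in `Z` are adjacent.
  G₁₁ G₁₀ G₀₁ G₀₀ : Fin n → Bool
  G₁₁ u = Z u ∧ ((cS u == i) ∧ (cT u == i))
  G₁₀ u = Z u ∧ ((cS u == i) ∧ not (cT u == i))
  G₀₁ u = Z u ∧ (not (cS u == i) ∧ (cT u == i))
  G₀₀ u = Z u ∧ (not (cS u == i) ∧ not (cT u == i))

  G₁₀-small : ¬ (d ≤ 8 * # G₁₀)
  G₁₀-small p = not-both G₁₀ G₁₀ (pairs-few G₁₀ G₁₀ (λ u → ∧₁) (λ u → ∧₁) λ u v p q →
    (λ e → not⁻ (∧₂ (∧₂ q)) (==⁺ (trans (sym e) (==⁻ (∧₁ (∧₂ p)))))) , (λ e → not⁻ (∧₂ (∧₂ p)) (==⁺ (trans (sym e) (==⁻ (∧₁ (∧₂ q))))))) p p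

  G₀₁-small : ¬ (d ≤ 8 * # G₀₁)
  G₀₁-small p = not-both G₀₁ G₀₁ (pairs-few G₀₁ G₀₁ (λ u → ∧₁) (λ u → ∧₁) λ u v p q →
    (λ e → not⁻ (∧₁ (∧₂ p)) (==⁺ (trans e (==⁻ (∧₂ (∧₂ q)))))) , (λ e → not⁻ (∧₁ (∧₂ q)) (==⁺ (trans e (==⁻ (∧₂ (∧₂ p))))))) p p

  rest-large : ∀ (C G G′ : Fin n → Bool) → (∀ u → T (C u) → T (G u) ⊎ T (G′ u)) → d ≤ 2 * # C + 2 * f → ¬ (d ≤ 8 * # G′) → d ≤ 8 * # G
  rest-large C G G′ sub large small = ≮⇒≥ λ lt → <⇒≱ {4 * d} {4 * d} (begin-strict
    4 * d ≤⟨ *-monoʳ-≤ 4 large ⟩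
    4 * (2 * # C + 2 * f) ≡⟨ e₁ (# C) f ⟩
    8 * # C + 8 * f ≤⟨ +-mono-≤ (*-monoʳ-≤ 8 (#-∪ sub)) 8f≤d ⟩
    8 * (# G + # G′) + d ≡⟨ cong (_+ d) (*-distribˡ-+ 8 (# G) (# G′)) ⟩
    8 * # G + 8 * # G′ + d <⟨ +-monoˡ-< d (+-mono-<-≤ lt (<⇒≤ (≰⇒> small))) ⟩
    d + d + d ≤⟨ m≤m+n (d + d + d) d ⟩
    d + d + d + d ≡⟨ e₂ d ⟩
    4 * d ∎) ≤-refl
    where
    open ≤-Reasoning
    e₁ : ∀ c f → 4 * (2 * c + 2 * f) ≡ 8 * c + 8 * f
    e₁ = solve-∀
    e₂ : ∀ d → d + d + d + d ≡ 4 * d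
    e₂ = solve-∀

  absurd : ⊥
  absurd = not-both G₁₁ G₀₀
    (pairs-few G₁₁ G₀₀ (λ u → ∧₁) (λ u → ∧₁) λ u v p q →
      (λ e → not⁻ (∧₂ (∧₂ q)) (==⁺ (trans (sym e) (==⁻ (∧₁ (∧₂ p)))))) , (λ e → not⁻ (∧₁ (∧₂ q)) (==⁺ (trans e (==⁻ (∧₂ (∧₂ p)))))))
    (rest-large A G₁₁ G₁₀ (λ u p → [ (λ t → inj₁ (∧⁺ (proj₁ (A⊆ u p)) (∧⁺ (==⁺ (proj₂ (A⊆ u p))) t))) , (λ t → inj₂ (∧⁺ (proj₁ (A⊆ u p)) (∧⁺ (==⁺ (proj₂ (A⊆ u p))) (not⁺ t)))) ]′ (em (cT u == i))) A-large G₁₀-small)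
    (rest-large B G₀₀ G₀₁ (λ u p → [ (λ t → inj₂ (∧⁺ (proj₁ (B⊆ u p)) (∧⁺ (off u p) t))) , (λ t → inj₁ (∧⁺ (proj₁ (B⊆ u p)) (∧⁺ (off u p) (not⁺ t)))) ]′ (em (cT u == i))) B-large G₀₁-small)
    where
    off : ∀ u → T (B u) → T (not (cS u == i))
    off u p = not⁺ λ e → i≢j (trans (sym (==⁻ e)) (proj₂ (B⊆ u p)))

-- Joining the two sides of a disconnected 1-factor

module TwoSides {n} {E : Digraph n} {d k x h V a g} (R : RegularGraph E d) (Fr : Frame E d k x h) (oriented : ∀ u v → T (E u v) → ¬ T (E v u))
  (n≤ : n ≤ 4 * d + 1) (La : Labelling Fr V a) (Sc : Scale n d x a h V g) (V≥10 : 10 ≤ V) (forced : Fin n → Bool) (few-forced : # forced ≤ a)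
  (π : Perm n) (Fa : Factor La forced π) (one-cycle : ∀ c u v → T (Factor.good Fa c u) → T (Factor.good Fa c v) → Cyc π u v)
  (apart : ∀ u → T (forced u) → ¬ T (forced (to π u))) (w w′ : Fin n) (¬ww′ : ¬ Cyc π w w′) (half : 2 * # (cyc π w) ≤ n) where
  open RegularGraph R
  open Frame Fr
  open Labelling La
  open Scale Sc
  open Factor Fa
  open Cores R Fr La Sc forced few-forced
  open Misfits π Fa
  open Sparse R d>0

  W D : Fin n → Bool
  W = cyc π w
  D u = not (W u)

  module CW = Crossing R d>0 oriented W
  module CD = Crossing R d>0 oriented D

  W-step : ∀ u → T (W u) → T (W (to π u))
  W-step u p = cyc⁺ π (Cyc-trans π (cyc⁻ π p) (Cyc-step π u))

  W-back : ∀ u → T (W (to π u)) → T (W u)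
  W-back u p = cyc⁺ π (Cyc-trans π (cyc⁻ π p) (Cyc-sym π (Cyc-step π u)))

  W-cyc : ∀ {u v} → Cyc π u v → T (W u) → T (W v)
  W-cyc c p = cyc⁺ π (Cyc-trans π (cyc⁻ π p) c)

  good-some : ∀ u → ¬ T (forced u) → ∃ λ c → T (good c u)
  good-some u fu = let c , l , l′ = compat⁻ (compatible u fu) in c , ∧⁺ (not⁺ fu) (∧⁺ l l′)

  good-near : ∀ u → ∃₂ λ c v → T (good c v) × Cyc π u v
  good-near u = [ (λ fu → let c , gd = good-some (to π u) (apart u fu) in c , to π u , gd , Cyc-step π u) , (λ fu → let c , gd = good-some u fu in c , u , gd , Cyc-refl π) ]′ (em (forced u))

  on : Fin k → Bool
  on c = any λ u → good c u ∧ W u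

  on⁺ : ∀ c u → T (good c u) → T (W u) → T (on c)
  on⁺ c u gd p = any⁺ (λ u → good c u ∧ W u) u (∧⁺ gd p)

  on⁻ : ∀ c u → T (on c) → T (good c u) → T (W u)
  on⁻ c u o gd = let v , p = any⁻ (λ u → good c u ∧ W u) o in W-cyc (one-cycle c v u (∧₁ p) gd) (∧₂ p)

  class-W : ∃ λ c → T (on c)
  class-W = let c , v , gd , p = good-near w in c , on⁺ c v gd (cyc⁺ π p)

  class-D : ∃ λ c → ¬ T (on c)
  class-D = let c , v , gd , p = good-near w′ in c , λ o → ¬ww′ (Cyc-trans π (cyc⁻ π (on⁻ c v o gd)) (Cyc-sym π p))

  core-large : ∀ c → d ≤ 2 * # (core c) + 2 * f
  core-large c = ≤-trans (large c) (≤-trans (*-monoʳ-≤ 2 (≤-trans (#-∪ {Q = core c} {R = λ u → (cS u == c) ∧ not (core c u)}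
    λ u p → [ inj₁ , (λ q → inj₂ (∧⁺ p (not⁺ q))) ]′ (em (core c u))) (+-monoʳ-≤ (# (core c)) (missing-S c)))) (≤-reflexive (*-distribˡ-+ 2 (# (core c)) f)))

  8f≤d : 8 * f ≤ d
  8f≤d = ≤-trans 8f≤h (≤-trans (≤-reflexive (sym (+-identityʳ h))) (ch≤d 1 (s≤s z≤n)))

  -- `X * d` bounds the edges between the sides: cross edges and edges with a misfit at one end. The
  -- larger side exceeds 2d by at most `s`, since the smaller one has at least 2d - 8X of at most 4d
  -- + 1 vertices.
  X s : ℕ
  X = x + 2 * f
  s = 1 + 8 * X

  fits-W : ∀ u → ¬ T (misfit u) → (T (W u) → T (on (cS u))) × (T (on (cS u)) → T (W u))
  fits-W u m = (λ p → on⁺ (cS u) u gd p) , (λ o → on⁻ (cS u) u o gd)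
    where
    gd : T (good (cS u) u)
    gd = ∧₁ (proj₂ (fits u m))

  out-W : #₂ CW.Out ≤ X * d
  out-W = begin
    #₂ CW.Out ≤⟨ #₂-∪ {Q = cross} {R = λ u v → (misfit u ∧ E u v) ∨ (E u v ∧ misfit (from π v))} cases ⟩
    #₂ cross + #₂ (λ u v → (misfit u ∧ E u v) ∨ (E u v ∧ misfit (from π v)))
      ≤⟨ +-mono-≤ cross-few (≤-trans (#₂-∪ {Q = λ u v → misfit u ∧ E u v} {R = λ u v → E u v ∧ misfit (from π v)} λ u v → ∨⁻)
           (+-mono-≤ (≤-trans (≤-reflexive (out-edges misfit)) (*-monoˡ-≤ d misfit-few))
             (≤-trans (≤-reflexive (in-edges (λ v → misfit (from π v)))) (*-monoˡ-≤ d (≤-trans (≤-reflexive (#-perm (inverse π) misfit)) misfit-few))))) ⟩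
    x * d + (f * d + f * d) ≡⟨ e x f d ⟩
    (x + 2 * f) * d ∎
    where
    open ≤-Reasoning
    e : ∀ x f d → x * d + (f * d + f * d) ≡ (x + 2 * f) * d
    e = solve-∀
    cases : ∀ u v → T (CW.Out u v) → T (cross u v) ⊎ T ((misfit u ∧ E u v) ∨ (E u v ∧ misfit (from π v)))
    cases u v p with em (misfit u) | em (misfit (from π v))
    ... | inj₁ m | _ = inj₂ (∨₁ (∧⁺ m (∧₂ (∧₁ p))))
    ... | inj₂ _ | inj₁ m = inj₂ (∨₂ (∧⁺ (∧₂ (∧₁ p)) m))
    ... | inj₂ m | inj₂ m′ = inj₁ (∧⁺ (∧₂ (∧₁ p)) (not⁺ λ e → not⁻ (∧₂ p) (subst (λ z → T (W z)) (to-from π v) (W-step (from π v) (proj₂ (fits-W (from π v) m′)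
        (subst (λ c → T (on c)) (trans (==⁻ e) (trans (cong cT (sym (to-from π v))) (proj₁ (fits (from π v) m′)))) (proj₁ (fits-W u m) (∧₁ (∧₁ p)))))))))

  out-D≤ : #₂ CD.Out ≤ #₂ CW.Out
  out-D≤ = ≤-trans (#₂-mono λ u v p → ∧⁺ (∧⁺ (∧₂ (∧₁ p)) (not-not (not⁻ (∧₂ p) ∘ id))) (∧₁ (∧₁ p))) (≤-reflexive CW.balance)

  -- By parity, since |W| ≥ 2d + 1 would make n ≥ 4d + 2. Beyond this size `many-crossing` is false,
  -- as a regular tournament on 2d + 1 vertices shows.
  W≤2d : # W ≤ 2 * d
  W≤2d = ≮⇒≥ λ lt → <⇒≱ (n<1+n (4 * d + 1)) (≤-trans (≤-trans (≤-reflexive (e d)) (*-monoʳ-≤ 2 lt)) (≤-trans half n≤))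
    where
    e : ∀ d → suc (4 * d + 1) ≡ 2 * suc (2 * d)
    e = solve-∀

  d≤4W : d ≤ 4 * # W
  d≤4W = +-cancelʳ-≤ d _ _ (begin
    d + d ≤⟨ +-mono-≤ big big ⟩
    (2 * # W + 2 * f) + (2 * # W + 2 * f) ≡⟨ e (# W) f ⟩
    4 * # W + 4 * f ≤⟨ +-monoʳ-≤ (4 * # W) (≤-trans (*-monoˡ-≤ f (m≤m+n 4 4)) 8f≤d) ⟩
    4 * # W + d ∎)
    where
    open ≤-Reasoning
    e : ∀ m f → (2 * m + 2 * f) + (2 * m + 2 * f) ≡ 4 * m + 4 * f
    e = solve-∀
    big : d ≤ 2 * # W + 2 * f
    big = ≤-trans (core-large (proj₁ class-W)) (+-monoˡ-≤ (2 * f) (*-monoʳ-≤ 2 (#-mono λ u p → on⁻ (proj₁ class-W) u (proj₂ class-W) (∧₁ p))))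

  D-size : # D ≤ 2 * d + s
  D-size = +-cancelˡ-≤ (# W) _ _ (begin
    # W + # D ≡⟨ #-compl W ⟩
    n ≤⟨ n≤ ⟩
    4 * d + 1 ≡⟨ e₁ d ⟩
    2 * d + (2 * d + 1) ≤⟨ +-monoˡ-≤ (2 * d + 1) (CW.nearly-2d X d≤4W W≤2d out-W) ⟩
    # W + 8 * X + (2 * d + 1) ≡⟨ e₂ (# W) X d ⟩
    # W + (2 * d + (1 + 8 * X)) ∎)
    where
    open ≤-Reasoning
    e₁ : ∀ d → 4 * d + 1 ≡ 2 * d + (2 * d + 1)
    e₁ = solve-∀
    e₂ : ∀ m X d → m + 8 * X + (2 * d + 1) ≡ m + (2 * d + (1 + 8 * X))
    e₂ = solve-∀

  tiny : 64 * (5 * s + 2 * X + 2 * x) < d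
  tiny = begin-strict
    64 * (5 * (1 + 8 * (x + 2 * f)) + 2 * (x + 2 * f) + 2 * x) ≡⟨ e₁ x f ⟩
    320 + 2816 * x + 672 * (8 * f) ≤⟨ +-mono-≤ (+-monoʳ-≤ 320 (≤-trans (*-monoʳ-≤ 2816 (≤-trans x≤a a≤f)) (≤-reflexive (e₂ f)))) ≤-refl ⟩
    320 + 352 * (8 * f) + 672 * (8 * f) ≤⟨ +-mono-≤ (+-mono-≤ (≤-trans (≤-reflexive (sym (*-identityʳ 320))) (*-monoʳ-≤ 320 h>0)) (*-monoʳ-≤ 352 8f≤h)) (*-monoʳ-≤ 672 8f≤h) ⟩
    320 * h + 352 * h + 672 * h ≡⟨ e₃ h ⟩
    1344 * h <⟨ *-monoˡ-< h {{>-nonZero h>0}} {1344} {2000} (m≤m+n 1345 655) ⟩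
    2000 * h ≡⟨ e₄ h ⟩
    200 * (10 * h) ≤⟨ *-monoʳ-≤ 200 (*-monoˡ-≤ h V≥10) ⟩
    200 * (V * h) ≤⟨ 200Vh≤d ⟩
    d ∎
    where
    open ≤-Reasoning
    e₁ : ∀ x f → 64 * (5 * (1 + 8 * (x + 2 * f)) + 2 * (x + 2 * f) + 2 * x) ≡ 320 + 2816 * x + 672 * (8 * f)
    e₁ = solve-∀
    e₂ : ∀ f → 2816 * f ≡ 352 * (8 * f)
    e₂ = solve-∀
    e₃ : ∀ h → 320 * h + 352 * h + 672 * h ≡ 1344 * h
    e₃ = solve-∀
    e₄ : ∀ h → 2000 * h ≡ 200 * (10 * h)
    e₄ = solve-∀

  core-class : ∀ c u → T (core c u) → cS u ≡ c
  core-class c u p = ==⁻ (∧₁ (∧₂ p))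

  on-unique : ∀ c c′ → T (on c) → T (on c′) → c ≡ c′
  on-unique c c′ o o′ with c ≟ c′
  ... | yes e = e
  ... | no ne = ⊥-elim (OneClass.absurd R Fr d>0 oriented W s X f n≤5d (≤-trans W≤2d (m≤m+n (2 * d) s)) out-W tiny 8f≤d (core c) (core c′) c c′ ne
    (λ u p → on⁻ c u o (∧₁ p) , core-class c u p) (λ u p → on⁻ c′ u o′ (∧₁ p) , core-class c′ u p) (core-large c) (core-large c′))

  off-unique : ∀ c c′ → ¬ T (on c) → ¬ T (on c′) → c ≡ c′
  off-unique c c′ o o′ with c ≟ c′
  ... | yes e = e
  ... | no ne = ⊥-elim (OneClass.absurd R Fr d>0 oriented D s X f n≤5d D-size (≤-trans out-D≤ out-W) tiny 8f≤d (core c) (core c′) c c′ ne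
    (λ u p → not⁺ (λ q → o (on⁺ c u (∧₁ p) q)) , core-class c u p) (λ u p → not⁺ (λ q → o′ (on⁺ c′ u (∧₁ p) q)) , core-class c′ u p) (core-large c) (core-large c′))

  -- By `on-unique` and `off-unique` a side has exactly one class, so the class can serve as the
  -- name of the side.
  pick : Bool → Fin k
  pick true = proj₁ class-W
  pick false = proj₁ class-D

  side : Fin n → Fin k
  side u = pick (W u)

  pick-T : ∀ {b} → T b → pick b ≡ proj₁ class-W
  pick-T {true} _ = refl

  pick-¬T : ∀ {b} → ¬ T b → pick b ≡ proj₁ class-D
  pick-¬T {true} h = ⊥-elim (h tt)
  pick-¬T {false} _ = refl

  good-side : ∀ c u → T (good c u) → c ≡ side u
  good-side c u gd = [ (λ p → trans (on-unique c _ (on⁺ c u gd p) (proj₂ class-W)) (sym (pick-T p))) ,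
    (λ p → trans (off-unique c _ (λ o → p (on⁻ c u o gd)) (proj₂ class-D)) (sym (pick-¬T p))) ]′ (em (W u))

  side-same : ∀ {u v} → (T (W u) → T (W v)) → (T (W v) → T (W u)) → side u ≡ side v
  side-same {u} {v} p q = [ (λ h → trans (pick-T h) (sym (pick-T (p h)))) , (λ h → trans (pick-¬T h) (sym (pick-¬T (λ h′ → h (q h′))))) ]′ (em (W u))

  side-π : ∀ u → side (to π u) ≡ side u
  side-π u = side-same (W-back u) (W-step u)

  side-from : ∀ v → side (from π v) ≡ side v
  side-from v = trans (sym (side-π (from π v))) (cong side (to-from π v))

  two-sides : ∀ p q → side p ≢ side q → ∀ c → c ≡ side p ⊎ c ≡ side q
  two-sides p q ne c = [ (λ wp → [ (λ wq → ⊥-elim (ne (trans (pick-T wp) (sym (pick-T wq))))) , (λ wq → cases wp wq) ]′ (em (W q))) ,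
      (λ wp → [ (λ wq → swap⊎ (cases wq wp)) , (λ wq → ⊥-elim (ne (trans (pick-¬T wp) (sym (pick-¬T wq))))) ]′ (em (W q))) ]′ (em (W p))
    where
    swap⊎ : ∀ {A B : Set} → A ⊎ B → B ⊎ A
    swap⊎ (inj₁ a) = inj₂ a
    swap⊎ (inj₂ b) = inj₁ b
    cases : ∀ {u v} → T (W u) → ¬ T (W v) → c ≡ side u ⊎ c ≡ side v
    cases wu wv = [ (λ o → inj₁ (trans (on-unique c _ o (proj₂ class-W)) (sym (pick-T wu)))) , (λ o → inj₂ (trans (off-unique c _ o (proj₂ class-D)) (sym (pick-¬T wv)))) ]′ (em (on c))

  side-labels : ∀ u → ¬ T (forced u) → T (LS u (side u)) × T (LT (to π u) (side u))
  side-labels u fu = let c , gd = good-some u fu in subst (λ c → T (LS u c) × T (LT (to π u) c)) (good-side c u gd) (∧₁ (∧₂ gd) , ∧₂ (∧₂ gd))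

  -- Every unforced vertex is labelled by the side it lies on only.
  LS′ LT′ : Fin n → Fin k → Bool
  LS′ u c = (forced u ∧ LS u c) ∨ (not (forced u) ∧ (side u == c))
  LT′ v c = (forced (from π v) ∧ LT v c) ∨ (not (forced (from π v)) ∧ (side v == c))

  LS′-free : ∀ u → ¬ T (forced u) → T (LS′ u (side u))
  LS′-free u fu = ∨₂ (∧⁺ (not⁺ fu) (==⁺ {x = side u} refl))

  LT′-free : ∀ v → ¬ T (forced (from π v)) → T (LT′ v (side v))
  LT′-free v fv = ∨₂ (∧⁺ (not⁺ fv) (==⁺ {x = side v} refl))

  LS′-only : ∀ u c → ¬ T (forced u) → T (LS′ u c) → c ≡ side u
  LS′-only u c fu l = [ (λ p → ⊥-elim (fu (∧₁ p))) , (λ p → sym (==⁻ (∧₂ p))) ]′ (∨⁻ l)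

  LT′-only : ∀ v c → ¬ T (forced (from π v)) → T (LT′ v c) → c ≡ side v
  LT′-only v c fv l = [ (λ p → ⊥-elim (fv (∧₁ p))) , (λ p → sym (==⁻ (∧₂ p))) ]′ (∨⁻ l)

  -- An unforced vertex keeps a label it had before, so thickness is inherited. Only misfits can
  -- fail to be typical for the new labels, hence `f ≤ a′`.
  relabelling : ∀ a′ → f ≤ a′ → Labelling Fr V a′
  relabelling a′ f≤a′ = record
    { LS = LS′ ; LT = LT′
    ; thick-S = λ u i l → thick-S u i ([ ∧₂ , (λ p → subst (λ c → T (LS u c)) (==⁻ (∧₂ p)) (proj₁ (side-labels u (not⁻ (∧₁ p))))) ]′ (∨⁻ l))
    ; thick-T = λ v i l → thick-T v i ([ ∧₂ , (λ p → subst₂ (λ z c → T (LT z c)) (to-from π v) (trans (side-from v) (==⁻ (∧₂ p))) (proj₂ (side-labels (from π v) (not⁻ (∧₁ p))))) ]′ (∨⁻ l))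
    ; typical-S = ≤-trans (#-mono λ u p → not-not λ m → not⁻ p (fit-S u (not⁻ m))) (≤-trans misfit-few f≤a′)
    ; typical-T = ≤-trans (#-mono λ v p → not-not λ m → not⁻ p (fit-T v (not⁻ m))) (≤-trans (≤-reflexive (#-perm (inverse π) misfit)) (≤-trans misfit-few f≤a′)) }
    where
    fit-S : ∀ u → ¬ T (misfit u) → T (LS′ u (cS u))
    fit-S u m = let gd = ∧₁ (proj₂ (fits u m)) in subst (λ c → T (LS′ u c)) (sym (good-side (cS u) u gd)) (LS′-free u (not⁻ (∧₁ gd)))
    fit-T : ∀ v → ¬ T (misfit (from π v)) → T (LT′ v (cT v))
    fit-T v m = let u = from π v ; gd = ∧₁ (proj₂ (fits u m)) in
      subst (λ c → T (LT′ v c)) (trans (sym (side-from v)) (trans (sym (good-side (cS u) u gd)) (trans (sym (proj₁ (fits u m))) (cong cT (to-from π v))))) (LT′-free v (not⁻ (∧₁ gd)))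

  -- Exchange the forced edge at t for the edge p → q, which leads to the other side.
  module Exchange (a′ : ℕ) (f≤a′ : f ≤ a′) (few′ : # forced + 1 ≤ a′) (p q t : Fin n) (pq : T (E p q)) (p-free : ¬ T (forced p)) (q-free : ¬ T (forced q))
    (not-head : ∀ u → T (forced u) → to π u ≢ p × to π u ≢ q) (sides : side p ≢ side q) (t-forced : T (forced t))
    (t-label : T (LS t (side p))) (t-image : T (LT (to π t) (side q))) where
    y : Fin n
    y = from π q

    y-free : ¬ T (forced y)
    y-free fy = proj₂ (not-head y fy) (to-from π q)

    p≢t : p ≢ t
    p≢t refl = p-free t-forced

    y≢t : y ≢ t
    y≢t e = y-free (subst (λ z → T (forced z)) (sym e) t-forced)

    p≢y : p ≢ y
    p≢y e = sides (trans (cong side e) (side-from q))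

    -- A 3-cycle of images: `p` goes to `q`, `t` to the old image of `p`, and `y` to the old image
    -- of `t`. The last two pairs are compatible because `t` carries the label `side p` and its old
    -- image the label `side q`.
    π′ : Perm n
    π′ = swap p t (swap t y π)

    π′-p : to π′ p ≡ q
    π′-p = trans (cong (to π ∘ transpose t y) (transpose-l p t)) (trans (cong (to π) (transpose-l t y)) (to-from π q))

    π′-t : to π′ t ≡ to π p
    π′-t = trans (cong (to π ∘ transpose t y) (transpose-r p t)) (cong (to π) (transpose-o p≢t p≢y))

    π′-y : to π′ y ≡ to π t
    π′-y = trans (cong (to π ∘ transpose t y) (transpose-o (λ e → p≢y (sym e)) y≢t)) (cong (to π) (transpose-r t y))

    π′-other : ∀ u → u ≢ p → u ≢ t → u ≢ y → to π′ u ≡ to π u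
    π′-other u np nt ny = trans (cong (to π ∘ transpose t y) (transpose-o np nt)) (cong (to π) (transpose-o nt ny))

    forced′ : Fin n → Bool
    forced′ u = (forced u ∧ not (t == u)) ∨ (p == u)

    π′-forced : ∀ u → T (forced u) → t ≢ u → to π′ u ≡ to π u
    π′-forced u fu nt = π′-other u (λ e → p-free (subst (λ z → T (forced z)) e fu)) (λ e → nt (sym e)) (λ e → y-free (subst (λ z → T (forced z)) e fu))

    La′ = relabelling a′ f≤a′
    open Labelling La′ using () renaming (compat to compat′; compat⁺ to compat′⁺)

    free-cases : ∀ u → ¬ T (forced′ u) → u ≢ p × (u ≡ t ⊎ ¬ T (forced u))
    free-cases u h = (λ e → h (∨₂ (==⁺ (sym e)))) , cases (t ≟ u)
      where
      cases : Dec (t ≡ u) → u ≡ t ⊎ ¬ T (forced u)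
      cases (yes e) = inj₁ (sym e)
      cases (no ne) = inj₂ λ fu → h (∨₁ (∧⁺ fu (not⁺ λ e → ne (==⁻ e))))

    compatible′ : ∀ u → ¬ T (forced′ u) → T (compat′ u (to π′ u))
    compatible′ u h = go (proj₁ (free-cases u h)) (proj₂ (free-cases u h)) (u ≟ y)
      where
      go : u ≢ p → u ≡ t ⊎ ¬ T (forced u) → Dec (u ≡ y) → T (compat′ u (to π′ u))
      go np (inj₁ refl) _ = subst (λ v → T (compat′ u v)) (sym π′-t) (compat′⁺ (side p) (∨₁ (∧⁺ t-forced t-label))
        (subst (λ c → T (LT′ (to π p) c)) (side-π p) (LT′-free (to π p) (subst (λ z → ¬ T (forced z)) (sym (from-to π p)) p-free))))
      go np (inj₂ fu) (yes refl) = subst (λ v → T (compat′ u v)) (sym π′-y) (compat′⁺ (side q) (subst (λ c → T (LS′ y c)) (side-from q) (LS′-free y y-free))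
        (∨₁ (∧⁺ (subst (λ z → T (forced z)) (sym (from-to π t)) t-forced) t-image)))
      go np (inj₂ fu) (no ny) = subst (λ v → T (compat′ u v)) (sym (π′-other u np (λ e → fu (subst (λ z → T (forced z)) (sym e) t-forced)) ny))
        (compat′⁺ (side u) (LS′-free u fu) (subst (λ c → T (LT′ (to π u) c)) (side-π u) (LT′-free (to π u) (subst (λ z → ¬ T (forced z)) (sym (from-to π u)) fu))))

    forced-cases : ∀ u → T (forced′ u) → (T (forced u) × to π′ u ≡ to π u) ⊎ (p ≡ u × to π′ u ≡ q)
    forced-cases u h = [ (λ z → inj₁ (∧₁ z , π′-forced u (∧₁ z) (λ e → not⁻ (∧₂ z) (==⁺ e)))) , (λ e → inj₂ (==⁻ e , trans (cong (to π′) (sym (==⁻ e))) π′-p)) ]′ (∨⁻ h)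

    q-free′ : ¬ T (forced′ q)
    q-free′ h = [ (λ z → q-free (∧₁ z)) , (λ e → sides (cong side (==⁻ e))) ]′ (∨⁻ h)

    bridge : Bridge La′
    bridge = record
      { forced = forced′
      ; few-forced = ≤-trans (#-∪ {Q = λ u → forced u ∧ not (t == u)} {R = p ==_} λ u → ∨⁻) (≤-trans (+-mono-≤ (#-mono λ u → ∧₁) (≤-reflexive (#-single p))) few′)
      ; π = π′
      ; forced-edge = λ u h → [ (λ (fu , e) → subst (λ v → T (E u v)) (sym e) (edge u)) , (λ { (refl , e) → subst (λ v → T (E u v)) (sym e) pq }) ]′ (forced-cases u h)
      ; compatible = compatible′
      ; apart = λ u h → [ (λ (fu , e) h′ → [ (λ z → apart u fu (subst (λ v → T (forced v)) e (∧₁ z))) , (λ e′ → proj₁ (not-head u fu) (trans (sym e) (sym (==⁻ e′)))) ]′ (∨⁻ h′)) ,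
                          (λ (_ , e) h′ → q-free′ (subst (λ v → T (forced′ v)) e h′)) ]′ (forced-cases u h)
      ; α = side p ; β = side q ; two = two-sides p q sides ; p = p ; p-forced = ∨₂ (==⁺ {x = p} refl)
      ; p-start = λ u h e′ → [ (λ (fu , e) → proj₁ (not-head u fu) (trans (sym e) e′)) , (λ (_ , e) → sides (cong side (trans (sym e′) e))) ]′ (forced-cases u h)
      ; p-class = λ c l → LT′-only p c (λ fp → proj₁ (not-head (from π p) fp) (to-from π p)) l
      ; q-class = λ c l → LS′-only q c q-free (subst (λ v → T (LS′ v c)) π′-p l) }

  -- Without forced edges: force an edge in each direction between the two sides.
  module Double (a′ : ℕ) (f≤a′ : f ≤ a′) (2≤a′ : 2 ≤ a′) (unforced : ∀ u → ¬ T (forced u)) (p q r z : Fin n) (pq : T (E p q)) (rz : T (E r z))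
    (p∈W : T (W p)) (q∉W : ¬ T (W q)) (r∉W : ¬ T (W r)) (z∈W : T (W z)) (q≢r : q ≢ r) (z≢p : z ≢ p) where
    y y′ : Fin n
    y = from π q
    y′ = from π z

    y∉W : ¬ T (W y)
    y∉W h = q∉W (subst (λ v → T (W v)) (to-from π q) (W-step y h))

    y′∈W : T (W y′)
    y′∈W = W-back y′ (subst (λ v → T (W v)) (sym (to-from π z)) z∈W)

    differ : ∀ {u v} → T (W u) → ¬ T (W v) → u ≢ v
    differ hu hv refl = hv hu

    differ′ : ∀ {u v} → T (W u) → ¬ T (W v) → v ≢ u
    differ′ hu hv refl = hv hu

    -- `p` goes to `q` and `r` to `z`. The old preimages `y′` of `z` and `y` of `q`, where
    -- displaced, take over the images of `p` and `r`, so every other vertex still maps into its own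
    -- side.
    π′ : Perm n
    π′ = swap p r (swap p y′ (swap r y π))

    π′-p : to π′ p ≡ q
    π′-p = trans (cong (to π ∘ transpose r y ∘ transpose p y′) (transpose-l p r))
      (trans (cong (to π ∘ transpose r y) (transpose-o (differ′ p∈W r∉W) (differ′ y′∈W r∉W))) (trans (cong (to π) (transpose-l r y)) (to-from π q)))

    π′-r : to π′ r ≡ z
    π′-r = trans (cong (to π ∘ transpose r y ∘ transpose p y′) (transpose-r p r))
      (trans (cong (to π ∘ transpose r y) (transpose-l p y′)) (trans (cong (to π) (transpose-o (differ y′∈W r∉W) (differ y′∈W y∉W))) (to-from π z)))

    side-transpose : ∀ b c u → side b ≡ side c → side (transpose b c u) ≡ side u
    side-transpose b c u e with transpose-case b c u
    ... | inj₁ (refl , e′) = trans (cong side e′) (sym e)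
    ... | inj₂ (inj₁ (refl , e′)) = trans (cong side e′) e
    ... | inj₂ (inj₂ (_ , _ , e′)) = cong side e′

    π′-side : ∀ u → u ≢ p → u ≢ r → side (to π′ u) ≡ side u
    π′-side u np nr = trans (side-π _) (trans (side-transpose r y _ (trans (pick-¬T r∉W) (sym (pick-¬T y∉W))))
      (trans (side-transpose p y′ _ (trans (pick-T p∈W) (sym (pick-T y′∈W)))) (cong side (transpose-o np nr))))

    forced′ : Fin n → Bool
    forced′ u = (p == u) ∨ (r == u)

    La′ = relabelling a′ f≤a′
    open Labelling La′ using () renaming (compat to compat′; compat⁺ to compat′⁺)

    compatible′ : ∀ u → ¬ T (forced′ u) → T (compat′ u (to π′ u))
    compatible′ u h = compat′⁺ (side u) (LS′-free u (unforced u))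
      (subst (λ c → T (LT′ (to π′ u) c)) (π′-side u (λ e → h (∨₁ (==⁺ (sym e)))) (λ e → h (∨₂ (==⁺ (sym e))))) (LT′-free (to π′ u) (unforced _)))

    forced-cases : ∀ u → T (forced′ u) → (p ≡ u × to π′ u ≡ q) ⊎ (r ≡ u × to π′ u ≡ z)
    forced-cases u h = [ (λ e → inj₁ (==⁻ e , trans (cong (to π′) (sym (==⁻ e))) π′-p)) , (λ e → inj₂ (==⁻ e , trans (cong (to π′) (sym (==⁻ e))) π′-r)) ]′ (∨⁻ h)

    q-free′ : ¬ T (forced′ q)
    q-free′ h = [ (λ e → differ p∈W q∉W (==⁻ e)) , (λ e → q≢r (sym (==⁻ e))) ]′ (∨⁻ h)

    z-free′ : ¬ T (forced′ z)
    z-free′ h = [ (λ e → z≢p (sym (==⁻ e))) , (λ e → differ′ z∈W r∉W (==⁻ e)) ]′ (∨⁻ h)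

    bridge : Bridge La′
    bridge = record
      { forced = forced′
      ; few-forced = ≤-trans (#-∪ {Q = p ==_} {R = r ==_} λ u → ∨⁻) (≤-trans (+-mono-≤ (≤-reflexive (#-single p)) (≤-reflexive (#-single r))) 2≤a′)
      ; π = π′
      ; forced-edge = λ u h → [ (λ { (refl , e) → subst (λ v → T (E u v)) (sym e) pq }) , (λ { (refl , e) → subst (λ v → T (E u v)) (sym e) rz }) ]′ (forced-cases u h)
      ; compatible = compatible′
      ; apart = λ u h → [ (λ (_ , e) h′ → q-free′ (subst (λ v → T (forced′ v)) e h′)) , (λ (_ , e) h′ → z-free′ (subst (λ v → T (forced′ v)) e h′)) ]′ (forced-cases u h)
      ; α = side p ; β = side q ; two = two-sides p q sides ; p = p ; p-forced = ∨₁ (==⁺ {x = p} refl)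
      ; p-start = λ u h e′ → [ (λ (_ , e) → differ′ p∈W q∉W (trans (sym e) e′)) , (λ (_ , e) → z≢p (trans (sym e) e′)) ]′ (forced-cases u h)
      ; p-class = λ c l → LT′-only p c (unforced _) l
      ; q-class = λ c l → LS′-only q c (unforced q) (subst (λ v → T (LS′ v c)) π′-p l) }
      where
      sides : side p ≢ side q
      sides e = proj₂ class-D (subst (λ c → T (on c)) (trans (sym (pick-T p∈W)) (trans e (pick-¬T q∉W))) (proj₂ class-W))

  -- Two vertex-disjoint edges across the sides in opposite directions; the two inequalities exclude
  -- the coincidences that membership in `W` does not.
  record Pair : Set where
    field
      p q r z : Fin n
      pq : T (E p q)
      rz : T (E r z)
      p∈W : T (W p)
      q∉W : ¬ T (W q)
      r∉W : ¬ T (W r)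
      z∈W : T (W z)
      q≢r : q ≢ r
      z≢p : z ≢ p

  module Pairs (unforced : ∀ u → ¬ T (forced u)) where
    Xr Yr : Fin n → Fin n → Bool
    Xr u v = (W u ∧ E u v) ∧ not (W v)
    Yr u v = (E u v ∧ W v) ∧ not (W u)

    X-many : d ≤ #₂ Xr
    X-many = CW.many-crossing (#-pos W w (cyc⁺ π (Cyc-refl π))) W≤2d

    Y-many : d ≤ #₂ Yr
    Y-many = ≤-trans X-many (≤-reflexive (sym CW.balance))

    Vf<d : V * f < d
    Vf<d = ≤-trans (+-mono-≤ (*-mono-≤ V>0 h>0) (*-monoʳ-≤ V (≤-trans (m≤n*m f 8) 8f≤h))) (≤-trans (≤-reflexive (cong (V * h +_) (sym (+-identityʳ (V * h))))) (cVh≤d 2 (s≤s (s≤s z≤n))))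

    thick-excess : ∀ t → d ≤ V * t → f < t
    thick-excess t le = ≰⇒> λ l → <⇒≱ Vf<d (≤-trans le (*-monoʳ-≤ V l))

    in-class : ∀ v → ¬ T (misfit (from π v)) → cT v ≡ side v
    in-class v m = let u = from π v ; gd = ∧₁ (proj₂ (fits u m)) in trans (cong cT (sym (to-from π v))) (trans (proj₁ (fits u m)) (trans (good-side (cS u) u gd) (side-from v)))

    out-class : ∀ u → ¬ T (misfit u) → cS u ≡ side u
    out-class u m = good-side (cS u) u (∧₁ (proj₂ (fits u m)))

    side-W : ∀ {u v} → side u ≡ side v → T (W u) → T (W v)
    side-W {u} {v} e hu = not-not λ hv → proj₂ class-D (subst (λ c → T (on c)) (trans (sym (pick-T hu)) (trans e (pick-¬T (not⁻ hv)))) (proj₂ class-W))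

    -- Every vertex has a neighbour on its own side, so less than d of its edges cross.
    out-inside : ∀ q → ∃ λ v → T (E q v) × side v ≡ side q
    out-inside q = go (#-excess (λ v → E q v ∧ (cT v == side q)) (λ v → misfit (from π v)) (≤-<-trans (≤-trans (≤-reflexive (#-perm (inverse π) misfit)) misfit-few)
        (thick-excess _ (thick-S q (side q) (proj₁ (side-labels q (unforced q)))))))
      where
      go : (∃ λ v → T (E q v ∧ (cT v == side q)) × ¬ T (misfit (from π v))) → ∃ λ v → T (E q v) × side v ≡ side q
      go (v , p , m) = v , ∧₁ p , trans (sym (in-class v m)) (==⁻ (∧₂ p))

    in-inside : ∀ p → ∃ λ u → T (E u p) × side u ≡ side p
    in-inside p = go (#-excess (λ u → E u p ∧ (cS u == side p)) misfit (≤-<-trans misfit-few (thick-excess _ (thick-T p (side p) lab))))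
      where
      lab : T (LT p (side p))
      lab = subst₂ (λ z c → T (LT z c)) (to-from π p) (side-from p) (proj₂ (side-labels (from π p) (unforced _)))
      go : (∃ λ u → T (E u p ∧ (cS u == side p)) × ¬ T (misfit u)) → ∃ λ u → T (E u p) × side u ≡ side p
      go (u , h , m) = u , ∧₁ h , trans (sym (out-class u m)) (==⁻ (∧₂ h))

    strict : ∀ (P Q : Fin n → Bool) → (∀ v → T (P v) → T (Q v)) → ∀ v → T (Q v) → ¬ T (P v) → # P < # Q
    strict P Q sub v qv ¬pv = begin
      suc (# P) ≡⟨ +-comm 1 (# P) ⟩
      # P + 1 ≤⟨ +-mono-≤ (#-mono λ u p → ∧⁺ (sub u p) p) (#-pos (λ u → Q u ∧ not (P u)) v (∧⁺ qv (not⁺ ¬pv))) ⟩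
      # (λ u → Q u ∧ P u) + # (λ u → Q u ∧ not (P u)) ≡⟨ sym (#-split Q P) ⟩
      # Q ∎
      where open ≤-Reasoning

    excess₂ : ∀ (A B : Fin n → Fin n → Bool) → #₂ B < #₂ A → ∃₂ λ u v → T (A u v) × ¬ T (B u v)
    excess₂ A B lt = go (#₂-∃ (λ u v → A u v ∧ not (B u v)) (+-cancelˡ-< (#₂ B) _ _ (subst (_< #₂ B + #₂ (λ u v → A u v ∧ not (B u v))) (sym (+-identityʳ (#₂ B))) (<-≤-trans lt (#₂-∪ λ u v p → [ inj₁ , (λ q → inj₂ (∧⁺ p (not⁺ q))) ]′ (em (B u v)))))))
      where
      go : (∃₂ λ u v → T (A u v ∧ not (B u v))) → ∃₂ λ u v → T (A u v) × ¬ T (B u v)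
      go (u , v , p) = u , v , ∧₁ p , not⁻ (∧₂ p)

    other-tail : ∀ q → ∃₂ λ r z → T (Yr r z) × r ≢ q
    other-tail q = go (excess₂ Yr (λ u v → (q == u) ∧ Yr u v) (<-≤-trans lt Y-many))
      where
      own = out-inside q
      lt : #₂ (λ u v → (q == u) ∧ Yr u v) < d
      lt = ≤-<-trans (≤-trans (#₂-rows-≤ (q ==_) Yr (# (Yr q)) λ u e → ≤-reflexive (cong (λ z → # (Yr z)) (sym (==⁻ e)))) (≤-reflexive (trans (cong (_* # (Yr q)) (#-single q)) (+-identityʳ _))))
        (<-≤-trans (strict (Yr q) (E q) (λ v h → ∧₁ (∧₁ h)) (proj₁ own) (proj₁ (proj₂ own)) (λ h → not⁻ (∧₂ h) (side-W (proj₂ (proj₂ own)) (∧₂ (∧₁ h))))) (≤-reflexive (out-deg q)))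
      go : (∃₂ λ u v → T (Yr u v) × ¬ T ((q == u) ∧ Yr u v)) → ∃₂ λ r z → T (Yr r z) × r ≢ q
      go (u , v , y , h) = u , v , y , λ e → h (∧⁺ (==⁺ (sym e)) y)

    other-head : ∀ p → ∃₂ λ r z → T (Yr r z) × z ≢ p
    other-head p = go (excess₂ Yr (λ u v → (p == v) ∧ Yr u v) (<-≤-trans lt Y-many))
      where
      own = in-inside p
      lt : #₂ (λ u v → (p == v) ∧ Yr u v) < d
      lt = ≤-<-trans (≤-trans (≤-reflexive (#₂-swap (λ u v → (p == v) ∧ Yr u v))) (≤-trans (#₂-rows-≤ (p ==_) (λ v u → Yr u v) (# (λ u → Yr u p)) λ v e → ≤-reflexive (cong (λ z → # (λ u → Yr u z)) (sym (==⁻ e)))) (≤-reflexive (trans (cong (_* # (λ u → Yr u p)) (#-single p)) (+-identityʳ _)))))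
        (<-≤-trans (strict (λ u → Yr u p) (λ u → E u p) (λ u h → ∧₁ (∧₁ h)) (proj₁ own) (proj₁ (proj₂ own)) (λ h → not⁻ (∧₂ h) (side-W (sym (proj₂ (proj₂ own))) (∧₂ (∧₁ h))))) (≤-reflexive (in-deg p)))
      go : (∃₂ λ u v → T (Yr u v) × ¬ T ((p == v) ∧ Yr u v)) → ∃₂ λ r z → T (Yr r z) × z ≢ p
      go (u , v , y , h) = u , v , y , λ e → h (∧⁺ (==⁺ (sym e)) y)

    make : ∀ {p q r z} → T (Xr p q) → T (Yr r z) → q ≢ r → z ≢ p → Pair
    make xr yr nq nz = record { pq = ∧₂ (∧₁ xr) ; rz = ∧₁ (∧₁ yr) ; p∈W = ∧₁ (∧₁ xr) ; q∉W = not⁻ (∧₂ xr) ; r∉W = not⁻ (∧₂ yr) ; z∈W = ∧₂ (∧₁ yr) ; q≢r = nq ; z≢p = nz }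

    -- Given crossing edges r₁ → p₀ and q₀ → z₂, any crossing edge other than p₀ → q₀ and z₂ → r₁ is disjoint from one of them.
    third : ∀ p₀ q₀ r₁ z₂ → T (Yr r₁ p₀) → T (Yr q₀ z₂) → r₁ ≢ q₀ → z₂ ≢ p₀ → 2 < d → Pair
    third p₀ q₀ r₁ z₂ y₁ y₂ nr nz d>2 = go (excess₂ Xr B (≤-<-trans two (<-≤-trans d>2 X-many)))
      where
      B : Fin n → Fin n → Bool
      B u v = ((p₀ == u) ∧ (q₀ == v)) ∨ ((z₂ == u) ∧ (r₁ == v))
      one : ∀ b c → #₂ (λ (u v : Fin n) → (b == u) ∧ (c == v)) ≡ 1
      one b c = trans (#₂-× (b ==_) (c ==_)) (cong₂ _*_ (#-single b) (#-single c))
      two : #₂ B ≤ 2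
      two = ≤-trans (#₂-∪ {Q = λ u v → (p₀ == u) ∧ (q₀ == v)} {R = λ u v → (z₂ == u) ∧ (r₁ == v)} λ u v → ∨⁻) (≤-reflexive (cong₂ _+_ (one p₀ q₀) (one z₂ r₁)))
      go : (∃₂ λ u v → T (Xr u v) × ¬ T (B u v)) → Pair
      go (u , v , xr , nb) = cases (v ≟ r₁) (p₀ ≟ u) (v ≟ q₀) (z₂ ≟ u)
        where
        cases : Dec (v ≡ r₁) → Dec (p₀ ≡ u) → Dec (v ≡ q₀) → Dec (z₂ ≡ u) → Pair
        cases (no a) (no b) _ _ = make xr y₁ a b
        cases _ _ (no a) (no b) = make xr y₂ a b
        cases (yes a) _ (yes b) _ = ⊥-elim (nr (trans (sym a) b))
        cases (yes a) _ (no _) (yes b) = ⊥-elim (nb (∨₂ (∧⁺ (==⁺ b) (==⁺ (sym a)))))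
        cases (no _) (yes a) (yes b) _ = ⊥-elim (nb (∨₁ (∧⁺ (==⁺ a) (==⁺ (sym b)))))
        cases (no _) (yes a) (no _) (yes b) = ⊥-elim (nz (trans b (sym a)))

    -- Besides an edge p₀ → q₀ out of `W` there are a returning edge with tail other than q₀ and one
    -- with head other than p₀. If neither is disjoint from the first edge, they are r₁ → p₀ and q₀
    -- → z₂, the situation of `third`.
    pair : 2 < d → Pair
    pair d>2 = start (#₂-∃ Xr (≤-trans d>0 X-many))
      where
      start : (∃₂ λ p q → T (Xr p q)) → Pair
      start (p₀ , q₀ , x₀) = next (other-tail q₀) (other-head p₀)
        where
        next : (∃₂ λ r z → T (Yr r z) × r ≢ q₀) → (∃₂ λ r z → T (Yr r z) × z ≢ p₀) → Pair
        next (r₁ , z₁ , y₁ , n₁) (r₂ , z₂ , y₂ , n₂) = cases (z₁ ≟ p₀) (r₂ ≟ q₀)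
          where
          cases : Dec (z₁ ≡ p₀) → Dec (r₂ ≡ q₀) → Pair
          cases (no a) _ = make x₀ y₁ (λ e → n₁ (sym e)) a
          cases (yes _) (no b) = make x₀ y₂ (λ e → b (sym e)) n₂
          cases (yes refl) (yes refl) = third p₀ q₀ r₁ z₂ y₁ y₂ n₁ n₂ d>2

-- The theorem for a fixed frame

module Main {n} {E : Digraph n} {d k x h V a a′ g} (R : RegularGraph E d) (Fr : Frame E d k x h) (oriented : ∀ u v → T (E u v) → ¬ T (E v u))
  (n≤ : n ≤ 4 * d + 1) (d>2 : 2 < d) (k≤8 : k ≤ 8) (V-large : 36 * 2 ^ k < V) (k<V : k < V)
  (Sc : Scale n d x a h V g) (Sc′ : Scale n d x a′ h V g) (selection-few : 2 ^ k * (5 * x) ≤ a) (2x≤a : 2 * x ≤ a)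
  (f≤a′ : Scale.f Sc ≤ a′) (a+1≤a′ : a + 1 ≤ a′) (2≤a′ : 2 ≤ a′) where
  open Scale Sc using (d>0; x≤a; f; h>0; cVh≤d; 8f≤h; V>0)
  open Scaled Sc
  open Frame Fr

  2Vx≤d : 2 * (V * x) ≤ d
  2Vx≤d = ≤-trans (m≤n+m (2 * (V * x)) (3 * a)) (≤-trans (≤-trans (m≤n*m f 8) 8f≤h) (≤-trans (≤-reflexive (sym (+-identityʳ h))) (Scale.ch≤d Sc 1 (s≤s z≤n))))

  V≥10 : 10 ≤ V
  V≥10 = ≤-trans (≤-trans (m≤m+n 10 26) (m≤m*n 36 (2 ^ k) {{m^n≢0 2 k}})) (<⇒≤ V-large)

  module I = Initial R Fr V a d>0 V-large k<V 2Vx≤d 2x≤a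
  module L = I.Loop k≤8 (λ u e → oriented u u e e)
  La = I.labelling
  open Labelling La

  record Start : Set where
    field
      C : L.Complete
      π₀ : Perm n
      π₀-J : ∀ u → T (compat u (to π₀ u) ∨ (I.Selection.tail (L.Complete.s C) u ∧ (to (I.Selection.ι (L.Complete.s C)) u == to π₀ u)))

  start : Start
  start = record { C = L.complete ; π₀ = proj₁ (L.Pseudo.pseudo L.complete) ; π₀-J = proj₂ (L.Pseudo.pseudo L.complete) }

  module From (St : Start) where
    open Start St
    open L.Complete C
    open I.Selection s

    -- Only incompatible pairs are forced. They are all selected edges, whereas a compatible pair
    -- can be rematched within its label.
    forced : Fin n → Bool
    forced u = not (compat u (to π₀ u))

    forced-tail : ∀ u → T (forced u) → T (tail u) × to ι u ≡ to π₀ u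
    forced-tail u fu = [ (λ c → ⊥-elim (not⁻ fu c)) , (λ p → ∧₁ p , ==⁻ (∧₂ p)) ]′ (∨⁻ (π₀-J u))

    few-forced : # forced ≤ a
    few-forced = ≤-trans (#-mono λ u fu → proj₁ (forced-tail u fu)) (≤-trans tail-few (≤-trans c≤ (≤-trans (*-monoʳ-≤ (2 ^ k) (L.r-bound C)) selection-few)))

    rematched = Rematch.rematch R Fr La d>0 x≤a 8a≤h 20a≤d 12aV<d forced few-forced π₀ (λ u fu → not-not fu)

    factor₁ : Factor La forced (proj₁ rematched)
    factor₁ = record
      { edge = λ u → [ (λ fu → subst (λ v → T (E u v)) (sym (trans (proj₁ (proj₂ rematched) u fu) (sym (proj₂ (forced-tail u fu))))) (∧₁ (edge u (proj₁ (forced-tail u fu))))) , (λ fu → proj₁ (proj₂ (proj₂ rematched) u fu)) ]′ (em (forced u))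
      ; compatible = λ u fu → proj₂ (proj₂ (proj₂ rematched) u fu) }

    open Cores R Fr La Sc forced few-forced

    record Second : Set where
      field
        σ : Perm n
        factor : Factor La forced σ
        keeps : ∀ u → T (forced u) → to σ u ≡ to π₀ u
        one-cycle : ∀ c u v → T (Factor.good factor c u) → T (Factor.good factor c v) → Cyc σ u v

    second : Second
    second = let S = saturate (proj₁ rematched) factor₁ in record
      { σ = Saturated.σ S ; factor = Saturated.factor S ; one-cycle = Saturated.one-cycle S
      ; keeps = λ u fu → trans (Saturated.keeps S u fu) (proj₁ (proj₂ rematched) u fu) }

    module Decide (Se : Second) where
      open Second Se

      forced-image : ∀ u → T (forced u) → T (tail u) × to σ u ≡ to ι u
      forced-image u fu = proj₁ (forced-tail u fu) , trans (keeps u fu) (sym (proj₂ (forced-tail u fu)))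

      apart-σ : ∀ u → T (forced u) → ¬ T (forced (to σ u))
      apart-σ u fu fu′ = apart u (proj₁ (forced-image u fu)) (subst (λ v → T (tail v)) (proj₂ (forced-image u fu)) (proj₁ (forced-image (to σ u) fu′)))

      module Split (w w′ : Fin n) (¬ww′ : ¬ Cyc σ w w′) (half : 2 * # (cyc σ w) ≤ n) where
        module S = TwoSides R Fr oriented n≤ La Sc V≥10 forced few-forced σ factor one-cycle apart-σ w w′ ¬ww′ half

        -- The number of selected edges is at most 2^k r = 0, so nothing is forced and `Double`
        -- applies.
        no-excess : r ≡ 0 → HamiltonCycle E
        no-excess r≡0 = Finish.hamilton R (S.relabelling a′ f≤a′) Sc′ (S.Double.bridge a′ f≤a′ 2≤a′ free P.p P.q P.r P.z P.pq P.rz P.p∈W P.q∉W P.r∉W P.z∈W P.q≢r P.z≢p)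
          where
          free : ∀ u → ¬ T (forced u)
          free u fu = <⇒≱ (#-pos tail u (proj₁ (forced-image u fu))) (≤-trans tail-few (≤-trans c≤ (≤-trans (≤-reflexive (cong (2 ^ k *_) r≡0)) (≤-reflexive (*-zeroʳ (2 ^ k))))))
          module P = S.Pair (S.Pairs.pair free d>2)

        -- If no forced tail were inside `J`, compatibility would map `inside J` into `touching J`,
        -- against the excess. The slack in `free-edge` provides one more disjoint edge p → q
        -- leaving `J`; as there are only two classes, one in `J` and one outside, it leads from one
        -- side to the other and can replace a forced edge at `t`.
        module Excess (r₀ : ℕ) (r≡ : r ≡ suc r₀) (v : Vec Bool k) (gap : # (I.touching (lookup v)) + r ≤ # (I.inside (lookup v))) where
          J : Fin k → Bool
          J = lookup v

          forced-inside : ∃ λ t → T (forced t) × T (I.inside J t)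
          forced-inside = decide (any? λ t → T? (forced t) ×-dec T? (I.inside J t))
            where
            decide : Dec (∃ λ t → T (forced t) × T (I.inside J t)) → ∃ λ t → T (forced t) × T (I.inside J t)
            decide (yes p) = p
            decide (no none) = ⊥-elim (<⇒≱ (≤-trans (m<m+n (# (I.touching J)) (≤-trans (s≤s z≤n) (≤-reflexive (sym r≡)))) gap)
              (≤-trans (#-mono λ u iu → touch u iu) (≤-reflexive (#-perm σ (I.touching J)))))
              where
              touch : ∀ u → T (I.inside J u) → T (I.touching J (to σ u))
              touch u iu = let i , l , l′ = compat⁻ (Factor.compatible factor u (λ fu → none (u , fu , iu))) in I.touching⁺ J (to σ u) i l′ (I.inside⁻ J u iu i l)

          module Use (p q : Fin n) (kpq : T (I.K p q)) (ip : T (I.inside J p)) (tq : ¬ T (I.touching J q)) (np : ¬ T (used p)) (nq : ¬ T (used q))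
            (t : Fin n) (ft : T (forced t)) (it : T (I.inside J t)) where
            p-free : ¬ T (forced p)
            p-free fp = np (tail-used p (proj₁ (forced-image p fp)))

            q-free : ¬ T (forced q)
            q-free fq = nq (tail-used q (proj₁ (forced-image q fq)))

            head-in-use : ∀ u → T (forced u) → T (used (to σ u))
            head-in-use u fu = subst (λ z → T (used z)) (sym (proj₂ (forced-image u fu))) (head-used u (proj₁ (forced-image u fu)))

            not-head : ∀ u → T (forced u) → to σ u ≢ p × to σ u ≢ q
            not-head u fu = (λ e → np (subst (λ z → T (used z)) e (head-in-use u fu))) , (λ e → nq (subst (λ z → T (used z)) e (head-in-use u fu)))

            J-p : T (J (S.side p))
            J-p = I.inside⁻ J p ip (S.side p) (proj₁ (S.side-labels p p-free))

            J-q : ¬ T (J (S.side q))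
            J-q j = tq (I.touching⁺ J q (S.side q) lab j)
              where
              y = from σ q
              lab : T (LT q (S.side q))
              lab = subst₂ (λ z c → T (LT z c)) (to-from σ q) (S.side-from q) (proj₂ (S.side-labels y (λ fy → proj₂ (not-head y fy) (to-from σ q))))

            sides : S.side p ≢ S.side q
            sides e = J-q (subst (λ c → T (J c)) e J-p)

            t-label : T (LS t (S.side p))
            t-label = go (I.some-S t)
              where
              go : (∃ λ i → T (LS t i)) → T (LS t (S.side p))
              go (i , l) = [ (λ e → subst (λ c → T (LS t c)) e l) , (λ e → ⊥-elim (J-q (subst (λ c → T (J c)) e (I.inside⁻ J t it i l)))) ]′ (S.two-sides p q sides i)

            -- A label `side p` at the image of `t` would make the forced pair compatible, so only
            -- `side q` is left.
            t-image : T (LT (to σ t) (S.side q))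
            t-image = go (I.some-T (to σ t))
              where
              go : (∃ λ i → T (LT (to σ t) i)) → T (LT (to σ t) (S.side q))
              go (i , l) = [ (λ e → ⊥-elim (not⁻ ft (compat⁺ i (subst (λ c → T (LS t c)) (sym e) t-label) (subst (λ z → T (LT z i)) (keeps t ft) l)))) , (λ e → subst (λ c → T (LT (to σ t) c)) e l) ]′ (S.two-sides p q sides i)

            hamilton : HamiltonCycle E
            hamilton = Finish.hamilton R (S.relabelling a′ f≤a′) Sc′
              (S.Exchange.bridge a′ f≤a′ (≤-trans (+-monoˡ-≤ 1 few-forced) a+1≤a′) p q t (∧₁ kpq) p-free q-free not-head sides ft t-label t-image)

          hamilton : HamiltonCycle E
          hamilton = use (I.free-edge J r₀ c used used-few (≤-trans c≤ (≤-reflexive (cong (2 ^ k *_) r≡))) (≤-trans (≤-reflexive (cong (# (I.touching J) +_) (sym r≡))) gap) k≤8) forced-inside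
            where
            use : (∃₂ λ p q → T (I.K p q) × T (I.inside J p) × ¬ T (I.touching J q) × ¬ T (used p) × ¬ T (used q)) → (∃ λ t → T (forced t) × T (I.inside J t)) → HamiltonCycle E
            use (p , q , kpq , ip , tq , np , nq) (t , ft , it) = Use.hamilton p q kpq ip tq np nq t ft it

        hamilton : HamiltonCycle E
        hamilton = by r refl witness
          where
          by : ∀ r′ → r ≡ r′ → (r ≡ 0 ⊎ ∃ λ v → # (I.touching (lookup v)) + r ≤ # (I.inside (lookup v))) → HamiltonCycle E
          by _ _ (inj₁ e) = no-excess e
          by zero e (inj₂ _) = no-excess e
          by (suc r₀) e (inj₂ (v , gap)) = Excess.hamilton r₀ e v gap

      hamilton : HamiltonCycle E
      hamilton = decide (any? λ u → any? λ v → ¬? (Cyc? σ u v))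
        where
        decide : Dec (∃ λ u → ∃ λ v → ¬ Cyc σ u v) → HamiltonCycle E
        decide (no none) = single-cycle⇒Hamilton E σ n>0 (Factor.edge factor) λ u v → stable u v
          where
          stable : ∀ u v → Cyc σ u v
          stable u v with Cyc? σ u v
          ... | yes p = p
          ... | no ¬p = ⊥-elim (none (u , v , ¬p))
        decide (yes (u , v , ¬uv)) = [ (λ le → Split.hamilton u v ¬uv (≤-trans (double le) both)) , (λ le → Split.hamilton v u (λ c → ¬uv (Cyc-sym σ c)) (≤-trans (double′ le) both)) ]′ (≤-total (# (cyc σ u)) (# (cyc σ v)))
          where
          both : # (cyc σ u) + # (cyc σ v) ≤ n
          both = ≤-trans (+-monoʳ-≤ (# (cyc σ u)) (#-mono λ y p → not⁺ λ q → ¬uv (Cyc-trans σ (cyc⁻ σ q) (Cyc-sym σ (cyc⁻ σ p))))) (≤-reflexive (#-compl (cyc σ u)))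
          double : ∀ {s t} → s ≤ t → 2 * s ≤ s + t
          double {s} le = +-monoʳ-≤ s (≤-trans (≤-reflexive (+-identityʳ s)) le)
          double′ : ∀ {s t} → t ≤ s → 2 * t ≤ s + t
          double′ {s} {t} le = +-mono-≤ le (≤-reflexive (+-identityʳ t))

  hamilton : HamiltonCycle E
  hamilton = From.Decide.hamilton start (From.second start)

-- Constants

length-filter : ∀ {m n} (p : Fin n → Bool) (f : Fin m → Fin n) → length (filter (λ v → T? (p v)) (tabulateL f)) ≡ # (p ∘ f)
length-filter {zero} p f = sym (∑-zero _)
length-filter {suc m} p f = trans (go (p (f zero)) refl) (sym (∑-suc _))
  where
  rest = length-filter p (f ∘ suc)
  go : ∀ b → p (f zero) ≡ b → length (filter (λ v → T? (p v)) (tabulateL f)) ≡ ⟦ p (f zero) ⟧ + # (p ∘ f ∘ suc)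
  go b e with p (f zero)
  ... | true = cong suc rest
  ... | false = rest

-- A: forced edges of the first matching, C: of the second; N: ratio of consecutive levels; 1 / M: the lowest level.
module Choice (V A C N M g : ℕ) (V-large : 36 * 256 < V) (A-large : 1280 ≤ A) (C-large : 3 * A + 2 * V ≤ C) (N-large : 8 * (3 * C + 2 * V) ≤ N)
  (M-large : 200 * (V * (N * suc N ^ 8)) ≤ M) (g-large : 400 * M ≤ g) where

  V>0 : 0 < V
  V>0 = ≤-trans (s≤s z≤n) V-large

  A>0 : 0 < A
  A>0 = ≤-trans (s≤s z≤n) A-large

  A+1≤C : A + 1 ≤ C
  A+1≤C = ≤-trans (+-mono-≤ (m≤n*m A 3) (≤-trans V>0 (m≤n*m V 2))) C-large

  A≤C : A ≤ C
  A≤C = ≤-trans (m≤m+n A 1) A+1≤C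

  2≤C : 2 ≤ C
  2≤C = ≤-trans (+-monoˡ-≤ 1 A>0) A+1≤C

  N>0 : 0 < N
  N>0 = ≤-trans (≤-trans V>0 (≤-trans (m≤n*m V 2) (≤-trans (m≤n+m (2 * V) (3 * C)) (m≤n*m (3 * C + 2 * V) 8)))) N-large

  M>0 : 0 < M
  M>0 = ≤-trans (*-mono-≤ {1} {200} (s≤s z≤n) (*-mono-≤ V>0 (*-mono-≤ N>0 (m^n>0 (suc N) 8)))) M-large

  instance
    M≢0 : NonZero M
    M≢0 = >-nonZero M>0

  bound : ℕ
  bound = n-bound (density-bound (20 * V) g) (3 * suc (2 * g))

  n₀ : ℕ
  -- The second summand gives M + 3 ≤ d through n ≤ 4d + 1: `M ≤ d` makes the unit `d / M` positive,
  -- and `few-parts` needs d > 2.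
  n₀ = suc bound + (4 * (M + 3) + 1)

  module _ (n d : ℕ) (n₀≤n : n₀ ≤ n) (n≤ : n ≤ 4 * d + 1) (E : Digraph n) (orient : Oriented E) (reg : Regular d E) where

    M+3≤d : M + 3 ≤ d
    M+3≤d = *-cancelˡ-≤ 4 (+-cancelʳ-≤ 1 _ _ (≤-trans (≤-trans (m≤n+m _ (suc bound)) n₀≤n) n≤))

    M≤d : M ≤ d
    M≤d = ≤-trans (m≤m+n M 3) M+3≤d

    d>2 : 2 < d
    d>2 = ≤-trans (m≤n+m 3 M) M+3≤d

    d>0 : 0 < d
    d>0 = ≤-trans (s≤s z≤n) d>2

    R : RegularGraph E d
    R = record
      { out-deg = λ u → trans (sym (length-filter (E u) id)) (proj₁ (reg u))
      ; in-deg = λ v → trans (sym (length-filter (λ u → E u v) id)) (proj₂ (reg v)) }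

    oriented : ∀ u v → T (E u v) → ¬ T (E v u)
    oriented u v e = ≡false⇒¬T (proj₂ orient u v e)

    n>0 : 0 < n
    n>0 = ≤-trans (s≤s z≤n) n₀≤n

    d≤n : d ≤ n
    d≤n = ≤-trans (≤-reflexive (sym (RegularGraph.out-deg R (fromℕ< n>0)))) (#≤n (E (fromℕ< n>0)))

    n≤5d : n ≤ 5 * d
    n≤5d = ≤-trans n≤ (≤-trans (+-monoʳ-≤ (4 * d) d>0) (≤-reflexive (+-comm (4 * d) d)))

    u : ℕ
    u = d / M

    u>0 : 0 < u
    u>0 = n≢0⇒n>0 λ e → <⇒≱ (m%n<n d M) (≤-trans M≤d (≤-reflexive (trans (m≡m%n+[m/n]*n d M) (trans (cong (λ t → d % M + t * M) e) (+-identityʳ _)))))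

    -- With `u = d / M` as unit, the levels grow by the factor N + 1, so that x (k + 1) is exactly x
    -- k + h k. Since k ≤ 8, even the highest level stays a small fraction of d.
    x h : ℕ → ℕ
    x k = u * suc N ^ k
    h k = N * x k

    next : ∀ k → x k + h k ≤ x (suc k)
    next k = ≤-reflexive (e u N (suc N ^ k))
      where
      e : ∀ u N p → u * p + N * (u * p) ≡ u * (suc N * p)
      e = solve-∀

    x>0 : ∀ k → 0 < x k
    x>0 k = *-mono-≤ u>0 (m^n>0 (suc N) k)

    h>0 : ∀ k → 0 < h k
    h>0 k = *-mono-≤ N>0 (x>0 k)

    200Vh≤d : ∀ k → k ≤ 8 → 200 * (V * h k) ≤ d
    200Vh≤d k k≤8 = begin
      200 * (V * (N * (u * suc N ^ k))) ≤⟨ *-monoʳ-≤ 200 (*-monoʳ-≤ V (*-monoʳ-≤ N (*-monoʳ-≤ u (^-monoʳ-≤ (suc N) k≤8)))) ⟩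
      200 * (V * (N * (u * suc N ^ 8))) ≡⟨ e V N u (suc N ^ 8) ⟩
      u * (200 * (V * (N * suc N ^ 8))) ≤⟨ *-monoʳ-≤ u M-large ⟩
      u * M ≤⟨ m/n*n≤m d M ⟩
      d ∎
      where
      open ≤-Reasoning
      e : ∀ V N u p → 200 * (V * (N * (u * p))) ≡ u * (200 * (V * (N * p)))
      e = solve-∀

    200d≤gh : ∀ k → 200 * d ≤ g * h k
    200d≤gh k = begin
      200 * d ≡⟨ cong (200 *_) (m≡m%n+[m/n]*n d M) ⟩
      200 * (d % M + u * M) ≤⟨ *-monoʳ-≤ 200 (+-monoˡ-≤ (u * M) (≤-trans (<⇒≤ (m%n<n d M)) (m≤n*m M u {{>-nonZero u>0}}))) ⟩
      200 * (u * M + u * M) ≡⟨ e u M ⟩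
      400 * M * u ≤⟨ *-mono-≤ g-large (≤-trans (≤-trans (m≤m*n u (suc N ^ k) {{m^n≢0 (suc N) k}}) ≤-refl) (m≤n*m (x k) N {{>-nonZero N>0}})) ⟩
      g * h k ∎
      where
      open ≤-Reasoning
      e : ∀ u M → 200 * (u * M + u * M) ≡ 400 * M * u
      e = solve-∀

    8f≤h : ∀ D → D ≤ C → ∀ k → 8 * (3 * (D * x k) + 2 * (V * x k)) ≤ h k
    8f≤h D D≤C k = ≤-trans (≤-reflexive (e D V (x k))) (*-monoˡ-≤ (x k) (≤-trans (*-monoʳ-≤ 8 (+-monoˡ-≤ (2 * V) (*-monoʳ-≤ 3 D≤C))) N-large))
      where
      e : ∀ D V x → 8 * (3 * (D * x) + 2 * (V * x)) ≡ 8 * (3 * D + 2 * V) * x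
      e = solve-∀

    scale : ∀ D → 0 < D → D ≤ C → ∀ k → k ≤ 8 → Scale n d (x k) (D * x k) (h k) V g
    scale D D>0 D≤C k k≤8 = record
      { d>0 = d>0 ; h>0 = h>0 k ; V>0 = V>0 ; d≤n = d≤n ; n≤5d = n≤5d ; x≤a = m≤n*m (x k) D {{>-nonZero D>0}} ; 8f≤h = 8f≤h D D≤C k
      ; 200Vh≤d = 200Vh≤d k k≤8 ; 200d≤gh = 200d≤gh k ; n-large = ≤-trans (m≤m+n (suc bound) _) n₀≤n }

    framed : ∀ k → k ≤ 8 → Frame E d k (x k) (h k) → HamiltonCycle E
    framed k k≤8 Fr = Main.hamilton {a = A * x k} {a′ = C * x k} R Fr oriented n≤ d>2 k≤8 pow (≤-trans (s≤s k≤8) (≤-trans (≤-trans (m≤m+n 9 _) (n≤1+n (36 * 256))) V-large))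
      (scale A A>0 A≤C k k≤8) (scale C (≤-trans (s≤s z≤n) 2≤C) ≤-refl k k≤8)
      (≤-trans (*-monoˡ-≤ (5 * x k) pow8) (≤-trans (≤-reflexive (e₁ (x k))) (*-monoˡ-≤ (x k) A-large)))
      (*-monoˡ-≤ (x k) (≤-trans (m≤m+n 2 1278) A-large))
      (≤-trans (≤-reflexive (e₂ A V (x k))) (*-monoˡ-≤ (x k) C-large))
      (≤-trans (+-monoʳ-≤ (A * x k) (x>0 k)) (≤-trans (≤-reflexive (e₃ A (x k))) (*-monoˡ-≤ (x k) A+1≤C)))
      (*-mono-≤ {2} {C} {1} {x k} 2≤C (x>0 k))
      where
      pow8 : 2 ^ k ≤ 256
      pow8 = ^-monoʳ-≤ 2 k≤8
      pow : 36 * 2 ^ k < V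
      pow = ≤-trans (s≤s (*-monoʳ-≤ 36 pow8)) V-large
      e₁ : ∀ x → 256 * (5 * x) ≡ 1280 * x
      e₁ = solve-∀
      e₂ : ∀ A V x → 3 * (A * x) + 2 * (V * x) ≡ (3 * A + 2 * V) * x
      e₂ = solve-∀
      e₃ : ∀ A x → A * x + x ≡ (A + 1) * x
      e₃ = solve-∀

    hamilton : HamiltonCycle E
    hamilton = let k , k≤8 , Fr = Partition.partition {E = E} n≤ d>2 x h next (≤-trans d≤n (m≤n*m n 2)) in framed k k≤8 Fr

  theorem : Σ ℕ λ n₀ → ∀ (n d : ℕ) → n₀ ≤ n → n ≤ 4 * d + 1 → (E : Digraph n) → Oriented E → Regular d E → HamiltonCycle E
  theorem = n₀ , hamilton

theorem1p2 : Σ ℕ λ n₀ → ∀ (n d : ℕ) → n₀ ≤ n → n ≤ 4 * d + 1 →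
    (E : Digraph n) → Oriented E → Regular d E → HamiltonCycle E
-- With 2^k ≤ 256 these are 9217 = 36 * 256 + 1, from the greedy choice of edges, and 1280 = 256 *
-- 5, the bound on the number of selected edges per unit of `x`. The other constants equal their
-- lower bounds in `Choice`.
theorem1p2 = Choice.theorem 9217 1280 _ _ _ _ ≤-refl ≤-refl ≤-refl ≤-refl ≤-refl ≤-refl
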